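{- For $\ell\in\{2,5,11\}$ let $H_\ell^\dagger=H_\ell^\dagger(\tau)=\left(\frac{\eta(3\tau)\eta(3\ell\tau)}{\eta(\tau)\eta(\ell\tau)}\right)^{\frac{12}{\ell+1}}$ and let $q=e^{\pi i\tau}$. Then \begin{align*} C_2(q^2)&=-6\frac{H_2^\dagger}{(1+9H_2^\dagger)^2},\\ C_5(q^2)&=-6H_5^\dagger\frac{1+4H_5^\dagger+9(H_5^\dagger)^2}{(1+9H_5^\dagger+9(H_5^\dagger)^2)^2},\\ C_{11}(q^2)&=-6H_{11}^\dagger\frac{U(H_{11}^\dagger)}{V^2(H_{11}^\dagger)}, \end{align*} where $U(s)=1+5s+18s^2+37s^3+54s^4+45s^5+27s^6$ and $V(s)=1+9s+18s^2+27s^3+9s^4$.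
   Context: $\eta(\tau)=e^{\pi i\tau/12}\prod_{k\ge1}(1-e^{2\pi ik\tau})$ is the Dedekind eta function. Let $a(q)=\sum_{m,n\in\mathbb Z}q^{m^2+mn+n^2}$ and for a positive integer $N$ $$C_N(q)=\frac{1}{a^2(q)a^2(q^N)}\det\begin{pmatrix}a(q)&a(q^N)\\ q\frac{da(q)}{dq}&q\frac{da(q^N)}{dq}\end{pmatrix}.$$ -}

module Defs where

-- Formal power series with integer coefficients, as coefficient functions.
-- All q-series in the paper (a(q), eta quotients, C_N) are convergent
-- q-expansions with integer coefficients; identities between them are
-- identities of formal power series (coefficientwise).

open import Data.Nat as ℕ using (ℕ; zero; suc; NonZero; _≡ᵇ_)
open import Data.Nat.DivMod using (_/_; _%_)
open import Data.Integer as ℤ using (ℤ; +_; -_; _+_; _*_; _-_)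
open import Data.List using (List; []; _∷_; map; upTo; foldr)
open import Data.Bool using (if_then_else_)
open import Relation.Nullary.Decidable using (⌊_⌋)
open import Relation.Binary.PropositionalEquality using (_≡_)

PS : Set
PS = ℕ → ℤ

infix 4 _≈ₚ_
_≈ₚ_ : PS → PS → Set
f ≈ₚ g = ∀ n → f n ≡ g n

sumTo : (ℕ → ℤ) → ℕ → ℤ
sumTo h zero    = h zero
sumTo h (suc n) = sumTo h n + h (suc n)

const : ℤ → PS
const c zero    = c
const c (suc n) = + 0

X : PS
X zero          = + 0
X (suc zero)    = + 1
X (suc (suc n)) = + 0

infixl 6 _⊕_ _⊖_
infixl 7 _⊗_

_⊕_ : PS → PS → PS
(f ⊕ g) n = f n + g n

_⊖_ : PS → PS → PS
(f ⊖ g) n = f n - g n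

_⊗_ : PS → PS → PS
(f ⊗ g) n = sumTo (λ k → f k * g (n ℕ.∸ k)) n

_·_ : ℤ → PS → PS
(c · f) n = c * f n

pow : PS → ℕ → PS
pow f zero    = const (+ 1)
pow f (suc k) = f ⊗ pow f k

-- Multiplicative inverse of a power series whose constant term f 0 is a unit
-- (±1) of ℤ; then f 0 ⁻¹ = f 0 and
--   g 0 = f 0,   g n = - f 0 * Σ_{k=1}^{n} f k * g (n - k).
-- invRev f n = [g n, g (n-1), ..., g 0].
private
  dotFrom : PS → ℕ → List ℤ → ℤ
  dotFrom f i []       = + 0
  dotFrom f i (x ∷ xs) = f (suc i) * x + dotFrom f (suc i) xs

  invRev : PS → ℕ → List ℤ
  invRev f zero    = f zero ∷ []
  invRev f (suc n) = let r = invRev f n in (- (f zero * dotFrom f 0 r)) ∷ r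

  headZ : List ℤ → ℤ
  headZ []      = + 0
  headZ (x ∷ _) = x

inv : PS → PS
inv f n = headZ (invRev f n)

_⊘_ : PS → PS → PS
f ⊘ g = f ⊗ inv g

scale : (d : ℕ) → .{{_ : NonZero d}} → PS → PS
scale d f n = if n % d ≡ᵇ 0 then f (n / d) else + 0

θ : PS → PS
θ f n = + n * f n

poly : List ℤ → PS → PS
poly []       s = const (+ 0)
poly (c ∷ cs) s = const c ⊕ s ⊗ poly cs s

oneMinusXpow : ℕ → PS
oneMinusXpow e n = (if n ≡ᵇ 0 then + 1 else + 0) - (if n ≡ᵇ e then + 1 else + 0)

prodTo : ℕ → ℕ → PS
prodTo m zero    = const (+ 1)
prodTo m (suc K) = prodTo m K ⊗ oneMinusXpow (m ℕ.* suc K)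

-- the infinite product ∏_{k≥1} (1 - q^{m k}) for m ≥ 1: its n-th coefficient
-- only involves the factors with k ≤ n.
euler : ℕ → PS
euler m n = prodTo m n n

-- a(q) = Σ_{m,n∈ℤ} q^{m²+mn+n²}.  Coefficient of q^n = #{(i,j) ∈ ℤ² : i²+ij+j² = n};
-- any such pair has |i|,|j| ≤ n (since i²+ij+j² ≥ (3/4)max(i²,j²)),
-- so we count within the box [-n,n]².
private
  rangeZ : ℕ → List ℤ
  rangeZ n = map (λ i → + i - + n) (upTo (suc (2 ℕ.* n)))

  sumL : List ℤ → ℤ
  sumL = foldr _+_ (+ 0)

a : PS
a n = sumL (map (λ i → sumL (map (λ j →
        if ⌊ (i * i + i * j + j * j) ℤ.≟ + n ⌋ then + 1 else + 0) (rangeZ n))) (rangeZ n))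

-- C_N(q) = det( a(q), a(q^N) ; q a'(q), q d/dq a(q^N) ) / ( a²(q) a²(q^N) )
C : (N : ℕ) → .{{_ : NonZero N}} → PS
C N = (a ⊗ θ (scale N a) ⊖ scale N a ⊗ θ a) ⊘ (pow a 2 ⊗ pow (scale N a) 2)

-- H†_ℓ as a series in Q = e^{2πiτ}:
--  (η(3τ)η(3ℓτ)/(η(τ)η(ℓτ)))^{12/(ℓ+1)}
--   = ( Q^{(ℓ+1)/12} ∏(1-Q^{3k})(1-Q^{3ℓk}) / ∏(1-Q^k)(1-Q^{ℓk}) )^{12/(ℓ+1)}
--   = Q · ( ∏ ... )^{12/(ℓ+1)}        (12/(ℓ+1) ∈ ℕ for ℓ ∈ {2,5,11})
HdagQ : ℕ → PS
HdagQ ℓ = X ⊗ pow ((euler 3 ⊗ euler (3 ℕ.* ℓ)) ⊘ (euler 1 ⊗ euler ℓ)) (12 / suc ℓ)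

-- H†_ℓ as a series in q = e^{πiτ} (so Q = q²)
Hdag : ℕ → PS
Hdag ℓ = scale 2 (HdagQ ℓ)

Ucoeffs : List ℤ
Ucoeffs = + 1 ∷ + 5 ∷ + 18 ∷ + 37 ∷ + 54 ∷ + 45 ∷ + 27 ∷ []

Vcoeffs : List ℤ
Vcoeffs = + 1 ∷ + 9 ∷ + 18 ∷ + 27 ∷ + 9 ∷ []

{-# OPTIONS --safe #-}
-- Jacobi's triple product over dual numbers (its derivative gives the cube of Euler's product) and a
-- reindexing of ℤ² yield a = 1 + 6 Σ χ(x) q^(kx), χ the nontrivial character modulo 3. Liouville's shear
-- (i, j; x, y) ↦ (i - j, j; x, x + y) of the solutions of i x + j y = n then proves the system
--   θ a = 9 K - 3 p a,   θ p = a K - 3 p²,   θ K = K (a² - 9 p)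
-- with θ = q d/dq, p = Σ k χ²(x) q^(kx), K = Σ k² χ(x) q^(kx). Put u = a(q), v = a(q^ℓ). The quantities
-- R₀ = u/v - ℓ v/u, w = (θv/v - θu/u)/(uv) = C_ℓ, and symmetrized weight 0 forms P, M of the two copies of K
-- satisfy an autonomous system, and logarithmic differentiation gives (ℓ + 1) θ H = H (u² + ℓ v²). Explicit
-- rational functions of H solve the same system. The differences of the two solutions satisfy a linear
-- system whose only resonances are at the exponents 1 and ℓ, so these two coefficients decide the equality.
module Submission where

-- The Lambert expansion of a rests on the terms of E³ with exponent divisible by 3, E being Euler's
-- product. As a triple product of pentagonal series, their index lattice splits orthogonally into
-- the form i² + i j + j² and one pentagonal direction, which gives a E. By Jacobi's series for the
-- cube they give E (1 + 6 Σ χ(x) q^(kx)). Finitely many coefficients can decide the formula for C_ℓ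
-- only if the difference obeys a recursion. The autonomous system supplies it: away from a
-- resonance, each coefficient of the errors is determined by the earlier ones, which are 0. What
-- resists is T = u/v + ℓ v/u. The system contains T itself, but only its square R₀² + 4ℓ is
-- expressed through R₀. Hence P is compared through its ratio to T, with the error 4 P - T p̂. At
-- the resonance q^ℓ a direct check would need H up to that order. Instead (T p̂)² - (4 m̂)²
-- factors, and it equals a constant times H^(ℓ+1)/V³ up to a multiple of the error of R₀. The first
-- factor is known to lowest order, so the leading coefficient of the second follows, in the same
-- way for all three ℓ.

import Defs
open import Level using (0ℓ; _⊔_)
open import Algebra.Bundles using (CommutativeRing; RawRing)
open import Algebra.Solver.Ring.AlmostCommutativeRing using (fromCommutativeRing; _-Raw-AlmostCommutative⟶_)
open import Data.Bool using (Bool; false; if_then_else_; true; _∧_)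
open import Data.Empty using (⊥; ⊥-elim)
open import Data.Integer as ℤ using (ℤ; +_; -[1+_]; ∣_∣)
import Data.Integer.Properties as ℤₚ
open import Data.Integer.Tactic.RingSolver using (solve-∀)
open import Data.List using (List; applyUpTo; foldr; map; upTo; []; _∷_)
open import Data.Maybe using (Maybe; just; nothing)
open import Data.Nat as ℕ using (suc; s≤s; zero; z≤n; ℕ; _≡ᵇ_)
import Data.Nat.Properties as ℕₚ
import Data.Nat.Tactic.RingSolver as ℕ-Solver
open import Data.Product using (proj₁; proj₂; Σ; _,_; _×_)
open import Data.Sum using (inj₁; inj₂)
open import Function using (id; _∘_)
open import Relation.Nullary using (contradiction; no; yes)
open import Relation.Nullary.Decidable using (from-no; ⌊_⌋)
open import Relation.Binary.PropositionalEquality as ≡ using (_≡_)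

-- The commutative ring of formal power series over ℤ.

module PowerSeries where
  open Defs
  open import Data.Integer using (-_; _+_; _*_; _-_)
  open ≡

  sumTo-cong : ∀ {g h : ℕ → ℤ} n → (∀ k → k ℕ.≤ n → g k ≡ h k) → sumTo g n ≡ sumTo h n
  sumTo-cong zero    e = e zero z≤n
  sumTo-cong (suc n) e = cong₂ _+_ (sumTo-cong n (λ k k≤n → e k (ℕₚ.m≤n⇒m≤1+n k≤n))) (e (suc n) ℕₚ.≤-refl)

  private
    +-interchange : ∀ a b c d → (a + b) + (c + d) ≡ (a + c) + (b + d)
    +-interchange = solve-∀

  sumTo-+ : ∀ (g h : ℕ → ℤ) n → sumTo (λ k → g k + h k) n ≡ sumTo g n + sumTo h n
  sumTo-+ g h zero    = refl
  sumTo-+ g h (suc n) = trans (cong (_+ (g (suc n) + h (suc n))) (sumTo-+ g h n))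
    (+-interchange (sumTo g n) (sumTo h n) (g (suc n)) (h (suc n)))

  sumTo-*ˡ : ∀ c (h : ℕ → ℤ) n → sumTo (λ k → c * h k) n ≡ c * sumTo h n
  sumTo-*ˡ c h zero    = refl
  sumTo-*ˡ c h (suc n) = trans (cong (_+ c * h (suc n)) (sumTo-*ˡ c h n))
    (sym (ℤₚ.*-distribˡ-+ c (sumTo h n) (h (suc n))))

  sumTo-zero : ∀ (h : ℕ → ℤ) n → (∀ k → k ℕ.≤ n → h k ≡ + 0) → sumTo h n ≡ + 0
  sumTo-zero h zero    z = z zero z≤n
  sumTo-zero h (suc n) z = cong₂ _+_ (sumTo-zero h n (λ k k≤n → z k (ℕₚ.m≤n⇒m≤1+n k≤n))) (z (suc n) ℕₚ.≤-refl)

  sumTo-head : ∀ (h : ℕ → ℤ) n → sumTo h (suc n) ≡ h 0 + sumTo (h ∘ suc) n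
  sumTo-head h zero    = refl
  sumTo-head h (suc n) = trans (cong (_+ h (suc (suc n))) (sumTo-head h n)) (ℤₚ.+-assoc (h 0) _ _)

  sumTo-swap : ∀ (h : ℕ → ℕ → ℤ) m n →
    sumTo (λ i → sumTo (h i) n) m ≡ sumTo (λ j → sumTo (λ i → h i j) m) n
  sumTo-swap h zero    n = refl
  sumTo-swap h (suc m) n = trans (cong (_+ sumTo (h (suc m)) n) (sumTo-swap h m n))
    (sym (sumTo-+ (λ j → sumTo (λ i → h i j) m) (h (suc m)) n))

  tail : PS → PS
  tail f = f ∘ suc

  ⊗-head : ∀ f g n → (f ⊗ g) (suc n) ≡ f 0 * g (suc n) + (tail f ⊗ g) n
  ⊗-head f g n = sumTo-head (λ k → f k * g (suc n ℕ.∸ k)) n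

  ⊗-last : ∀ f g n → (f ⊗ g) (suc n) ≡ (f ⊗ tail g) n + f (suc n) * g 0
  ⊗-last f g n = cong₂ _+_
    (sumTo-cong n (λ k k≤n → cong (λ i → f k * g i) (ℕₚ.+-∸-assoc 1 k≤n)))
    (cong (λ i → f (suc n) * g i) (ℕₚ.n∸n≡0 n))

  ⊗-cong : ∀ {f f′ g g′} → f ≈ₚ f′ → g ≈ₚ g′ → f ⊗ g ≈ₚ f′ ⊗ g′
  ⊗-cong e e′ n = sumTo-cong n (λ k _ → cong₂ _*_ (e k) (e′ (n ℕ.∸ k)))

  ⊗-comm : ∀ f g → f ⊗ g ≈ₚ g ⊗ f
  ⊗-comm f g zero    = ℤₚ.*-comm (f 0) (g 0)
  ⊗-comm f g (suc n) = begin
    (f ⊗ g) (suc n)                   ≡⟨ ⊗-head f g n ⟩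
    f 0 * g (suc n) + (tail f ⊗ g) n  ≡⟨ cong₂ _+_ (ℤₚ.*-comm (f 0) _) (⊗-comm (tail f) g n) ⟩
    g (suc n) * f 0 + (g ⊗ tail f) n  ≡⟨ ℤₚ.+-comm (g (suc n) * f 0) _ ⟩
    (g ⊗ tail f) n + g (suc n) * f 0  ≡⟨ ⊗-last g f n ⟨
    (g ⊗ f) (suc n)                   ∎
    where open ≡-Reasoning

  ⊗-distribʳ : ∀ h f g → (f ⊕ g) ⊗ h ≈ₚ f ⊗ h ⊕ g ⊗ h
  ⊗-distribʳ h f g n = trans (sumTo-cong n (λ k _ → ℤₚ.*-distribʳ-+ (h (n ℕ.∸ k)) (f k) (g k)))
    (sumTo-+ (λ k → f k * h (n ℕ.∸ k)) (λ k → g k * h (n ℕ.∸ k)) n)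

  ·-⊗ : ∀ c f g → (c · f) ⊗ g ≈ₚ c · (f ⊗ g)
  ·-⊗ c f g n = trans (sumTo-cong n (λ k _ → ℤₚ.*-assoc c (f k) (g (n ℕ.∸ k)))) (sumTo-*ˡ c _ n)

  -- Induction on the degree: by `⊗-head` the tail of `f ⊗ g` is `f 0 · tail g ⊕ tail f ⊗ g`, so f
  -- loses its head in the recursive call while g and h stay.
  ⊗-assoc : ∀ f g h → (f ⊗ g) ⊗ h ≈ₚ f ⊗ (g ⊗ h)
  ⊗-assoc f g h zero    = ℤₚ.*-assoc (f 0) (g 0) (h 0)
  ⊗-assoc f g h (suc n) = begin
    ((f ⊗ g) ⊗ h) (suc n)
      ≡⟨ ⊗-head (f ⊗ g) h n ⟩
    f 0 * g 0 * h (suc n) + (tail (f ⊗ g) ⊗ h) n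
      ≡⟨ cong (λ z → f 0 * g 0 * h (suc n) + z) (⊗-cong {g = h} (⊗-head f g) (λ _ → refl) n) ⟩
    f 0 * g 0 * h (suc n) + ((f 0 · tail g ⊕ tail f ⊗ g) ⊗ h) n
      ≡⟨ cong (λ z → f 0 * g 0 * h (suc n) + z) (⊗-distribʳ h (f 0 · tail g) (tail f ⊗ g) n) ⟩
    f 0 * g 0 * h (suc n) + (((f 0 · tail g) ⊗ h) n + ((tail f ⊗ g) ⊗ h) n)
      ≡⟨ cong (λ z → f 0 * g 0 * h (suc n) + z) (cong₂ _+_ (·-⊗ (f 0) (tail g) h n) (⊗-assoc (tail f) g h n)) ⟩
    f 0 * g 0 * h (suc n) + (f 0 * (tail g ⊗ h) n + (tail f ⊗ (g ⊗ h)) n)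
      ≡⟨ regroup (f 0) (g 0) (h (suc n)) _ _ ⟩
    f 0 * (g 0 * h (suc n) + (tail g ⊗ h) n) + (tail f ⊗ (g ⊗ h)) n
      ≡⟨ cong (λ z → f 0 * z + (tail f ⊗ (g ⊗ h)) n) (⊗-head g h n) ⟨
    f 0 * (g ⊗ h) (suc n) + (tail f ⊗ (g ⊗ h)) n
      ≡⟨ ⊗-head f (g ⊗ h) n ⟨
    (f ⊗ (g ⊗ h)) (suc n) ∎
    where
    open ≡-Reasoning
    regroup : ∀ a b c x y → a * b * c + (a * x + y) ≡ a * (b * c + x) + y
    regroup = solve-∀

  const-⊗ : ∀ c f → const c ⊗ f ≈ₚ c · f
  const-⊗ c f zero    = refl
  const-⊗ c f (suc n) = trans (⊗-head (const c) f n)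
    (trans (cong (λ z → c * f (suc n) + z) (sumTo-zero _ n (λ k _ → ℤₚ.*-zeroˡ (f (n ℕ.∸ k))))) (ℤₚ.+-identityʳ _))

  ⊗-identityˡ : ∀ f → const (+ 1) ⊗ f ≈ₚ f
  ⊗-identityˡ f n = trans (const-⊗ (+ 1) f n) (ℤₚ.*-identityˡ (f n))

  0ₚ 1ₚ : PS
  0ₚ _ = + 0
  1ₚ = const (+ 1)

  neg : PS → PS
  neg f n = - f n

  PS-commutativeRing : CommutativeRing 0ℓ 0ℓ
  PS-commutativeRing = record
    { Carrier = PS ; _≈_ = _≈ₚ_ ; _+_ = _⊕_ ; _*_ = _⊗_ ; -_ = neg ; 0# = 0ₚ ; 1# = 1ₚ
    ; isCommutativeRing = record
      { isRing = record
        { +-isAbelianGroup = record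
          { isGroup = record
            { isMonoid = record
              { isSemigroup = record
                { isMagma = record
                  { isEquivalence = record
                    { refl = λ _ → refl
                    ; sym = λ e n → sym (e n)
                    ; trans = λ e e′ n → trans (e n) (e′ n) }
                  ; ∙-cong = λ e e′ n → cong₂ _+_ (e n) (e′ n) }
                ; assoc = λ f g h n → ℤₚ.+-assoc (f n) (g n) (h n) }
              ; identity = (λ f n → ℤₚ.+-identityˡ (f n)) , λ f n → ℤₚ.+-identityʳ (f n) }
            ; inverse = (λ f n → ℤₚ.+-inverseˡ (f n)) , λ f n → ℤₚ.+-inverseʳ (f n)
            ; ⁻¹-cong = λ e n → cong -_ (e n) }
          ; comm = λ f g n → ℤₚ.+-comm (f n) (g n) }
        ; *-cong = ⊗-cong
        ; *-assoc = ⊗-assoc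
        ; *-identity = ⊗-identityˡ , λ f n → trans (⊗-comm f 1ₚ n) (⊗-identityˡ f n)
        ; distrib = (λ h f g n → trans (⊗-comm h (f ⊕ g) n)
            (trans (⊗-distribʳ h f g n) (cong₂ _+_ (⊗-comm f h n) (⊗-comm g h n)))) , ⊗-distribʳ }
      ; *-comm = ⊗-comm } }

-- Multiplicative inverses of power series.

module Inverse where
  open Defs
  open PowerSeries
  open import Data.Integer using (-_; _+_; _*_; _-_)
  open ≡

  -- The recursion behind inv is private to Defs. Its unfolding contains
  -- a dot product starting at the offset 0; abstracting this 0 in the goal lets unification find the
  -- dot product at a general offset.
  mutual
    dot : PS → ℕ → ℕ → ℤ
    dot = _

    inv-suc : ∀ f n → inv f (suc n) ≡ - (f zero * dot f zero n)
    inv-suc f n with zero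
    ... | w = refl

  -- The offset i has to be general, since the recursion of the dot product raises it at each entry.
  dot-sum : ∀ f i n → dot f i n ≡ sumTo (λ k → f (suc i ℕ.+ k) * inv f (n ℕ.∸ k)) n
  dot-sum f i zero    = trans (ℤₚ.+-identityʳ _) (cong (λ j → f (suc j) * f 0) (sym (ℕₚ.+-identityʳ i)))
  dot-sum f i (suc n) = trans (cong₂ (λ j s → f (suc j) * inv f (suc n) + s) (sym (ℕₚ.+-identityʳ i)) (trans (dot-sum f (suc i) n)
      (sumTo-cong n (λ k _ → cong (λ j → f (suc j) * inv f (n ℕ.∸ k)) (sym (ℕₚ.+-suc i k))))))
    (sym (sumTo-head (λ k → f (suc i ℕ.+ k) * inv f (suc n ℕ.∸ k)) n))

  ⊗-inverseʳ : ∀ f → f 0 ≡ + 1 → f ⊗ inv f ≈ₚ 1ₚ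
  ⊗-inverseʳ f e zero    = cong₂ _*_ e e
  ⊗-inverseʳ f e (suc n) = trans (⊗-head f (inv f) n) (trans
    (cong₂ (λ u v → u * v + (tail f ⊗ inv f) n) e (trans (inv-suc f n) (cong₂ (λ u v → - (u * v)) e (dot-sum f 0 n))))
    (cancel ((tail f ⊗ inv f) n)))
    where
    cancel : ∀ x → + 1 * - (+ 1 * x) + x ≡ + 0
    cancel = solve-∀

  ⊗-inverseˡ : ∀ f → f 0 ≡ + 1 → inv f ⊗ f ≈ₚ 1ₚ
  ⊗-inverseˡ f e n = trans (⊗-comm (inv f) f n) (⊗-inverseʳ f e n)

  ⊗-cancelʳ : ∀ f g h → h 0 ≡ + 1 → f ⊗ h ≈ₚ g ⊗ h → f ≈ₚ g
  ⊗-cancelʳ f g h e p n = trans (sym (undo f n)) (trans (⊗-cong {g = inv h} p (λ _ → refl) n) (undo g n))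
    where
    undo : ∀ f → (f ⊗ h) ⊗ inv h ≈ₚ f
    undo f n = trans (⊗-assoc f h (inv h) n) (trans (⊗-cong {f} (λ _ → refl) (⊗-inverseʳ h e) n)
      (trans (⊗-comm f 1ₚ n) (⊗-identityˡ f n)))

-- Finite sums with indicator terms.

module FiniteSums where
  open Defs
  open import Data.Integer using (_+_; _*_)
  open ≡

  -- Indicators that carry their value: h is kept where m = n, respectively m < n. Recursion on both
  -- numbers lets common successors cancel by computation, without a decision procedure.
  at below : ℕ → ℕ → ℤ → ℤ
  at zero    zero    h = h
  at zero    (suc n) h = + 0
  at (suc m) zero    h = + 0
  at (suc m) (suc n) h = at m n h
  below m       zero    h = + 0
  below zero    (suc n) h = h
  below (suc m) (suc n) h = below m n h

  at-sym : ∀ m n h → at m n h ≡ at n m h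
  at-sym zero    zero    h = refl
  at-sym zero    (suc n) h = refl
  at-sym (suc m) zero    h = refl
  at-sym (suc m) (suc n) h = at-sym m n h

  at-diag : ∀ n h → at n n h ≡ h
  at-diag zero    h = refl
  at-diag (suc n) h = at-diag n h

  at-> : ∀ {m n} h → n ℕ.< m → at m n h ≡ + 0
  at-> {suc m} {zero}  h _       = refl
  at-> {suc m} {suc n} h (s≤s p) = at-> h p

  at-< : ∀ {m n} h → m ℕ.< n → at m n h ≡ + 0
  at-< {m} {n} h p = trans (at-sym m n h) (at-> h p)

  at-≢ : ∀ {m n} h → m ≢ n → at m n h ≡ + 0
  at-≢ {zero}  {zero}  h ¬e = ⊥-elim (¬e refl)
  at-≢ {zero}  {suc n} h ¬e = refl
  at-≢ {suc m} {zero}  h ¬e = refl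
  at-≢ {suc m} {suc n} h ¬e = at-≢ {m} {n} h (¬e ∘ cong suc)

  at-0 : ∀ m n → at m n (+ 0) ≡ + 0
  at-0 zero    zero    = refl
  at-0 zero    (suc n) = refl
  at-0 (suc m) zero    = refl
  at-0 (suc m) (suc n) = at-0 m n

  at-+ : ∀ m n g h → at m n (g + h) ≡ at m n g + at m n h
  at-+ zero    zero    g h = refl
  at-+ zero    (suc n) g h = refl
  at-+ (suc m) zero    g h = refl
  at-+ (suc m) (suc n) g h = at-+ m n g h

  at-*ˡ : ∀ m n c h → at m n (c * h) ≡ c * at m n h
  at-*ˡ zero    zero    c h = refl
  at-*ˡ zero    (suc n) c h = sym (ℤₚ.*-zeroʳ c)
  at-*ˡ (suc m) zero    c h = sym (ℤₚ.*-zeroʳ c)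
  at-*ˡ (suc m) (suc n) c h = at-*ˡ m n c h

  at-subst : ∀ m n (f : ℕ → ℤ) → at m n (f m) ≡ at m n (f n)
  at-subst zero    zero    f = refl
  at-subst zero    (suc n) f = refl
  at-subst (suc m) zero    f = refl
  at-subst (suc m) (suc n) f = at-subst m n (f ∘ suc)

  at-comm : ∀ m n p q h → at m n (at p q h) ≡ at p q (at m n h)
  at-comm zero    zero    p q h = refl
  at-comm zero    (suc n) p q h = sym (at-0 p q)
  at-comm (suc m) zero    p q h = sym (at-0 p q)
  at-comm (suc m) (suc n) p q h = at-comm m n p q h

  at-below-comm : ∀ m n p q h → at m n (below p q h) ≡ below p q (at m n h)
  at-below-comm m n p       zero    h = at-0 m n
  at-below-comm m n zero    (suc q) h = refl
  at-below-comm m n (suc p) (suc q) h = at-below-comm m n p q h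

  trichotomy : ∀ m n h → h ≡ below n m h + below m n h + at m n h
  trichotomy zero    zero    h = sym (ℤₚ.+-identityˡ h)
  trichotomy zero    (suc n) h = sym (trans (ℤₚ.+-identityʳ _) (ℤₚ.+-identityˡ h))
  trichotomy (suc m) zero    h = sym (trans (ℤₚ.+-identityʳ _) (ℤₚ.+-identityʳ h))
  trichotomy (suc m) (suc n) h = trichotomy m n h

  below-+ : ∀ m n g h → below m n (g + h) ≡ below m n g + below m n h
  below-+ m       zero    g h = refl
  below-+ zero    (suc n) g h = refl
  below-+ (suc m) (suc n) g h = below-+ m n g h

  below-≥ : ∀ {m n} h → n ℕ.≤ m → below m n h ≡ + 0
  below-≥ h z≤n     = refl
  below-≥ h (s≤s p) = below-≥ h p

  below-0 : ∀ m n → below m n (+ 0) ≡ + 0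
  below-0 m       zero    = refl
  below-0 zero    (suc n) = refl
  below-0 (suc m) (suc n) = below-0 m n

  below-suc-+ : ∀ m n h → below m (suc n ℕ.+ m) h ≡ h
  below-suc-+ m n h = trans (cong (λ k → below m (suc k) h) (ℕₚ.+-comm n m)) (go m)
    where
    go : ∀ k → below k (suc (k ℕ.+ n)) h ≡ h
    go zero    = refl
    go (suc k) = go k

  -- Agreement above m suffices, as `below m` discards the rest. This is how expressions in a
  -- truncated difference n ∸ m are simplified where the difference is genuine.
  below-cong : ∀ m n (f g : ℕ → ℤ) → (∀ k → f (m ℕ.+ suc k) ≡ g (m ℕ.+ suc k)) → below m n (f n) ≡ below m n (g n)
  below-cong m       zero    f g e = refl
  below-cong zero    (suc n) f g e = e n
  below-cong (suc m) (suc n) f g e = below-cong m n (f ∘ suc) (g ∘ suc) e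

  -- The sum starts at 1, since it will run over divisors.
  ∑ : ℕ → (ℕ → ℤ) → ℤ
  ∑ zero    h = + 0
  ∑ (suc N) h = ∑ N h + h (suc N)

  ∑-cong : ∀ N {g h : ℕ → ℤ} → (∀ k → 1 ℕ.≤ k → k ℕ.≤ N → g k ≡ h k) → ∑ N g ≡ ∑ N h
  ∑-cong zero    e = refl
  ∑-cong (suc N) e = cong₂ _+_ (∑-cong N (λ k l u → e k l (ℕₚ.m≤n⇒m≤1+n u))) (e (suc N) (s≤s z≤n) ℕₚ.≤-refl)

  ∑-ext : ∀ N {g h : ℕ → ℤ} → (∀ k → g k ≡ h k) → ∑ N g ≡ ∑ N h
  ∑-ext N e = ∑-cong N (λ k _ _ → e k)

  ∑-+ : ∀ N (g h : ℕ → ℤ) → ∑ N (λ k → g k + h k) ≡ ∑ N g + ∑ N h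
  ∑-+ zero    g h = refl
  ∑-+ (suc N) g h = trans (cong (_+ (g (suc N) + h (suc N))) (∑-+ N g h))
    (interchange (∑ N g) (∑ N h) (g (suc N)) (h (suc N)))
    where
    interchange : ∀ a b c d → (a + b) + (c + d) ≡ (a + c) + (b + d)
    interchange = solve-∀

  ∑-*ˡ : ∀ N c (h : ℕ → ℤ) → ∑ N (λ k → c * h k) ≡ c * ∑ N h
  ∑-*ˡ zero    c h = sym (ℤₚ.*-zeroʳ c)
  ∑-*ˡ (suc N) c h = trans (cong (_+ c * h (suc N)) (∑-*ˡ N c h)) (sym (ℤₚ.*-distribˡ-+ c (∑ N h) (h (suc N))))

  ∑-*ʳ : ∀ N c (h : ℕ → ℤ) → ∑ N (λ k → h k * c) ≡ ∑ N h * c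
  ∑-*ʳ N c h = trans (∑-ext N (λ k → ℤₚ.*-comm (h k) c)) (trans (∑-*ˡ N c h) (ℤₚ.*-comm c (∑ N h)))

  ∑-at : ∀ N m n (h : ℕ → ℤ) → ∑ N (λ k → at m n (h k)) ≡ at m n (∑ N h)
  ∑-at zero    m n h = sym (at-0 m n)
  ∑-at (suc N) m n h = trans (cong (_+ at m n (h (suc N))) (∑-at N m n h)) (sym (at-+ m n (∑ N h) (h (suc N))))

  ∑-below : ∀ N m n (h : ℕ → ℤ) → ∑ N (λ k → below m n (h k)) ≡ below m n (∑ N h)
  ∑-below zero    m n h = sym (below-0 m n)
  ∑-below (suc N) m n h = trans (cong (_+ below m n (h (suc N))) (∑-below N m n h)) (sym (below-+ m n (∑ N h) (h (suc N))))

  ∑-zero : ∀ N (h : ℕ → ℤ) → (∀ k → 1 ℕ.≤ k → k ℕ.≤ N → h k ≡ + 0) → ∑ N h ≡ + 0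
  ∑-zero zero    h z = refl
  ∑-zero (suc N) h z = cong₂ _+_ (∑-zero N h (λ k l u → z k l (ℕₚ.m≤n⇒m≤1+n u))) (z (suc N) (s≤s z≤n) ℕₚ.≤-refl)

  ∑-swap : ∀ M N (h : ℕ → ℕ → ℤ) → ∑ M (λ i → ∑ N (h i)) ≡ ∑ N (λ j → ∑ M (λ i → h i j))
  ∑-swap zero    N h = sym (∑-zero N (λ _ → + 0) (λ _ _ _ → refl))
  ∑-swap (suc M) N h = trans (cong (_+ ∑ N (h (suc M))) (∑-swap M N h))
    (sym (∑-+ N (λ j → ∑ M (λ i → h i j)) (h (suc M))))

  ∑-extend : ∀ M N (h : ℕ → ℤ) → (∀ k → N ℕ.< k → h k ≡ + 0) → ∑ (M ℕ.+ N) h ≡ ∑ N h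
  ∑-extend zero    N h z = refl
  ∑-extend (suc M) N h z = trans (cong₂ _+_ (∑-extend M N h z) (z (suc M ℕ.+ N) (s≤s (ℕₚ.m≤n+m N M)))) (ℤₚ.+-identityʳ _)

  ∑-bound : ∀ {M N} (h : ℕ → ℤ) → N ℕ.≤ M → (∀ k → N ℕ.< k → h k ≡ + 0) → ∑ M h ≡ ∑ N h
  ∑-bound {M} {N} h N≤M z = subst (λ k → ∑ k h ≡ ∑ N h) (ℕₚ.m∸n+n≡m N≤M) (∑-extend (M ℕ.∸ N) N h z)

  -- The translation by b carries 1, 2, ... onto the indices above b. The vanishing of h beyond N
  -- absorbs the mismatch of the upper ends.
  ∑-shift : ∀ N b (h : ℕ → ℤ) → (∀ k → N ℕ.< k → h k ≡ + 0) → ∑ N (λ a → below b a (h a)) ≡ ∑ N (λ a → h (a ℕ.+ b))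
  ∑-shift N b h z = trans (sym (∑-bound (λ a → below b a (h a)) (ℕₚ.m≤m+n N b)
      (λ k p → trans (cong (below b k) (z k p)) (below-0 b k)))) (go N)
    where
    go : ∀ M → ∑ (M ℕ.+ b) (λ a → below b a (h a)) ≡ ∑ M (λ a → h (a ℕ.+ b))
    go zero    = ∑-zero b _ (λ k _ k≤b → below-≥ (h k) k≤b)
    go (suc M) = cong₂ _+_ (go M) (below-suc-+ b M _)

  ∑-pick : ∀ N m (f : ℕ → ℤ) → 1 ℕ.≤ m → m ℕ.≤ N → ∑ N (λ k → at m k (f k)) ≡ f m
  ∑-pick zero    zero    f () m≤N
  ∑-pick (suc N) m f 1≤m m≤N with ℕₚ.m≤n⇒m<n∨m≡n m≤N
  ... | inj₁ (s≤s m≤N′) = trans (cong₂ _+_ (∑-pick N m f 1≤m m≤N′) (at-< (f (suc N)) (s≤s m≤N′))) (ℤₚ.+-identityʳ (f m))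
  ... | inj₂ refl = trans (cong₂ _+_ (∑-zero N _ (λ k _ k≤N → at-> (f k) (s≤s k≤N))) (at-diag m (f m))) (ℤₚ.+-identityˡ (f m))

-- Divisor sums, sums over a x + b y = n, and Liouville's shear.

module DivisorSums where
  open Defs
  open PowerSeries
  open FiniteSums
  open import Data.Integer using (_+_; _*_)
  open ≡

  -- The series Σ F(a, x) q^(ax) over positive a and x; both are at most n = a x, which bounds the
  -- sums. `Quad` is likewise Σ F(a, b, x, y) q^(ax + by).
  Λ : (ℕ → ℕ → ℤ) → PS
  Λ F n = ∑ n (λ a → ∑ n (λ x → at (a ℕ.* x) n (F a x)))

  Quad : (ℕ → ℕ → ℕ → ℕ → ℤ) → PS
  Quad F n = ∑ n (λ a → ∑ n (λ b → ∑ n (λ x → ∑ n (λ y → at (a ℕ.* x ℕ.+ b ℕ.* y) n (F a b x y)))))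

  m≤m*n : ∀ m {n} → 1 ℕ.≤ n → m ℕ.≤ m ℕ.* n
  m≤m*n m {suc n} _ = ℕₚ.m≤m*n m (suc n)

  m≤n*m : ∀ m {n} → 1 ℕ.≤ n → m ℕ.≤ n ℕ.* m
  m≤n*m m {suc n} _ = ℕₚ.m≤m+n m (n ℕ.* m)

  Λ-ext : ∀ {F G} → (∀ a x → F a x ≡ G a x) → Λ F ≈ₚ Λ G
  Λ-ext e n = ∑-ext n (λ a → ∑-ext n (λ x → cong (at (a ℕ.* x) n) (e a x)))

  Λ-+ : ∀ F G → Λ (λ a x → F a x + G a x) ≈ₚ Λ F ⊕ Λ G
  Λ-+ F G n = trans (∑-ext n (λ a → trans (∑-ext n (λ x → at-+ (a ℕ.* x) n (F a x) (G a x))) (∑-+ n _ _)))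
    (∑-+ n _ _)

  Λ-*ˡ : ∀ c F → Λ (λ a x → c * F a x) ≈ₚ c · Λ F
  Λ-*ˡ c F n = trans (∑-ext n (λ a → trans (∑-ext n (λ x → at-*ˡ (a ℕ.* x) n c (F a x)))
      (∑-*ˡ n c (λ x → at (a ℕ.* x) n (F a x)))))
    (∑-*ˡ n c (λ a → ∑ n (λ x → at (a ℕ.* x) n (F a x))))

  θ-Λ : ∀ F → θ (Λ F) ≈ₚ Λ (λ a x → + a * + x * F a x)
  θ-Λ F n = trans (sym (Λ-*ˡ (+ n) F n)) (∑-ext n (λ a → ∑-ext n (λ x →
    trans (sym (at-subst (a ℕ.* x) n (λ m → + m * F a x)))
      (cong (λ z → at (a ℕ.* x) n (z * F a x)) (ℤₚ.pos-* a x)))))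

  Λ-bound : ∀ F {k n} → k ℕ.≤ n → Λ F k ≡ ∑ n (λ a → ∑ n (λ x → at (a ℕ.* x) k (F a x)))
  Λ-bound F {k} {n} k≤n = trans
    (∑-cong k (λ a 1≤a _ → sym (∑-bound _ k≤n (λ x k<x → at-> (F a x) (ℕₚ.<-≤-trans k<x (m≤n*m x 1≤a))))))
    (sym (∑-bound _ k≤n (λ a k<a → ∑-zero n _ (λ x 1≤x _ → at-> (F a x) (ℕₚ.<-≤-trans k<a (m≤m*n a 1≤x))))))

  Quad-ext : ∀ {F G} → (∀ a b x y → F a b x y ≡ G a b x y) → Quad F ≈ₚ Quad G
  Quad-ext e n = ∑-ext n (λ a → ∑-ext n (λ b → ∑-ext n (λ x → ∑-ext n (λ y →
    cong (at (a ℕ.* x ℕ.+ b ℕ.* y) n) (e a b x y)))))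

  Λ-ext⁺ : ∀ {F G} → (∀ a x → F (suc a) (suc x) ≡ G (suc a) (suc x)) → Λ F ≈ₚ Λ G
  Λ-ext⁺ e n = ∑-cong n (λ { (suc a) _ _ → ∑-cong n (λ { (suc x) _ _ → cong (at (suc a ℕ.* suc x) n) (e a x) }) })

  Λ-transpose : ∀ F → Λ F ≈ₚ Λ (λ a x → F x a)
  Λ-transpose F n = trans (∑-swap n n _) (∑-ext n (λ x → ∑-ext n (λ a → cong (λ m → at m n (F a x)) (ℕₚ.*-comm a x))))

  Quad-ext⁺ : ∀ {F G} → (∀ a b x y → F (suc a) (suc b) (suc x) (suc y) ≡ G (suc a) (suc b) (suc x) (suc y)) → Quad F ≈ₚ Quad G
  Quad-ext⁺ e n = ∑-cong n (λ { (suc a) _ _ → ∑-cong n (λ { (suc b) _ _ → ∑-cong n (λ { (suc x) _ _ → ∑-cong n (λ { (suc y) _ _ →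
    cong (at (suc a ℕ.* suc x ℕ.+ suc b ℕ.* suc y) n) (e a b x y) }) }) }) })

  Quad-+ : ∀ (F G : ℕ → ℕ → ℕ → ℕ → ℤ) → Quad (λ a b x y → F a b x y + G a b x y) ≈ₚ Quad F ⊕ Quad G
  Quad-+ F G n = trans (∑-ext n (λ a → trans (∑-ext n (λ b → trans (∑-ext n (λ x → trans (∑-ext n (λ y →
    at-+ (a ℕ.* x ℕ.+ b ℕ.* y) n (F a b x y) (G a b x y))) (∑-+ n _ _))) (∑-+ n _ _))) (∑-+ n _ _))) (∑-+ n _ _)

  Quad-*ˡ : ∀ c (F : ℕ → ℕ → ℕ → ℕ → ℤ) → Quad (λ a b x y → c * F a b x y) ≈ₚ c · Quad F
  Quad-*ˡ c F n =
    trans (∑-ext n (λ a → trans (∑-ext n (λ b → trans (∑-ext n (λ x → trans (∑-ext n (λ y →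
      at-*ˡ (a ℕ.* x ℕ.+ b ℕ.* y) n c (F a b x y)))
      (∑-*ˡ n c (G a b x)))) (∑-*ˡ n c (λ x → ∑ n (G a b x))))) (∑-*ˡ n c (λ b → ∑ n (λ x → ∑ n (G a b x))))))
      (∑-*ˡ n c (λ a → ∑ n (λ b → ∑ n (λ x → ∑ n (G a b x)))))
    where
    G : ℕ → ℕ → ℕ → ℕ → ℤ
    G a b x y = at (a ℕ.* x ℕ.+ b ℕ.* y) n (F a b x y)

  Quad-swap : ∀ F → Quad F ≈ₚ Quad (λ a b x y → F b a y x)
  Quad-swap F n = trans (∑-swap n n _) (∑-ext n (λ b → ∑-ext n (λ a → trans (∑-swap n n _)
    (∑-ext n (λ y → ∑-ext n (λ x → cong (λ m → at m n (F a b x y)) (ℕₚ.+-comm (a ℕ.* x) (b ℕ.* y))))))))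

  Quad-inner : ∀ n (g : ℕ → ℕ → ℕ → ℕ → ℤ) →
    ∑ n (λ a → ∑ n (λ b → ∑ n (λ x → ∑ n (λ y → g a b x y)))) ≡ ∑ n (λ b → ∑ n (λ x → ∑ n (λ a → ∑ n (λ y → g a b x y))))
  Quad-inner n g = trans (∑-swap n n _) (∑-ext n (λ b → ∑-swap n n _))

  Quad-transpose : ∀ F → Quad F ≈ₚ Quad (λ a b x y → F x y a b)
  Quad-transpose F n = trans (∑-ext n (λ a → ∑-swap n n _)) (trans (∑-swap n n _) (∑-ext n (λ x →
    trans (∑-ext n (λ a → ∑-swap n n _)) (trans (∑-swap n n _) (∑-ext n (λ y → ∑-ext n (λ a → ∑-ext n (λ b →
    cong (λ m → at m n (F a b x y)) (cong₂ ℕ._+_ (ℕₚ.*-comm a x) (ℕₚ.*-comm b y))))))))))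

  -- From a x + b y = (a - b) x + b (x + y): the solutions with b < a correspond to those with x <
  -- y. For fixed b and x both sides are brought to `mid`, where a and y run freely.
  shear : ∀ (F : ℕ → ℕ → ℕ → ℕ → ℤ) → Quad (λ a b x y → below b a (F a b x y)) ≈ₚ Quad (λ a b x y → below x y (F (a ℕ.+ b) b x (y ℕ.∸ x)))
  shear F n = trans (Quad-inner n (λ a b x y → at (a ℕ.* x ℕ.+ b ℕ.* y) n (below b a (F a b x y))))
    (trans (∑-cong n (λ b 1≤b _ → ∑-cong n (λ x 1≤x _ → trans (left b x 1≤x) (sym (right b x 1≤b)))))
    (sym (Quad-inner n (λ a b x y → at (a ℕ.* x ℕ.+ b ℕ.* y) n (below x y (F (a ℕ.+ b) b x (y ℕ.∸ x)))))))
    where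
    mid : ℕ → ℕ → ℤ
    mid b x = ∑ n (λ a → ∑ n (λ y → at ((a ℕ.+ b) ℕ.* x ℕ.+ b ℕ.* y) n (F (a ℕ.+ b) b x y)))
    left : ∀ b x → 1 ℕ.≤ x → ∑ n (λ a → ∑ n (λ y → at (a ℕ.* x ℕ.+ b ℕ.* y) n (below b a (F a b x y)))) ≡ mid b x
    left b x 1≤x = trans
      (∑-ext n (λ a → trans (∑-ext n (λ y → at-below-comm (a ℕ.* x ℕ.+ b ℕ.* y) n b a (F a b x y))) (∑-below n b a _)))
      (∑-shift n b (λ a → ∑ n (λ y → at (a ℕ.* x ℕ.+ b ℕ.* y) n (F a b x y)))
        (λ a n<a → ∑-zero n _ (λ y _ _ → at-> (F a b x y) (ℕₚ.<-≤-trans n<a (ℕₚ.≤-trans (m≤m*n a 1≤x) (ℕₚ.m≤m+n _ _))))))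
    rearrange : ∀ a b x y → a ℕ.* x ℕ.+ b ℕ.* (y ℕ.+ x) ≡ (a ℕ.+ b) ℕ.* x ℕ.+ b ℕ.* y
    rearrange = ℕ-Solver.solve-∀
    right : ∀ b x → 1 ℕ.≤ b → ∑ n (λ a → ∑ n (λ y → at (a ℕ.* x ℕ.+ b ℕ.* y) n (below x y (F (a ℕ.+ b) b x (y ℕ.∸ x))))) ≡ mid b x
    right b x 1≤b = ∑-ext n (λ a → trans
      (∑-ext n (λ y → at-below-comm (a ℕ.* x ℕ.+ b ℕ.* y) n x y (F (a ℕ.+ b) b x (y ℕ.∸ x))))
      (trans (∑-shift n x (λ y → at (a ℕ.* x ℕ.+ b ℕ.* y) n (F (a ℕ.+ b) b x (y ℕ.∸ x)))
        (λ y n<y → at-> (F (a ℕ.+ b) b x (y ℕ.∸ x)) (ℕₚ.<-≤-trans n<y (ℕₚ.≤-trans (m≤n*m y 1≤b) (ℕₚ.m≤n+m _ (a ℕ.* x))))))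
      (∑-ext n (λ y → cong₂ (λ m z → at m n (F (a ℕ.+ b) b x z)) (rearrange a b x y) (ℕₚ.m+n∸n≡m y x)))))

  shear′ : ∀ (F : ℕ → ℕ → ℕ → ℕ → ℤ) → Quad (λ a b x y → below a b (F a b x y)) ≈ₚ Quad (λ a b x y → below y x (F a (a ℕ.+ b) (x ℕ.∸ y) y))
  shear′ F n = trans (Quad-swap (λ a b x y → below a b (F a b x y)) n) (trans (shear (λ a b x y → F b a y x) n)
    (trans (Quad-swap (λ a b x y → below x y (F b (a ℕ.+ b) (y ℕ.∸ x) x)) n)
    (Quad-ext {λ a b x y → below y x (F a (b ℕ.+ a) (x ℕ.∸ y) y)} {λ a b x y → below y x (F a (a ℕ.+ b) (x ℕ.∸ y) y)}
      (λ a b x y → cong (λ m → below y x (F a m (x ℕ.∸ y) y)) (ℕₚ.+-comm b a)) n)))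

  mono : ℕ → PS
  mono p n = at p n (+ 1)

  at-mono : ∀ m n h → at m n h ≡ h * mono m n
  at-mono m n h = trans (cong (at m n) (sym (ℤₚ.*-identityʳ h))) (at-*ˡ m n h (+ 1))

  mono-⊗ : ∀ p q → mono p ⊗ mono q ≈ₚ mono (p ℕ.+ q)
  mono-⊗ zero    q zero    = ℤₚ.*-identityˡ (mono q 0)
  mono-⊗ zero    q (suc n) = trans (⊗-head (mono 0) (mono q) n)
    (trans (cong₂ _+_ (ℤₚ.*-identityˡ (mono q (suc n))) (sumTo-zero _ n (λ k _ → ℤₚ.*-zeroˡ (mono q (n ℕ.∸ k))))) (ℤₚ.+-identityʳ _))
  mono-⊗ (suc p) q zero    = ℤₚ.*-zeroˡ (mono q 0)
  mono-⊗ (suc p) q (suc n) = trans (⊗-head (mono (suc p)) (mono q) n)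
    (trans (cong (_+ (mono p ⊗ mono q) n) (ℤₚ.*-zeroˡ (mono q (suc n)))) (trans (ℤₚ.+-identityˡ _) (mono-⊗ p q n)))

  sumTo-∑-swap : ∀ N n (h : ℕ → ℕ → ℤ) → sumTo (λ k → ∑ N (h k)) n ≡ ∑ N (λ j → sumTo (λ k → h k j) n)
  sumTo-∑-swap N zero    h = refl
  sumTo-∑-swap N (suc n) h = trans (cong (_+ ∑ N (h (suc n))) (sumTo-∑-swap N n h)) (sym (∑-+ N _ _))

  ∑-product : ∀ n (g h : ℕ → ℕ → ℤ) → ∑ n (λ a → ∑ n (g a)) * ∑ n (λ b → ∑ n (h b)) ≡
    ∑ n (λ a → ∑ n (λ b → ∑ n (λ x → ∑ n (λ y → g a x * h b y))))
  ∑-product n g h = trans (sym (∑-*ʳ n _ (λ a → ∑ n (g a)))) (∑-ext n (λ a →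
    trans (sym (∑-*ˡ n (∑ n (g a)) (λ b → ∑ n (h b)))) (∑-ext n (λ b →
    trans (sym (∑-*ʳ n (∑ n (h b)) (g a))) (∑-ext n (λ x → sym (∑-*ˡ n (g a x) (h b))))))))

  Λ-⊗ : ∀ (F G : ℕ → ℕ → ℤ) → Λ F ⊗ Λ G ≈ₚ Quad (λ a b x y → F a x * G b y)
  Λ-⊗ F G n = trans
    (sumTo-cong n (λ k k≤n → trans (cong₂ _*_ (Λ-bound F k≤n) (Λ-bound G (ℕₚ.m∸n≤m n k))) (∑-product n _ _)))
    (trans (sumTo-∑-swap n n _) (∑-ext n (λ a → trans (sumTo-∑-swap n n _) (∑-ext n (λ b →
     trans (sumTo-∑-swap n n _) (∑-ext n (λ x → trans (sumTo-∑-swap n n _) (∑-ext n (λ y → coefficient a b x y)))))))))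
    where
    regroup : ∀ d f e g → f * d * (g * e) ≡ f * g * (d * e)
    regroup = solve-∀
    coefficient : ∀ a b x y → sumTo (λ k → at (a ℕ.* x) k (F a x) * at (b ℕ.* y) (n ℕ.∸ k) (G b y)) n
      ≡ at (a ℕ.* x ℕ.+ b ℕ.* y) n (F a x * G b y)
    coefficient a b x y = trans
      (sumTo-cong n (λ k _ → trans (cong₂ _*_ (at-mono (a ℕ.* x) k (F a x)) (at-mono (b ℕ.* y) (n ℕ.∸ k) (G b y)))
        (regroup (mono (a ℕ.* x) k) (F a x) (mono (b ℕ.* y) (n ℕ.∸ k)) (G b y))))
      (trans (sumTo-*ˡ (F a x * G b y) (λ k → mono (a ℕ.* x) k * mono (b ℕ.* y) (n ℕ.∸ k)) n)
      (trans (cong (F a x * G b y *_) (mono-⊗ (a ℕ.* x) (b ℕ.* y) n)) (sym (at-mono (a ℕ.* x ℕ.+ b ℕ.* y) n (F a x * G b y)))))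

  ∑-at-+ : ∀ k X N (f : ℕ → ℤ) → f 0 ≡ + 0 → X ℕ.≤ N → ∑ N (λ y → at (k ℕ.+ y) X (f y)) ≡ f (X ℕ.∸ k)
  ∑-at-+ zero    zero    N f z X≤N = trans (∑-zero N _ (λ y 1≤y _ → at-> (f y) 1≤y)) (sym z)
  ∑-at-+ zero    (suc X) N f z X≤N = trans (∑-ext N (λ y → at-sym y (suc X) (f y))) (∑-pick N (suc X) f (s≤s z≤n) X≤N)
  ∑-at-+ (suc k) zero    N f z X≤N = trans (∑-zero N _ (λ y _ _ → refl)) (sym z)
  ∑-at-+ (suc k) (suc X) N f z X≤N = ∑-at-+ k X N f z (ℕₚ.≤-trans (ℕₚ.n≤1+n X) X≤N)

  sumTo-∑ : ∀ (h : ℕ → ℤ) n → sumTo h n ≡ h 0 + ∑ n h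
  sumTo-∑ h zero    = sym (ℤₚ.+-identityʳ (h 0))
  sumTo-∑ h (suc n) = trans (cong (_+ h (suc n)) (sumTo-∑ h n)) (ℤₚ.+-assoc (h 0) _ _)

  ⊗-∑ : ∀ g g′ → g 0 ≡ + 0 → g′ 0 ≡ + 0 → ∀ X N → X ℕ.≤ N →
    (g ⊗ g′) X ≡ ∑ N (λ x → ∑ N (λ y → at (x ℕ.+ y) X (g x * g′ y)))
  ⊗-∑ g g′ z z′ X N X≤N = trans (sumTo-∑ h X) (trans (cong (λ w → w * g′ X + ∑ X h) z)
    (trans (trans (cong (_+ ∑ X h) (ℤₚ.*-zeroˡ (g′ X))) (ℤₚ.+-identityˡ _))
    (trans (sym (∑-bound h X≤N (λ x X<x → trans (cong (g x *_) (trans (cong g′ (ℕₚ.m≤n⇒m∸n≡0 (ℕₚ.<⇒≤ X<x))) z′)) (ℤₚ.*-zeroʳ (g x)))))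
    (∑-ext N (λ x → sym (∑-at-+ x X N (λ y → g x * g′ y) (trans (cong (g x *_) z′) (ℤₚ.*-zeroʳ (g x))) X≤N))))))
    where
    h : ℕ → ℤ
    h x = g x * g′ (X ℕ.∸ x)

  -- For a = b the exponent is a (x + y), so only X = x + y matters. The weights of the
  -- decompositions of X add up to a coefficient of `g ⊗ g′`, where g and g′ are read as power
  -- series.
  diagonal : ∀ (G : ℕ → ℕ → ℤ) g g′ → g 0 ≡ + 0 → g′ 0 ≡ + 0 →
    Quad (λ a b x y → at a b (G a (x ℕ.+ y) * (g x * g′ y))) ≈ₚ Λ (λ d X → G d X * (g ⊗ g′) X)
  diagonal G g g′ z z′ n = ∑-cong n (λ a 1≤a a≤n → trans (left a 1≤a a≤n) (sym (right a 1≤a)))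
    where
    K : ℕ → ℕ → ℕ → ℤ
    K a x y = G a (x ℕ.+ y) * (g x * g′ y)
    mid : ℕ → ℤ
    mid a = ∑ n (λ x → ∑ n (λ y → at (a ℕ.* (x ℕ.+ y)) n (K a x y)))
    left : ∀ a → 1 ℕ.≤ a → a ℕ.≤ n → ∑ n (λ b → ∑ n (λ x → ∑ n (λ y → at (a ℕ.* x ℕ.+ b ℕ.* y) n (at a b (K a x y))))) ≡ mid a
    left a 1≤a a≤n = trans
      (∑-ext n (λ b → trans (∑-ext n (λ x → trans (∑-ext n (λ y →
        at-comm (a ℕ.* x ℕ.+ b ℕ.* y) n a b (K a x y))) (∑-at n a b _))) (∑-at n a b _)))
      (trans (∑-pick n a (λ b → ∑ n (λ x → ∑ n (λ y → at (a ℕ.* x ℕ.+ b ℕ.* y) n (K a x y)))) 1≤a a≤n)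
      (∑-ext n (λ x → ∑-ext n (λ y → cong (λ m → at m n (K a x y)) (sym (ℕₚ.*-distribˡ-+ a x y))))))
    pick : ∀ a x y → 1 ℕ.≤ a → 1 ℕ.≤ x → ∑ n (λ X → at (x ℕ.+ y) X (at (a ℕ.* X) n (G a X * (g x * g′ y)))) ≡ at (a ℕ.* (x ℕ.+ y)) n (K a x y)
    pick a x y 1≤a 1≤x with x ℕ.+ y ℕ.≤? n
    ... | yes p = ∑-pick n (x ℕ.+ y) _ (ℕₚ.≤-trans 1≤x (ℕₚ.m≤m+n x y)) p
    ... | no ¬p = trans (∑-zero n _ (λ X _ X≤n → at-> _ (ℕₚ.≤-<-trans X≤n (ℕₚ.≰⇒> ¬p))))
      (sym (at-> _ (ℕₚ.<-≤-trans (ℕₚ.≰⇒> ¬p) (m≤n*m (x ℕ.+ y) 1≤a))))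
    expand : ∀ a X → X ℕ.≤ n → at (a ℕ.* X) n (G a X * (g ⊗ g′) X) ≡
      ∑ n (λ x → ∑ n (λ y → at (x ℕ.+ y) X (at (a ℕ.* X) n (G a X * (g x * g′ y)))))
    expand a X X≤n = trans (cong (λ w → at (a ℕ.* X) n (G a X * w)) (⊗-∑ g g′ z z′ X n X≤n))
      (trans (cong (at (a ℕ.* X) n) (sym (∑-*ˡ n (G a X) (λ x → ∑ n (λ y → at (x ℕ.+ y) X (g x * g′ y))))))
      (trans (sym (∑-at n (a ℕ.* X) n _)) (∑-ext n (λ x →
      trans (cong (at (a ℕ.* X) n) (sym (∑-*ˡ n (G a X) (λ y → at (x ℕ.+ y) X (g x * g′ y)))))
      (trans (sym (∑-at n (a ℕ.* X) n _)) (∑-ext n (λ y →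
      trans (cong (at (a ℕ.* X) n) (sym (at-*ˡ (x ℕ.+ y) X (G a X) (g x * g′ y))))
      (at-comm (a ℕ.* X) n (x ℕ.+ y) X (G a X * (g x * g′ y))))))))))
    right : ∀ a → 1 ℕ.≤ a → ∑ n (λ X → at (a ℕ.* X) n (G a X * (g ⊗ g′) X)) ≡ mid a
    right a 1≤a = trans (∑-cong n (λ X _ X≤n → expand a X X≤n))
      (trans (∑-swap n n _) (∑-cong n (λ x 1≤x _ → trans (∑-swap n n _) (∑-ext n (λ y → pick a x y 1≤a 1≤x)))))

-- Residue classes modulo 3.

module Residues where
  open Defs
  open PowerSeries
  open FiniteSums
  open DivisorSums
  open import Data.Integer using (-_; _+_; _*_; _-_)
  open ≡

  -- Indicators of the residues among the positive integers. The convention `c₀ 0 = 0` makes a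
  -- convolution such as `c₁ ⊗ c₀` count decompositions into positive parts.
  c₀ c₁ c₂ : ℕ → ℤ
  c₁ 0 = + 0
  c₁ 1 = + 1
  c₁ 2 = + 0
  c₁ (suc (suc (suc n))) = c₁ n
  c₂ 0 = + 0
  c₂ 1 = + 0
  c₂ 2 = + 1
  c₂ (suc (suc (suc n))) = c₂ n
  c₀ zero    = + 0
  c₀ (suc n) = c₂ n

  -- `χ` is the nontrivial character modulo 3 and `ν` its square.
  χ ν : ℕ → ℤ
  χ n = c₁ n - c₂ n
  ν n = c₁ n + c₂ n

  mod3-induction : (P : ℕ → Set) → P 0 → P 1 → P 2 → (∀ n → P n → P (3 ℕ.+ n)) → ∀ n → P n
  mod3-induction P p0 p1 p2 step 0 = p0
  mod3-induction P p0 p1 p2 step 1 = p1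
  mod3-induction P p0 p1 p2 step 2 = p2
  mod3-induction P p0 p1 p2 step (suc (suc (suc n))) = step n (mod3-induction P p0 p1 p2 step n)

  c₁-2+ : ∀ n → c₁ (2 ℕ.+ n) ≡ c₂ n
  c₁-2+ = mod3-induction _ refl refl refl (λ _ e → e)

  c₂-1+ : ∀ n → c₂ (1 ℕ.+ n) ≡ c₁ n
  c₂-1+ = mod3-induction _ refl refl refl (λ _ e → e)

  c₁c₁ : ∀ x k → c₁ x * c₁ k ≡ c₁ x * c₂ (x ℕ.+ k)
  c₁c₁ = mod3-induction _ (λ _ → refl) (λ k → cong (+ 1 *_) (sym (c₂-1+ k))) (λ _ → refl) (λ _ e → e)

  c₂c₂ : ∀ x k → c₂ x * c₂ k ≡ c₂ x * c₁ (x ℕ.+ k)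
  c₂c₂ = mod3-induction _ (λ _ → refl) (λ _ → refl) (λ k → cong (+ 1 *_) (sym (c₁-2+ k))) (λ _ e → e)

  c₁c₂ : ∀ x k → c₁ x * c₂ k ≡ c₁ x * c₀ (x ℕ.+ k)
  c₁c₂ = mod3-induction _ (λ _ → refl) (λ k → refl) (λ _ → refl)
    (λ { zero e k → refl ; (suc n) e k → e k })

  c₂c₁ : ∀ x k → c₂ x * c₁ k ≡ c₂ x * c₀ (x ℕ.+ k)
  c₂c₁ = mod3-induction _ (λ _ → refl) (λ _ → refl) (λ k → cong (+ 1 *_) (sym (c₂-1+ k)))
    (λ { zero e k → refl ; (suc n) e k → e k })

  -- The argument is `suc k` because `c₀` vanishes at 0, although 0 belongs to the class.
  c₁c₀ : ∀ x k → c₁ x * c₀ (suc k) ≡ c₁ x * c₁ (x ℕ.+ suc k)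
  c₁c₀ = mod3-induction _ (λ _ → refl) (λ k → cong (+ 1 *_) (sym (c₁-2+ k))) (λ _ → refl) (λ _ e → e)

  c₂c₀ : ∀ x k → c₂ x * c₀ (suc k) ≡ c₂ x * c₂ (x ℕ.+ suc k)
  c₂c₀ = mod3-induction _ (λ _ → refl) (λ _ → refl) (λ k → refl) (λ _ e → e)

  c₀c₁ : ∀ x k → c₀ x * c₁ k ≡ c₀ x * c₁ (x ℕ.+ k)
  c₀c₁ zero k = refl
  c₀c₁ (suc x) k = mod3-induction (λ z → c₂ z * c₁ k ≡ c₂ z * c₁ (suc z ℕ.+ k)) refl refl refl (λ _ e → e) x

  c₀c₂ : ∀ x k → c₀ x * c₂ k ≡ c₀ x * c₂ (x ℕ.+ k)
  c₀c₂ zero k = refl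
  c₀c₂ (suc x) k = mod3-induction (λ z → c₂ z * c₂ k ≡ c₂ z * c₂ (suc z ℕ.+ k)) refl refl refl (λ _ e → e) x

  c₁*c₂ : ∀ x → c₁ x * c₂ x ≡ + 0
  c₁*c₂ = mod3-induction _ refl refl refl (λ _ e → e)

  c₁-idem : ∀ x → c₁ x * c₁ x ≡ c₁ x
  c₁-idem = mod3-induction _ refl refl refl (λ _ e → e)

  c₂-idem : ∀ x → c₂ x * c₂ x ≡ c₂ x
  c₂-idem = mod3-induction _ refl refl refl (λ _ e → e)

  c₁*c₀ : ∀ x → c₁ x * c₀ x ≡ + 0
  c₁*c₀ = mod3-induction _ refl refl refl (λ { zero e → refl ; (suc n) e → e })

  c₂*c₀ : ∀ x → c₂ x * c₀ x ≡ + 0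
  c₂*c₀ = mod3-induction _ refl refl refl (λ { zero e → refl ; (suc n) e → e })

  private
    c₁⊗ : ∀ (g : PS) n → (c₁ ⊗ g) (3 ℕ.+ n) ≡ g (2 ℕ.+ n) + (c₁ ⊗ g) n
    c₁⊗ g n = trans (⊗-head c₁ g (2 ℕ.+ n)) (trans (cong (λ z → + 0 + z) (⊗-head (tail c₁) g (1 ℕ.+ n)))
      (trans (cong (λ z → + 0 + (+ 1 * g (2 ℕ.+ n) + z)) (⊗-head (tail (tail c₁)) g n)) (simplify (g (2 ℕ.+ n)) (g (1 ℕ.+ n)) _)))
      where
      simplify : ∀ x y z → + 0 + (+ 1 * x + (+ 0 * y + z)) ≡ x + z
      simplify = solve-∀

    c₂⊗ : ∀ (g : PS) n → (c₂ ⊗ g) (3 ℕ.+ n) ≡ g (1 ℕ.+ n) + (c₂ ⊗ g) n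
    c₂⊗ g n = trans (⊗-head c₂ g (2 ℕ.+ n)) (trans (cong (λ z → + 0 + z) (⊗-head (tail c₂) g (1 ℕ.+ n)))
      (trans (cong (λ z → + 0 + (+ 0 * g (2 ℕ.+ n) + z)) (⊗-head (tail (tail c₂)) g n)) (simplify (g (2 ℕ.+ n)) (g (1 ℕ.+ n)) _)))
      where
      simplify : ∀ x y z → + 0 + (+ 0 * x + (+ 1 * y + z)) ≡ y + z
      simplify = solve-∀

    step : ∀ c d m s → + 3 * s ≡ c * (m + d) → + 3 * (c + s) ≡ c * (+ 3 + m + d)
    step c d m s e = trans (ℤₚ.*-distribˡ-+ (+ 3) c s) (trans (cong (λ z → + 3 * c + z) e) (regroup c d m))
      where
      regroup : ∀ c d m → + 3 * c + c * (m + d) ≡ c * (+ 3 + m + d)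
      regroup = solve-∀

  -- If x and X - x are 1 modulo 3, then X is 2 modulo 3 and x runs through 1, 4, ..., X - 1, which
  -- makes (X + 1)/3 values. The factor 3 keeps the count integral and passes into the identities
  -- built on it.
  count-c₁c₁ : ∀ X → + 3 * (c₁ ⊗ c₁) X ≡ c₂ X * (+ X + + 1)
  count-c₁c₁ = mod3-induction _ refl refl refl (λ n e → trans (cong (λ z → + 3 * z) (c₁⊗ c₁ n))
    (trans (cong (λ z → + 3 * (z + (c₁ ⊗ c₁) n)) (c₁-2+ n)) (step (c₂ n) (+ 1) (+ n) _ e)))

  count-c₂c₂ : ∀ X → + 3 * (c₂ ⊗ c₂) X ≡ c₁ X * (+ X + - (+ 1))
  count-c₂c₂ = mod3-induction _ refl refl refl (λ n e → trans (cong (λ z → + 3 * z) (c₂⊗ c₂ n))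
    (trans (cong (λ z → + 3 * (z + (c₂ ⊗ c₂) n)) (c₂-1+ n)) (step (c₁ n) (- (+ 1)) (+ n) _ e)))

  count-c₁c₀ : ∀ X → + 3 * (c₁ ⊗ c₀) X ≡ c₁ X * (+ X + - (+ 1))
  count-c₁c₀ = mod3-induction _ refl refl refl (λ n e → trans (cong (λ z → + 3 * z) (c₁⊗ c₀ n))
    (trans (cong (λ z → + 3 * (z + (c₁ ⊗ c₀) n)) (c₂-1+ n)) (step (c₁ n) (- (+ 1)) (+ n) _ e)))

  count-c₂c₀ : ∀ X → + 3 * (c₂ ⊗ c₀) X ≡ c₂ X * (+ X + - (+ 2))
  count-c₂c₀ = mod3-induction _ refl refl refl (λ n e → trans (cong (λ z → + 3 * z) (c₂⊗ c₀ n))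
    (step (c₂ n) (- (+ 2)) (+ n) _ e))

  one : ℕ → ℤ
  one zero    = + 0
  one (suc n) = + 1

  count-one : ∀ X → (one ⊗ one) (suc X) ≡ + X
  count-one zero    = refl
  count-one (suc X) = trans (⊗-last one one (suc X)) (trans (ℤₚ.+-identityʳ _)
    (trans (sumTo-head (λ k → one k * + 1) X) (trans (ℤₚ.+-identityˡ _) (go X))))
    where
    go : ∀ n → sumTo (λ k → one (suc k) * + 1) n ≡ + suc n
    go zero    = refl
    go (suc n) = trans (cong (_+ + 1) (go n)) (cong +_ (ℕₚ.+-comm (suc n) 1))

-- Identities that the shear yields between residue classes.

module ShearIdentities where
  open Defs
  open PowerSeries
  open FiniteSums
  open DivisorSums
  open Residues
  open import Data.Integer using (-_; _+_; _*_; _-_)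
  open import Algebra.Properties.AbelianGroup ℤₚ.+-0-abelianGroup using () renaming (∙-cancelˡ to +-cancelˡ)
  open ≡

  Quad-split : ∀ (F : ℕ → ℕ → ℕ → ℕ → ℤ) → Quad F ≈ₚ
    Quad (λ a b x y → below b a (F a b x y)) ⊕ Quad (λ a b x y → below a b (F a b x y)) ⊕ Quad (λ a b x y → at a b (F a b x y))
  Quad-split F n = trans (Quad-ext (λ a b x y → trichotomy a b (F a b x y)) n)
    (trans (Quad-+ _ _ n) (cong (_+ Quad (λ a b x y → at a b (F a b x y)) n) (Quad-+ _ _ n)))

  Quad-splitʳ : ∀ (F : ℕ → ℕ → ℕ → ℕ → ℤ) → Quad F ≈ₚ
    Quad (λ a b x y → below y x (F a b x y)) ⊕ Quad (λ a b x y → below x y (F a b x y)) ⊕ Quad (λ a b x y → at x y (F a b x y))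
  Quad-splitʳ F n = trans (Quad-ext (λ a b x y → trichotomy x y (F a b x y)) n)
    (trans (Quad-+ _ _ n) (cong (_+ Quad (λ a b x y → at x y (F a b x y)) n) (Quad-+ _ _ n)))

  Quad-zero : ∀ (F : ℕ → ℕ → ℕ → ℕ → ℤ) → (∀ a b x y → F a b x y ≡ + 0) → ∀ n → Quad F n ≡ + 0
  Quad-zero F z n = ∑-zero n _ (λ a _ _ → ∑-zero n _ (λ b _ _ → ∑-zero n _ (λ x _ _ → ∑-zero n _ (λ y _ _ →
    trans (cong (at (a ℕ.* x ℕ.+ b ℕ.* y) n) (z a b x y)) (at-0 (a ℕ.* x ℕ.+ b ℕ.* y) n)))))

  -- For residues with c x c′ x = 0 the terms with x = y drop out.
  Quad-splitʳ-off : ∀ (m : ℕ → ℕ → ℤ) (c c′ : ℕ → ℤ) → (∀ x → c x * c′ x ≡ + 0) →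
    Quad (λ a b x y → m a b * (c x * c′ y)) ≈ₚ
    Quad (λ a b x y → below y x (m a b * (c x * c′ y))) ⊕ Quad (λ a b x y → below x y (m a b * (c x * c′ y)))
  Quad-splitʳ-off m c c′ z n = trans (Quad-splitʳ (λ a b x y → m a b * (c x * c′ y)) n)
    (trans (cong (λ w → Quad (λ a b x y → below y x (m a b * (c x * c′ y))) n + Quad (λ a b x y → below x y (m a b * (c x * c′ y))) n + w)
      (Quad-zero (λ a b x y → at x y (m a b * (c x * c′ y))) (λ a b x y → trans (sym (at-subst x y (λ t → m a b * (c x * c′ t))))
        (trans (cong (λ t → at x y (m a b * t)) (z x)) (trans (cong (at x y) (ℤₚ.*-zeroʳ (m a b))) (at-0 x y)))) n))
    (ℤₚ.+-identityʳ _))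

  -- The shear replaces y by y - x under x < y, and for x in the class c the difference lies in c
  -- exactly when y lies in c′. So each half off the diagonal a = b becomes half of a sum over mixed
  -- classes.
  residue-split : ∀ (p : ℕ → ℕ → ℤ) (c c′ : ℕ → ℤ) → c 0 ≡ + 0 → (∀ x k → c x * c k ≡ c x * c′ (x ℕ.+ k)) →
    Quad (λ a b x y → p a b * (c x * c y)) ≈ₚ
    Quad (λ a b x y → below x y (p (a ℕ.+ b) b * (c x * c′ y))) ⊕ Quad (λ a b x y → below y x (p a (a ℕ.+ b) * (c′ x * c y)))
    ⊕ Λ (λ d X → p d d * (c ⊗ c) X)
  residue-split p c c′ c0 e n = trans (Quad-split (λ a b x y → p a b * (c x * c y)) n) (cong₂ _+_ (cong₂ _+_
    (trans (shear (λ a b x y → p a b * (c x * c y)) n) (Quad-ext (λ a b x y → below-cong x y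
      (λ y → p (a ℕ.+ b) b * (c x * c (y ℕ.∸ x))) (λ y → p (a ℕ.+ b) b * (c x * c′ y))
      (λ k → cong (p (a ℕ.+ b) b *_) (trans (cong (λ t → c x * c t) (ℕₚ.m+n∸m≡n x (suc k))) (e x (suc k))))) n))
    (trans (shear′ (λ a b x y → p a b * (c x * c y)) n) (Quad-ext (λ a b x y → below-cong y x
      (λ x → p a (a ℕ.+ b) * (c (x ℕ.∸ y) * c y)) (λ x → p a (a ℕ.+ b) * (c′ x * c y))
      (λ k → cong (p a (a ℕ.+ b) *_) (trans (cong (λ t → c t * c y) (ℕₚ.m+n∸m≡n y (suc k)))
        (trans (ℤₚ.*-comm (c (suc k)) (c y)) (trans (e y (suc k)) (ℤₚ.*-comm (c y) _)))))) n)))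
    (trans (Quad-ext (λ a b x y → sym (at-subst a b (λ t → p a t * (c x * c y)))) n) (diagonal (λ d X → p d d) c c c0 c0 n)))

  -- Each sum on the left yields one half of each mixed sum, and the four conditions on the weights
  -- say that these halves fit together. Nothing is missing at x = y, because the two classes there
  -- are disjoint.
  star : ∀ (p p′ m : ℕ → ℕ → ℤ) →
    (∀ a b → p (a ℕ.+ b) b ≡ m a b) → (∀ a b → p a (a ℕ.+ b) ≡ m b a) →
    (∀ a b → p′ (a ℕ.+ b) b ≡ m b a) → (∀ a b → p′ a (a ℕ.+ b) ≡ m a b) →
    Quad (λ a b x y → p a b * (c₁ x * c₁ y)) ⊕ Quad (λ a b x y → p′ a b * (c₂ x * c₂ y)) ≈ₚ
    Quad (λ a b x y → m a b * (c₁ x * c₂ y)) ⊕ Quad (λ a b x y → m b a * (c₂ x * c₁ y))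
    ⊕ (Λ (λ d X → p d d * (c₁ ⊗ c₁) X) ⊕ Λ (λ d X → p′ d d * (c₂ ⊗ c₂) X))
  star p p′ m e₁ e₂ e₃ e₄ n = trans
    (cong₂ _+_
      (trans (residue-split p c₁ c₂ refl c₁c₁ n) (cong₂ (λ s t → s + t + L₁)
        (Quad-ext (λ a b x y → cong (λ w → below x y (w * (c₁ x * c₂ y))) (e₁ a b)) n)
        (Quad-ext (λ a b x y → cong (λ w → below y x (w * (c₂ x * c₁ y))) (e₂ a b)) n)))
      (trans (residue-split p′ c₂ c₁ refl c₂c₂ n) (cong₂ (λ s t → s + t + L₂)
        (Quad-ext (λ a b x y → cong (λ w → below x y (w * (c₂ x * c₁ y))) (e₃ a b)) n)
        (Quad-ext (λ a b x y → cong (λ w → below y x (w * (c₁ x * c₂ y))) (e₄ a b)) n))))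
    (trans (regroup (Quad (λ a b x y → below x y (m a b * (c₁ x * c₂ y))) n) (Quad (λ a b x y → below y x (m b a * (c₂ x * c₁ y))) n)
      L₁ (Quad (λ a b x y → below x y (m b a * (c₂ x * c₁ y))) n) (Quad (λ a b x y → below y x (m a b * (c₁ x * c₂ y))) n) L₂)
    (sym (cong₂ (λ s t → s + t + (L₁ + L₂)) (Quad-splitʳ-off m c₁ c₂ c₁*c₂ n)
      (Quad-splitʳ-off (λ a b → m b a) c₂ c₁ (λ x → trans (ℤₚ.*-comm (c₂ x) (c₁ x)) (c₁*c₂ x)) n))))
    where
    L₁ L₂ : ℤ
    L₁ = Λ (λ d X → p d d * (c₁ ⊗ c₁) X) n
    L₂ = Λ (λ d X → p′ d d * (c₂ ⊗ c₂) X) n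
    regroup : ∀ s t l u v k → (s + t + l) + (u + v + k) ≡ (v + s) + (t + u) + (l + k)
    regroup = solve-∀

  module SameResidue (ψ : ℕ → ℤ) (c : ℕ → ℤ) (c0 : c 0 ≡ + 0) (idem : ∀ x → c x * c x ≡ c x) (off : ∀ x → c x * c₀ x ≡ + 0)
    (forward : ∀ x k → c x * c₀ (suc k) ≡ c x * c (x ℕ.+ suc k)) (backward : ∀ x k → c₀ x * c k ≡ c₀ x * c (x ℕ.+ k)) where

    upper : PS
    upper = Quad (λ a b x y → below b a (ψ a * (c x * c₀ y)))

    -- The shear turns a weight in a into a weight in a + b, so the half x < y is `upper`;
    -- exchanging the two pairs gives the other half. On x = y the d - 1 decompositions d = a + b
    -- remain.
    sum-weight : Quad (λ a b x y → ψ (a ℕ.+ b) * (c x * c y)) ≈ₚ upper ⊕ upper ⊕ Λ (λ d X → ψ d * c X * (+ d - + 1))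
    sum-weight n = trans (Quad-splitʳ (λ a b x y → ψ (a ℕ.+ b) * (c x * c y)) n) (cong₂ _+_ (cong₂ _+_ lower upper′) diag)
      where
      upper′ : Quad (λ a b x y → below x y (ψ (a ℕ.+ b) * (c x * c y))) n ≡ upper n
      upper′ = sym (trans (shear (λ a b x y → ψ a * (c x * c₀ y)) n) (Quad-ext (λ a b x y → below-cong x y
        (λ y → ψ (a ℕ.+ b) * (c x * c₀ (y ℕ.∸ x))) (λ y → ψ (a ℕ.+ b) * (c x * c y))
        (λ k → cong (ψ (a ℕ.+ b) *_) (trans (cong (λ t → c x * c₀ t) (ℕₚ.m+n∸m≡n x (suc k))) (forward x k)))) n))
      lower : Quad (λ a b x y → below y x (ψ (a ℕ.+ b) * (c x * c y))) n ≡ upper n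
      lower = trans (Quad-swap (λ a b x y → below y x (ψ (a ℕ.+ b) * (c x * c y))) n) (trans
        (Quad-ext {λ a b x y → below x y (ψ (b ℕ.+ a) * (c y * c x))} (λ a b x y →
          cong₂ (λ s t → below x y (ψ s * t)) (ℕₚ.+-comm b a) (ℤₚ.*-comm (c y) (c x))) n) upper′)
      pull : ∀ w s → w * s ≡ w * s * (+ 1 * + 1)
      pull = solve-∀
      diag : Quad (λ a b x y → at x y (ψ (a ℕ.+ b) * (c x * c y))) n ≡ Λ (λ d X → ψ d * c X * (+ d - + 1)) n
      diag = trans (Quad-transpose (λ a b x y → at x y (ψ (a ℕ.+ b) * (c x * c y))) n)
        (trans (Quad-ext⁺ (λ a b x y → trans (sym (at-subst (suc a) (suc b) (λ t → ψ (suc x ℕ.+ suc y) * (c (suc a) * c t))))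
          (cong (at (suc a) (suc b)) (trans (cong (ψ (suc x ℕ.+ suc y) *_) (idem (suc a))) (pull (ψ (suc x ℕ.+ suc y)) (c (suc a)))))) n)
        (trans (diagonal (λ d X → ψ X * c d) one one refl refl n)
        (trans (Λ-transpose (λ d X → ψ X * c d * (one ⊗ one) X) n)
        (Λ-ext⁺ (λ a x → cong (ψ (suc a) * c (suc x) *_) (trans (count-one a) (sym (ℤₚ.m-n≡m⊖n (suc a) 1)))) n))))

    -- The full sum is split once by the order of x and y and once by the order of a and b. The
    -- shear identifies the half a < b with the half y < x; cancelling them leaves x < y against b <
    -- a and the diagonal.
    first-weight : Quad (λ a b x y → below x y (ψ a * (c x * c₀ y))) ≈ₚ upper ⊕ Λ (λ d X → ψ d * (c ⊗ c₀) X)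
    first-weight n = cancel (Quad (λ a b x y → below y x (ψ a * (c x * c₀ y))) n) _ (upper n) _
      (trans (sym (Quad-splitʳ-off (λ a b → ψ a) c c₀ off n)) (trans (Quad-split (λ a b x y → ψ a * (c x * c₀ y)) n)
        (cong₂ (λ s t → upper n + s + t) lower (diagonal (λ d X → ψ d) c c₀ c0 refl n))))
      where
      cancel : ∀ l s u d → l + s ≡ u + l + d → s ≡ u + d
      cancel l s u d e = +-cancelˡ l s (u + d) (trans e (regroup l u d))
        where
        regroup : ∀ l u d → u + l + d ≡ l + (u + d)
        regroup = solve-∀
      lower : Quad (λ a b x y → below a b (ψ a * (c x * c₀ y))) n ≡ Quad (λ a b x y → below y x (ψ a * (c x * c₀ y))) n
      lower = trans (shear′ (λ a b x y → ψ a * (c x * c₀ y)) n) (Quad-ext (λ a b x y → below-cong y x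
        (λ x → ψ a * (c (x ℕ.∸ y) * c₀ y)) (λ x → ψ a * (c x * c₀ y))
        (λ k → cong (ψ a *_) (trans (cong (λ t → c t * c₀ y) (ℕₚ.m+n∸m≡n y (suc k)))
          (trans (ℤₚ.*-comm (c (suc k)) (c₀ y)) (trans (backward y (suc k)) (ℤₚ.*-comm (c₀ y) _)))))) n)

  module Square (ψ⁺ ψ⁻ : ℕ → ℤ) (Φ : ℕ → ℕ → ℤ)
    (Φ-above : ∀ a b → Φ (a ℕ.+ b) b ≡ ψ⁺ a) (Φ-below : ∀ a b → Φ a (a ℕ.+ b) ≡ ψ⁻ b) (Φ-diag : ∀ a → Φ a a ≡ + 0) where
    private
      module S₁ = SameResidue ψ⁺ c₁ refl c₁-idem c₁*c₀ c₁c₀ c₀c₁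
      module S₂ = SameResidue ψ⁻ c₂ refl c₂-idem c₂*c₀ c₂c₀ c₀c₂

    -- The classes 1 and 2 add up to the class 0 under the shear, and Φ removes the terms with a =
    -- b.
    difference-weight : Quad (λ a b x y → Φ a b * (c₁ x * c₂ y)) ≈ₚ
      Quad (λ a b x y → below x y (ψ⁺ a * (c₁ x * c₀ y))) ⊕ Quad (λ a b x y → below x y (ψ⁻ a * (c₂ x * c₀ y)))
    difference-weight n = trans (Quad-split (λ a b x y → Φ a b * (c₁ x * c₂ y)) n) (trans
      (cong₂ _+_ (cong₂ _+_
        (trans (shear (λ a b x y → Φ a b * (c₁ x * c₂ y)) n) (Quad-ext (λ a b x y → below-cong x y
          (λ y → Φ (a ℕ.+ b) b * (c₁ x * c₂ (y ℕ.∸ x))) (λ y → ψ⁺ a * (c₁ x * c₀ y))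
          (λ k → cong₂ _*_ (Φ-above a b) (trans (cong (λ t → c₁ x * c₂ t) (ℕₚ.m+n∸m≡n x (suc k))) (c₁c₂ x (suc k))))) n))
        (trans (shear′ (λ a b x y → Φ a b * (c₁ x * c₂ y)) n) (trans (Quad-ext (λ a b x y → below-cong y x
          (λ x → Φ a (a ℕ.+ b) * (c₁ (x ℕ.∸ y) * c₂ y)) (λ x → ψ⁻ b * (c₂ y * c₀ x))
          (λ k → cong₂ _*_ (Φ-below a b) (trans (cong (λ t → c₁ t * c₂ y) (ℕₚ.m+n∸m≡n y (suc k)))
            (trans (ℤₚ.*-comm (c₁ (suc k)) (c₂ y)) (c₂c₁ y (suc k)))))) n)
          (Quad-swap (λ a b x y → below y x (ψ⁻ b * (c₂ y * c₀ x))) n))))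
        (Quad-zero _ (λ a b x y → trans (sym (at-subst a b (λ t → Φ a t * (c₁ x * c₂ y))))
          (trans (cong (at a b) (trans (cong (_* (c₁ x * c₂ y)) (Φ-diag a)) (ℤₚ.*-zeroˡ (c₁ x * c₂ y)))) (at-0 a b))) n))
      (ℤₚ.+-identityʳ _))

    -- Both sides contain each `upper` twice: on the left by symmetry in x and y, on the right once
    -- for each mixed sum, the two being equal by exchange of the pairs. So `upper` is never
    -- evaluated.
    square : Quad (λ a b x y → ψ⁺ (a ℕ.+ b) * (c₁ x * c₁ y)) ⊕ Quad (λ a b x y → ψ⁻ (a ℕ.+ b) * (c₂ x * c₂ y))
      ⊕ ((+ 2) · Λ (λ d X → ψ⁺ d * (c₁ ⊗ c₀) X) ⊕ (+ 2) · Λ (λ d X → ψ⁻ d * (c₂ ⊗ c₀) X)) ≈ₚ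
      Quad (λ a b x y → Φ a b * (c₁ x * c₂ y)) ⊕ Quad (λ a b x y → Φ b a * (c₂ x * c₁ y))
      ⊕ (Λ (λ d X → ψ⁺ d * c₁ X * (+ d - + 1)) ⊕ Λ (λ d X → ψ⁻ d * c₂ X * (+ d - + 1)))
    square n = trans (cong₂ (λ s t → s + t + (+ 2 * E + + 2 * E′)) (S₁.sum-weight n) (S₂.sum-weight n))
      (trans (regroup (S₁.upper n) (S₂.upper n) D D′ E E′)
      (cong₂ (λ s t → s + t + (D + D′)) (sym difference) (trans (sym difference) swapped)))
      where
      D D′ E E′ : ℤ
      D = Λ (λ d X → ψ⁺ d * c₁ X * (+ d - + 1)) n
      D′ = Λ (λ d X → ψ⁻ d * c₂ X * (+ d - + 1)) n
      E = Λ (λ d X → ψ⁺ d * (c₁ ⊗ c₀) X) n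
      E′ = Λ (λ d X → ψ⁻ d * (c₂ ⊗ c₀) X) n
      regroup : ∀ u v d d′ e e′ → (u + u + d) + (v + v + d′) + (+ 2 * e + + 2 * e′) ≡ ((u + e) + (v + e′)) + ((u + e) + (v + e′)) + (d + d′)
      regroup = solve-∀
      difference : Quad (λ a b x y → Φ a b * (c₁ x * c₂ y)) n ≡ S₁.upper n + E + (S₂.upper n + E′)
      difference = trans (difference-weight n) (cong₂ _+_ (S₁.first-weight n) (S₂.first-weight n))
      swapped : Quad (λ a b x y → Φ a b * (c₁ x * c₂ y)) n ≡ Quad (λ a b x y → Φ b a * (c₂ x * c₁ y)) n
      swapped = trans (Quad-swap (λ a b x y → Φ a b * (c₁ x * c₂ y)) n)
        (Quad-ext {λ a b x y → Φ b a * (c₁ y * c₂ x)} {λ a b x y → Φ b a * (c₂ x * c₁ y)}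
          (λ a b x y → cong (Φ b a *_) (ℤₚ.*-comm (c₁ y) (c₂ x))) n)

-- Differential equations between Lambert series.

module LambertSeries where
  open Defs
  open PowerSeries
  open DivisorSums
  open Residues
  open ShearIdentities
  open import Data.Integer using (-_; _+_; _*_; _-_)
  open import Algebra.Properties.AbelianGroup ℤₚ.+-0-abelianGroup using () renaming (∙-cancelˡ to +-cancelˡ)
  open ≡

  -- `s₁` and `s₂` are the series p and K; `s₃` is auxiliary and is expressed by the others in
  -- `s₃-product`.
  s₀ s₁ s₂ s₃ : PS
  s₀ = Λ (λ a x → χ x)
  s₁ = Λ (λ a x → + a * ν x)
  s₂ = Λ (λ a x → + a * + a * χ x)
  s₃ = Λ (λ a x → + a * + a * + a * ν x)

  private
    Quad-balance : ∀ (F G H J K : ℕ → ℕ → ℕ → ℕ → ℤ) →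
      (∀ a b x y → F a b x y + (G a b x y + H a b x y) ≡ J a b x y + K a b x y) →
      ∀ n → Quad F n + (Quad G n + Quad H n) ≡ Quad J n + Quad K n
    Quad-balance F G H J K e n = trans (cong (λ z → Quad F n + z) (sym (Quad-+ G H n)))
      (trans (sym (Quad-+ F (λ a b x y → G a b x y + H a b x y) n)) (trans (Quad-ext e n) (Quad-+ J K n)))

    three-Λ : ∀ (F G : ℕ → ℕ → ℤ) n → + 3 * (Λ F n + Λ G n) ≡ Λ (λ d X → + 3 * F d X + + 3 * G d X) n
    three-Λ F G n = trans (ℤₚ.*-distribˡ-+ (+ 3) (Λ F n) (Λ G n))
      (trans (cong₂ _+_ (sym (Λ-*ˡ (+ 3) F n)) (sym (Λ-*ˡ (+ 3) G n))) (sym (Λ-+ _ _ n)))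

    Λ-linear : ∀ c d (F G : ℕ → ℕ → ℤ) n → Λ (λ a x → c * F a x + d * G a x) n ≡ c * Λ F n + d * Λ G n
    Λ-linear c d F G n = trans (Λ-+ _ _ n) (cong₂ _+_ (Λ-*ˡ c F n) (Λ-*ˡ d G n))

    by-count : ∀ u s {t} → + 3 * s ≡ t → + 3 * (u * s) ≡ u * t
    by-count u s refl = commute u s
      where
      commute : ∀ u s → + 3 * (u * s) ≡ u * (+ 3 * s)
      commute = solve-∀

    star-diagonal : ∀ (p p′ : ℕ → ℤ) n → + 3 * (Λ (λ d X → p d * (c₁ ⊗ c₁) X) n + Λ (λ d X → p′ d * (c₂ ⊗ c₂) X) n) ≡
      Λ (λ d X → p d * (c₂ X * (+ X + + 1)) + p′ d * (c₁ X * (+ X + - (+ 1)))) n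
    star-diagonal p p′ n = trans (three-Λ _ _ n) (Λ-ext (λ d X →
      cong₂ _+_ (by-count (p d) _ (count-c₁c₁ X)) (by-count (p′ d) _ (count-c₂c₂ X))) n)

    -- F is to be chosen such that adding the mixed sums of `star` leaves only products of equal
    -- residues. The mixed sums then cancel, and a combination of products of Lambert series equals
    -- a single Lambert series.
    star-product : ∀ (p p′ m : ℕ → ℕ → ℤ) (F : ℕ → ℕ → ℕ → ℕ → ℤ) →
      (∀ a b → p (a ℕ.+ b) b ≡ m a b) → (∀ a b → p a (a ℕ.+ b) ≡ m b a) →
      (∀ a b → p′ (a ℕ.+ b) b ≡ m b a) → (∀ a b → p′ a (a ℕ.+ b) ≡ m a b) →
      (∀ a b x y → F a b x y + (m a b * (c₁ x * c₂ y) + m b a * (c₂ x * c₁ y)) ≡ p a b * (c₁ x * c₁ y) + p′ a b * (c₂ x * c₂ y)) →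
      ∀ n → + 3 * Quad F n ≡ Λ (λ d X → p d d * (c₂ X * (+ X + + 1)) + p′ d d * (c₁ X * (+ X + - (+ 1)))) n
    star-product p p′ m F e₁ e₂ e₃ e₄ e n = trans
      (cong (λ z → + 3 * z) (cancel (Quad F n) _ _ (trans (Quad-balance F _ _ _ _ e n) (star p p′ m e₁ e₂ e₃ e₄ n))))
      (star-diagonal (λ d → p d d) (λ d → p′ d d) n)
      where
      cancel : ∀ f s t → f + s ≡ s + t → f ≡ t
      cancel f s t e = +-cancelˡ s f t (trans (ℤₚ.+-comm s f) e)

  -- Constant weights satisfy the conditions of `star`. With a = 1 + 6 s₀ this says that a² is 1
  -- plus 12 times the right side.
  square-identity : ∀ n → + 3 * (s₀ ⊗ s₀) n + s₀ n ≡ Λ (λ a x → + x * ν x) n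
  square-identity n = trans (cong (λ z → + 3 * z + s₀ n) (Λ-⊗ (λ a x → χ x) (λ a x → χ x) n))
    (trans (cong (_+ s₀ n) (trans (star-product (λ _ _ → + 1) (λ _ _ → + 1) (λ _ _ → + 1) (λ a b x y → χ x * χ y)
        (λ _ _ → refl) (λ _ _ → refl) (λ _ _ → refl) (λ _ _ → refl) (λ a b x y → expand (c₁ x) (c₂ x) (c₁ y) (c₂ y)) n)
      (trans (Λ-ext (λ d X → collect (+ X) (c₁ X) (c₂ X)) n) (Λ-linear (+ 1) (- (+ 1)) (λ a x → + x * ν x) (λ a x → χ x) n))))
    (cancel (Λ (λ a x → + x * ν x) n) (s₀ n)))
    where
    expand : ∀ p q r s → (p - q) * (r - s) + (+ 1 * (p * s) + + 1 * (q * r)) ≡ + 1 * (p * r) + + 1 * (q * s)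
    expand = solve-∀
    collect : ∀ X p q → + 1 * (q * (X + + 1)) + + 1 * (p * (X + - (+ 1))) ≡ + 1 * (X * (p + q)) + - (+ 1) * (p - q)
    collect = solve-∀
    cancel : ∀ l s → + 1 * l + - (+ 1) * s + s ≡ l
    cancel = solve-∀

  -- The form a² - a b + b² becomes a² + a b + b² when either variable is replaced by a + b, as
  -- `star` requires. The combination (a² + b²) χ χ - a b ν ν equals the first form on equal
  -- residues and minus the second on different ones.
  θs₁-star : ∀ n → θ s₁ n ≡ + 6 * (s₀ ⊗ s₂) n - + 3 * (s₁ ⊗ s₁) n + s₂ n
  θs₁-star n = sym (trans (cong₂ (λ u v → u + v) prod refl) (cancel (θ s₁ n) (s₂ n)))
    where
    F : ℕ → ℕ → ℕ → ℕ → ℤ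
    F a b x y = (χ x * (+ b * + b * χ y) + + a * + a * χ x * χ y) + - (+ 1) * (+ a * ν x * (+ b * ν y))
    quad-F : Quad F n ≡ (s₀ ⊗ s₂) n + (s₂ ⊗ s₀) n + - (+ 1) * (s₁ ⊗ s₁) n
    quad-F = trans (Quad-+ _ _ n) (cong₂ _+_ (trans (Quad-+ _ _ n) (cong₂ _+_ (sym (Λ-⊗ _ _ n)) (sym (Λ-⊗ _ _ n))))
      (trans (Quad-*ˡ (- (+ 1)) _ n) (cong (λ z → - (+ 1) * z) (sym (Λ-⊗ (λ a x → + a * ν x) (λ a x → + a * ν x) n)))))
    p m : ℕ → ℕ → ℤ
    p a b = + a * + a - + a * + b + + b * + b
    m a b = + a * + a + + a * + b + + b * + b
    p-above : ∀ a b → (a + b) * (a + b) - (a + b) * b + b * b ≡ a * a + a * b + b * b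
    p-above = solve-∀
    p-below : ∀ a b → a * a - a * (a + b) + (a + b) * (a + b) ≡ b * b + b * a + a * a
    p-below = solve-∀
    p-above′ : ∀ a b → (a + b) * (a + b) - (a + b) * b + b * b ≡ b * b + b * a + a * a
    p-above′ = solve-∀
    p-below′ : ∀ a b → a * a - a * (a + b) + (a + b) * (a + b) ≡ a * a + a * b + b * b
    p-below′ = solve-∀
    expand : ∀ a b p q r s → ((p - q) * (b * b * (r - s)) + a * a * (p - q) * (r - s)) + - (+ 1) * (a * (p + q) * (b * (r + s)))
      + ((a * a + a * b + b * b) * (p * s) + (b * b + b * a + a * a) * (q * r))
      ≡ (a * a - a * b + b * b) * (p * r) + (a * a - a * b + b * b) * (q * s)
    expand = solve-∀
    collect : ∀ d X p q → (d * d - d * d + d * d) * (q * (X + + 1)) + (d * d - d * d + d * d) * (p * (X + - (+ 1)))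
      ≡ + 1 * (d * X * (d * (p + q))) + - (+ 1) * (d * d * (p - q))
    collect = solve-∀
    sum : + 3 * ((s₀ ⊗ s₂) n + (s₂ ⊗ s₀) n + - (+ 1) * (s₁ ⊗ s₁) n) ≡ + 1 * θ s₁ n + - (+ 1) * s₂ n
    sum = trans (cong (λ z → + 3 * z) (sym quad-F)) (trans
      (star-product p p m F (λ a b → p-above (+ a) (+ b)) (λ a b → p-below (+ a) (+ b)) (λ a b → p-above′ (+ a) (+ b)) (λ a b → p-below′ (+ a) (+ b))
        (λ a b x y → expand (+ a) (+ b) (c₁ x) (c₂ x) (c₁ y) (c₂ y)) n)
      (trans (Λ-ext (λ d X → collect (+ d) (+ X) (c₁ X) (c₂ X)) n)
      (trans (Λ-linear (+ 1) (- (+ 1)) (λ a x → + a * + x * (+ a * ν x)) (λ a x → + a * + a * χ x) n)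
      (cong (λ z → + 1 * z + - (+ 1) * s₂ n) (sym (θ-Λ (λ a x → + a * ν x) n))))))
    prod : + 6 * (s₀ ⊗ s₂) n - + 3 * (s₁ ⊗ s₁) n ≡ + 1 * θ s₁ n + - (+ 1) * s₂ n
    prod = trans (double ((s₀ ⊗ s₂) n) ((s₁ ⊗ s₁) n))
      (trans (cong (λ z → + 3 * ((s₀ ⊗ s₂) n + z + - (+ 1) * (s₁ ⊗ s₁) n)) (⊗-comm s₀ s₂ n)) sum)
      where
      double : ∀ x y → + 6 * x - + 3 * y ≡ + 3 * (x + x + - (+ 1) * y)
      double = solve-∀
    cancel : ∀ t s → + 1 * t + - (+ 1) * s + s ≡ t
    cancel = solve-∀

  -- The weight is -(a + b)(2a - b)(a - 2b), which the shear turns into -(a - b)(2a + b)(a + 2b) up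
  -- to sign. The latter is antisymmetric, so the class 2 must carry the opposite weight.
  θs₂-star : ∀ n → θ s₂ n ≡ + 6 * (s₀ ⊗ s₃) n - + 9 * (s₁ ⊗ s₂) n + s₃ n
  θs₂-star n = sym (ℤₚ.*-cancelˡ-≡ (+ 2) _ _ (trans prod refl))
    where
    F : ℕ → ℕ → ℕ → ℕ → ℤ
    F a b x y = - (+ 2) * (χ x * (+ b * + b * + b * ν y) + + a * + a * + a * ν x * χ y)
      + + 3 * (+ a * + a * χ x * (+ b * ν y) + + a * ν x * (+ b * + b * χ y))
    quad-F : Quad F n ≡ - (+ 2) * ((s₀ ⊗ s₃) n + (s₃ ⊗ s₀) n) + + 3 * ((s₂ ⊗ s₁) n + (s₁ ⊗ s₂) n)
    quad-F = trans (Quad-+ _ _ n) (cong₂ _+_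
      (trans (Quad-*ˡ (- (+ 2)) _ n) (cong (λ z → - (+ 2) * z) (trans (Quad-+ _ _ n) (cong₂ _+_ (sym (Λ-⊗ _ _ n)) (sym (Λ-⊗ _ _ n))))))
      (trans (Quad-*ˡ (+ 3) _ n) (cong (λ z → + 3 * z) (trans (Quad-+ _ _ n)
        (cong₂ _+_ (sym (Λ-⊗ (λ a x → + a * + a * χ x) (λ a x → + a * ν x) n)) (sym (Λ-⊗ (λ a x → + a * ν x) (λ a x → + a * + a * χ x) n)))))))
    p p′ m : ℕ → ℕ → ℤ
    p a b = (- (+ 2) * ((+ a) * (+ a) * (+ a) + (+ b) * (+ b) * (+ b)) + + 3 * ((+ a) * (+ a) * (+ b) + (+ a) * (+ b) * (+ b)))
    p′ a b = - (- (+ 2) * ((+ a) * (+ a) * (+ a) + (+ b) * (+ b) * (+ b)) + + 3 * ((+ a) * (+ a) * (+ b) + (+ a) * (+ b) * (+ b)))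
    m a b = (- (+ 2) * ((+ a) * (+ a) * (+ a) - (+ b) * (+ b) * (+ b)) - + 3 * ((+ a) * (+ a) * (+ b) - (+ a) * (+ b) * (+ b)))
    p-above : ∀ a b → (- (+ 2) * ((a + b) * (a + b) * (a + b) + b * b * b) + + 3 * ((a + b) * (a + b) * b + (a + b) * b * b)) ≡ (- (+ 2) * (a * a * a - b * b * b) - + 3 * (a * a * b - a * b * b))
    p-above = solve-∀
    p-below : ∀ a b → (- (+ 2) * (a * a * a + (a + b) * (a + b) * (a + b)) + + 3 * (a * a * (a + b) + a * (a + b) * (a + b))) ≡ (- (+ 2) * (b * b * b - a * a * a) - + 3 * (b * b * a - b * a * a))
    p-below = solve-∀
    p-above′ : ∀ a b → - (- (+ 2) * ((a + b) * (a + b) * (a + b) + b * b * b) + + 3 * ((a + b) * (a + b) * b + (a + b) * b * b)) ≡ (- (+ 2) * (b * b * b - a * a * a) - + 3 * (b * b * a - b * a * a))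
    p-above′ = solve-∀
    p-below′ : ∀ a b → - (- (+ 2) * (a * a * a + (a + b) * (a + b) * (a + b)) + + 3 * (a * a * (a + b) + a * (a + b) * (a + b))) ≡ (- (+ 2) * (a * a * a - b * b * b) - + 3 * (a * a * b - a * b * b))
    p-below′ = solve-∀
    expand : ∀ a b p q r s → - (+ 2) * ((p - q) * (b * b * b * (r + s)) + a * a * a * (p + q) * (r - s))
      + + 3 * (a * a * (p - q) * (b * (r + s)) + a * (p + q) * (b * b * (r - s)))
      + ((- (+ 2) * (a * a * a - b * b * b) - + 3 * (a * a * b - a * b * b)) * (p * s) + (- (+ 2) * (b * b * b - a * a * a) - + 3 * (b * b * a - b * a * a)) * (q * r)) ≡ (- (+ 2) * (a * a * a + b * b * b) + + 3 * (a * a * b + a * b * b)) * (p * r) + - (- (+ 2) * (a * a * a + b * b * b) + + 3 * (a * a * b + a * b * b)) * (q * s)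
    expand = solve-∀
    collect : ∀ d X p q → (- (+ 2) * (d * d * d + d * d * d) + + 3 * (d * d * d + d * d * d)) * (q * (X + + 1)) + - (- (+ 2) * (d * d * d + d * d * d) + + 3 * (d * d * d + d * d * d)) * (p * (X + - (+ 1)))
      ≡ - (+ 2) * (d * X * (d * d * (p - q))) + + 2 * (d * d * d * (p + q))
    collect = solve-∀
    sum : + 3 * (- (+ 2) * ((s₀ ⊗ s₃) n + (s₃ ⊗ s₀) n) + + 3 * ((s₂ ⊗ s₁) n + (s₁ ⊗ s₂) n)) ≡ - (+ 2) * θ s₂ n + + 2 * s₃ n
    sum = trans (cong (λ z → + 3 * z) (sym quad-F)) (trans
      (star-product p p′ m F (λ a b → p-above (+ a) (+ b)) (λ a b → p-below (+ a) (+ b)) (λ a b → p-above′ (+ a) (+ b)) (λ a b → p-below′ (+ a) (+ b))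
        (λ a b x y → expand (+ a) (+ b) (c₁ x) (c₂ x) (c₁ y) (c₂ y)) n)
      (trans (Λ-ext (λ d X → collect (+ d) (+ X) (c₁ X) (c₂ X)) n)
      (trans (Λ-linear (- (+ 2)) (+ 2) (λ a x → + a * + x * (+ a * + a * χ x)) (λ a x → + a * + a * + a * ν x) n)
      (cong (λ z → - (+ 2) * z + + 2 * s₃ n) (sym (θ-Λ (λ a x → + a * + a * χ x) n))))))
    prod : + 2 * (+ 6 * (s₀ ⊗ s₃) n - + 9 * (s₁ ⊗ s₂) n + s₃ n) ≡ + 2 * θ s₂ n
    prod = trans (double ((s₀ ⊗ s₃) n) ((s₁ ⊗ s₂) n) (s₃ n))
      (trans (cong₂ (λ y z → - (+ 3 * (- (+ 2) * ((s₀ ⊗ s₃) n + y) + + 3 * (z + (s₁ ⊗ s₂) n))) + + 2 * s₃ n) (⊗-comm s₀ s₃ n) (⊗-comm s₁ s₂ n))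
      (trans (cong (λ z → - z + + 2 * s₃ n) sum) (cancel (θ s₂ n) (s₃ n))))
      where
      double : ∀ x y z → + 2 * (+ 6 * x - + 9 * y + z) ≡ - (+ 3 * (- (+ 2) * (x + x) + + 3 * (y + y))) + + 2 * z
      double = solve-∀
      cancel : ∀ t s → - (- (+ 2) * t + + 2 * s) + + 2 * s ≡ + 2 * t
      cancel = solve-∀

  private
    square-product : ∀ (ψ⁺ ψ⁻ : ℕ → ℤ) (Φ : ℕ → ℕ → ℤ) (F : ℕ → ℕ → ℕ → ℕ → ℤ) →
      (∀ a b → Φ (a ℕ.+ b) b ≡ ψ⁺ a) → (∀ a b → Φ a (a ℕ.+ b) ≡ ψ⁻ b) → (∀ a → Φ a a ≡ + 0) →
      (∀ a b x y → F a b x y + (Φ a b * (c₁ x * c₂ y) + Φ b a * (c₂ x * c₁ y)) ≡ ψ⁺ (a ℕ.+ b) * (c₁ x * c₁ y) + ψ⁻ (a ℕ.+ b) * (c₂ x * c₂ y)) →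
      ∀ n → + 3 * Quad F n ≡ Λ (λ d X → + 1 * (+ 3 * (ψ⁺ d * c₁ X * (+ d - + 1)) + + 3 * (ψ⁻ d * c₂ X * (+ d - + 1)))
        + - (+ 2) * (ψ⁺ d * (c₁ X * (+ X + - (+ 1))) + ψ⁻ d * (c₂ X * (+ X + - (+ 2))))) n
    square-product ψ⁺ ψ⁻ Φ F e₁ e₂ e₃ e n = trans (solve-for-F (Quad F n) K D D′ E E′ main)
      (trans (cong₂ (λ u v → + 1 * u + - (+ 2) * v) (three-Λ _ _ n)
        (trans (three-Λ _ _ n) (Λ-ext (λ d X → cong₂ _+_ (by-count (ψ⁺ d) _ (count-c₁c₀ X)) (by-count (ψ⁻ d) _ (count-c₂c₀ X))) n)))
      (sym (Λ-linear (+ 1) (- (+ 2)) _ _ n)))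
      where
      K D D′ E E′ : ℤ
      K = Quad (λ a b x y → Φ a b * (c₁ x * c₂ y)) n + Quad (λ a b x y → Φ b a * (c₂ x * c₁ y)) n
      D = Λ (λ d X → ψ⁺ d * c₁ X * (+ d - + 1)) n
      D′ = Λ (λ d X → ψ⁻ d * c₂ X * (+ d - + 1)) n
      E = Λ (λ d X → ψ⁺ d * (c₁ ⊗ c₀) X) n
      E′ = Λ (λ d X → ψ⁻ d * (c₂ ⊗ c₀) X) n
      main : Quad F n + K + (+ 2 * E + + 2 * E′) ≡ K + (D + D′)
      main = trans (cong (_+ (+ 2 * E + + 2 * E′)) (Quad-balance F _ _ _ _ e n)) (Square.square ψ⁺ ψ⁻ Φ e₁ e₂ e₃ n)
      solve-for-F : ∀ f c d d′ e e′ → f + c + (+ 2 * e + + 2 * e′) ≡ c + (d + d′) → + 3 * f ≡ + 1 * (+ 3 * (d + d′)) + - (+ 2) * (+ 3 * (e + e′))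
      solve-for-F f c d d′ e e′ eq = trans (expand f c e e′) (trans (cong (λ z → + 3 * z - + 3 * c - + 6 * (e + e′)) eq) (simplify c d d′ e e′))
        where
        expand : ∀ f c e e′ → + 3 * f ≡ + 3 * (f + c + (+ 2 * e + + 2 * e′)) - + 3 * c - + 6 * (e + e′)
        expand = solve-∀
        simplify : ∀ c d d′ e e′ → + 3 * (c + (d + d′)) - + 3 * c - + 6 * (e + e′) ≡ + 1 * (+ 3 * (d + d′)) + - (+ 2) * (+ 3 * (e + e′))
        simplify = solve-∀

  -- Here `square` applies with Φ = a - b, whose values on the two sides of the diagonal weight the
  -- classes 1 and 2 by d and -d.
  θs₀-heat : ∀ n → + 2 * θ s₀ n ≡ + 3 * s₂ n - + 6 * (s₀ ⊗ s₁) n - s₁ n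
  θs₀-heat n = rearrange (θ s₀ n) (s₂ n) ((s₀ ⊗ s₁) n) (s₁ n) (trans (cong (λ z → + 3 * ((s₀ ⊗ s₁) n + z)) (⊗-comm s₀ s₁ n)) sum)
    where
    F : ℕ → ℕ → ℕ → ℕ → ℤ
    F a b x y = χ x * (+ b * ν y) + + a * ν x * χ y
    expand : ∀ a b p q r s → (p - q) * (b * (r + s)) + a * (p + q) * (r - s) + ((a - b) * (p * s) + (b - a) * (q * r))
      ≡ (a + b) * (p * r) + - (a + b) * (q * s)
    expand = solve-∀
    above : ∀ a b → a + b - b ≡ a
    above = solve-∀
    beneath : ∀ a b → a - (a + b) ≡ - b
    beneath = solve-∀
    collect : ∀ d X p q → + 1 * (+ 3 * (d * p * (d - + 1)) + + 3 * (- d * q * (d - + 1)))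
      + - (+ 2) * (d * (p * (X + - (+ 1))) + - d * (q * (X + - (+ 2))))
      ≡ + 1 * (+ 3 * (d * d * (p - q)) + - (+ 1) * (d * (p + q))) + - (+ 2) * (d * X * (p - q))
    collect = solve-∀
    sum : + 3 * ((s₀ ⊗ s₁) n + (s₁ ⊗ s₀) n) ≡ + 1 * (+ 3 * s₂ n + - (+ 1) * s₁ n) + - (+ 2) * θ s₀ n
    sum = trans (cong (λ z → + 3 * z) (sym (trans (Quad-+ _ _ n) (cong₂ _+_ (sym (Λ-⊗ _ _ n)) (sym (Λ-⊗ _ _ n))))))
      (trans (square-product (λ d → + d) (λ d → - + d) (λ a b → + a - + b) F
        (λ a b → above (+ a) (+ b)) (λ a b → beneath (+ a) (+ b)) (λ a → ℤₚ.+-inverseʳ (+ a))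
        (λ a b x y → expand (+ a) (+ b) (c₁ x) (c₂ x) (c₁ y) (c₂ y)) n)
      (trans (Λ-ext (λ d X → collect (+ d) (+ X) (c₁ X) (c₂ X)) n)
      (trans (Λ-linear (+ 1) (- (+ 2)) _ (λ a x → + a * + x * χ x) n)
      (cong₂ (λ u v → + 1 * u + - (+ 2) * v) (Λ-linear (+ 3) (- (+ 1)) (λ a x → + a * + a * χ x) (λ a x → + a * ν x) n)
        (sym (θ-Λ (λ a x → χ x) n))))))
    rearrange : ∀ t s x y → + 3 * (x + x) ≡ + 1 * (+ 3 * s + - (+ 1) * y) + - (+ 2) * t → + 2 * t ≡ + 3 * s - + 6 * x - y
    rearrange t s x y e = trans (expand′ t x) (trans (cong (λ z → z + + 2 * t - + 6 * x) e) (simplify t s x y))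
      where
      expand′ : ∀ t x → + 2 * t ≡ + 3 * (x + x) + + 2 * t - + 6 * x
      expand′ = solve-∀
      simplify : ∀ t s x y → + 1 * (+ 3 * s + - (+ 1) * y) + - (+ 2) * t + + 2 * t - + 6 * x ≡ + 3 * s - + 6 * x - y
      simplify = solve-∀

  -- A second formula for θ s₁, from Φ = (a - b)²; it is wanted for comparison with `θs₁-star`.
  θs₁-heat : ∀ n → + 2 * θ s₁ n ≡ + 3 * s₃ n - + 6 * (s₀ ⊗ s₂) n - + 6 * (s₁ ⊗ s₁) n - s₂ n
  θs₁-heat n = rearrange (θ s₁ n) (s₃ n) ((s₀ ⊗ s₂) n) ((s₁ ⊗ s₁) n) (s₂ n)
    (trans (cong (λ z → + 3 * ((s₀ ⊗ s₂) n + z + ((s₁ ⊗ s₁) n + (s₁ ⊗ s₁) n))) (⊗-comm s₀ s₂ n)) sum)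
    where
    F : ℕ → ℕ → ℕ → ℕ → ℤ
    F a b x y = χ x * (+ b * + b * χ y) + + a * + a * χ x * χ y + (+ a * ν x * (+ b * ν y) + + a * ν x * (+ b * ν y))
    expand : ∀ a b p q r s → (p - q) * (b * b * (r - s)) + a * a * (p - q) * (r - s) + (a * (p + q) * (b * (r + s)) + a * (p + q) * (b * (r + s)))
      + ((a - b) * (a - b) * (p * s) + (b - a) * (b - a) * (q * r))
      ≡ (a + b) * (a + b) * (p * r) + (a + b) * (a + b) * (q * s)
    expand = solve-∀
    above : ∀ a b → (a + b - b) * (a + b - b) ≡ a * a
    above = solve-∀
    beneath : ∀ a b → (a - (a + b)) * (a - (a + b)) ≡ b * b
    beneath = solve-∀
    diag : ∀ a → (a - a) * (a - a) ≡ + 0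
    diag = solve-∀
    collect : ∀ d X p q → + 1 * (+ 3 * (d * d * p * (d - + 1)) + + 3 * (d * d * q * (d - + 1)))
      + - (+ 2) * (d * d * (p * (X + - (+ 1))) + d * d * (q * (X + - (+ 2))))
      ≡ + 1 * (+ 3 * (d * d * d * (p + q)) + - (+ 1) * (d * d * (p - q))) + - (+ 2) * (d * X * (d * (p + q)))
    collect = solve-∀
    sum : + 3 * ((s₀ ⊗ s₂) n + (s₂ ⊗ s₀) n + ((s₁ ⊗ s₁) n + (s₁ ⊗ s₁) n)) ≡ + 1 * (+ 3 * s₃ n + - (+ 1) * s₂ n) + - (+ 2) * θ s₁ n
    sum = trans (cong (λ z → + 3 * z) (sym (trans (Quad-+ _ _ n) (cong₂ _+_
        (trans (Quad-+ _ _ n) (cong₂ _+_ (sym (Λ-⊗ _ _ n)) (sym (Λ-⊗ _ _ n))))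
        (trans (Quad-+ _ _ n) (cong₂ _+_ (sym (Λ-⊗ (λ a x → + a * ν x) (λ a x → + a * ν x) n)) (sym (Λ-⊗ (λ a x → + a * ν x) (λ a x → + a * ν x) n))))))))
      (trans (square-product (λ d → + d * + d) (λ d → + d * + d) (λ a b → (+ a - + b) * (+ a - + b)) F
        (λ a b → above (+ a) (+ b)) (λ a b → beneath (+ a) (+ b)) (λ a → diag (+ a))
        (λ a b x y → expand (+ a) (+ b) (c₁ x) (c₂ x) (c₁ y) (c₂ y)) n)
      (trans (Λ-ext (λ d X → collect (+ d) (+ X) (c₁ X) (c₂ X)) n)
      (trans (Λ-linear (+ 1) (- (+ 2)) _ (λ a x → + a * + x * (+ a * ν x)) n)
      (cong₂ (λ u v → + 1 * u + - (+ 2) * v) (Λ-linear (+ 3) (- (+ 1)) (λ a x → + a * + a * + a * ν x) (λ a x → + a * + a * χ x) n)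
        (sym (θ-Λ (λ a x → + a * ν x) n))))))
    rearrange : ∀ t s x z y → + 3 * (x + x + (z + z)) ≡ + 1 * (+ 3 * s + - (+ 1) * y) + - (+ 2) * t → + 2 * t ≡ + 3 * s - + 6 * x - + 6 * z - y
    rearrange t s x z y e = trans (expand′ t x z) (trans (cong (λ w → w + + 2 * t - + 6 * x - + 6 * z) e) (simplify t s x z y))
      where
      expand′ : ∀ t x z → + 2 * t ≡ + 3 * (x + x + (z + z)) + + 2 * t - + 6 * x - + 6 * z
      expand′ = solve-∀
      simplify : ∀ t s x z y → + 1 * (+ 3 * s + - (+ 1) * y) + - (+ 2) * t + + 2 * t - + 6 * x - + 6 * z ≡ + 3 * s - + 6 * x - + 6 * z - y
      simplify = solve-∀

  -- Equating the two formulas for θ s₁ also eliminates s₁². What remains determines `s₃` as a K,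
  -- which closes the system.
  s₃-product : ∀ n → s₃ n ≡ + 6 * (s₀ ⊗ s₂) n + s₂ n
  s₃-product n = ℤₚ.*-cancelˡ-≡ (+ 3) _ _ (combine (θ s₁ n) (s₃ n) ((s₀ ⊗ s₂) n) ((s₁ ⊗ s₁) n) (s₂ n) (θs₁-heat n) (θs₁-star n))
    where
    combine : ∀ t s x z y → + 2 * t ≡ + 3 * s - + 6 * x - + 6 * z - y → t ≡ + 6 * x - + 3 * z + y → + 3 * s ≡ + 3 * (+ 6 * x + y)
    combine t s x z y e₁ e₂ = trans (isolate s x z y) (trans (cong (λ w → w + + 6 * x + + 6 * z + y) (trans (sym e₁) (cong (λ w → + 2 * w) e₂))) (simplify x z y))
      where
      isolate : ∀ s x z y → + 3 * s ≡ + 3 * s - + 6 * x - + 6 * z - y + + 6 * x + + 6 * z + y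
      isolate = solve-∀
      simplify : ∀ x z y → + 2 * (+ 6 * x - + 3 * z + y) + + 6 * x + + 6 * z + y ≡ + 3 * (+ 6 * x + y)
      simplify = solve-∀

-- Gaussian binomials and the finite form of the triple product.

module RingIdentities where
  import Algebra.Solver.Ring

  ℤ-rawRing : RawRing _ _
  ℤ-rawRing = CommutativeRing.rawRing ℤₚ.+-*-commutativeRing

  module RingSolver {c ℓ} (R : CommutativeRing c ℓ)
    (ι : ℤ-rawRing -Raw-AlmostCommutative⟶ fromCommutativeRing R) where
    open CommutativeRing R
    open _-Raw-AlmostCommutative⟶_ ι using (⟦_⟧)
    coeff≟ : (i j : ℤ) → Maybe (⟦ i ⟧ ≈ ⟦ j ⟧)
    coeff≟ i j with i ℤ.≟ j
    ... | yes ≡.refl = just refl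
    ... | no _       = nothing
    private
      module Solver = Algebra.Solver.Ring ℤ-rawRing (fromCommutativeRing R) ι coeff≟
    open Solver public using (solve; con; _:=_; _:+_; _:*_; :-_; _:-_)

  module _ {c ℓ} (R : CommutativeRing c ℓ) where
    open CommutativeRing R
    open import Algebra.Properties.Ring ring using (-‿distribˡ-*; -‿distribʳ-*)

    null-factor : ∀ {m} → m ≈ 1# → 1# * (1# - m) ≈ 0#
    null-factor e = trans (*-identityˡ _) (trans (+-congˡ (-‿cong e)) (-‿inverseʳ 1#))

    null-product : ∀ {a} b → a ≈ 0# → a * b ≈ 0#
    null-product b e = trans (*-congʳ e) (zeroˡ b)

    minus-cube : ∀ {a a′ b c x y} → c ≈ x → a ≈ 0# → a′ ≈ - y → y ≈ x → c * (a * b + a′ * c) ≈ - (x * (x * x))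
    minus-cube {b = b} c≈x a≈0 a′≈-y y≈x = trans (*-cong c≈x (trans (+-cong (null-product b a≈0) (*-cong (trans a′≈-y (-‿cong y≈x)) c≈x))
        (trans (+-identityˡ _) (sym (-‿distribˡ-* _ _)))))
      (sym (-‿distribʳ-* _ _))

  module FiniteTripleProduct {c ℓ} (R : CommutativeRing c ℓ)
    (ι : ℤ-rawRing -Raw-AlmostCommutative⟶ fromCommutativeRing R)
    (q : CommutativeRing.Carrier R) where
    open CommutativeRing R hiding (zero)
    open RingSolver R ι using (solve; con; _:=_; _:+_; _:*_; :-_; _:-_)
    open import Algebra.Properties.Semiring.Exp semiring using (_^_; ^-homo-*; ^-assocʳ)
    open import Algebra.Properties.Ring ring using (-0#≈0#)
    open import Relation.Binary.Reasoning.Setoid setoid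

    sumR : (ℕ → Carrier) → ℕ → Carrier
    sumR h zero    = h 0
    sumR h (suc n) = sumR h n + h (suc n)

    sumR-cong : ∀ {g h} n → (∀ i → i ℕ.≤ n → g i ≈ h i) → sumR g n ≈ sumR h n
    sumR-cong zero    e = e 0 z≤n
    sumR-cong (suc n) e = +-cong (sumR-cong n (λ i i≤n → e i (ℕₚ.m≤n⇒m≤1+n i≤n))) (e (suc n) ℕₚ.≤-refl)

    sumR-+ : ∀ g h n → sumR (λ i → g i + h i) n ≈ sumR g n + sumR h n
    sumR-+ g h zero    = refl
    sumR-+ g h (suc n) = trans (+-congʳ (sumR-+ g h n))
      (solve 4 (λ a b c d → (a :+ b) :+ (c :+ d) := (a :+ c) :+ (b :+ d)) refl (sumR g n) (sumR h n) (g (suc n)) (h (suc n)))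

    sumR-*ˡ : ∀ c h n → sumR (λ i → c * h i) n ≈ c * sumR h n
    sumR-*ˡ c h zero    = refl
    sumR-*ˡ c h (suc n) = trans (+-congʳ (sumR-*ˡ c h n)) (sym (distribˡ c (sumR h n) (h (suc n))))

    sumR-head : ∀ h n → sumR h (suc n) ≈ h 0 + sumR (λ i → h (suc i)) n
    sumR-head h zero    = refl
    sumR-head h (suc n) = trans (+-congʳ (sumR-head h n)) (+-assoc _ _ _)

    -- The Gaussian binomial coefficient, by Pascal's recursion, which needs no division.
    binom : ℕ → ℕ → Carrier
    binom M       zero    = 1#
    binom zero    (suc i) = 0#
    binom (suc M) (suc i) = binom M i + q ^ suc i * binom M (suc i)

    binom-above : ∀ M k → binom M (suc k ℕ.+ M) ≈ 0#
    binom-above zero    k = refl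
    binom-above (suc M) k = trans (+-cong vanish (*-congˡ vanish′)) (trans (+-identityˡ _) (zeroʳ _))
      where
      vanish : binom M (k ℕ.+ suc M) ≈ 0#
      vanish = trans (reflexive (≡.cong (binom M) (ℕₚ.+-suc k M))) (binom-above M k)
      vanish′ : binom M (suc (k ℕ.+ suc M)) ≈ 0#
      vanish′ = trans (reflexive (≡.cong (λ z → binom M (suc z)) (ℕₚ.+-suc k M))) (binom-above M (suc k))

    -- Pascal's rule transposed: raising the upper index amounts to replacing T(i) by T(i + 1) + q^i
    -- T(i). Every new factor of the products below acts on the terms in this way.
    pascal-sum : ∀ (T : ℕ → Carrier) M →
      sumR (λ i → binom (suc M) i * T i) (suc M) ≈ sumR (λ i → binom M i * (T (suc i) + q ^ i * T i)) M
    pascal-sum T M = begin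
      sumR (λ i → binom (suc M) i * T i) (suc M)
        ≈⟨ sumR-head (λ i → binom (suc M) i * T i) M ⟩
      1# * T 0 + sumR (λ i → (binom M i + q ^ suc i * binom M (suc i)) * T (suc i)) M
        ≈⟨ +-congˡ (trans (sumR-cong M (λ i _ → distribʳ _ _ _)) (sumR-+ _ _ M)) ⟩
      1# * T 0 + (sumR (λ i → binom M i * T (suc i)) M + sumR (λ i → q ^ suc i * binom M (suc i) * T (suc i)) M)
        ≈⟨ solve 3 (λ a b c → a :+ (b :+ c) := b :+ (a :+ c)) refl _ _ _ ⟩
      sumR (λ i → binom M i * T (suc i)) M + (1# * T 0 + sumR (λ i → q ^ suc i * binom M (suc i) * T (suc i)) M)
        ≈⟨ +-congˡ (+-congʳ (*-congʳ (*-identityˡ 1#))) ⟨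
      sumR (λ i → binom M i * T (suc i)) M + (1# * 1# * T 0 + sumR (λ i → q ^ suc i * binom M (suc i) * T (suc i)) M)
        ≈⟨ +-congˡ (sumR-head (λ i → q ^ i * binom M i * T i) M) ⟨
      sumR (λ i → binom M i * T (suc i)) M + (sumR (λ i → q ^ i * binom M i * T i) M + q ^ suc M * binom M (suc M) * T (suc M))
        ≈⟨ +-congˡ (+-congˡ (trans (*-congʳ (trans (*-congˡ (binom-above M 0)) (zeroʳ _))) (zeroˡ _))) ⟩
      sumR (λ i → binom M i * T (suc i)) M + (sumR (λ i → q ^ i * binom M i * T i) M + 0#)
        ≈⟨ +-congˡ (trans (+-identityʳ _) (sumR-cong M (λ i _ →
            solve 3 (λ a b c → a :* b :* c := b :* (a :* c)) refl (q ^ i) (binom M i) (T i)))) ⟩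
      sumR (λ i → binom M i * T (suc i)) M + sumR (λ i → binom M i * (q ^ i * T i)) M
        ≈⟨ trans (sumR-cong M (λ i _ → distribˡ (binom M i) _ _)) (sumR-+ _ _ M) ⟨
      sumR (λ i → binom M i * (T (suc i) + q ^ i * T i)) M ∎

    -- The theta term (-1)^i q^(i(i-1)/2) x^i.
    term : Carrier → ℕ → Carrier
    term x zero    = 1#
    term x (suc i) = - (q ^ i * x * term x i)

    factors : Carrier → ℕ → Carrier
    factors x zero    = 1#
    factors x (suc m) = factors x m * (1# - x * q ^ m)

    poch : ℕ → Carrier
    poch zero    = 1#
    poch (suc m) = poch m * (1# - q ^ suc m)

    factors-cong : ∀ {x x′} m → x ≈ x′ → factors x m ≈ factors x′ m
    factors-cong zero    e = refl
    factors-cong (suc m) e = *-cong (factors-cong m e) (+-congˡ (-‿cong (*-congʳ e)))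

    factors-front : ∀ x m → factors x (suc m) ≈ (1# - x) * factors (x * q) m
    factors-front x zero = trans (*-identityˡ _) (trans (+-congˡ (-‿cong (*-identityʳ x))) (sym (*-identityʳ _)))
    factors-front x (suc m) = trans (*-congʳ (factors-front x m))
      (solve 5 (λ a x q f p → ((a :- x) :* f) :* (a :- x :* (q :* p)) := (a :- x) :* (f :* (a :- (x :* q) :* p)))
        refl 1# x q (factors (x * q) m) (q ^ m))

    factors-poch : ∀ m → factors q m ≈ poch m
    factors-poch zero    = refl
    factors-poch (suc m) = *-congʳ (factors-poch m)

    term-scale : ∀ x i → term (x * q) i ≈ q ^ i * term x i
    term-scale x zero    = sym (*-identityˡ 1#)
    term-scale x (suc i) = trans (-‿cong (*-congˡ (term-scale x i)))
      (solve 4 (λ x q p t → :- (p :* (x :* q) :* (p :* t)) := (q :* p) :* (:- (p :* x :* t))) refl x q (q ^ i) (term x i))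

    q-binomial : ∀ m x → factors x m ≈ sumR (λ i → binom m i * term x i) m
    q-binomial zero    x = sym (*-identityˡ 1#)
    q-binomial (suc m) x = begin
      factors x (suc m)
        ≈⟨ factors-front x m ⟩
      (1# - x) * factors (x * q) m
        ≈⟨ *-congˡ (q-binomial m (x * q)) ⟩
      (1# - x) * sumR (λ i → binom m i * term (x * q) i) m
        ≈⟨ sumR-*ˡ (1# - x) _ m ⟨
      sumR (λ i → (1# - x) * (binom m i * term (x * q) i)) m
        ≈⟨ sumR-cong m (λ i _ → trans (*-congˡ (*-congˡ (term-scale x i))) (trans
            (solve 5 (λ a b p t x → (a :- x) :* (b :* (p :* t)) := b :* (:- (p :* x :* t) :+ p :* (a :* t))) refl 1# (binom m i) (q ^ i) (term x i) x)
            (*-congˡ (+-congˡ (*-congˡ (*-identityˡ _)))))) ⟩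
      sumR (λ i → binom m i * (term x (suc i) + q ^ i * term x i)) m
        ≈⟨ pascal-sum (term x) m ⟨
      sumR (λ i → binom (suc m) i * term x i) (suc m) ∎

    module _ (x y : Carrier) (xy≈q : x * y ≈ q) where

      -- Position i stands for the exponent i - n of a Laurent series: powers of x from position n
      -- on, powers of y before it.
      bilateral : ℕ → ℕ → Carrier
      bilateral zero    i       = term x i
      bilateral (suc n) zero    = term y (suc n)
      bilateral (suc n) (suc i) = bilateral n i

      -- Multiplying by y raises the power of y on one side of the middle; on the other it lowers
      -- the power of x, by x y = q.
      bilateral-step : ∀ n i → q ^ i * bilateral (suc n) i ≈ - (y * q ^ n * bilateral n i)
      bilateral-step zero zero = trans (*-identityˡ _) (-‿cong (*-congʳ (*-comm 1# y)))
      bilateral-step zero (suc i) = begin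
        q * q ^ i * term x i                     ≈⟨ *-congʳ (*-congʳ xy≈q) ⟨
        x * y * q ^ i * term x i                 ≈⟨ *-identityˡ _ ⟨
        1# * (x * y * q ^ i * term x i)          ≈⟨ solve 5 (λ a x y p t → a :* (x :* y :* p :* t) := :- (y :* a :* (:- (p :* x :* t)))) refl 1# x y (q ^ i) (term x i) ⟩
        - (y * 1# * - (q ^ i * x * term x i))    ∎
      bilateral-step (suc n) zero = trans (*-identityˡ _) (-‿cong (*-congʳ (*-comm _ y)))
      bilateral-step (suc n) (suc i) = begin
        q * q ^ i * bilateral (suc n) i          ≈⟨ *-assoc q _ _ ⟩
        q * (q ^ i * bilateral (suc n) i)        ≈⟨ *-congˡ (bilateral-step n i) ⟩
        q * (- (y * q ^ n * bilateral n i))      ≈⟨ solve 4 (λ q y p b → q :* (:- (y :* p :* b)) := :- (y :* (q :* p) :* b)) refl q y (q ^ n) (bilateral n i) ⟩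
        - (y * (q * q ^ n) * bilateral n i)      ∎

      -- For n = 0 this is the q-binomial theorem in x; each further factor 1 - y q^n is absorbed by
      -- `pascal-sum`.
      triple-product : ∀ m n → factors x m * factors y n ≈ sumR (λ i → binom (n ℕ.+ m) i * bilateral n i) (n ℕ.+ m)
      triple-product m zero = trans (*-identityʳ _) (q-binomial m x)
      triple-product m (suc n) = begin
        factors x m * (factors y n * (1# - y * q ^ n))
          ≈⟨ *-assoc _ _ _ ⟨
        factors x m * factors y n * (1# - y * q ^ n)
          ≈⟨ trans (*-comm _ _) (*-congˡ (triple-product m n)) ⟩
        (1# - y * q ^ n) * sumR (λ i → binom (n ℕ.+ m) i * bilateral n i) (n ℕ.+ m)
          ≈⟨ sumR-*ˡ _ _ (n ℕ.+ m) ⟨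
        sumR (λ i → (1# - y * q ^ n) * (binom (n ℕ.+ m) i * bilateral n i)) (n ℕ.+ m)
          ≈⟨ sumR-cong (n ℕ.+ m) (λ i _ → trans
              (solve 4 (λ a b t y → (a :- y) :* (b :* t) := b :* (a :* t :+ :- (y :* t))) refl 1# (binom (n ℕ.+ m) i) (bilateral n i) (y * q ^ n))
              (*-congˡ (+-cong (*-identityˡ _) (sym (bilateral-step n i))))) ⟩
        sumR (λ i → binom (n ℕ.+ m) i * (bilateral (suc n) (suc i) + q ^ i * bilateral (suc n) i)) (n ℕ.+ m)
          ≈⟨ pascal-sum (bilateral (suc n)) (n ℕ.+ m) ⟨
        sumR (λ i → binom (suc (n ℕ.+ m)) i * bilateral (suc n) i) (suc (n ℕ.+ m)) ∎

      sum-bilateral : ∀ m n → sumR (bilateral (suc n)) (suc n ℕ.+ m) ≈ sumR (term x) m + sumR (λ j → term y (suc j)) n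
      sum-bilateral m zero = trans (sumR-head _ m) (+-comm _ _)
      sum-bilateral m (suc n) = trans (sumR-head _ (suc n ℕ.+ m)) (trans (+-congˡ (sum-bilateral m n))
        (solve 3 (λ a b c → a :+ (b :+ c) := b :+ (c :+ a)) refl _ _ _))

    binom-value : ∀ i k → binom (i ℕ.+ k) i * (poch i * poch k) ≈ poch (i ℕ.+ k)
    binom-value zero    k       = trans (*-identityˡ _) (*-identityˡ _)
    binom-value (suc i) zero    = trans (*-cong (diag (suc i)) (*-identityʳ _)) (trans (*-identityˡ _)
        (reflexive (≡.cong (λ z → poch (suc z)) (≡.sym (ℕₚ.+-identityʳ i)))))
      where
      diag : ∀ j → binom (j ℕ.+ 0) j ≈ 1#
      diag zero    = refl
      diag (suc j) = trans (+-cong (diag j) (trans (*-congˡ (trans (reflexive (≡.cong (λ z → binom z (suc j)) (ℕₚ.+-identityʳ j)))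
        (binom-above j 0))) (zeroʳ _))) (+-identityʳ _)
    binom-value (suc i) (suc k) = begin
      (binom (i ℕ.+ suc k) i + q ^ suc i * binom (i ℕ.+ suc k) (suc i)) * (poch i * (1# - q ^ suc i) * (poch k * (1# - q ^ suc k)))
        ≈⟨ solve 8 (λ b p b′ f g a p′ o → (b :+ p :* b′) :* (f :* (o :- p) :* (g :* (o :- p′))) :=
              b :* (f :* (g :* (o :- p′))) :* (o :- p) :+ p :* (b′ :* (f :* (o :- p) :* g)) :* (o :- p′))
            refl (binom (i ℕ.+ suc k) i) (q ^ suc i) (binom (i ℕ.+ suc k) (suc i)) (poch i) (poch k) 1# (q ^ suc k) 1# ⟩
      binom (i ℕ.+ suc k) i * (poch i * poch (suc k)) * (1# - q ^ suc i) + q ^ suc i * (binom (i ℕ.+ suc k) (suc i) * (poch (suc i) * poch k)) * (1# - q ^ suc k)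
        ≈⟨ +-cong (*-congʳ (binom-value i (suc k))) (*-congʳ (*-congˡ (trans (reflexive (≡.cong (λ z → binom z (suc i) * (poch (suc i) * poch k)) (ℕₚ.+-suc i k)))
            (trans (binom-value (suc i) k) (reflexive (≡.cong poch (≡.sym (ℕₚ.+-suc i k)))))))) ⟩
      poch (i ℕ.+ suc k) * (1# - q ^ suc i) + q ^ suc i * poch (i ℕ.+ suc k) * (1# - q ^ suc k)
        ≈⟨ solve 4 (λ f o p p′ → f :* (o :- p) :+ p :* f :* (o :- p′) := f :* (o :- p :* p′) :+ f :* (p :* o :- p)) refl (poch (i ℕ.+ suc k)) 1# (q ^ suc i) (q ^ suc k) ⟩
      poch (i ℕ.+ suc k) * (1# - q ^ suc i * q ^ suc k) + poch (i ℕ.+ suc k) * (q ^ suc i * 1# - q ^ suc i)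
        ≈⟨ +-cong (*-congˡ (+-congˡ (-‿cong (sym (^-homo-* q (suc i) (suc k)))))) (trans (*-congˡ (trans (+-congʳ (*-identityʳ _)) (-‿inverseʳ _))) (zeroʳ _)) ⟩
      poch (i ℕ.+ suc k) * (1# - q ^ suc (i ℕ.+ suc k)) + 0#
        ≈⟨ +-identityʳ _ ⟩
      poch (i ℕ.+ suc k) * (1# - q ^ suc (i ℕ.+ suc k)) ∎

    module Nilpotent (n : ℕ) (nil : ∀ k → n ℕ.< k → q ^ k ≈ 0#) where

      poch-stable : ∀ k → poch (k ℕ.+ n) ≈ poch n
      poch-stable zero    = refl
      poch-stable (suc k) = trans (*-cong (poch-stable k) (trans (+-congˡ (trans (-‿cong (nil (suc k ℕ.+ n) (s≤s (ℕₚ.m≤n+m n k)))) -0#≈0#)) (+-identityʳ 1#)))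
        (*-identityʳ _)

      poch-large : ∀ {m} → n ℕ.≤ m → poch m ≈ poch n
      poch-large {m} n≤m = trans (reflexive (≡.cong poch (≡.sym (ℕₚ.m∸n+n≡m n≤m)))) (poch-stable (m ℕ.∸ n))

      geometric : ∀ z m → (1# - z) * sumR (z ^_) m ≈ 1# - z ^ suc m
      geometric z zero    = trans (*-identityʳ _) (+-congˡ (-‿cong (sym (*-identityʳ z))))
      geometric z (suc m) = trans (distribˡ _ _ _) (trans (+-congʳ (geometric z m))
        (trans (+-congˡ (trans (distribʳ _ _ _) (+-congʳ (*-identityˡ _))))
        (solve 3 (λ o z p → (o :- p) :+ (p :+ (:- z) :* p) := o :- z :* p) refl 1# z (z ^ suc m))))

      -- Each factor is inverted by a geometric series, which terminates since q is nilpotent.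
      poch-unit : ∀ m → Σ Carrier (λ u → poch m * u ≈ 1#)
      poch-unit zero = 1# , *-identityˡ 1#
      poch-unit (suc m) with poch-unit m
      ... | u , pu≈1 = u * sumR ((q ^ suc m) ^_) n , (begin
        poch m * (1# - q ^ suc m) * (u * sumR ((q ^ suc m) ^_) n)   ≈⟨ solve 4 (λ a b c d → a :* b :* (c :* d) := (a :* c) :* (b :* d)) refl (poch m) (1# - q ^ suc m) u _ ⟩
        poch m * u * ((1# - q ^ suc m) * sumR ((q ^ suc m) ^_) n)   ≈⟨ *-cong pu≈1 (geometric (q ^ suc m) n) ⟩
        1# * (1# - (q ^ suc m) ^ suc n)                             ≈⟨ *-identityˡ _ ⟩
        1# - (q ^ suc m) ^ suc n                                    ≈⟨ +-congˡ (-‿cong (trans (^-assocʳ q (suc m) (suc n)) (nil _ (ℕₚ.m≤m+n (suc n) _)))) ⟩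
        1# - 0#                                                     ≈⟨ trans (+-congˡ -0#≈0#) (+-identityʳ 1#) ⟩
        1#                                                          ∎)

      -- All three products in `binom-value` equal `poch n` here, and one copy cancels because it is
      -- a unit.
      binom-limit : ∀ {i k} → n ℕ.≤ i → n ℕ.≤ k → binom (i ℕ.+ k) i * poch n ≈ 1#
      binom-limit {i} {k} n≤i n≤k with poch-unit n
      ... | u , pu≈1 = begin
        binom (i ℕ.+ k) i * poch n                      ≈⟨ trans (*-congˡ pu≈1) (*-identityʳ _) ⟨
        binom (i ℕ.+ k) i * poch n * (poch n * u)       ≈⟨ solve 3 (λ b p u → b :* p :* (p :* u) := b :* (p :* p) :* u) refl (binom (i ℕ.+ k) i) (poch n) u ⟩
        binom (i ℕ.+ k) i * (poch n * poch n) * u       ≈⟨ *-congʳ (*-congˡ (*-cong (poch-large n≤i) (poch-large n≤k))) ⟨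
        binom (i ℕ.+ k) i * (poch i * poch k) * u       ≈⟨ *-congʳ (binom-value i k) ⟩
        poch (i ℕ.+ k) * u                              ≈⟨ *-congʳ (poch-large (ℕₚ.≤-trans n≤i (ℕₚ.m≤m+n i k))) ⟩
        poch n * u                                      ≈⟨ pu≈1 ⟩
        1#                                              ∎

      term-vanish : ∀ x {i} → suc n ℕ.< i → term x i ≈ 0#
      term-vanish x {suc i} (s≤s n<i) = trans (-‿cong (trans (*-congʳ (trans (*-congʳ (nil i n<i)) (zeroˡ x))) (zeroˡ _))) -0#≈0#

      -- Large enough that an index i with i < n or 2N - i < n lies more than n + 1 away from the
      -- middle N, where the theta term is zero. For all other i ≤ 2N `binom-limit` applies.
      N : ℕ
      N = suc (n ℕ.+ suc n)

      module _ (x y : Carrier) (xy≈q : x * y ≈ q) where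

        bilateral-y : ∀ i k → bilateral x y xy≈q (i ℕ.+ suc k) i ≈ term y (suc k)
        bilateral-y zero    k = refl
        bilateral-y (suc i) k = bilateral-y i k

        bilateral-x : ∀ m k → bilateral x y xy≈q m (m ℕ.+ k) ≈ term x k
        bilateral-x zero    k = refl
        bilateral-x (suc m) k = bilateral-x m k

        coefficient-limit : ∀ i → i ℕ.≤ N ℕ.+ N → poch N * (binom (N ℕ.+ N) i * bilateral x y xy≈q N i) ≈ bilateral x y xy≈q N i
        coefficient-limit i i≤2N with ℕₚ.m≤n⇒∃[o]m+o≡n i≤2N
        ... | k , i+k≡2N with n ℕ.≤? i | n ℕ.≤? k
        ... | yes n≤i | yes n≤k = trans (solve 3 (λ p b t → p :* (b :* t) := b :* p :* t) refl (poch N) (binom (N ℕ.+ N) i) _)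
          (trans (*-congʳ (trans (*-cong (reflexive (≡.cong (λ z → binom z i) (≡.sym i+k≡2N))) (poch-large n≤N)) (binom-limit n≤i n≤k))) (*-identityˡ _))
          where
          n≤N : n ℕ.≤ N
          n≤N = ℕₚ.≤-trans (ℕₚ.m≤m+n n (suc n)) (ℕₚ.n≤1+n _)
        ... | no n≰i | _ = trans (*-congˡ (trans (*-congˡ vanish) (zeroʳ _))) (trans (zeroʳ _) (sym vanish))
          where
          i<n : i ℕ.< n
          i<n = ℕₚ.≰⇒> n≰i
          vanish : bilateral x y xy≈q N i ≈ 0#
          vanish with ℕₚ.m≤n⇒∃[o]m+o≡n (ℕₚ.≤-trans (ℕₚ.<⇒≤ i<n) (ℕₚ.≤-trans (ℕₚ.m≤m+n n (suc (suc n))) (ℕₚ.≤-reflexive (ℕₚ.+-suc n (suc n)))))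
          ... | zero , e = contradiction (≡.trans (≡.sym (ℕₚ.+-identityʳ i)) e) (ℕₚ.<⇒≢ (ℕₚ.<-≤-trans i<n (ℕₚ.≤-trans (ℕₚ.m≤m+n n (suc n)) (ℕₚ.n≤1+n _))))
          ... | suc o , e = trans (reflexive (≡.cong (λ z → bilateral x y xy≈q z i) (≡.sym e))) (trans (bilateral-y i o) (term-vanish y 
              (s≤s (ℕₚ.+-cancelˡ-< n n o (ℕₚ.<-≤-trans (ℕₚ.≤-reflexive (≡.sym (ℕₚ.+-suc n n))) 
                (ℕₚ.≤-trans (ℕₚ.≤-reflexive (ℕₚ.suc-injective (≡.trans (≡.sym e) (ℕₚ.+-suc i o)))) (ℕₚ.+-monoˡ-≤ o (ℕₚ.<⇒≤ i<n))))))))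
        ... | yes _ | no n≰k = trans (*-congˡ (trans (*-congˡ vanish) (zeroʳ _))) (trans (zeroʳ _) (sym vanish))
          where
          k<n : k ℕ.< n
          k<n = ℕₚ.≰⇒> n≰k
          vanish : bilateral x y xy≈q N i ≈ 0#
          vanish with ℕₚ.≤-total N i
          ... | inj₂ i≤N = contradiction (ℕₚ.≤-trans (ℕₚ.≤-reflexive (≡.sym i+k≡2N)) (ℕₚ.+-mono-≤ i≤N (ℕₚ.<⇒≤ k<n)))
                  (ℕₚ.<⇒≱ (ℕₚ.+-monoʳ-< N (s≤s (ℕₚ.m≤m+n n (suc n)))))
          ... | inj₁ N≤i with ℕₚ.m≤n⇒∃[o]m+o≡n N≤i
          ... | o , N+o≡i = trans (reflexive (≡.cong (bilateral x y xy≈q N) (≡.sym N+o≡i))) (trans (bilateral-x N o) (term-vanish x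
              (ℕₚ.+-cancelʳ-< n (suc n) o (ℕₚ.≤-<-trans (ℕₚ.≤-reflexive (≡.cong suc (ℕₚ.+-comm n n))) 
                (ℕₚ.<-≤-trans (s≤s (ℕₚ.≤-reflexive (≡.sym (ℕₚ.+-suc n n))))
                (ℕₚ.≤-trans (ℕₚ.≤-reflexive (≡.sym o+k≡N)) (ℕₚ.+-monoʳ-≤ o (ℕₚ.<⇒≤ k<n))))))))
            where
            o+k≡N : o ℕ.+ k ≡ N
            o+k≡N = ℕₚ.+-cancelˡ-≡ N _ _ (≡.trans (≡.sym (ℕₚ.+-assoc N o k)) (≡.trans (≡.cong (ℕ._+ k) N+o≡i) i+k≡2N))

        triple-product-limit : poch N * (factors x N * factors y N) ≈ sumR (term x) N + sumR (λ j → term y (suc j)) (n ℕ.+ suc n)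
        triple-product-limit = begin
          poch N * (factors x N * factors y N)
            ≈⟨ *-congˡ (triple-product x y xy≈q N N) ⟩
          poch N * sumR (λ i → binom (N ℕ.+ N) i * bilateral x y xy≈q N i) (N ℕ.+ N)
            ≈⟨ sumR-*ˡ (poch N) _ (N ℕ.+ N) ⟨
          sumR (λ i → poch N * (binom (N ℕ.+ N) i * bilateral x y xy≈q N i)) (N ℕ.+ N)
            ≈⟨ sumR-cong (N ℕ.+ N) coefficient-limit ⟩
          sumR (bilateral x y xy≈q N) (N ℕ.+ N)
            ≈⟨ sum-bilateral x y xy≈q N (n ℕ.+ suc n) ⟩
          sumR (term x) N + sumR (λ j → term y (suc j)) (n ℕ.+ suc n) ∎

-- Dual numbers and truncated power series.

module DualNumbersAndTruncation where
  open Defs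
  open PowerSeries
  open DivisorSums
  open RingIdentities

  module Dual {c ℓ} (R : CommutativeRing c ℓ)
    (ι : ℤ-rawRing -Raw-AlmostCommutative⟶ fromCommutativeRing R) where
    open CommutativeRing R
    open RingSolver R ι using (solve; _:=_; _:+_; _:*_)
    open _-Raw-AlmostCommutative⟶_ ι
      renaming (⟦_⟧ to inject; +-homo to inject-+; *-homo to inject-*; -‿homo to inject-neg; 0-homo to inject-0; 1-homo to inject-1)
    open import Algebra.Properties.Ring ring using (-0#≈0#)

    D : Set c
    D = Carrier × Carrier

    _≈ᴰ_ : D → D → Set ℓ
    (a , a′) ≈ᴰ (b , b′) = (a ≈ b) × (a′ ≈ b′)

    _+ᴰ_ _*ᴰ_ : D → D → D
    (a , a′) +ᴰ (b , b′) = a + b , a′ + b′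
    (a , a′) *ᴰ (b , b′) = a * b , a * b′ + a′ * b

    -ᴰ_ : D → D
    -ᴰ (a , a′) = - a , - a′

    Dual-commutativeRing : CommutativeRing c ℓ
    Dual-commutativeRing = record
      { Carrier = D ; _≈_ = _≈ᴰ_ ; _+_ = _+ᴰ_ ; _*_ = _*ᴰ_ ; -_ = -ᴰ_ ; 0# = 0# , 0# ; 1# = 1# , 0#
      ; isCommutativeRing = record
        { isRing = record
          { +-isAbelianGroup = record
            { isGroup = record
              { isMonoid = record
                { isSemigroup = record
                  { isMagma = record
                    { isEquivalence = record
                      { refl = refl , refl
                      ; sym = λ (e , e′) → sym e , sym e′
                      ; trans = λ (e , e′) (f , f′) → trans e f , trans e′ f′ }
                    ; ∙-cong = λ (e , e′) (f , f′) → +-cong e f , +-cong e′ f′ }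
                  ; assoc = λ (a , a′) (b , b′) (c , c′) → +-assoc a b c , +-assoc a′ b′ c′ }
                ; identity = (λ (a , a′) → +-identityˡ a , +-identityˡ a′) , λ (a , a′) → +-identityʳ a , +-identityʳ a′ }
              ; inverse = (λ (a , a′) → -‿inverseˡ a , -‿inverseˡ a′) , λ (a , a′) → -‿inverseʳ a , -‿inverseʳ a′
              ; ⁻¹-cong = λ (e , e′) → -‿cong e , -‿cong e′ }
            ; comm = λ (a , a′) (b , b′) → +-comm a b , +-comm a′ b′ }
          ; *-cong = λ (e , e′) (f , f′) → *-cong e f , +-cong (*-cong e f′) (*-cong e′ f)
          ; *-assoc = λ (a , a′) (b , b′) (c , c′) → *-assoc a b c ,
              solve 6 (λ a a′ b b′ c c′ → a :* b :* c′ :+ (a :* b′ :+ a′ :* b) :* c := a :* (b :* c′ :+ b′ :* c) :+ a′ :* (b :* c)) refl a a′ b b′ c c′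
          ; *-identity = (λ (a , a′) → *-identityˡ a , trans (+-cong (*-identityˡ a′) (zeroˡ a)) (+-identityʳ a′)) ,
              λ (a , a′) → *-identityʳ a , trans (+-cong (zeroʳ a) (*-identityʳ a′)) (+-identityˡ a′)
          ; distrib = (λ (a , a′) (b , b′) (c , c′) → distribˡ a b c ,
                solve 6 (λ a a′ b b′ c c′ → a :* (b′ :+ c′) :+ a′ :* (b :+ c) := (a :* b′ :+ a′ :* b) :+ (a :* c′ :+ a′ :* c)) refl a a′ b b′ c c′) ,
              λ (a , a′) (b , b′) (c , c′) → distribʳ a b c ,
                solve 6 (λ a a′ b b′ c c′ → (b :+ c) :* a′ :+ (b′ :+ c′) :* a := (b :* a′ :+ b′ :* a) :+ (c :* a′ :+ c′ :* a)) refl a a′ b b′ c c′ }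
        ; *-comm = λ (a , a′) (b , b′) → *-comm a b , trans (+-comm _ _) (+-cong (*-comm a′ b) (*-comm a b′)) } }

    Dual-ι : ℤ-rawRing -Raw-AlmostCommutative⟶ fromCommutativeRing Dual-commutativeRing
    Dual-ι = record
      { ⟦_⟧ = λ i → inject i , 0#
      ; +-homo = λ i j → inject-+ i j , sym (+-identityʳ 0#)
      ; *-homo = λ i j → inject-* i j , sym (trans (+-cong (zeroʳ _) (zeroˡ _)) (+-identityʳ 0#))
      ; -‿homo = λ i → inject-neg i , sym -0#≈0#
      ; 0-homo = inject-0 , refl
      ; 1-homo = inject-1 , refl }

  infix 4 _≈[_]_
  -- Congruence modulo q^(n+1), taken as the equality of a ring on the same carrier. There q is
  -- nilpotent, and an infinite product agrees with a finite one.
  _≈[_]_ : PS → ℕ → PS → Set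
  f ≈[ n ] g = ∀ k → k ℕ.≤ n → f k ≡ g k

  ⊗-cong-mod : ∀ {n f f′ g g′} → f ≈[ n ] f′ → g ≈[ n ] g′ → f ⊗ g ≈[ n ] f′ ⊗ g′
  ⊗-cong-mod e e′ k k≤n = sumTo-cong k (λ i i≤k → ≡.cong₂ ℤ._*_ (e i (ℕₚ.≤-trans i≤k k≤n)) (e′ (k ℕ.∸ i) (ℕₚ.≤-trans (ℕₚ.m∸n≤m k i) k≤n)))

  truncate : ∀ {n f g} → f ≈ₚ g → f ≈[ n ] g
  truncate e k _ = e k

  PSmod-commutativeRing : ℕ → CommutativeRing 0ℓ 0ℓ
  PSmod-commutativeRing n = record
    { Carrier = PS ; _≈_ = λ f g → f ≈[ n ] g ; _+_ = _⊕_ ; _*_ = _⊗_ ; -_ = neg ; 0# = 0ₚ ; 1# = 1ₚ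
    ; isCommutativeRing = record
      { isRing = record
        { +-isAbelianGroup = record
          { isGroup = record
            { isMonoid = record
              { isSemigroup = record
                { isMagma = record
                  { isEquivalence = record
                    { refl = λ _ _ → ≡.refl
                    ; sym = λ e k l → ≡.sym (e k l)
                    ; trans = λ e e′ k l → ≡.trans (e k l) (e′ k l) }
                  ; ∙-cong = λ e e′ k l → ≡.cong₂ ℤ._+_ (e k l) (e′ k l) }
                ; assoc = λ f g h → truncate (+-assoc f g h) }
              ; identity = (λ f → truncate (+-identityˡ f)) , λ f → truncate (+-identityʳ f) }
            ; inverse = (λ f → truncate (-‿inverseˡ f)) , λ f → truncate (-‿inverseʳ f)
            ; ⁻¹-cong = λ e k l → ≡.cong ℤ.-_ (e k l) }
          ; comm = λ f g → truncate (+-comm f g) }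
        ; *-cong = ⊗-cong-mod
        ; *-assoc = λ f g h → truncate (*-assoc f g h)
        ; *-identity = (λ f → truncate (*-identityˡ f)) , λ f → truncate (*-identityʳ f)
        ; distrib = (λ f g h → truncate (distribˡ f g h)) , λ f g h → truncate (distribʳ f g h) }
      ; *-comm = λ f g → truncate (*-comm f g) } }
    where open CommutativeRing PS-commutativeRing

  const-+ : ∀ i j → const (i ℤ.+ j) ≈ₚ const i ⊕ const j
  const-+ i j zero    = ≡.refl
  const-+ i j (suc n) = ≡.refl

  const-* : ∀ i j → const (i ℤ.* j) ≈ₚ const i ⊗ const j
  const-* i j zero    = ≡.refl
  const-* i j (suc n) = ≡.sym (≡.trans (const-⊗ i (const j) (suc n)) (ℤₚ.*-zeroʳ i))

  const-neg : ∀ i → const (ℤ.- i) ≈ₚ neg (const i)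
  const-neg i zero    = ≡.refl
  const-neg i (suc n) = ≡.refl

  const-0 : const (+ 0) ≈ₚ 0ₚ
  const-0 zero    = ≡.refl
  const-0 (suc n) = ≡.refl

  PS-ι : ℤ-rawRing -Raw-AlmostCommutative⟶ fromCommutativeRing PS-commutativeRing
  PS-ι = record { ⟦_⟧ = const ; +-homo = const-+ ; *-homo = const-* ; -‿homo = const-neg ; 0-homo = const-0 ; 1-homo = λ _ → ≡.refl }

  PSmod-ι : ∀ n → ℤ-rawRing -Raw-AlmostCommutative⟶ fromCommutativeRing (PSmod-commutativeRing n)
  PSmod-ι n = record
    { ⟦_⟧ = const
    ; +-homo = λ i j → truncate (const-+ i j)
    ; *-homo = λ i j → truncate (const-* i j)
    ; -‿homo = λ i → truncate (const-neg i)
    ; 0-homo = truncate const-0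
    ; 1-homo = λ _ _ → ≡.refl }

-- The triple product together with its derivative.

module JacobiTripleProduct where
  open RingIdentities
  open DualNumbersAndTruncation using (module Dual)

  sgn : ℕ → ℤ
  sgn zero    = + 1
  sgn (suc i) = ℤ.- sgn i

  -- d i (i - 1) / 2 + e i
  exponent : ℕ → ℕ → ℕ → ℕ
  exponent d e zero    = 0
  exponent d e (suc i) = d ℕ.* i ℕ.+ e ℕ.+ exponent d e i

  module DualTripleProduct {c ℓ} (R : CommutativeRing c ℓ)
    (ι : ℤ-rawRing -Raw-AlmostCommutative⟶ fromCommutativeRing R)
    (M : ℕ → CommutativeRing.Carrier R)
    (M-0 : CommutativeRing._≈_ R (M 0) (CommutativeRing.1# R))
    (M-+ : ∀ i j → CommutativeRing._≈_ R (M (i ℕ.+ j)) (CommutativeRing._*_ R (M i) (M j)))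
    (n : ℕ) (M-nil : ∀ k → n ℕ.< k → CommutativeRing._≈_ R (M k) (CommutativeRing.0# R))
    (d e e′ : ℕ) (e+e′≡d : e ℕ.+ e′ ≡ d) (1≤d : 1 ℕ.≤ d) where
    open CommutativeRing R hiding (zero)
    open RingSolver R ι using (solve; con; _:=_; _:+_; _:*_; :-_; _:-_)
    open _-Raw-AlmostCommutative⟶_ ι
      renaming (⟦_⟧ to inject; +-homo to inject-+; *-homo to inject-*; -‿homo to inject-neg; 0-homo to inject-0; 1-homo to inject-1)
    open import Relation.Binary.Reasoning.Setoid setoid
    open Dual R ι using (Dual-commutativeRing; Dual-ι; D)
    private module 𝔻 = CommutativeRing Dual-commutativeRing

    q : D
    q = M d , 0#

    -- The dual number q^f (1 + s ε). For s = 1 and s = -1 the product of two points is free of ε,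
    -- so the constraint x y = q survives. The ε-part of the identity is then its derivative in z
    -- for x = z q^e, y = q^(e′)/z, at z = 1.
    point : ℤ → ℕ → D
    point s f = M f , inject s * M f

    open FiniteTripleProduct Dual-commutativeRing Dual-ι q hiding (sumR-cong)
    open import Algebra.Properties.Semiring.Exp 𝔻.semiring using () renaming (_^_ to _^ᴰ_)

    sumC : (ℕ → Carrier) → ℕ → Carrier
    sumC h zero    = h 0
    sumC h (suc m) = sumC h m + h (suc m)

    sumC-cong : ∀ {g h} m → (∀ i → g i ≈ h i) → sumC g m ≈ sumC h m
    sumC-cong zero    e = e 0
    sumC-cong (suc m) e = +-cong (sumC-cong m e) (e (suc m))

    sumR-components : ∀ (h : ℕ → D) m → sumR h m 𝔻.≈ (sumC (λ i → proj₁ (h i)) m , sumC (λ i → proj₂ (h i)) m)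
    sumR-components h zero    = 𝔻.refl
    sumR-components h (suc m) = 𝔻.+-congʳ (sumR-components h m)

    q-power : ∀ k → (q ^ᴰ k) 𝔻.≈ (M (d ℕ.* k) , 0#)
    q-power zero    = trans (sym M-0) (reflexive (≡.cong M (≡.sym (ℕₚ.*-zeroʳ d)))) , refl
    q-power (suc k) = trans (*-congˡ (proj₁ (q-power k))) (trans (sym (M-+ d (d ℕ.* k))) (reflexive (≡.cong M (≡.sym (ℕₚ.*-suc d k))))) ,
      trans (+-cong (trans (*-congˡ (proj₂ (q-power k))) (zeroʳ _)) (zeroˡ _)) (+-identityʳ 0#)

    q-nil : ∀ k → n ℕ.< k → (q ^ᴰ k) 𝔻.≈ 𝔻.0#
    q-nil k n<k = 𝔻.trans (q-power k) (M-nil _ (ℕₚ.<-≤-trans n<k (ℕₚ.m≤n*m k d {{ℕ.>-nonZero 1≤d}})) , refl)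

    open Nilpotent n q-nil

    xy≈q : (point (+ 1) e 𝔻.* point (-[1+ 0 ]) e′) 𝔻.≈ q
    xy≈q = trans (sym (M-+ e e′)) (reflexive (≡.cong M e+e′≡d)) ,
      trans (solve 4 (λ a b m m′ → m :* (b :* m′) :+ a :* m :* m′ := (a :+ b) :* (m :* m′)) refl (inject (+ 1)) (inject -[1+ 0 ]) (M e) (M e′))
      (trans (*-congʳ (trans (sym (inject-+ (+ 1) -[1+ 0 ])) inject-0)) (zeroˡ _))

    progression : ℕ → ℕ → Carrier
    progression f zero    = 1#
    progression f (suc m) = progression f m * (1# - M (f ℕ.+ d ℕ.* m))

    factor : ∀ s f k → (point s f 𝔻.* q ^ᴰ k) 𝔻.≈ (M (f ℕ.+ d ℕ.* k) , inject s * M (f ℕ.+ d ℕ.* k))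
    factor s f k = 𝔻.trans (𝔻.*-congˡ (q-power k)) (sym (M-+ f (d ℕ.* k)) ,
      trans (+-cong (zeroʳ _) (*-assoc _ _ _)) (trans (+-identityˡ _) (*-congˡ (sym (M-+ f (d ℕ.* k))))))

    factors₁ : ∀ s f m → proj₁ (factors (point s f) m) ≈ progression f m
    factors₁ s f zero    = refl
    factors₁ s f (suc m) = *-cong (factors₁ s f m) (+-congˡ (-‿cong (proj₁ (factor s f m))))

    module _ (G : ℕ → Carrier) (f : ℕ) (geometric-series : ∀ k → (1# - M (f ℕ.+ d ℕ.* k)) * G (f ℕ.+ d ℕ.* k) ≈ M (f ℕ.+ d ℕ.* k)) where

      log-derivative : ℕ → Carrier
      log-derivative zero    = 0#
      log-derivative (suc m) = log-derivative m + G (f ℕ.+ d ℕ.* m)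

      -- The logarithmic derivative of the product, where division by 1 - M is replaced by a given
      -- solution `G` of (1 - M) G = M.
      factors₂ : ∀ s m → proj₂ (factors (point s f) m) ≈ - (inject s * (progression f m * log-derivative m))
      factors₂ s zero = sym (trans (-‿cong (trans (*-congˡ (zeroʳ 1#)) (zeroʳ _))) -0#≈0#)
        where open import Algebra.Properties.Ring ring using (-0#≈0#)
      factors₂ s (suc m) = begin
        proj₁ (factors (point s f) m) * (0# - proj₂ (point s f 𝔻.* q ^ᴰ m)) + proj₂ (factors (point s f) m) * (1# - proj₁ (point s f 𝔻.* q ^ᴰ m))
          ≈⟨ +-cong (*-cong (factors₁ s f m) (trans (+-identityˡ _) (-‿cong (proj₂ (factor s f m)))))
              (*-cong (factors₂ s m) (+-congˡ (-‿cong (proj₁ (factor s f m))))) ⟩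
        P * (- (s′ * m′)) + (- (s′ * (P * L))) * (1# - m′)
          ≈⟨ +-congʳ (*-congˡ (-‿cong (*-congˡ (geometric-series m)))) ⟨
        P * (- (s′ * ((1# - m′) * g))) + (- (s′ * (P * L))) * (1# - m′)
          ≈⟨ solve 5 (λ p s u g l → p :* (:- (s :* (u :* g))) :+ (:- (s :* (p :* l))) :* u := :- (s :* (p :* u :* (l :+ g)))) refl P s′ (1# - m′) g L ⟩
        - (s′ * (P * (1# - m′) * (L + g))) ∎
        where
        P = progression f m
        L = log-derivative m
        s′ = inject s
        m′ = M (f ℕ.+ d ℕ.* m)
        g = G (f ℕ.+ d ℕ.* m)

    poch-components : ∀ m → poch m 𝔻.≈ (progression d m , 0#)
    poch-components zero    = 𝔻.refl
    poch-components (suc m) = 𝔻.trans (𝔻.*-cong (poch-components m) (𝔻.+-congˡ (𝔻.-‿cong (𝔻.trans (q-power (suc m)) (reflexive (≡.cong M (ℕₚ.*-suc d m)) , refl)))))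
      (refl , trans (+-cong (trans (*-congˡ (-‿inverseʳ 0#)) (zeroʳ _)) (zeroˡ _)) (+-identityʳ 0#))

    term-components : ∀ s f i → term (point s f) i 𝔻.≈ (inject (sgn i) * M (exponent d f i) , inject (sgn i ℤ.* (s ℤ.* + i)) * M (exponent d f i))
    term-components s f zero =
      sym (trans (*-cong inject-1 M-0) (*-identityˡ 1#)) ,
      sym (trans (*-congʳ (trans (reflexive (≡.cong inject (≡.trans (≡.cong (λ z → + 1 ℤ.* z) (ℤₚ.*-zeroʳ s)) ≡.refl))) inject-0)) (zeroˡ _))
    term-components s f (suc i) = 𝔻.trans (𝔻.-‿cong (𝔻.*-cong step (term-components s f i)))
      ( (begin
          - (M (d ℕ.* i ℕ.+ f) * (inject (sgn i) * M x))
            ≈⟨ solve 3 (λ m s x → :- (m :* (s :* x)) := :- s :* (m :* x)) refl _ _ _ ⟩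
          - inject (sgn i) * (M (d ℕ.* i ℕ.+ f) * M x)
            ≈⟨ *-cong (sym (inject-neg (sgn i))) (sym (M-+ _ x)) ⟩
          inject (sgn (suc i)) * M (exponent d f (suc i)) ∎)
      , (begin
          - (M (d ℕ.* i ℕ.+ f) * (inject (sgn i ℤ.* (s ℤ.* + i)) * M x) + inject s * M (d ℕ.* i ℕ.+ f) * (inject (sgn i) * M x))
            ≈⟨ -‿cong (+-congʳ (*-congˡ (*-congʳ (trans (inject-* (sgn i) (s ℤ.* + i)) (*-congˡ (inject-* s (+ i))))))) ⟩
          - (M (d ℕ.* i ℕ.+ f) * (inject (sgn i) * (inject s * inject (+ i)) * M x) + inject s * M (d ℕ.* i ℕ.+ f) * (inject (sgn i) * M x))
            ≈⟨ -‿cong (+-congˡ (trans (*-congˡ (trans (sym (*-identityˡ _)) (*-congʳ (sym inject-1)))) refl)) ⟩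
          - (M (d ℕ.* i ℕ.+ f) * (inject (sgn i) * (inject s * inject (+ i)) * M x) + inject s * M (d ℕ.* i ℕ.+ f) * (inject (+ 1) * (inject (sgn i) * M x)))
            ≈⟨ solve 6 (λ m g s i x o → :- (m :* (g :* (s :* i) :* x) :+ s :* m :* (o :* (g :* x))) := :- g :* (s :* (o :+ i)) :* (m :* x)) refl _ _ _ _ _ _ ⟩
          - inject (sgn i) * (inject s * (inject (+ 1) + inject (+ i))) * (M (d ℕ.* i ℕ.+ f) * M x)
            ≈⟨ *-cong (trans (*-cong (inject-neg (sgn i)) (trans (inject-* s (+ suc i)) (*-congˡ (inject-+ (+ 1) (+ i))))) refl) (M-+ _ x) ⟨
          inject (sgn (suc i)) * inject (s ℤ.* + suc i) * M (exponent d f (suc i))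
            ≈⟨ *-congʳ (inject-* (sgn (suc i)) (s ℤ.* + suc i)) ⟨
          inject (sgn (suc i) ℤ.* (s ℤ.* + suc i)) * M (exponent d f (suc i)) ∎) )
      where
      x : ℕ
      x = exponent d f i
      step : ((q ^ᴰ i) 𝔻.* point s f) 𝔻.≈ (M (d ℕ.* i ℕ.+ f) , inject s * M (d ℕ.* i ℕ.+ f))
      step = 𝔻.trans (𝔻.*-comm _ _) (𝔻.trans (factor s f i) (reflexive (≡.cong M (ℕₚ.+-comm f _)) , *-congˡ (reflexive (≡.cong M (ℕₚ.+-comm f _)))))

    A B : D
    A = factors (point (+ 1) e) N
    B = factors (point -[1+ 0 ] e′) N

    limit : (poch N 𝔻.* (A 𝔻.* B)) 𝔻.≈
      ( sumC (λ i → inject (sgn i) * M (exponent d e i)) N + sumC (λ j → inject (sgn (suc j)) * M (exponent d e′ (suc j))) (n ℕ.+ suc n)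
      , sumC (λ i → inject (sgn i ℤ.* (+ 1 ℤ.* + i)) * M (exponent d e i)) N
        + sumC (λ j → inject (sgn (suc j) ℤ.* (-[1+ 0 ] ℤ.* + suc j)) * M (exponent d e′ (suc j))) (n ℕ.+ suc n) )
    limit = 𝔻.trans (triple-product-limit (point (+ 1) e) (point -[1+ 0 ] e′) xy≈q)
      (𝔻.trans (𝔻.+-cong (sumR-components _ N) (sumR-components _ (n ℕ.+ suc n)))
      ( +-cong (sumC-cong N (λ i → proj₁ (term-components (+ 1) e i))) (sumC-cong (n ℕ.+ suc n) (λ j → proj₁ (term-components -[1+ 0 ] e′ (suc j))))
      , +-cong (sumC-cong N (λ i → proj₂ (term-components (+ 1) e i))) (sumC-cong (n ℕ.+ suc n) (λ j → proj₂ (term-components -[1+ 0 ] e′ (suc j)))) ))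

    -- poch N has no derivative.
    limit₁ : progression d N * (progression e N * progression e′ N) ≈
      sumC (λ i → inject (sgn i) * M (exponent d e i)) N + sumC (λ j → inject (sgn (suc j)) * M (exponent d e′ (suc j))) (n ℕ.+ suc n)
    limit₁ = trans (sym (*-cong (proj₁ (poch-components N)) (*-cong (factors₁ (+ 1) e N) (factors₁ -[1+ 0 ] e′ N)))) (proj₁ limit)

    limit₂ : progression d N * (progression e N * proj₂ B + proj₂ A * progression e′ N) ≈
      sumC (λ i → inject (sgn i ℤ.* (+ 1 ℤ.* + i)) * M (exponent d e i)) N
        + sumC (λ j → inject (sgn (suc j) ℤ.* (-[1+ 0 ] ℤ.* + suc j)) * M (exponent d e′ (suc j))) (n ℕ.+ suc n)
    limit₂ = trans (sym (trans (+-cong (*-cong (proj₁ (poch-components N)) (+-cong (*-congʳ (factors₁ (+ 1) e N)) (*-congˡ (factors₁ -[1+ 0 ] e′ N))))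
        (trans (*-congʳ (proj₂ (poch-components N))) (zeroˡ _))) (+-identityʳ _))) (proj₂ limit)

    -- The two logarithmic derivatives enter with opposite signs, because x carries ε and y carries
    -- -ε.
    limit-log : ∀ (G : ℕ → Carrier)
      (h : ∀ k → (1# - M (e ℕ.+ d ℕ.* k)) * G (e ℕ.+ d ℕ.* k) ≈ M (e ℕ.+ d ℕ.* k))
      (h′ : ∀ k → (1# - M (e′ ℕ.+ d ℕ.* k)) * G (e′ ℕ.+ d ℕ.* k) ≈ M (e′ ℕ.+ d ℕ.* k)) →
      - (progression d N * (progression e N * progression e′ N) * (log-derivative G e h N - log-derivative G e′ h′ N)) ≈
      sumC (λ i → inject (sgn i ℤ.* (+ 1 ℤ.* + i)) * M (exponent d e i)) N
        + sumC (λ j → inject (sgn (suc j) ℤ.* (-[1+ 0 ] ℤ.* + suc j)) * M (exponent d e′ (suc j))) (n ℕ.+ suc n)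
    limit-log G h h′ = trans (sym (trans
      (*-congˡ (+-cong (*-congˡ (factors₂ G e′ h′ -[1+ 0 ] N)) (*-congʳ (factors₂ G e h (+ 1) N))))
      (solve 5 (λ a b c l l′ → c :* (a :* (:- (con -[1+ 0 ] :* (b :* l′))) :+ (:- (con (+ 1) :* (a :* l))) :* b) := :- (c :* (a :* b) :* (l :- l′)))
        refl (progression e N) (progression e′ N) (progression d N) (log-derivative G e h N) (log-derivative G e′ h′ N)))) limit₂

    -- When e = 0 the first factor 1 - x is a pure infinitesimal.
    factors₂-at-1 : e ≡ 0 → proj₂ A ≈ - progression d (n ℕ.+ suc n)
    factors₂-at-1 ≡.refl = trans (proj₂ (factors-front (point (+ 1) 0) (n ℕ.+ suc n))) (trans (+-cong
        (trans (*-congʳ (trans (+-congˡ (-‿cong M-0)) (-‿inverseʳ 1#))) (zeroˡ _))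
        (*-cong (trans (+-congˡ (-‿cong (trans (*-cong inject-1 M-0) (*-identityˡ 1#)))) (+-identityˡ _))
          (trans (proj₁ (factors-cong (n ℕ.+ suc n) (trans (*-congʳ M-0) (*-identityˡ _) , shifted)))
          (factors₁ (+ 1) d (n ℕ.+ suc n)))))
      (trans (+-identityˡ _) (solve-neg _)))
      where
      shifted : proj₂ (point (+ 1) 0 𝔻.* q) ≈ inject (+ 1) * M d
      shifted = trans (+-cong (zeroʳ _) (trans (*-congʳ (trans (*-congˡ M-0) (*-identityʳ _))) refl)) (+-identityˡ _)
      solve-neg : ∀ p → - 1# * p ≈ - p
      solve-neg p = trans (solve 2 (λ o p → :- o :* p := :- (o :* p)) refl 1# p) (-‿cong (*-identityˡ p))

-- Euler's product: its pentagonal series, the derivative of that series, and its cube.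

module EulerFunction where
  open Defs
  open PowerSeries
  open FiniteSums
  open DivisorSums
  open Residues
  open LambertSeries using (s₀)
  open RingIdentities
  open DualNumbersAndTruncation
  open JacobiTripleProduct
  open import Data.Integer using (-_; _+_; _*_; _-_)
  open ≡

  mono-shift : ∀ c f n → (mono c ⊗ f) (c ℕ.+ n) ≡ f n
  mono-shift zero    f n = trans (⊗-cong {g = f} {g′ = f} mono-0 (λ _ → refl) n) (⊗-identityˡ f n)
    where
    mono-0 : mono 0 ≈ₚ 1ₚ
    mono-0 zero    = refl
    mono-0 (suc n) = refl
  mono-shift (suc c) f n = trans (⊗-head (mono (suc c)) f (c ℕ.+ n))
    (trans (cong (_+ (mono c ⊗ f) (c ℕ.+ n)) (ℤₚ.*-zeroˡ (f (suc c ℕ.+ n)))) (trans (ℤₚ.+-identityˡ _) (mono-shift c f n)))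

  mono-⊗-< : ∀ {c k} f → k ℕ.< c → (mono c ⊗ f) k ≡ + 0
  mono-⊗-< {c} {k} f k<c = sumTo-zero _ k (λ i i≤k → trans (cong (_* f (k ℕ.∸ i)) (at-> (+ 1) (ℕₚ.≤-<-trans i≤k k<c))) (ℤₚ.*-zeroˡ (f (k ℕ.∸ i))))

  mono-vanish : ∀ {n c} → n ℕ.< c → mono c ≈[ n ] 0ₚ
  mono-vanish n<c k k≤n = at-> (+ 1) (ℕₚ.≤-<-trans k≤n n<c)

  mono-0≈1 : mono 0 ≈ₚ 1ₚ
  mono-0≈1 zero    = refl
  mono-0≈1 (suc n) = refl

  at-+-cancel : ∀ c m n h → at (c ℕ.+ m) (c ℕ.+ n) h ≡ at m n h
  at-+-cancel zero    m n h = refl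
  at-+-cancel (suc c) m n h = at-+-cancel c m n h

  -- The geometric series q^c/(1 - q^c).
  geo : ℕ → PS
  geo c n = ∑ n (λ a → at (a ℕ.* c) n (+ 1))

  ∑-head : ∀ N h → ∑ (suc N) h ≡ h 1 + ∑ N (λ k → h (suc k))
  ∑-head zero    h = trans (ℤₚ.+-identityˡ (h 1)) (sym (ℤₚ.+-identityʳ (h 1)))
  ∑-head (suc N) h = trans (cong (_+ h (suc (suc N))) (∑-head N h)) (ℤₚ.+-assoc (h 1) _ _)

  geo-unfold : ∀ c → geo (suc c) ≈ₚ mono (suc c) ⊗ (1ₚ ⊕ geo (suc c))
  geo-unfold c k with ℕₚ.≤-<-connex (suc c) k
  ... | inj₂ k<c = trans (∑-zero k _ (λ a 1≤a _ → at-> (+ 1) (ℕₚ.<-≤-trans k<c (m≤n*m (suc c) 1≤a))))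
                    (sym (mono-⊗-< (1ₚ ⊕ geo (suc c)) k<c))
  ... | inj₁ c≤k with ℕₚ.m≤n⇒∃[o]m+o≡n c≤k
  ... | n , refl = trans (∑-head (c ℕ.+ n) _) (trans (cong₂ _+_ first rest) (sym (mono-shift (suc c) (1ₚ ⊕ geo (suc c)) n)))
    where
    first : at (1 ℕ.* suc c) (suc c ℕ.+ n) (+ 1) ≡ 1ₚ n
    first = trans (at-+-cancel (suc c) 0 n (+ 1)) (mono-0≈1 n)
    rest : ∑ (c ℕ.+ n) (λ a → at (suc a ℕ.* suc c) (suc c ℕ.+ n) (+ 1)) ≡ geo (suc c) n
    rest = trans (∑-ext (c ℕ.+ n) (λ a → at-+-cancel (suc c) (a ℕ.* suc c) n (+ 1)))
      (∑-bound (λ a → at (a ℕ.* suc c) n (+ 1)) (ℕₚ.m≤n+m n c) (λ a n<a → at-> (+ 1) (ℕₚ.<-≤-trans n<a (ℕₚ.m≤m*n a (suc c)))))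

  geo-product : ∀ c → (1ₚ ⊖ mono (suc c)) ⊗ geo (suc c) ≈ₚ mono (suc c)
  geo-product c n = trans (distribute n) (trans (cong (λ z → z - (mono (suc c) ⊗ geo (suc c)) n) (trans (geo-unfold c n) (expand n)))
      (cancel (mono (suc c) n) ((mono (suc c) ⊗ geo (suc c)) n)))
    where
    open CommutativeRing PS-commutativeRing using (distribʳ; distribˡ; *-comm; *-identityʳ)
    open import Algebra.Properties.Ring (CommutativeRing.ring PS-commutativeRing) using (-‿distribˡ-*)
    distribute : (1ₚ ⊖ mono (suc c)) ⊗ geo (suc c) ≈ₚ geo (suc c) ⊖ mono (suc c) ⊗ geo (suc c)
    distribute n = trans (distribʳ (geo (suc c)) 1ₚ (neg (mono (suc c))) n)
      (cong₂ _+_ (⊗-identityˡ (geo (suc c)) n) (sym (-‿distribˡ-* (mono (suc c)) (geo (suc c)) n)))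
    expand : mono (suc c) ⊗ (1ₚ ⊕ geo (suc c)) ≈ₚ mono (suc c) ⊕ mono (suc c) ⊗ geo (suc c)
    expand n = trans (distribˡ (mono (suc c)) 1ₚ (geo (suc c)) n) (cong (_+ (mono (suc c) ⊗ geo (suc c)) n) (*-identityʳ (mono (suc c)) n))
    cancel : ∀ x y → x + y - y ≡ x
    cancel = solve-∀

  oneMinusXpow-mono : ∀ e → oneMinusXpow (suc e) ≈ₚ 1ₚ ⊖ mono (suc e)
  oneMinusXpow-mono e n = cong₂ _-_ (unit n) (indicator (suc e) n)
    where
    unit : ∀ n → (if n ≡ᵇ 0 then + 1 else + 0) ≡ 1ₚ n
    unit zero    = refl
    unit (suc n) = refl
    indicator : ∀ e n → (if n ≡ᵇ e then + 1 else + 0) ≡ mono e n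
    indicator zero    zero    = refl
    indicator zero    (suc n) = refl
    indicator (suc e) zero    = refl
    indicator (suc e) (suc n) = indicator e n

  prodTo-stable : ∀ m n k → prodTo (suc m) (k ℕ.+ n) ≈[ n ] prodTo (suc m) n
  prodTo-stable m n zero    i _   = refl
  prodTo-stable m n (suc k) i i≤n = trans (⊗-cong-mod (prodTo-stable m n k)
      (λ j j≤n → trans (oneMinusXpow-mono _ j) (trans (cong (λ z → 1ₚ j - z) (mono-vanish big j j≤n)) (ℤₚ.+-identityʳ (1ₚ j)))) i i≤n)
    (CommutativeRing.*-identityʳ PS-commutativeRing (prodTo (suc m) n) i)
    where
    big : n ℕ.< suc m ℕ.* suc (k ℕ.+ n)
    big = ℕₚ.<-≤-trans (s≤s (ℕₚ.m≤n+m n k)) (ℕₚ.m≤m+n _ _)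

  euler-prodTo : ∀ m n K → n ℕ.≤ K → euler (suc m) ≈[ n ] prodTo (suc m) K
  euler-prodTo m n K n≤K i i≤n = trans (sym (prodTo-stable m i (K ℕ.∸ i) i ℕₚ.≤-refl))
    (cong (λ z → prodTo (suc m) z i) (ℕₚ.m∸n+n≡m (ℕₚ.≤-trans i≤n n≤K)))

  E : PS
  E = euler 1

  module Instance (n d′ e e′ : ℕ) (e+e′≡d : e ℕ.+ e′ ≡ suc d′) where
    open DualTripleProduct (PSmod-commutativeRing n) (PSmod-ι n) mono (truncate mono-0≈1)
      (λ i j → truncate (λ k → sym (mono-⊗ i j k))) n (λ k n<k → mono-vanish n<k)
      (suc d′) e e′ e+e′≡d (s≤s z≤n) public

    bound : ℕ
    bound = suc (n ℕ.+ suc n)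

    n≤bound : n ℕ.≤ bound
    n≤bound = ℕₚ.≤-trans (ℕₚ.m≤m+n n (suc n)) (ℕₚ.n≤1+n _)

    sumC-coefficient : ∀ (w : ℕ → ℤ) (x : ℕ → ℕ) m k → sumC (λ i → const (w i) ⊗ mono (x i)) m k ≡ sumTo (λ i → w i * mono (x i) k) m
    sumC-coefficient w x zero    k = const-⊗ (w 0) (mono (x 0)) k
    sumC-coefficient w x (suc m) k = cong₂ _+_ (sumC-coefficient w x m k) (const-⊗ (w (suc m)) (mono (x (suc m))) k)

  module _ (n : ℕ) where
    private
      -- `T` has x = q, y = q² over the base q³, so that its three products together run over all
      -- factors of E. `U` has x = 1, y = q over the base q; there the product is zero and the
      -- derivative is a cube.
      module T = Instance n 2 1 2 refl
      module U = Instance n 0 0 1 refl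
      module P = CommutativeRing (PSmod-commutativeRing n)

    product-by-residues : ∀ m → T.progression 3 m ⊗ (T.progression 1 m ⊗ T.progression 2 m) ≈[ n ] prodTo 1 (m ℕ.* 3)
    product-by-residues zero = P.trans (P.*-identityˡ _) (P.*-identityˡ _)
    product-by-residues (suc m) = P.trans
      (regroup (T.progression 3 m) (T.progression 1 m) (T.progression 2 m) (1ₚ ⊖ mono (3 ℕ.+ 3 ℕ.* m)) (1ₚ ⊖ mono (1 ℕ.+ 3 ℕ.* m)) (1ₚ ⊖ mono (2 ℕ.+ 3 ℕ.* m)))
      (P.*-cong (P.*-cong (P.*-cong (product-by-residues m) (factor 0)) (factor 1)) (factor 2))
      where
      open RingSolver (PSmod-commutativeRing n) (PSmod-ι n) using (solve; _:=_; _:*_)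
      regroup : ∀ a b c x y z → (a ⊗ x) ⊗ ((b ⊗ y) ⊗ (c ⊗ z)) ≈[ n ] a ⊗ (b ⊗ c) ⊗ y ⊗ z ⊗ x
      regroup = solve 6 (λ a b c x y z → (a :* x) :* ((b :* y) :* (c :* z)) := a :* (b :* c) :* y :* z :* x) P.refl
      factor : ∀ i → 1ₚ ⊖ mono (suc i ℕ.+ 3 ℕ.* m) ≈[ n ] oneMinusXpow (1 ℕ.* (suc i ℕ.+ m ℕ.* 3))
      factor i k _ = trans (cong (λ z → 1ₚ k - mono (suc i ℕ.+ z) k) (ℕₚ.*-comm 3 m)) (trans (sym (oneMinusXpow-mono (i ℕ.+ m ℕ.* 3) k))
        (cong (λ z → oneMinusXpow z k) (sym (ℕₚ.*-identityˡ (suc i ℕ.+ m ℕ.* 3)))))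

    product-E : T.progression 3 T.bound ⊗ (T.progression 1 T.bound ⊗ T.progression 2 T.bound) ≈[ n ] E
    product-E = P.trans (product-by-residues T.bound) (P.sym (euler-prodTo 0 n (T.bound ℕ.* 3) (ℕₚ.≤-trans T.n≤bound (ℕₚ.m≤m*n T.bound 3))))

    pentagonal-mod : ∀ k → k ℕ.≤ n → E k ≡ sumTo (λ i → sgn i * mono (exponent 3 1 i) k) T.bound
      + sumTo (λ j → sgn (suc j) * mono (exponent 3 2 (suc j)) k) (n ℕ.+ suc n)
    pentagonal-mod k k≤n = trans (sym (product-E k k≤n)) (trans (T.limit₁ k k≤n)
      (cong₂ _+_ (T.sumC-coefficient sgn (exponent 3 1) T.bound k) (T.sumC-coefficient (λ j → sgn (suc j)) (λ j → exponent 3 2 (suc j)) (n ℕ.+ suc n) k)))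

    L₁ L₂ : ℕ → PS
    L₁ = T.log-derivative geo 1 (λ k → truncate (geo-product (3 ℕ.* k)))
    L₂ = T.log-derivative geo 2 (λ k → truncate (geo-product (1 ℕ.+ 3 ℕ.* k)))

    -- Exponents that are 1 or 2 modulo 3 come with the sign given by χ, and multiples of 3 may be
    -- added freely since χ vanishes there.
    residues-Λ : ∀ m i → L₁ m i - L₂ m i ≡ ∑ (m ℕ.* 3) (λ x → χ x * geo x i)
    residues-Λ zero    i = refl
    residues-Λ (suc m) i = trans (cong₂ (λ u v → (L₁ m i + geo (1 ℕ.+ u) i) - (L₂ m i + geo (2 ℕ.+ v) i)) (ℕₚ.*-comm 3 m) (ℕₚ.*-comm 3 m))
      (trans (regroup (L₁ m i) (geo (1 ℕ.+ m ℕ.* 3) i) (L₂ m i) (geo (2 ℕ.+ m ℕ.* 3) i) (geo (3 ℕ.+ m ℕ.* 3) i))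
      (cong₂ _+_ (cong₂ _+_ (cong₂ _+_ (residues-Λ m i)
        (cong (_* geo (1 ℕ.+ m ℕ.* 3) i) (sym (χ-1 m)))) (cong (_* geo (2 ℕ.+ m ℕ.* 3) i) (sym (χ-2 m)))) (cong (_* geo (3 ℕ.+ m ℕ.* 3) i) (sym (χ-0 m)))))
      where
      regroup : ∀ l g l′ g′ g″ → (l + g) - (l′ + g′) ≡ l - l′ + + 1 * g + - (+ 1) * g′ + + 0 * g″
      regroup = solve-∀
      χ-0 : ∀ m → χ (m ℕ.* 3) ≡ + 0
      χ-0 zero    = refl
      χ-0 (suc m) = χ-0 m
      χ-1 : ∀ m → χ (1 ℕ.+ m ℕ.* 3) ≡ + 1
      χ-1 zero    = refl
      χ-1 (suc m) = χ-1 m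
      χ-2 : ∀ m → χ (2 ℕ.+ m ℕ.* 3) ≡ - (+ 1)
      χ-2 zero    = refl
      χ-2 (suc m) = χ-2 m

    residues-s₀ : L₁ T.bound ⊖ L₂ T.bound ≈[ n ] s₀
    residues-s₀ i i≤n = trans (residues-Λ T.bound i) (trans
      (∑-bound (λ x → χ x * geo x i) (ℕₚ.≤-trans i≤n (ℕₚ.≤-trans T.n≤bound (ℕₚ.m≤m*n T.bound 3)))
        (λ x i<x → trans (cong (χ x *_) (∑-zero i _ (λ a 1≤a _ → at-> (+ 1) (ℕₚ.<-≤-trans i<x (m≤n*m x 1≤a))))) (ℤₚ.*-zeroʳ (χ x))))
      (trans (∑-ext i (λ x → trans (sym (∑-*ˡ i (χ x) (λ a → at (a ℕ.* x) i (+ 1))))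
        (∑-ext i (λ a → sym (at-mono (a ℕ.* x) i (χ x)))))) (∑-swap i i (λ x a → at (a ℕ.* x) i (χ x)))))

    -- On the product side the derivative is E times a difference of logarithmic derivatives over
    -- the classes 1 and 2, and this difference is `s₀`.
    pentagonal-derivative-mod : ∀ k → k ℕ.≤ n → - (E ⊗ s₀) k ≡ sumTo (λ i → sgn i * (+ 1 * + i) * mono (exponent 3 1 i) k) T.bound
      + sumTo (λ j → sgn (suc j) * (- (+ 1) * + suc j) * mono (exponent 3 2 (suc j)) k) (n ℕ.+ suc n)
    pentagonal-derivative-mod k k≤n = trans (cong -_ (⊗-cong-mod {f = E} (λ i l → sym (product-E i l)) (λ i l → sym (residues-s₀ i l)) k k≤n))
      (trans (T.limit-log geo (λ i → truncate (geo-product (3 ℕ.* i))) (λ i → truncate (geo-product (1 ℕ.+ 3 ℕ.* i))) k k≤n)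
      (cong₂ _+_ (T.sumC-coefficient (λ i → sgn i * (+ 1 * + i)) (exponent 3 1) T.bound k)
        (T.sumC-coefficient (λ j → sgn (suc j) * (- (+ 1) * + suc j)) (λ j → exponent 3 2 (suc j)) (n ℕ.+ suc n) k)))

    -- As the factor 1 - x has value 0, the product rule leaves only the derivative of the factors
    -- in x, which is -E. The other two progressions contribute E each.
    jacobi-mod : ∀ k → k ℕ.≤ n → - (E ⊗ (E ⊗ E)) k ≡ sumTo (λ i → sgn i * (+ 1 * + i) * mono (exponent 1 0 i) k) U.bound
      + sumTo (λ j → sgn (suc j) * (- (+ 1) * + suc j) * mono (exponent 1 1 (suc j)) k) (n ℕ.+ suc n)
    jacobi-mod k k≤n = trans (sym (derivative k k≤n))
      (trans (U.limit₂ k k≤n) (cong₂ _+_ (U.sumC-coefficient (λ i → sgn i * (+ 1 * + i)) (exponent 1 0) U.bound k)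
        (U.sumC-coefficient (λ j → sgn (suc j) * (- (+ 1) * + suc j)) (λ j → exponent 1 1 (suc j)) (n ℕ.+ suc n) k)))
      where
      factor : ∀ m → U.progression 1 m ≈[ n ] prodTo 1 m
      factor zero    = P.refl
      factor (suc m) = ⊗-cong-mod (factor m) (λ k _ → trans (cong (λ z → 1ₚ k - mono (suc z) k) (ℕₚ.*-identityˡ m))
        (trans (sym (oneMinusXpow-mono m k)) (cong (λ z → oneMinusXpow z k) (sym (ℕₚ.*-identityˡ (suc m))))))
      progression-E : ∀ m → n ℕ.≤ m → U.progression 1 m ≈[ n ] E
      progression-E m n≤m = P.trans (factor m) (P.sym (euler-prodTo 0 n m n≤m))
      progression-0 : ∀ m → U.progression 0 (suc m) ≈[ n ] 0ₚ
      progression-0 zero    = null-factor (PSmod-commutativeRing n) {mono 0} (truncate mono-0≈1)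
      progression-0 (suc m) = null-product (PSmod-commutativeRing n) {U.progression 0 (suc m)} (1ₚ ⊖ mono (0 ℕ.+ 1 ℕ.* suc m)) (progression-0 m)
      derivative : U.progression 1 U.bound ⊗ (U.progression 0 U.bound ⊗ proj₂ U.B ⊕ proj₂ U.A ⊗ U.progression 1 U.bound) ≈[ n ] neg (E ⊗ (E ⊗ E))
      derivative = minus-cube (PSmod-commutativeRing n) {U.progression 0 U.bound} {proj₂ U.A} {proj₂ U.B} {U.progression 1 U.bound} {E} {U.progression 1 (n ℕ.+ suc n)}
        (progression-E U.bound U.n≤bound) (progression-0 (n ℕ.+ suc n)) (U.factors₂-at-1 refl) (progression-E (n ℕ.+ suc n) (ℕₚ.m≤m+n n (suc n)))

-- Weighted expansions and sums over symmetric intervals of integers.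

module SummationRanges where
  open Defs
  open PowerSeries
  open FiniteSums
  open DivisorSums
  open JacobiTripleProduct
  open EulerFunction
  open import Data.Integer using (-_; _+_; _*_; _-_)
  open ≡

  -- Any linear summation over an index set, so that products of expansions are treated once for
  -- ranges, boxes and their products.
  record Summation (A : Set) : Set where
    field
      sum      : (A → ℤ) → ℤ
      sum-cong : ∀ {g h} → (∀ x → g x ≡ h x) → sum g ≡ sum h
      sum-+    : ∀ g h → sum (λ x → g x + h x) ≡ sum g + sum h
      sum-*ˡ   : ∀ c h → sum (λ x → c * h x) ≡ c * sum h

    sum-*ʳ : ∀ c h → sum (λ x → h x * c) ≡ sum h * c
    sum-*ʳ c h = trans (sum-cong (λ x → ℤₚ.*-comm (h x) c)) (trans (sum-*ˡ c h) (ℤₚ.*-comm c (sum h)))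

    sumTo-sum : ∀ (h : ℕ → A → ℤ) n → sumTo (λ k → sum (h k)) n ≡ sum (λ x → sumTo (λ k → h k x) n)
    sumTo-sum h zero    = refl
    sumTo-sum h (suc n) = trans (cong (_+ sum (h (suc n))) (sumTo-sum h n)) (sym (sum-+ _ _))

  open Summation

  _⊗ₛ_ : ∀ {A B} → Summation A → Summation B → Summation (A × B)
  (S ⊗ₛ T) .sum h = sum S (λ x → sum T (λ y → h (x , y)))
  (S ⊗ₛ T) .sum-cong e = sum-cong S (λ x → sum-cong T (λ y → e (x , y)))
  (S ⊗ₛ T) .sum-+ g h = trans (sum-cong S (λ x → sum-+ T _ _)) (sum-+ S _ _)
  (S ⊗ₛ T) .sum-*ˡ c h = trans (sum-cong S (λ x → sum-*ˡ T c (λ y → h (x , y)))) (sum-*ˡ S c (λ x → sum T (λ y → h (x , y))))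

  -- f agrees with Σ w(x) q^(ω(x)) up to degree K; a finite index set can promise no more.
  Expansion : ∀ {A} → Summation A → (A → ℤ) → (A → ℕ) → ℕ → PS → Set
  Expansion S w ω K f = ∀ k → k ℕ.≤ K → f k ≡ sum S (λ x → w x * mono (ω x) k)

  Expansion-⊗ : ∀ {A B} (S : Summation A) (T : Summation B) w ω w′ ω′ {K f g} → Expansion S w ω K f → Expansion T w′ ω′ K g →
    Expansion (S ⊗ₛ T) (λ p → w (proj₁ p) * w′ (proj₂ p)) (λ p → ω (proj₁ p) ℕ.+ ω′ (proj₂ p)) K (f ⊗ g)
  Expansion-⊗ S T w ω w′ ω′ F G k k≤K = trans
    (sumTo-cong k (λ i i≤k → trans (cong₂ _*_ (F i (ℕₚ.≤-trans i≤k k≤K)) (G (k ℕ.∸ i) (ℕₚ.≤-trans (ℕₚ.m∸n≤m k i) k≤K)))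
      (trans (sym (sum-*ʳ S (sum T (λ y → w′ y * mono (ω′ y) (k ℕ.∸ i))) (λ x → w x * mono (ω x) i)))
        (sum-cong S (λ x → sym (sum-*ˡ T (w x * mono (ω x) i) (λ y → w′ y * mono (ω′ y) (k ℕ.∸ i))))))))
    (trans (sumTo-sum S _ k) (sum-cong S (λ x → trans (sumTo-sum T _ k) (sum-cong T (λ y →
      trans (sumTo-cong k (λ i _ → regroup (w x) (mono (ω x) i) (w′ y) (mono (ω′ y) (k ℕ.∸ i))))
      (trans (sumTo-*ˡ (w x * w′ y) (λ i → mono (ω x) i * mono (ω′ y) (k ℕ.∸ i)) k)
        (cong (w x * w′ y *_) (mono-⊗ (ω x) (ω′ y) k))))))))
    where
    regroup : ∀ a b c d → a * b * (c * d) ≡ a * c * (b * d)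
    regroup = solve-∀

  sumℤ : ℕ → (ℤ → ℤ) → ℤ
  sumℤ zero    h = h (+ 0)
  sumℤ (suc B) h = sumℤ B h + (h (+ suc B) + h -[1+ B ])

  sumℤ-cong : ∀ B {g h} → (∀ i → ∣ i ∣ ℕ.≤ B → g i ≡ h i) → sumℤ B g ≡ sumℤ B h
  sumℤ-cong zero    e = e (+ 0) z≤n
  sumℤ-cong (suc B) e = cong₂ _+_ (sumℤ-cong B (λ i l → e i (ℕₚ.m≤n⇒m≤1+n l)))
    (cong₂ _+_ (e (+ suc B) ℕₚ.≤-refl) (e -[1+ B ] ℕₚ.≤-refl))

  sumℤ-+ : ∀ B g h → sumℤ B (λ i → g i + h i) ≡ sumℤ B g + sumℤ B h
  sumℤ-+ zero    g h = refl
  sumℤ-+ (suc B) g h = trans (cong (_+ (g (+ suc B) + h (+ suc B) + (g -[1+ B ] + h -[1+ B ]))) (sumℤ-+ B g h))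
    (interchange (sumℤ B g) (sumℤ B h) (g (+ suc B)) (h (+ suc B)) (g -[1+ B ]) (h -[1+ B ]))
    where
    interchange : ∀ a b c d e f → a + b + ((c + d) + (e + f)) ≡ a + (c + e) + (b + (d + f))
    interchange = solve-∀

  sumℤ-*ˡ : ∀ B c h → sumℤ B (λ i → c * h i) ≡ c * sumℤ B h
  sumℤ-*ˡ zero    c h = refl
  sumℤ-*ˡ (suc B) c h = trans (cong (_+ (c * h (+ suc B) + c * h -[1+ B ])) (sumℤ-*ˡ B c h))
    (factor c (sumℤ B h) (h (+ suc B)) (h -[1+ B ]))
    where
    factor : ∀ c s x y → c * s + (c * x + c * y) ≡ c * (s + (x + y))
    factor = solve-∀

  box : ℕ → Summation ℤ
  box B = record { sum = sumℤ B ; sum-cong = λ e → sumℤ-cong B (λ i _ → e i) ; sum-+ = sumℤ-+ B ; sum-*ˡ = sumℤ-*ˡ B }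

  sumℤ-zero : ∀ B h → (∀ i → ∣ i ∣ ℕ.≤ B → h i ≡ + 0) → sumℤ B h ≡ + 0
  sumℤ-zero B h z = trans (sumℤ-cong B {h} {λ _ → + 0 * + 0} z) (sumℤ-*ˡ B (+ 0) (λ _ → + 0))

  sumℤ-swap : ∀ B B′ (h : ℤ → ℤ → ℤ) → sumℤ B (λ i → sumℤ B′ (h i)) ≡ sumℤ B′ (λ j → sumℤ B (λ i → h i j))
  sumℤ-swap zero    B′ h = refl
  sumℤ-swap (suc B) B′ h = trans (cong (_+ (sumℤ B′ (h (+ suc B)) + sumℤ B′ (h -[1+ B ]))) (sumℤ-swap B B′ h))
    (sym (trans (sumℤ-+ B′ _ _) (cong (λ z → sumℤ B′ (λ j → sumℤ B (λ i → h i j)) + z) (sumℤ-+ B′ _ _))))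

  Supported : ℕ → (ℤ → ℤ) → Set
  Supported S h = ∀ i → S ℕ.< ∣ i ∣ → h i ≡ + 0

  sumℤ-extend : ∀ {S} h B → Supported S h → S ℕ.≤ B → sumℤ B h ≡ sumℤ S h
  sumℤ-extend {S} h B z S≤B = subst (λ b → sumℤ b h ≡ sumℤ S h) (ℕₚ.m∸n+n≡m S≤B) (go (B ℕ.∸ S))
    where
    go : ∀ k → sumℤ (k ℕ.+ S) h ≡ sumℤ S h
    go zero    = refl
    go (suc k) = trans (cong₂ _+_ (go k) (cong₂ _+_ (z (+ suc (k ℕ.+ S)) (s≤s (ℕₚ.m≤n+m S k))) (z -[1+ k ℕ.+ S ] (s≤s (ℕₚ.m≤n+m S k)))))
      (ℤₚ.+-identityʳ _)

  sumℤ-shift-one : ∀ B h → sumℤ B (λ i → h (i + + 1)) + h (- (+ B)) ≡ sumℤ B h + h (+ suc B)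
  sumℤ-shift-one zero    h = ℤₚ.+-comm (h (+ 1)) (h (+ 0))
  sumℤ-shift-one (suc B) h = trans
    (cong₂ (λ u v → sumℤ B (λ i → h (i + + 1)) + (u + v) + h -[1+ B ]) (cong (λ z → h (+ z)) (ℕₚ.+-comm (suc B) 1)) (cong h (step B)))
    (trans (regroup (sumℤ B (λ i → h (i + + 1))) (h (+ suc (suc B))) (h (- (+ B))) (h -[1+ B ]))
    (trans (cong (λ z → z + h -[1+ B ] + h (+ suc (suc B))) (sumℤ-shift-one B h))
    (cong (_+ h (+ suc (suc B))) (ℤₚ.+-assoc (sumℤ B h) _ _))))
    where
    step : ∀ B → -[1+ B ] + + 1 ≡ - (+ B)
    step zero    = refl
    step (suc B) = refl
    regroup : ∀ a b c d → a + (b + c) + d ≡ a + c + d + b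
    regroup = solve-∀

  private
    ∣i+m∣ : ∀ {S} i m → S ℕ.+ m ℕ.< ∣ i ∣ → S ℕ.< ∣ i + + m ∣
    ∣i+m∣ {S} i m p = ℕₚ.+-cancelʳ-< m S _ (ℕₚ.<-≤-trans p (ℕₚ.≤-trans
      (ℕₚ.≤-reflexive (cong ∣_∣ (sym (back i (+ m))))) (ℕₚ.≤-trans (ℤₚ.∣i-j∣≤∣i∣+∣j∣ (i + + m) (+ m)) ℕₚ.≤-refl)))
      where
      back : ∀ i m → i + m - m ≡ i
      back = solve-∀

    shift-up : ∀ {S} m B h → Supported S h → S ℕ.+ m ℕ.≤ B → sumℤ B (λ i → h (i + + m)) ≡ sumℤ B h
    shift-up zero B h z p = sumℤ-cong B (λ i _ → cong h (ℤₚ.+-identityʳ i))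
    shift-up {S} (suc m) B h z p = trans (sumℤ-cong B (λ i _ → cong h (assoc i (+ m)))) (trans
      (trans (sym (ℤₚ.+-identityʳ _)) (trans (cong (λ w → sumℤ B (λ i → h (i + + 1 + + m)) + w) (sym low))
        (trans (sumℤ-shift-one B (λ i → h (i + + m))) (trans (cong (λ w → sumℤ B (λ i → h (i + + m)) + w) high) (ℤₚ.+-identityʳ _)))))
      (shift-up m B h z (ℕₚ.≤-trans (ℕₚ.+-monoʳ-≤ S (ℕₚ.n≤1+n m)) p)))
      where
      assoc : ∀ i m → i + (+ 1 + m) ≡ i + + 1 + m
      assoc = solve-∀
      S+m<B : S ℕ.+ m ℕ.< B
      S+m<B = ℕₚ.<-≤-trans (ℕₚ.≤-reflexive (sym (ℕₚ.+-suc S m))) p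
      low : h (- (+ B) + + m) ≡ + 0
      low = z _ (∣i+m∣ (- (+ B)) m (subst (S ℕ.+ m ℕ.<_) (sym (ℤₚ.∣-i∣≡∣i∣ (+ B))) S+m<B))
      high : h (+ suc B + + m) ≡ + 0
      high = z _ (ℕₚ.<-≤-trans (ℕₚ.≤-<-trans (ℕₚ.m≤m+n S m) S+m<B) (ℕₚ.≤-trans (ℕₚ.n≤1+n B) (ℕₚ.m≤m+n (suc B) m)))

  -- A negative shift is undone by a positive one, applied to the shifted function, whose support is
  -- already larger by ∣ t ∣. Hence ∣ t ∣ occurs twice in the bound.
  sumℤ-shift : ∀ {S} t B h → Supported S h → S ℕ.+ (∣ t ∣ ℕ.+ ∣ t ∣) ℕ.≤ B → sumℤ B (λ i → h (i + t)) ≡ sumℤ B h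
  sumℤ-shift {S} (+ m) B h z p = shift-up m B h z (ℕₚ.≤-trans (ℕₚ.+-monoʳ-≤ S (ℕₚ.m≤m+n m m)) p)
  sumℤ-shift {S} -[1+ m ] B h z p = sym (trans (sumℤ-cong B (λ i _ → cong h (back i (+ suc m))))
    (shift-up {S ℕ.+ suc m} (suc m) B (λ i → h (i + -[1+ m ])) supported (subst (ℕ._≤ B) (sym (ℕₚ.+-assoc S (suc m) (suc m))) p)))
    where
    back : ∀ i m → i ≡ i + m + - m
    back = solve-∀
    supported : Supported (S ℕ.+ suc m) (λ i → h (i + -[1+ m ]))
    supported i q = z _ (ℕₚ.+-cancelʳ-< (suc m) S _ (ℕₚ.<-≤-trans q (ℕₚ.≤-trans
      (ℕₚ.≤-reflexive (cong ∣_∣ (forth i (+ suc m)))) (ℤₚ.∣i+j∣≤∣i∣+∣j∣ (i + -[1+ m ]) (+ suc m)))))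
      where
      forth : ∀ i m → i ≡ i + - m + m
      forth = solve-∀

  sumℤ-triples : ∀ B h → (∀ t → h (+ 3 * t + + 1) ≡ + 0) → (∀ t → h (+ 3 * t + + 2) ≡ + 0) →
    sumℤ (B ℕ.* 3) h ≡ sumℤ B (λ t → h (+ 3 * t))
  sumℤ-triples zero    h z₁ z₂ = refl
  sumℤ-triples (suc B) h z₁ z₂ = trans
    (cong₂ _+_ (cong₂ _+_ (cong₂ _+_ (sumℤ-triples B h z₁ z₂)
        (cong₂ _+_ (trans (cong h up₁) (z₁ (+ B))) (trans (cong h down₁) (z₂ -[1+ B ]))))
        (cong₂ _+_ (trans (cong h up₂) (z₂ (+ B))) (trans (cong h down₂) (z₁ -[1+ B ]))))
      (cong₂ (λ u v → h u + h v) up₃ down₃))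
    (cong (_+ (h (+ 3 * + suc B) + h (+ 3 * -[1+ B ]))) (trans (ℤₚ.+-identityʳ (sumℤ B (λ t → h (+ 3 * t)) + + 0)) (ℤₚ.+-identityʳ (sumℤ B (λ t → h (+ 3 * t))))))
    where
    up₁ : + 1 + + (B ℕ.* 3) ≡ + 3 * + B + + 1
    up₁ = trans (cong (λ z → + 1 + z) (ℤₚ.pos-* B 3)) (swap (+ B))
      where
      swap : ∀ b → + 1 + b * + 3 ≡ + 3 * b + + 1
      swap = solve-∀
    up₂ : + 2 + + (B ℕ.* 3) ≡ + 3 * + B + + 2
    up₂ = trans (cong (λ z → + 2 + z) (ℤₚ.pos-* B 3)) (swap (+ B))
      where
      swap : ∀ b → + 2 + b * + 3 ≡ + 3 * b + + 2
      swap = solve-∀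
    up₃ : + 3 + + (B ℕ.* 3) ≡ + 3 * + suc B
    up₃ = trans (cong (λ z → + 3 + z) (ℤₚ.pos-* B 3)) (swap (+ B))
      where
      swap : ∀ b → + 3 + b * + 3 ≡ + 3 * (+ 1 + b)
      swap = solve-∀
    down₁ : - (+ 1 + + (B ℕ.* 3)) ≡ + 3 * - (+ 1 + + B) + + 2
    down₁ = trans (cong (λ z → - (+ 1 + z)) (ℤₚ.pos-* B 3)) (swap (+ B))
      where
      swap : ∀ b → - (+ 1 + b * + 3) ≡ + 3 * - (+ 1 + b) + + 2
      swap = solve-∀
    down₂ : - (+ 2 + + (B ℕ.* 3)) ≡ + 3 * - (+ 1 + + B) + + 1
    down₂ = trans (cong (λ z → - (+ 2 + z)) (ℤₚ.pos-* B 3)) (swap (+ B))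
      where
      swap : ∀ b → - (+ 2 + b * + 3) ≡ + 3 * - (+ 1 + b) + + 1
      swap = solve-∀
    down₃ : - (+ 3 + + (B ℕ.* 3)) ≡ + 3 * - (+ 1 + + B)
    down₃ = trans (cong (λ z → - (+ 3 + z)) (ℤₚ.pos-* B 3)) (swap (+ B))
      where
      swap : ∀ b → - (+ 3 + b * + 3) ≡ + 3 * - (+ 1 + b)
      swap = solve-∀

-- Pentagonal numbers and the form i² + i j + j².

module NormForm where
  open Defs
  open PowerSeries
  open FiniteSums
  open DivisorSums
  open LambertSeries using (s₀)
  open JacobiTripleProduct
  open EulerFunction
  open SummationRanges
  open import Data.Integer using (-_; _+_; _*_; _-_)
  open import Data.Nat.Divisibility using (_∣_)
  open ≡

  open Summation

  par : ℤ → ℤ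
  par i = sgn ∣ i ∣

  -- The pentagonal number i (3 i + 1) / 2.
  ω : ℤ → ℕ
  ω (+ j)    = exponent 3 2 j
  ω -[1+ i ] = exponent 3 1 (suc i)

  2ω : ∀ i → + 2 * + ω i ≡ + 3 * i * i + i
  2ω (+ j) = go j
    where
    go : ∀ j → + 2 * + exponent 3 2 j ≡ + 3 * + j * + j + + j
    go zero    = refl
    go (suc j) = trans (cong (λ z → + 2 * (z + + 2 + + exponent 3 2 j)) (ℤₚ.pos-* 3 j)) (trans (expand (+ j) (+ exponent 3 2 j))
      (trans (cong (λ z → + 2 * (+ 3 * + j + + 2) + z) (go j)) (collect (+ j))))
      where
      expand : ∀ j x → + 2 * (+ 3 * j + + 2 + x) ≡ + 2 * (+ 3 * j + + 2) + + 2 * x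
      expand = solve-∀
      collect : ∀ j → + 2 * (+ 3 * j + + 2) + (+ 3 * j * j + j) ≡ + 3 * (+ 1 + j) * (+ 1 + j) + (+ 1 + j)
      collect = solve-∀
  2ω -[1+ i ] = trans (go (suc i)) (flip (+ suc i))
    where
    flip : ∀ j → + 3 * j * j - j ≡ + 3 * (- j) * (- j) + (- j)
    flip = solve-∀
    go : ∀ j → + 2 * + exponent 3 1 j ≡ + 3 * + j * + j - + j
    go zero    = refl
    go (suc j) = trans (cong (λ z → + 2 * (z + + 1 + + exponent 3 1 j)) (ℤₚ.pos-* 3 j)) (trans (expand (+ j) (+ exponent 3 1 j))
      (trans (cong (λ z → + 2 * (+ 3 * + j + + 1) + z) (go j)) (collect (+ j))))
      where
      expand : ∀ j x → + 2 * (+ 3 * j + + 1 + x) ≡ + 2 * (+ 3 * j + + 1) + + 2 * x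
      expand = solve-∀
      collect : ∀ j → + 2 * (+ 3 * j + + 1) + (+ 3 * j * j - j) ≡ + 3 * (+ 1 + j) * (+ 1 + j) - (+ 1 + j)
      collect = solve-∀

  exponent-≥ : ∀ f j → 1 ℕ.≤ f → j ℕ.≤ exponent 3 f j
  exponent-≥ f zero    _   = z≤n
  exponent-≥ f (suc j) 1≤f = ℕₚ.≤-trans (ℕₚ.≤-trans (ℕₚ.≤-reflexive (ℕₚ.+-comm 1 j)) (ℕₚ.+-mono-≤ (ℕₚ.m≤m+n j (2 ℕ.* j)) 1≤f)) (ℕₚ.m≤m+n _ _)

  ∣i∣≤ω : ∀ i → ∣ i ∣ ℕ.≤ ω i
  ∣i∣≤ω (+ j)    = exponent-≥ 2 j (s≤s z≤n)
  ∣i∣≤ω -[1+ i ] = exponent-≥ 1 (suc i) (s≤s z≤n)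

  sgn-+ : ∀ m n → sgn (m ℕ.+ n) ≡ sgn m * sgn n
  sgn-+ zero    n = sym (ℤₚ.*-identityˡ (sgn n))
  sgn-+ (suc m) n = trans (cong -_ (sgn-+ m n)) (ℤₚ.neg-distribˡ-* (sgn m) (sgn n))

  sgn-⊖ : ∀ m n → sgn ∣ m ℤ.⊖ n ∣ ≡ sgn m * sgn n
  sgn-⊖ zero    zero    = refl
  sgn-⊖ zero    (suc n) = sym (ℤₚ.*-identityˡ (sgn (suc n)))
  sgn-⊖ (suc m) zero    = sym (ℤₚ.*-identityʳ (sgn (suc m)))
  sgn-⊖ (suc m) (suc n) = trans (cong par (ℤₚ.[1+m]⊖[1+n]≡m⊖n m n)) (trans (sgn-⊖ m n) (negate (sgn m) (sgn n)))
    where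
    negate : ∀ x y → x * y ≡ - x * - y
    negate = solve-∀

  par-+ : ∀ i j → par (i + j) ≡ par i * par j
  par-+ (+ m)    (+ n)    = sgn-+ m n
  par-+ (+ m)    -[1+ n ] = sgn-⊖ m (suc n)
  par-+ -[1+ m ] (+ n)    = trans (sgn-⊖ n (suc m)) (ℤₚ.*-comm (sgn n) (sgn (suc m)))
  par-+ -[1+ m ] -[1+ n ] = trans (cong (λ z → sgn (suc z)) (sym (ℕₚ.+-suc m n))) (sgn-+ (suc m) (suc n))

  par-square : ∀ i → par i * par i ≡ + 1
  par-square i = go ∣ i ∣
    where
    go : ∀ n → sgn n * sgn n ≡ + 1
    go zero    = refl
    go (suc n) = trans (negate (sgn n)) (go n)
      where
      negate : ∀ x → - x * - x ≡ x * x
      negate = solve-∀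

  square-abs : ∀ z → z * z ≡ + (∣ z ∣ ℕ.* ∣ z ∣)
  square-abs (+ n)    = sym (ℤₚ.pos-* n n)
  square-abs -[1+ n ] = refl

  nrm : ℤ → ℤ → ℕ
  nrm i j = ∣ i * i + i * j + j * j ∣

  -- Completing the square. It shows that the absolute value in `nrm` changes nothing, and it bounds
  -- i by the norm.
  4norm : ∀ i j → + 4 * (i * i + i * j + j * j) ≡ + (3 ℕ.* (∣ i ∣ ℕ.* ∣ i ∣) ℕ.+ ∣ i + + 2 * j ∣ ℕ.* ∣ i + + 2 * j ∣)
  4norm i j = trans (complete i j) (cong₂ _+_ (trans (cong (λ z → + 3 * z) (square-abs i)) (sym (ℤₚ.pos-* 3 (∣ i ∣ ℕ.* ∣ i ∣)))) (square-abs (i + + 2 * j)))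
    where
    complete : ∀ i j → + 4 * (i * i + i * j + j * j) ≡ + 3 * (i * i) + (i + + 2 * j) * (i + + 2 * j)
    complete = solve-∀

  nonneg : ∀ q {x} → + 4 * q ≡ + x → + ∣ q ∣ ≡ q
  nonneg (+ n) _ = refl

  nrm-eq : ∀ i j → + nrm i j ≡ i * i + i * j + j * j
  nrm-eq i j = nonneg _ (4norm i j)

  -- From 3 i² ≤ 4 N: if N < ∣ i ∣, then 3 i² + 4 ≤ 4 ∣ i ∣, which has no solution.
  ∣i∣≤nrm : ∀ i j → ∣ i ∣ ℕ.≤ nrm i j
  ∣i∣≤nrm i j = bound ∣ i ∣ (nrm i j) (subst (3 ℕ.* (∣ i ∣ ℕ.* ∣ i ∣) ℕ.≤_)
    (ℤₚ.+-injective (trans (sym (4norm i j)) (trans (cong (λ z → + 4 * z) (sym (nrm-eq i j))) (sym (ℤₚ.pos-* 4 (nrm i j)))))) (ℕₚ.m≤m+n _ _))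
    where
    bound : ∀ x N → 3 ℕ.* (x ℕ.* x) ℕ.≤ 4 ℕ.* N → x ℕ.≤ N
    bound x N p with ℕₚ.≤-<-connex x N
    ... | inj₁ x≤N = x≤N
    ... | inj₂ N<x = ⊥-elim (impossible x (ℕₚ.≤-trans (ℕₚ.+-monoʳ-≤ 4 p) (ℕₚ.≤-trans (ℕₚ.≤-reflexive (sym (ℕₚ.*-suc 4 N))) (ℕₚ.*-monoʳ-≤ 4 N<x))))
      where
      impossible : ∀ x → 4 ℕ.+ 3 ℕ.* (x ℕ.* x) ℕ.≤ 4 ℕ.* x → ⊥
      impossible zero ()
      impossible (suc zero) (s≤s (s≤s (s≤s (s≤s ()))))
      impossible (suc (suc x)) q = ℕₚ.<⇒≱ (ℕₚ.m<m+n (4 ℕ.* suc (suc x)) {8 ℕ.+ 8 ℕ.* x ℕ.+ 3 ℕ.* (x ℕ.* x)} (s≤s z≤n)) (ℕₚ.≤-trans (ℕₚ.≤-reflexive (expand x)) q)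
        where
        expand : ∀ x → 4 ℕ.* suc (suc x) ℕ.+ (8 ℕ.+ 8 ℕ.* x ℕ.+ 3 ℕ.* (x ℕ.* x)) ≡ 4 ℕ.+ 3 ℕ.* (suc (suc x) ℕ.* suc (suc x))
        expand = ℕ-Solver.solve-∀

  nrm-sym : ∀ i j → nrm i j ≡ nrm j i
  nrm-sym i j = cong ∣_∣ (swap i j)
    where
    swap : ∀ i j → i * i + i * j + j * j ≡ j * j + j * i + i * i
    swap = solve-∀

  ∣j∣≤nrm : ∀ i j → ∣ j ∣ ℕ.≤ nrm i j
  ∣j∣≤nrm i j = subst (∣ j ∣ ℕ.≤_) (nrm-sym j i) (∣i∣≤nrm j i)

  a-box : ∀ n → a n ≡ sumℤ n (λ i → sumℤ n (λ j → mono (nrm i j) n))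
  a-box n = trans (range-sum _) (sumℤ-cong n (λ i _ → trans (range-sum _) (sumℤ-cong n (λ j _ → indicator i j))))
    where
    list-sum : ∀ (f : ℤ → ℤ) (g : ℕ → ℤ) s m → foldr _+_ (+ 0) (map f (map g (applyUpTo s (suc m)))) ≡ sumTo (λ i → f (g (s i))) m
    list-sum f g s zero    = ℤₚ.+-identityʳ _
    list-sum f g s (suc m) = trans (cong (λ z → f (g (s 0)) + z) (list-sum f g (s ∘ suc) m)) (sym (sumTo-head (λ i → f (g (s i))) m))
    window : ∀ (f : ℤ → ℤ) n → sumTo (λ i → f (+ i - + n)) (2 ℕ.* n) ≡ sumℤ n f
    window f zero    = refl
    window f (suc n) = trans (cong (sumTo F) (ℕₚ.*-suc 2 n)) (trans (cong (_+ F (2 ℕ.+ 2 ℕ.* n)) (sumTo-head F (2 ℕ.* n)))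
      (trans (cong₂ (λ u v → F 0 + u + v) (trans (sumTo-cong (2 ℕ.* n) (λ i _ → cong f (lower (+ i) (+ n)))) (window f n)) (cong f (top n)))
      (regroup (F 0) (sumℤ n f) (f (+ suc n)))))
      where
      F : ℕ → ℤ
      F i = f (+ i - + suc n)
      lower : ∀ i n → + 1 + i - (+ 1 + n) ≡ i - n
      lower = solve-∀
      top : ∀ n → + (2 ℕ.+ 2 ℕ.* n) - + suc n ≡ + suc n
      top n = trans (cong (λ z → + 2 + z - + suc n) (ℤₚ.pos-* 2 n)) (simplify (+ n))
        where
        simplify : ∀ n → + 2 + + 2 * n - (+ 1 + n) ≡ + 1 + n
        simplify = solve-∀
      regroup : ∀ x y z → x + y + z ≡ y + (z + x)
      regroup = solve-∀
    range-sum : ∀ f → foldr _+_ (+ 0) (map f (map (λ i → + i - + n) (upTo (suc (2 ℕ.* n))))) ≡ sumℤ n f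
    range-sum f = trans (list-sum f (λ i → + i - + n) id (2 ℕ.* n)) (window f n)
    indicator : ∀ i j → (if ⌊ (i * i + i * j + j * j) ℤ.≟ + n ⌋ then + 1 else + 0) ≡ mono (nrm i j) n
    indicator i j with (i * i + i * j + j * j) ℤ.≟ + n
    ... | yes e = sym (trans (cong (λ z → mono z n) (ℤₚ.+-injective (trans (nrm-eq i j) e))) (at-diag n (+ 1)))
    ... | no ¬e = sym (at-≢ (+ 1) (λ e → ¬e (trans (sym (nrm-eq i j)) (cong +_ e))))

  a-expansion : ∀ B K → K ℕ.≤ B → Expansion (box B ⊗ₛ box B) (λ _ → + 1) (λ p → nrm (proj₁ p) (proj₂ p)) K a
  a-expansion B K K≤B k k≤K = trans (a-box k) (trans
    (sumℤ-cong k (λ i _ → sym (sumℤ-extend (λ j → mono (nrm i j) k) B (λ j k<j → at-> (+ 1) (ℕₚ.<-≤-trans k<j (∣j∣≤nrm i j))) k≤B)))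
    (trans (sym (sumℤ-extend (λ i → sumℤ B (λ j → mono (nrm i j) k)) B
      (λ i k<i → sumℤ-zero B _ (λ j _ → at-> (+ 1) (ℕₚ.<-≤-trans k<i (∣i∣≤nrm i j)))) k≤B))
    (sumℤ-cong B (λ i _ → sumℤ-cong B (λ j _ → sym (ℤₚ.*-identityˡ (mono (nrm i j) k)))))))
    where
    k≤B : k ℕ.≤ B
    k≤B = ℕₚ.≤-trans k≤K K≤B

  -- h covers 0, -1, ..., -(m + 1) and g covers 1, ..., m + 1, the two ranges in which the triple
  -- product delivers its sum.
  two-sided : ∀ (H : ℤ → ℤ) (h g : ℕ → ℤ) → (∀ j → h j ≡ H (- (+ j))) → (∀ j → g j ≡ H (+ suc j)) →
    ∀ m → sumTo h (suc m) + sumTo g m ≡ sumℤ (suc m) H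
  two-sided H h g e e′ zero    = trans (cong₂ _+_ (cong₂ _+_ (e 0) (e 1)) (e′ 0)) (regroup (H (+ 0)) _ _)
    where
    regroup : ∀ x y z → x + y + z ≡ x + (z + y)
    regroup = solve-∀
  two-sided H h g e e′ (suc m) = trans (regroup (sumTo h (suc m)) _ (sumTo g m) _)
    (cong₂ _+_ (two-sided H h g e e′ m) (cong₂ _+_ (e′ (suc m)) (e (suc (suc m)))))
    where
    regroup : ∀ x y z w → x + y + (z + w) ≡ x + z + (w + y)
    regroup = solve-∀

  -- The number `N` of factors in the triple product.
  cutoff : ℕ → ℕ
  cutoff n = suc (n ℕ.+ suc n)

  E-expansion : ∀ n → Expansion (box (cutoff n)) par ω n E
  E-expansion n k k≤n = trans (pentagonal-mod n k k≤n) (two-sided (λ i → par i * mono (ω i) k) _ _ (λ { zero → refl ; (suc j) → refl }) (λ j → refl) (n ℕ.+ suc n))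

  Es₀-expansion : ∀ n → Expansion (box (cutoff n)) (λ i → par i * i) ω n (E ⊗ s₀)
  Es₀-expansion n k k≤n = trans (sym (ℤₚ.neg-involutive ((E ⊗ s₀) k))) (trans (cong -_ (trans (pentagonal-derivative-mod n k k≤n)
      (two-sided (λ i → - (+ 1) * (par i * i * mono (ω i) k)) _ _ (λ { zero → refl ; (suc j) → left (sgn (suc j)) (+ suc j) _ }) (λ j → right (sgn (suc j)) (+ suc j) _) (n ℕ.+ suc n))))
    (trans (cong -_ (sumℤ-*ˡ (cutoff n) (- (+ 1)) (λ i → par i * i * mono (ω i) k))) (cancel _)))
    where
    left : ∀ s j m → s * (+ 1 * j) * m ≡ - (+ 1) * (s * (- j) * m)
    left = solve-∀
    right : ∀ s j m → s * (- (+ 1) * j) * m ≡ - (+ 1) * (s * j * m)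
    right = solve-∀
    cancel : ∀ x → - (- (+ 1) * x) ≡ x
    cancel = solve-∀

-- The product a E as the part of E³ with exponents divisible by 3.

module LatticeReindexing where
  open Defs
  open FiniteSums
  open DivisorSums
  open JacobiTripleProduct
  open EulerFunction
  open SummationRanges
  open NormForm
  open import Data.Integer using (-_; _+_; _*_; _-_)
  open import Data.Nat.Divisibility using (_∣_; divides; _∣?_)
  open ≡

  open Summation

  3z≢1 : ∀ z → + 3 * z ≢ + 1
  3z≢1 z e = from-no (3 ∣? 1) (divides ∣ z ∣ (trans (sym (cong ∣_∣ e)) (trans (ℤₚ.abs-* (+ 3) z) (ℕₚ.*-comm 3 ∣ z ∣))))

  3z≢2 : ∀ z → + 3 * z ≢ + 2
  3z≢2 z e = from-no (3 ∣? 2) (divides ∣ z ∣ (trans (sym (cong ∣_∣ e)) (trans (ℤₚ.abs-* (+ 3) z) (ℕₚ.*-comm 3 ∣ z ∣))))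

  at-*3 : ∀ m n h → at (3 ℕ.* m) (3 ℕ.* n) h ≡ at m n h
  at-*3 zero    zero    h = refl
  at-*3 zero    (suc n) h = refl
  at-*3 (suc m) zero    h = refl
  at-*3 (suc m) (suc n) h = trans (cong₂ (λ u v → at u v h) (ℕₚ.*-suc 3 m) (ℕₚ.*-suc 3 n)) (at-*3 m n h)

  -- The 15 comes from `inner`: contributing indices are at most S = 3 m in size, since ∣ I ∣ ≤
  -- ω(I), and a shift by -I - J of size 2 S needs the range S + 2 · 2 S = 5 S.
  module Lattice (m B : ℕ) (n≤B : 15 ℕ.* m ℕ.≤ B) (E-sum : Expansion (box B) par ω (15 ℕ.* m) E) where
    S : ℕ
    S = 3 ℕ.* m

    g : ℤ → ℤ → ℤ → ℤ
    g I J K = par I * (par J * par K) * mono (ω I ℕ.+ (ω J ℕ.+ ω K)) (3 ℕ.* m)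

    third : ℤ → ℤ → ℤ → ℤ
    third s I J = s + (- I - J)

    f : ℤ → ℤ → ℤ → ℤ
    f M i j = + 1 * par M * mono (nrm i j ℕ.+ ω M) m

    vanish : ∀ I J K → 3 ℕ.* m ℕ.< ω I ℕ.+ (ω J ℕ.+ ω K) → g I J K ≡ + 0
    vanish I J K p = trans (cong (par I * (par J * par K) *_) (at-> (+ 1) p)) (ℤₚ.*-zeroʳ (par I * (par J * par K)))

    g-I : ∀ I J K → S ℕ.< ∣ I ∣ → g I J K ≡ + 0
    g-I I J K p = vanish I J K (ℕₚ.<-≤-trans p (ℕₚ.≤-trans (∣i∣≤ω I) (ℕₚ.m≤m+n (ω I) _)))
    g-J : ∀ I J K → S ℕ.< ∣ J ∣ → g I J K ≡ + 0
    g-J I J K p = vanish I J K (ℕₚ.<-≤-trans p (ℕₚ.≤-trans (∣i∣≤ω J) (ℕₚ.≤-trans (ℕₚ.m≤m+n (ω J) (ω K)) (ℕₚ.m≤n+m _ (ω I)))))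
    g-K : ∀ I J K → S ℕ.< ∣ K ∣ → g I J K ≡ + 0
    g-K I J K p = vanish I J K (ℕₚ.<-≤-trans p (ℕₚ.≤-trans (∣i∣≤ω K) (ℕₚ.≤-trans (ℕₚ.m≤n+m (ω K) (ω J)) (ℕₚ.m≤n+m _ (ω I)))))

    -- Twice the exponent is 3 (I² + J² + K²) + (I + J + K).
    2exponent : ∀ I J K → + 2 * + (ω I ℕ.+ (ω J ℕ.+ ω K)) ≡ + 3 * (I * I + J * J + K * K) + (I + J + K)
    2exponent I J K = trans (distribute (+ ω I) (+ ω J) (+ ω K)) (trans (cong₂ _+_ (2ω I) (cong₂ _+_ (2ω J) (2ω K))) (collect I J K))
      where
      distribute : ∀ x y z → + 2 * (x + (y + z)) ≡ + 2 * x + (+ 2 * y + + 2 * z)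
      distribute = solve-∀
      collect : ∀ I J K → + 3 * I * I + I + (+ 3 * J * J + J + (+ 3 * K * K + K)) ≡ + 3 * (I * I + J * J + K * K) + (I + J + K)
      collect = solve-∀

    -- The triple is (i, j, -i - j) + M (1, 1, 1), an orthogonal decomposition. So the exponent
    -- separates into 3 (i² + i j + j²) and 3 ω(M), and the sign is that of 3 M, hence that of M.
    reindexed : ∀ M i j → g (i + M) (j + M) (third (+ 3 * M) (i + M) (j + M)) ≡ f M i j
    reindexed M i j = cong₂ _*_ signs (trans (cong (λ z → mono z (3 ℕ.* m)) exponents) (at-*3 (nrm i j ℕ.+ ω M) m (+ 1)))
      where
      K = third (+ 3 * M) (i + M) (j + M)
      total : ∀ M i j → i + M + (j + M + (+ 3 * M + (- (i + M) - (j + M)))) ≡ M + (M + M)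
      total = solve-∀
      signs : par (i + M) * (par (j + M) * par K) ≡ + 1 * par M
      signs = trans (cong (par (i + M) *_) (sym (par-+ (j + M) K))) (trans (sym (par-+ (i + M) (j + M + K)))
        (trans (cong par (total M i j)) (trans (par-+ M (M + M)) (trans (cong (par M *_) (trans (par-+ M M) (par-square M))) (ℤₚ.*-comm (par M) (+ 1))))))
      expand : ∀ M i j → + 3 * ((i + M) * (i + M) + (j + M) * (j + M) + (+ 3 * M + (- (i + M) - (j + M))) * (+ 3 * M + (- (i + M) - (j + M))))
          + (i + M + (j + M) + (+ 3 * M + (- (i + M) - (j + M)))) ≡ + 6 * (i * i + i * j + j * j) + + 3 * (+ 3 * M * M + M)
      expand = solve-∀
      collect : ∀ N w → + 6 * N + + 3 * (+ 2 * w) ≡ + 2 * (+ 3 * (N + w))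
      collect = solve-∀
      exponents : ω (i + M) ℕ.+ (ω (j + M) ℕ.+ ω K) ≡ 3 ℕ.* (nrm i j ℕ.+ ω M)
      exponents = ℤₚ.+-injective (ℤₚ.*-cancelˡ-≡ (+ 2) _ _ (trans (2exponent (i + M) (j + M) K) (trans (expand M i j)
        (trans (cong₂ (λ u v → + 6 * u + + 3 * v) (sym (nrm-eq i j)) (sym (2ω M))) (trans (collect (+ nrm i j) (+ ω M))
        (cong (λ z → + 2 * z) (sym (ℤₚ.pos-* 3 (nrm i j ℕ.+ ω M)))))))))

    -- Twice the exponent is congruent to I + J + K modulo 3, so the exponent 3 m forces a sum
    -- divisible by 3.
    wrong-residue : ∀ I J t r → (∀ z → + 3 * z ≢ r) → g I J (third (+ 3 * t + r) I J) ≡ + 0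
    wrong-residue I J t r r≢ = trans (cong (w *_) (at-≢ (+ 1) (λ e → r≢ _ (isolate e)))) (ℤₚ.*-zeroʳ w)
      where
      K = third (+ 3 * t + r) I J
      w = par I * (par J * par K)
      total : ∀ I J t r → I + J + (+ 3 * t + r + (- I - J)) ≡ + 3 * t + r
      total = solve-∀
      rearrange : ∀ x t r q → + 2 * (+ 3 * x) ≡ + 3 * q + (+ 3 * t + r) → + 3 * (+ 2 * x - q - t) ≡ r
      rearrange x t r q e = trans (expand x q t) (trans (cong (λ z → z - + 3 * q - + 3 * t) e) (simplify q t r))
        where
        expand : ∀ x q t → + 3 * (+ 2 * x - q - t) ≡ + 2 * (+ 3 * x) - + 3 * q - + 3 * t
        expand = solve-∀
        simplify : ∀ q t r → + 3 * q + (+ 3 * t + r) - + 3 * q - + 3 * t ≡ r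
        simplify = solve-∀
      isolate : ω I ℕ.+ (ω J ℕ.+ ω K) ≡ 3 ℕ.* m → + 3 * (+ 2 * + m - (I * I + J * J + K * K) - t) ≡ r
      isolate e = rearrange (+ m) t r (I * I + J * J + K * K) (trans (cong (λ z → + 2 * z) (trans (sym (ℤₚ.pos-* 3 m)) (cong +_ (sym e))))
        (trans (2exponent I J K) (cong (λ z → + 3 * (I * I + J * J + K * K) + z) (total I J t r))))

    S≤B : ∀ c → c ℕ.* S ℕ.≤ 15 ℕ.* m → c ℕ.* S ℕ.≤ B
    S≤B c p = ℕₚ.≤-trans p n≤B

    multiple : ∀ c → c ℕ.* 3 ℕ.≤ 15 → c ℕ.* S ℕ.≤ B
    multiple c p = S≤B c (ℕₚ.≤-trans (ℕₚ.≤-reflexive (sym (ℕₚ.*-assoc c 3 m))) (ℕₚ.*-monoˡ-≤ m p))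

    -- With M varying, K = 3 M - I - J reaches only the sums divisible by 3; the others are inserted
    -- as zeros, and a shift by -I - J turns the sum s into K. If I or J exceeds S, both sides
    -- vanish termwise.
    inner : ∀ I J → sumℤ S (λ M → g I J (third (+ 3 * M) I J)) ≡ sumℤ B (g I J)
    inner I J with ℕₚ.≤-<-connex ∣ I ∣ S | ℕₚ.≤-<-connex ∣ J ∣ S
    ... | inj₂ p | _ = trans (sumℤ-zero S _ (λ M _ → g-I I J (third (+ 3 * M) I J) p)) (sym (sumℤ-zero B _ (λ K _ → g-I I J K p)))
    ... | inj₁ _ | inj₂ p = trans (sumℤ-zero S _ (λ M _ → g-J I J (third (+ 3 * M) I J) p)) (sym (sumℤ-zero B _ (λ K _ → g-J I J K p)))
    ... | inj₁ I≤S | inj₁ J≤S = trans (sym (sumℤ-triples S (λ s → g I J (third s I J))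
        (λ t → wrong-residue I J t (+ 1) 3z≢1) (λ t → wrong-residue I J t (+ 2) 3z≢2)))
      (trans (sym (sumℤ-extend (λ s → g I J (third s I J)) B supported (ℕₚ.≤-trans (ℕₚ.≤-reflexive (ℕₚ.*-comm S 3)) (multiple 3 (ℕₚ.m≤m+n 9 6)))))
      (sumℤ-shift (- I - J) B (g I J) (g-K I J)
        (ℕₚ.≤-trans (ℕₚ.+-monoʳ-≤ S (ℕₚ.+-mono-≤ shift-bound shift-bound)) (ℕₚ.≤-trans (ℕₚ.≤-reflexive (five S)) (multiple 5 ℕₚ.≤-refl)))))
      where
      five : ∀ S → S ℕ.+ (S ℕ.+ S ℕ.+ (S ℕ.+ S)) ≡ 5 ℕ.* S
      five = ℕ-Solver.solve-∀
      shift-bound : ∣ - I - J ∣ ℕ.≤ S ℕ.+ S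
      shift-bound = ℕₚ.≤-trans (ℤₚ.∣i-j∣≤∣i∣+∣j∣ (- I) J) (ℕₚ.+-mono-≤ (subst (ℕ._≤ S) (sym (ℤₚ.∣-i∣≡∣i∣ I)) I≤S) J≤S)
      supported : Supported (S ℕ.* 3) (λ s → g I J (third s I J))
      supported s p = g-K I J (third s I J) (ℕₚ.+-cancelʳ-< (S ℕ.+ S) S _ (ℕₚ.<-≤-trans (subst (ℕ._< ∣ s ∣) (three S) p)
        (ℕₚ.≤-trans (ℕₚ.≤-reflexive (cong ∣_∣ (back s (- I - J)))) (ℕₚ.≤-trans (ℤₚ.∣i-j∣≤∣i∣+∣j∣ (third s I J) (- I - J)) (ℕₚ.+-monoʳ-≤ ∣ third s I J ∣ shift-bound)))))
        where
        three : ∀ S → S ℕ.* 3 ≡ S ℕ.+ (S ℕ.+ S)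
        three = ℕ-Solver.solve-∀
        back : ∀ s t → s ≡ s + t - t
        back = solve-∀

    shifted : ∀ M → ∣ M ∣ ℕ.≤ S → sumℤ B (λ i → sumℤ B (λ j → f M i j)) ≡ sumℤ B (λ I → sumℤ B (λ J → g I J (third (+ 3 * M) I J)))
    shifted M M≤S = trans (sumℤ-cong B (λ i _ → trans (sumℤ-cong B (λ j _ → sym (reindexed M i j)))
        (sumℤ-shift M B (λ J → g (i + M) J (third (+ 3 * M) (i + M) J)) (λ J p → g-J (i + M) J (third (+ 3 * M) (i + M) J) p) small)))
      (sumℤ-shift M B (λ I → sumℤ B (λ J → g I J (third (+ 3 * M) I J))) (λ I p → sumℤ-zero B _ (λ J _ → g-I I J (third (+ 3 * M) I J) p)) small)
      where
      three : ∀ S → S ℕ.+ (S ℕ.+ S) ≡ 3 ℕ.* S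
      three = ℕ-Solver.solve-∀
      small : S ℕ.+ (∣ M ∣ ℕ.+ ∣ M ∣) ℕ.≤ B
      small = ℕₚ.≤-trans (ℕₚ.+-monoʳ-≤ S (ℕₚ.+-mono-≤ M≤S M≤S)) (ℕₚ.≤-trans (ℕₚ.≤-reflexive (three S)) (multiple 3 (ℕₚ.m≤m+n 9 6)))

    -- The index triples of E³ are grouped by M = (I + J + K)/3: M becomes the pentagonal index of
    -- E, and I - M, J - M become the lattice point counted by a.
    lattice : (a ⊗ E) m ≡ (E ⊗ (E ⊗ E)) (3 ℕ.* m)
    lattice = begin
      (a ⊗ E) m
        ≡⟨ Expansion-⊗ (box B ⊗ₛ box B) (box B) (λ _ → + 1) (λ p → nrm (proj₁ p) (proj₂ p)) par ω (a-expansion B (15 ℕ.* m) n≤B) E-sum m (ℕₚ.m≤n*m m 15) ⟩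
      sumℤ B (λ i → sumℤ B (λ j → sumℤ B (λ M → f M i j)))
        ≡⟨ trans (sumℤ-cong B (λ i _ → sumℤ-swap B B (λ j M → f M i j))) (sumℤ-swap B B (λ i M → sumℤ B (f M i))) ⟩
      sumℤ B (λ M → sumℤ B (λ i → sumℤ B (f M i)))
        ≡⟨ sumℤ-extend (λ M → sumℤ B (λ i → sumℤ B (f M i))) B supported (ℕₚ.≤-trans (ℕₚ.≤-reflexive (sym (ℕₚ.*-identityˡ S))) (multiple 1 (ℕₚ.m≤m+n 3 12))) ⟩
      sumℤ S (λ M → sumℤ B (λ i → sumℤ B (f M i)))
        ≡⟨ sumℤ-cong S shifted ⟩
      sumℤ S (λ M → sumℤ B (λ I → sumℤ B (λ J → g I J (third (+ 3 * M) I J))))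
        ≡⟨ trans (sumℤ-swap S B (λ M I → sumℤ B (λ J → g I J (third (+ 3 * M) I J)))) (sumℤ-cong B (λ I _ → sumℤ-swap S B (λ M J → g I J (third (+ 3 * M) I J)))) ⟩
      sumℤ B (λ I → sumℤ B (λ J → sumℤ S (λ M → g I J (third (+ 3 * M) I J))))
        ≡⟨ sumℤ-cong B (λ I _ → sumℤ-cong B (λ J _ → inner I J)) ⟩
      sumℤ B (λ I → sumℤ B (λ J → sumℤ B (g I J)))
        ≡⟨ Expansion-⊗ (box B) (box B ⊗ₛ box B) par ω (λ p → par (proj₁ p) * par (proj₂ p)) (λ p → ω (proj₁ p) ℕ.+ ω (proj₂ p))
             E-sum (Expansion-⊗ (box B) (box B) par ω par ω E-sum E-sum)
             (3 ℕ.* m) (ℕₚ.*-monoˡ-≤ m {3} {15} (ℕₚ.m≤m+n 3 12)) ⟨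
      (E ⊗ (E ⊗ E)) (3 ℕ.* m) ∎
      where
      open ≡-Reasoning
      supported : Supported S (λ M → sumℤ B (λ i → sumℤ B (f M i)))
      supported M p = sumℤ-zero B _ (λ i _ → sumℤ-zero B _ (λ j _ → trans (cong (+ 1 * par M *_)
        (at-> (+ 1) (ℕₚ.<-≤-trans (ℕₚ.≤-<-trans (ℕₚ.m≤n*m m 3) p) (ℕₚ.≤-trans (∣i∣≤ω M) (ℕₚ.m≤n+m (ω M) (nrm i j)))))) (ℤₚ.*-zeroʳ (+ 1 * par M))))

  lattice-identity : ∀ m → (a ⊗ E) m ≡ (E ⊗ (E ⊗ E)) (3 ℕ.* m)
  lattice-identity m = Lattice.lattice m (cutoff (15 ℕ.* m)) (ℕₚ.≤-trans (ℕₚ.m≤m+n _ _) (ℕₚ.n≤1+n _)) (E-expansion (15 ℕ.* m))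

-- Jacobi's series for the cube and the Lambert expansion of a.

module LambertExpansion where
  open Defs
  open PowerSeries
  open Inverse
  open FiniteSums
  open DivisorSums
  open LambertSeries using (s₀)
  open JacobiTripleProduct
  open EulerFunction
  open SummationRanges
  open NormForm
  open LatticeReindexing
  open import Data.Integer using (-_; _+_; _*_; _-_)
  open ≡

  tri : ℕ → ℕ
  tri = exponent 1 1

  2tri : ∀ i → + 2 * + tri i ≡ + i * + i + + i
  2tri zero    = refl
  2tri (suc i) = trans (cong (λ z → + 2 * (+ (z ℕ.+ 1) + + tri i)) (ℕₚ.*-identityˡ i)) (trans (expand (+ i) (+ tri i))
    (trans (cong (λ z → + 2 * (+ i + + 1) + z) (2tri i)) (collect (+ i))))
    where
    expand : ∀ i x → + 2 * (i + + 1 + x) ≡ + 2 * (i + + 1) + + 2 * x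
    expand = solve-∀
    collect : ∀ i → + 2 * (i + + 1) + (i * i + i) ≡ (+ 1 + i) * (+ 1 + i) + (+ 1 + i)
    collect = solve-∀

  tri-previous : ∀ i → exponent 1 0 (suc i) ≡ tri i
  tri-previous zero    = refl
  tri-previous (suc i) = cong₂ ℕ._+_ (shift i) (tri-previous i)
    where
    shift : ∀ i → 1 ℕ.* suc i ℕ.+ 0 ≡ 1 ℕ.* i ℕ.+ 1
    shift = ℕ-Solver.solve-∀

  i≤tri : ∀ i → i ℕ.≤ tri i
  i≤tri zero    = z≤n
  i≤tri (suc i) = ℕₚ.≤-trans (ℕₚ.≤-reflexive (shift i)) (ℕₚ.m≤m+n _ _)
    where
    shift : ∀ i → suc i ≡ 1 ℕ.* i ℕ.+ 1
    shift = ℕ-Solver.solve-∀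

  jacobi-term : ℕ → ℕ → ℤ
  jacobi-term k i = sgn i * (+ 2 * + i + + 1) * mono (tri i) k

  jacobi-term-vanish : ∀ k i → k ℕ.< i → jacobi-term k i ≡ + 0
  jacobi-term-vanish k i k<i = trans (cong (sgn i * (+ 2 * + i + + 1) *_) (at-> (+ 1) (ℕₚ.<-≤-trans k<i (i≤tri i)))) (ℤₚ.*-zeroʳ (sgn i * (+ 2 * + i + + 1)))

  sumTo-extend : ∀ (h : ℕ → ℤ) M j → (∀ i → M ℕ.< i → h i ≡ + 0) → sumTo h (j ℕ.+ M) ≡ sumTo h M
  sumTo-extend h M zero    z = refl
  sumTo-extend h M (suc j) z = trans (cong₂ _+_ (sumTo-extend h M j z) (z (suc j ℕ.+ M) (s≤s (ℕₚ.m≤n+m M j)))) (ℤₚ.+-identityʳ _)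

  -- The two halves of the bilateral series share the triangular exponents, and their weights i + 1
  -- and i add up to 2 i + 1.
  jacobi : ∀ k → (E ⊗ (E ⊗ E)) k ≡ sumTo (jacobi-term k) (k ℕ.+ suc k)
  jacobi k = trans (sym (ℤₚ.neg-involutive _)) (trans (cong -_ (trans (jacobi-mod k k ℕₚ.≤-refl) (cong₂ _+_ first second)))
    (trans (cong -_ (sym (sumTo-+ A D M))) (trans (cong -_ (trans (sumTo-cong M (λ i _ → combine (sgn i) (+ i) (mono (tri i) k)))
      (sumTo-*ˡ (- (+ 1)) (jacobi-term k) M))) (cancel _))))
    where
    M = k ℕ.+ suc k
    A D : ℕ → ℤ
    A i = - sgn i * (+ 1 + + i) * mono (tri i) k
    D j = sgn j * (- (+ 1) * + j) * mono (tri j) k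
    first : sumTo (λ i → sgn i * (+ 1 * + i) * mono (exponent 1 0 i) k) (suc M) ≡ sumTo A M
    first = trans (sumTo-head (λ i → sgn i * (+ 1 * + i) * mono (exponent 1 0 i) k) M) (trans
      (cong (_+ sumTo (λ i → sgn (suc i) * (+ 1 * + suc i) * mono (exponent 1 0 (suc i)) k) M) (ℤₚ.*-zeroˡ (mono 0 k))) (trans (ℤₚ.+-identityˡ _)
      (sumTo-cong M (λ i _ → cong₂ (λ u v → - sgn i * u * mono v k) (ℤₚ.*-identityˡ (+ suc i)) (tri-previous i)))))
    second : sumTo (λ j → sgn (suc j) * (- (+ 1) * + suc j) * mono (exponent 1 1 (suc j)) k) M ≡ sumTo D M
    second = trans (sym (trans (sumTo-head D M) (trans (cong (_+ sumTo (D ∘ suc) M) (ℤₚ.*-zeroˡ (mono 0 k))) (ℤₚ.+-identityˡ _))))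
      (sumTo-extend D M 1 (λ i M<i → trans (cong (sgn i * (- (+ 1) * + i) *_) (at-> (+ 1) (ℕₚ.<-≤-trans (ℕₚ.≤-<-trans (ℕₚ.m≤m+n k (suc k)) M<i) (i≤tri i))))
        (ℤₚ.*-zeroʳ (sgn i * (- (+ 1) * + i)))))
    combine : ∀ s i m → - s * (+ 1 + i) * m + s * (- (+ 1) * i) * m ≡ - (+ 1) * (s * (+ 2 * i + + 1) * m)
    combine = solve-∀
    cancel : ∀ x → - (- (+ 1) * x) ≡ x
    cancel = solve-∀

  sgn-double : ∀ t → sgn (t ℕ.* 3) ≡ sgn t
  sgn-double zero    = refl
  sgn-double (suc t) = trans (ℤₚ.neg-involutive _) (cong -_ (sgn-double t))

  module Section (m : ℕ) where
    u : ℤ → ℤ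
    u i = par i * (+ 6 * i + + 1) * mono (ω i) m

    u-supported : Supported m u
    u-supported i m<i = trans (cong (par i * (+ 6 * i + + 1) *_) (at-> (+ 1) (ℕₚ.<-≤-trans m<i (∣i∣≤ω i)))) (ℤₚ.*-zeroʳ (par i * (+ 6 * i + + 1)))

    index : ∀ t → + (t ℕ.* 3) ≡ + 3 * + t
    index t = trans (ℤₚ.pos-* t 3) (ℤₚ.*-comm (+ t) (+ 3))

    triangular : ∀ i j → + 2 * + tri i ≡ + 3 * (+ 2 * + j) → tri i ≡ 3 ℕ.* j
    triangular i j e = ℤₚ.+-injective (ℤₚ.*-cancelˡ-≡ (+ 2) _ _ (trans e (trans (swap (+ j)) (cong (λ z → + 2 * z) (sym (ℤₚ.pos-* 3 j))))))
      where
      swap : ∀ j → + 3 * (+ 2 * j) ≡ + 2 * (+ 3 * j)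
      swap = solve-∀

    -- The triangular numbers divisible by 3 have index 3 t or 3 t + 2 and equal 3 ω(t) and 3 ω(-t -
    -- 1). The weights 2 i + 1 become 6 t + 1 and, up to sign, 6 (-t - 1) + 1, so the two cases are
    -- the two halves of one series over ℤ.
    residue-0 : ∀ t → jacobi-term (3 ℕ.* m) (t ℕ.* 3) ≡ u (+ t)
    residue-0 t = cong₂ _*_ (cong₂ _*_ (sgn-double t) (trans (cong (λ z → + 2 * z + + 1) (index t)) (six (+ t))))
      (trans (cong (λ z → mono z (3 ℕ.* m)) (triangular (t ℕ.* 3) (ω (+ t)) (trans (2tri (t ℕ.* 3)) (trans (cong (λ z → z * z + z) (index t))
        (trans (expand (+ t)) (cong (λ z → + 3 * z) (sym (2ω (+ t))))))))) (at-*3 (ω (+ t)) m (+ 1)))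
      where
      six : ∀ t → + 2 * (+ 3 * t) + + 1 ≡ + 6 * t + + 1
      six = solve-∀
      expand : ∀ t → + 3 * t * (+ 3 * t) + + 3 * t ≡ + 3 * (+ 3 * t * t + t)
      expand = solve-∀

    residue-1 : ∀ t → jacobi-term (3 ℕ.* m) (1 ℕ.+ t ℕ.* 3) ≡ + 0
    residue-1 t = trans (cong (w *_) (at-≢ {tri (1 ℕ.+ t ℕ.* 3)} (+ 1) (λ e → 3z≢2 (+ 2 * + m - + 3 * + t * + t - + 3 * + t)
        (isolate (+ m) (+ t) (trans (cong (λ z → + 2 * z) (trans (sym (ℤₚ.pos-* 3 m)) (cong +_ (sym e)))) (trans (2tri (1 ℕ.+ t ℕ.* 3)) (cong (λ z → (+ 1 + z) * (+ 1 + z) + (+ 1 + z)) (index t)))))))) (ℤₚ.*-zeroʳ w)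
      where
      w = sgn (1 ℕ.+ t ℕ.* 3) * (+ 2 * + (1 ℕ.+ t ℕ.* 3) + + 1)
      isolate : ∀ m t → + 2 * (+ 3 * m) ≡ (+ 1 + + 3 * t) * (+ 1 + + 3 * t) + (+ 1 + + 3 * t) → + 3 * (+ 2 * m - + 3 * t * t - + 3 * t) ≡ + 2
      isolate m t e = trans (expand m t) (trans (cong (λ z → z - + 9 * t * t - + 9 * t) e) (simplify t))
        where
        expand : ∀ m t → + 3 * (+ 2 * m - + 3 * t * t - + 3 * t) ≡ + 2 * (+ 3 * m) - + 9 * t * t - + 9 * t
        expand = solve-∀
        simplify : ∀ t → (+ 1 + + 3 * t) * (+ 1 + + 3 * t) + (+ 1 + + 3 * t) - + 9 * t * t - + 9 * t ≡ + 2
        simplify = solve-∀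

    residue-2 : ∀ t → jacobi-term (3 ℕ.* m) (2 ℕ.+ t ℕ.* 3) ≡ u -[1+ t ]
    residue-2 t = cong₂ _*_ (trans (cong₂ _*_ (trans (ℤₚ.neg-involutive _) (sgn-double t)) (cong (λ z → + 2 * (+ 2 + z) + + 1) (index t))) (signs (sgn t) (+ t)))
      (trans (cong (λ z → mono z (3 ℕ.* m)) (triangular (2 ℕ.+ t ℕ.* 3) (ω -[1+ t ]) (trans (2tri (2 ℕ.+ t ℕ.* 3)) (trans (cong (λ z → (+ 2 + z) * (+ 2 + z) + (+ 2 + z)) (index t))
        (trans (expand (+ t)) (cong (λ z → + 3 * z) (sym (2ω -[1+ t ])))))))) (at-*3 (ω -[1+ t ]) m (+ 1)))
      where
      signs : ∀ s t → s * (+ 2 * (+ 2 + + 3 * t) + + 1) ≡ - s * (+ 6 * (- (+ 1 + t)) + + 1)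
      signs = solve-∀
      expand : ∀ t → (+ 2 + + 3 * t) * (+ 2 + + 3 * t) + (+ 2 + + 3 * t) ≡ + 3 * (+ 3 * (- (+ 1 + t)) * (- (+ 1 + t)) + (- (+ 1 + t)))
      expand = solve-∀

    -- Indices up to 3 B + 2 reach -(B + 1) on the negative side but only B on the positive one; the
    -- extra term completes the symmetric range.
    by-residues : ∀ B → sumTo (jacobi-term (3 ℕ.* m)) (2 ℕ.+ B ℕ.* 3) + u (+ suc B) ≡ sumℤ (suc B) u
    by-residues zero    = trans (cong (_+ u (+ 1)) (cong₂ _+_ (cong₂ _+_ (residue-0 0) (residue-1 0)) (residue-2 0))) (regroup (u (+ 0)) _ _)
      where
      regroup : ∀ x y z → x + + 0 + y + z ≡ x + (z + y)
      regroup = solve-∀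
    by-residues (suc B) = trans (cong (_+ u (+ suc (suc B))) (cong₂ _+_ (cong₂ _+_ (cong (λ z → sumTo (jacobi-term (3 ℕ.* m)) (2 ℕ.+ B ℕ.* 3) + z) (residue-0 (suc B))) (residue-1 (suc B))) (residue-2 (suc B))))
      (trans (regroup (sumTo (jacobi-term (3 ℕ.* m)) (2 ℕ.+ B ℕ.* 3)) (u (+ suc B)) (u -[1+ suc B ]) (u (+ suc (suc B))))
      (cong (_+ (u (+ suc (suc B)) + u -[1+ suc B ])) (by-residues B)))
      where
      regroup : ∀ s x y z → s + x + + 0 + y + z ≡ s + x + (z + y)
      regroup = solve-∀

    cube-section : (E ⊗ (E ⊗ E)) (3 ℕ.* m) ≡ sumℤ m u
    cube-section = trans (jacobi k) (trans (sym (trans (cong (sumTo (jacobi-term k)) (sym (bound-split k)))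
        (sumTo-extend (jacobi-term k) (k ℕ.+ suc k) (2 ℕ.+ (k ℕ.+ suc k) ℕ.* 2) (λ i p → jacobi-term-vanish k i (ℕₚ.≤-<-trans (ℕₚ.m≤m+n k (suc k)) p)))))
      (trans (sym (trans (cong (λ z → sumTo (jacobi-term k) (2 ℕ.+ (k ℕ.+ suc k) ℕ.* 3) + z) (u-supported (+ suc (k ℕ.+ suc k)) (s≤s m≤M))) (ℤₚ.+-identityʳ _)))
      (trans (by-residues (k ℕ.+ suc k)) (sumℤ-extend u (suc (k ℕ.+ suc k)) u-supported (ℕₚ.≤-trans m≤M (ℕₚ.n≤1+n _))))))
      where
      k = 3 ℕ.* m
      bound-split : ∀ k → 2 ℕ.+ (k ℕ.+ suc k) ℕ.* 2 ℕ.+ (k ℕ.+ suc k) ≡ 2 ℕ.+ (k ℕ.+ suc k) ℕ.* 3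
      bound-split = ℕ-Solver.solve-∀
      m≤M : m ℕ.≤ k ℕ.+ suc k
      m≤M = ℕₚ.≤-trans (ℕₚ.m≤n*m m 3) (ℕₚ.m≤m+n k (suc k))

    derivative-section : E m + + 6 * (E ⊗ s₀) m ≡ sumℤ m u
    derivative-section = trans (cong₂ (λ x y → x + + 6 * y) (E-expansion m m ℕₚ.≤-refl) (Es₀-expansion m m ℕₚ.≤-refl))
      (trans (cong (λ z → sumℤ (cutoff m) (λ i → par i * mono (ω i) m) + z) (sym (sumℤ-*ˡ (cutoff m) (+ 6) (λ i → par i * i * mono (ω i) m))))
      (trans (sym (sumℤ-+ (cutoff m) _ _)) (trans (sumℤ-cong (cutoff m) (λ i _ → combine (par i) i (mono (ω i) m)))
      (sumℤ-extend u (cutoff m) u-supported (ℕₚ.≤-trans (ℕₚ.m≤m+n m (suc m)) (ℕₚ.n≤1+n _))))))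
      where
      combine : ∀ p i w → p * w + + 6 * (p * i * w) ≡ p * (+ 6 * i + + 1) * w
      combine = solve-∀

  -- Multiplied by E, both sides have as m-th coefficient that of E³ at 3 m: the left by the
  -- lattice, the right because E + 6 E s₀ has the weights 6 i + 1 on pentagonal exponents.
  a-lambert : a ≈ₚ 1ₚ ⊕ (+ 6) · s₀
  a-lambert = ⊗-cancelʳ a (1ₚ ⊕ (+ 6) · s₀) E refl (λ m → trans (lattice-identity m) (trans (Section.cube-section m)
    (trans (sym (Section.derivative-section m)) (sym (trans (⊗-distribʳ E 1ₚ ((+ 6) · s₀) m)
      (cong₂ _+_ (⊗-identityˡ E m) (trans (·-⊗ (+ 6) s₀ E m) (cong (λ z → + 6 * z) (⊗-comm s₀ E m)))))))))

-- The derivation θ and the substitution of q^d for q.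

module EulerDerivation where
  open Defs
  open PowerSeries
  open FiniteSums
  open DivisorSums
  open LambertSeries
  open EulerFunction
  open SummationRanges
  open import Data.Integer using (_+_; _*_)
  open import Data.Nat.DivMod using (_/_; _%_; m≡m%n+[m/n]*n; m*n/n≡m; m*n%n≡0)
  open ≡

  open Summation

  θ-cong : ∀ {f g} → f ≈ₚ g → θ f ≈ₚ θ g
  θ-cong e n = cong (+ n *_) (e n)

  θ-⊕ : ∀ f g → θ (f ⊕ g) ≈ₚ θ f ⊕ θ g
  θ-⊕ f g n = ℤₚ.*-distribˡ-+ (+ n) (f n) (g n)

  θ-const : ∀ c → θ (const c) ≈ₚ 0ₚ
  θ-const c zero    = refl
  θ-const c (suc n) = ℤₚ.*-zeroʳ (+ suc n)

  θ-⊗ : ∀ f g → θ (f ⊗ g) ≈ₚ θ f ⊗ g ⊕ f ⊗ θ g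
  θ-⊗ f g n = trans (sym (sumTo-*ˡ (+ n) (λ k → f k * g (n ℕ.∸ k)) n)) (trans
    (sumTo-cong n (λ k k≤n → trans (cong (λ z → + z * (f k * g (n ℕ.∸ k))) (sym (ℕₚ.m+[n∸m]≡n k≤n))) (distribute (+ k) (+ (n ℕ.∸ k)) (f k) (g (n ℕ.∸ k)))))
    (sumTo-+ (λ k → + k * f k * g (n ℕ.∸ k)) (λ k → f k * (+ (n ℕ.∸ k) * g (n ℕ.∸ k))) n))
    where
    distribute : ∀ k l x y → (k + l) * (x * y) ≡ k * x * y + x * (l * y)
    distribute = solve-∀

  θ-mono : ∀ c → θ (mono c) ≈ₚ (+ c) · mono c
  θ-mono c n = trans (sym (at-*ˡ c n (+ n) (+ 1))) (trans (sym (at-subst c n (λ m → + m * + 1))) (at-*ˡ c n (+ c) (+ 1)))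

  range : ℕ → Summation ℕ
  range B = record { sum = λ h → sumTo h B ; sum-cong = λ e → sumTo-cong B (λ k _ → e k) ; sum-+ = λ g h → sumTo-+ g h B ; sum-*ˡ = λ c h → sumTo-*ˡ c h B }

  sumTo-pick : ∀ N m (f : ℕ → ℤ) → m ℕ.≤ N → sumTo (λ k → f k * mono k m) N ≡ f m
  sumTo-pick zero    zero f m≤N = ℤₚ.*-identityʳ (f 0)
  sumTo-pick (suc N) m f m≤N with ℕₚ.m≤n⇒m<n∨m≡n m≤N
  ... | inj₁ (s≤s m≤N′) = trans (cong₂ _+_ (sumTo-pick N m f m≤N′) (trans (cong (f (suc N) *_) (at-> (+ 1) (s≤s m≤N′))) (ℤₚ.*-zeroʳ (f (suc N)))))
                            (ℤₚ.+-identityʳ (f m))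
  ... | inj₂ refl = trans (cong₂ _+_ (sumTo-zero _ N (λ k k≤N → trans (cong (f k *_) (at-< (+ 1) (s≤s k≤N))) (ℤₚ.*-zeroʳ (f k))))
      (trans (cong (f (suc N) *_) (at-diag (suc N) (+ 1))) (ℤₚ.*-identityʳ (f (suc N))))) (ℤₚ.+-identityˡ (f (suc N)))

  PS-expansion : ∀ B f → Expansion (range B) f (λ i → i) B f
  PS-expansion B f k k≤B = sym (sumTo-pick B k f k≤B)

  at-*-cancel : ∀ d m n h → at (suc d ℕ.* m) (suc d ℕ.* n) h ≡ at m n h
  at-*-cancel d zero    zero    h = cong₂ (λ u v → at u v h) (ℕₚ.*-zeroʳ d) (ℕₚ.*-zeroʳ d)
  at-*-cancel d zero    (suc n) h = cong (λ u → at u (suc d ℕ.* suc n) h) (ℕₚ.*-zeroʳ d)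
  at-*-cancel d (suc m) zero    h = cong (λ u → at (suc d ℕ.* suc m) u h) (ℕₚ.*-zeroʳ d)
  at-*-cancel d (suc m) (suc n) h = trans (cong₂ (λ u v → at u v h) (ℕₚ.*-suc (suc d) m) (ℕₚ.*-suc (suc d) n))
    (trans (at-+-cancel (suc d) (suc d ℕ.* m) (suc d ℕ.* n) h) (at-*-cancel d m n h))

  module _ (d′ : ℕ) where
    private
      d : ℕ
      d = suc d′

    scale-* : ∀ f m → scale d f (d ℕ.* m) ≡ f m
    scale-* f m = trans (cong₂ (λ u v → if u ≡ᵇ 0 then f v else + 0)
      (trans (cong (_% d) (ℕₚ.*-comm d m)) (m*n%n≡0 m d)) (trans (cong (_/ d) (ℕₚ.*-comm d m)) (m*n/n≡m m d))) refl

    -- A description of the substitution without quotient and remainder. Compatibility with products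
    -- and with θ is read off from it.
    scale-expansion : ∀ B f → Expansion (range B) f (d ℕ.*_) B (scale d f)
    scale-expansion B f n n≤B with n % d in eq
    ... | zero = trans (sym (sumTo-pick B (n / d) f (ℕₚ.≤-trans (ℕₚ.≤-trans (ℕₚ.m≤n*m (n / d) d) (ℕₚ.≤-reflexive (sym n≡d*q))) n≤B)))
        (sumTo-cong B (λ i _ → cong (f i *_) (trans (sym (at-*-cancel d′ i (n / d) (+ 1))) (cong (λ z → mono (d ℕ.* i) z) (sym n≡d*q)))))
      where
      n≡d*q : n ≡ d ℕ.* (n / d)
      n≡d*q = trans (m≡m%n+[m/n]*n n d) (trans (cong (ℕ._+ (n / d) ℕ.* d) eq) (ℕₚ.*-comm (n / d) d))
    ... | suc r = sym (sumTo-zero _ B (λ i _ → trans (cong (f i *_) (off i)) (ℤₚ.*-zeroʳ (f i))))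
      where
      off : ∀ i → mono (d ℕ.* i) n ≡ + 0
      off i with d ℕ.* i ℕ.≟ n
      ... | yes e = case-impossible (trans (sym eq) (trans (cong (_% d) (trans (sym e) (ℕₚ.*-comm d i))) (m*n%n≡0 i d)))
        where
        case-impossible : ∀ {x} → suc x ≡ 0 → mono (d ℕ.* i) n ≡ + 0
        case-impossible ()
      ... | no ¬e = at-≢ (+ 1) ¬e

    scale-cong : ∀ {f g} → f ≈ₚ g → scale d f ≈ₚ scale d g
    scale-cong e n with n % d ≡ᵇ 0
    ... | true  = e (n / d)
    ... | false = refl

    scale-⊕ : ∀ f g → scale d (f ⊕ g) ≈ₚ scale d f ⊕ scale d g
    scale-⊕ f g n with n % d ≡ᵇ 0
    ... | true  = refl
    ... | false = refl

    scale-⊖ : ∀ f g → scale d (f ⊖ g) ≈ₚ scale d f ⊖ scale d g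
    scale-⊖ f g n with n % d ≡ᵇ 0
    ... | true  = refl
    ... | false = refl

    scale-· : ∀ c f → scale d (c · f) ≈ₚ c · scale d f
    scale-· c f n with n % d ≡ᵇ 0
    ... | true  = refl
    ... | false = sym (ℤₚ.*-zeroʳ c)

    scale-mono : ∀ c → scale d (mono c) ≈ₚ mono (d ℕ.* c)
    scale-mono c n = trans (scale-expansion (n ℕ.+ c) (mono c) n (ℕₚ.m≤m+n n c))
      (trans (sumTo-cong (n ℕ.+ c) (λ i _ → trans (ℤₚ.*-comm (mono c i) (mono (d ℕ.* i) n)) (cong (mono (d ℕ.* i) n *_) (at-sym c i (+ 1)))))
      (sumTo-pick (n ℕ.+ c) c (λ i → mono (d ℕ.* i) n) (ℕₚ.m≤n+m c n)))

    scale-const : ∀ c → scale d (const c) ≈ₚ const c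
    scale-const c zero = trans (cong (scale d (const c)) (sym (ℕₚ.*-zeroʳ d))) (scale-* (const c) 0)
    scale-const c (suc n) = trans (scale-expansion (suc n) (const c) (suc n) ℕₚ.≤-refl) (trans (sumTo-head (λ i → const c i * mono (d ℕ.* i) (suc n)) n)
      (trans (cong₂ (λ u v → c * u + v) (trans (cong (λ z → mono z (suc n)) (ℕₚ.*-zeroʳ d)) refl) (sumTo-zero _ n (λ k _ → ℤₚ.*-zeroˡ (mono (d ℕ.* suc k) (suc n))))) (trans (ℤₚ.+-identityʳ _) (ℤₚ.*-zeroʳ c))))

    scale-⊗ : ∀ f g → scale d (f ⊗ g) ≈ₚ scale d f ⊗ scale d g
    scale-⊗ f g n = trans (scale-expansion n (f ⊗ g) n ℕₚ.≤-refl) (trans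
      (sumTo-cong n (λ i i≤n → trans (cong (_* mono (d ℕ.* i) n)
        (Expansion-⊗ (range n) (range n) f (λ i → i) g (λ i → i) (PS-expansion n f) (PS-expansion n g) i i≤n))
        (sym (sum-*ʳ (range n ⊗ₛ range n) (mono (d ℕ.* i) n) (λ p → f (proj₁ p) * g (proj₂ p) * mono (proj₁ p ℕ.+ proj₂ p) i)))))
      (trans (sumTo-sum (range n ⊗ₛ range n) (λ i p → f (proj₁ p) * g (proj₂ p) * mono (proj₁ p ℕ.+ proj₂ p) i * mono (d ℕ.* i) n) n)
      (trans (sumTo-cong n (λ j _ → sumTo-cong n (λ k _ → collapse (f j * g k) (j ℕ.+ k))))
      (sym (Expansion-⊗ (range n) (range n) f (d ℕ.*_) g (d ℕ.*_) (scale-expansion n f) (scale-expansion n g) n ℕₚ.≤-refl)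
        ▹ λ j k → cong (λ z → f j * g k * mono z n) (ℕₚ.*-distribˡ-+ d j k)))))
      where
      collapse : ∀ w m → sumTo (λ i → w * mono m i * mono (d ℕ.* i) n) n ≡ w * mono (d ℕ.* m) n
      collapse w m = trans (sumTo-cong n (λ i _ → ℤₚ.*-assoc w (mono m i) _)) (trans (sumTo-*ˡ w _ n)
        (cong (w *_) (trans (sym (scale-expansion n (mono m) n ℕₚ.≤-refl)) (scale-mono m n))))
      _▹_ : ∀ {w : ℕ → ℕ → ℤ} {w′ : ℕ → ℕ → ℤ} {r} → sumTo (λ j → sumTo (w j) n) n ≡ r → (∀ j k → w′ j k ≡ w j k) → sumTo (λ j → sumTo (w′ j) n) n ≡ r
      p ▹ e = trans (sumTo-cong n (λ j _ → sumTo-cong n (λ k _ → e j k))) p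

    θ-scale : ∀ f → θ (scale d f) ≈ₚ (+ d) · scale d (θ f)
    θ-scale f n = trans (cong (+ n *_) (scale-expansion n f n ℕₚ.≤-refl)) (trans (sym (sumTo-*ˡ (+ n) _ n))
      (trans (sumTo-cong n (λ i _ → term i)) (trans (sumTo-*ˡ (+ d) _ n) (cong (+ d *_) (sym (scale-expansion n (θ f) n ℕₚ.≤-refl))))))
      where
      regroup : ∀ f d i m → f * (d * i * m) ≡ d * (i * f * m)
      regroup = solve-∀
      swap : ∀ n f m → n * (f * m) ≡ f * (n * m)
      swap = solve-∀
      term : ∀ i → + n * (f i * mono (d ℕ.* i) n) ≡ + d * (+ i * f i * mono (d ℕ.* i) n)
      term i = trans (swap (+ n) (f i) _) (trans (cong (f i *_) (trans (θ-mono (d ℕ.* i) n) (cong (_* mono (d ℕ.* i) n) (ℤₚ.pos-* d i))))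
        (regroup (f i) (+ d) (+ i) (mono (d ℕ.* i) n)))

-- Logarithmic derivatives of Euler products.

module LogarithmicDerivative where
  open Defs
  open PowerSeries
  open FiniteSums
  open DivisorSums
  open Residues
  open LambertSeries
  open RingIdentities
  open DualNumbersAndTruncation using (⊗-cong-mod; PS-ι)
  open EulerFunction
  open EulerDerivation

  module Logarithmic {c ℓ} (R : CommutativeRing c ℓ)
    (ι : ℤ-rawRing -Raw-AlmostCommutative⟶ fromCommutativeRing R) where
    open CommutativeRing R hiding (zero)
    open RingSolver R ι using (solve; con; _:=_; _:+_; _:*_; :-_; _:-_)
    open _-Raw-AlmostCommutative⟶_ ι using () renaming (⟦_⟧ to int)

    log-step : ∀ {P dP O dO L m g} c → dP ≈ - (P * L) → dO ≈ - (int c * m) → O * g ≈ m →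
      dP * O + P * dO ≈ - (P * O * (L + int c * g))
    log-step {P} {dP} {O} {dO} {L} {m} {g} c e₁ e₂ e₃ = trans (+-cong (*-congʳ e₁) (*-congˡ (trans e₂ (-‿cong (*-congˡ (sym e₃))))))
      (solve 5 (λ P L O c g → (:- (P :* L)) :* O :+ P :* (:- (c :* (O :* g))) := :- (P :* O :* (L :+ c :* g))) refl P L O (int c) g)

    -- The relation Q e e′ = f f′ is differentiated in place of the quotient, and the inverse j of e
    -- e′ isolates dQ.
    log-quotient : ∀ {e e′ f f′ L L′ M M′ de de′ df df′ dQ Q j} → 
      de ≈ - (e * L) → de′ ≈ - (e′ * L′) → df ≈ - (f * M) → df′ ≈ - (f′ * M′) →
      dQ * (e * e′) + Q * (de * e′ + e * de′) ≈ df * f′ + f * df′ → Q * (e * e′) ≈ f * f′ → e * e′ * j ≈ 1# →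
      dQ ≈ Q * ((L - M) + (L′ - M′))
    log-quotient {e} {e′} {f} {f′} {L} {L′} {M} {M′} {de} {de′} {df} {df′} {dQ} {Q} {j} h₁ h₂ h₃ h₄ leibniz quotient unit = begin
      dQ
        ≈⟨ trans (*-congˡ unit) (*-identityʳ dQ) ⟨
      dQ * (e * e′ * j)
        ≈⟨ solve 6 (λ dQ e e′ j Q w → dQ :* (e :* e′ :* j) := (dQ :* (e :* e′) :+ Q :* w) :* j :+ (:- (Q :* w :* j))) refl dQ e e′ j Q (de * e′ + e * de′) ⟩
      (dQ * (e * e′) + Q * (de * e′ + e * de′)) * j + (- (Q * (de * e′ + e * de′) * j))
        ≈⟨ +-cong (*-congʳ (trans leibniz (+-cong (*-congʳ h₃) (*-congˡ h₄)))) (-‿cong (*-congʳ (*-congˡ (+-cong (*-congʳ h₁) (*-congˡ h₂))))) ⟩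
      (- (f * M) * f′ + f * - (f′ * M′)) * j + (- (Q * (- (e * L) * e′ + e * - (e′ * L′)) * j))
        ≈⟨ solve 10 (λ f f′ M M′ j Q e e′ L L′ → ((:- (f :* M)) :* f′ :+ f :* (:- (f′ :* M′))) :* j :+ (:- (Q :* ((:- (e :* L)) :* e′ :+ e :* (:- (e′ :* L′))) :* j))
              := (:- (f :* f′ :* j :* (M :+ M′))) :+ Q :* (e :* e′ :* j) :* (L :+ L′)) refl f f′ M M′ j Q e e′ L L′ ⟩
      - (f * f′ * j * (M + M′)) + Q * (e * e′ * j) * (L + L′)
        ≈⟨ +-congʳ (-‿cong (*-congʳ (*-congʳ quotient))) ⟨
      - (Q * (e * e′) * j * (M + M′)) + Q * (e * e′ * j) * (L + L′)
        ≈⟨ solve 8 (λ Q e e′ j L L′ M M′ → (:- (Q :* (e :* e′) :* j :* (M :+ M′))) :+ Q :* (e :* e′ :* j) :* (L :+ L′)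
              := Q :* ((L :- M) :+ (L′ :- M′)) :* (e :* e′ :* j)) refl Q e e′ j L L′ M M′ ⟩
      Q * ((L - M) + (L′ - M′)) * (e * e′ * j)
        ≈⟨ trans (*-congˡ unit) (*-identityʳ _) ⟩
      Q * ((L - M) + (L′ - M′)) ∎
      where open import Relation.Binary.Reasoning.Setoid setoid

    log-power-step : ∀ {Q dQ P dP Z} k → dQ ≈ Q * Z → dP ≈ int k * (P * Z) → dQ * P + Q * dP ≈ int (+ 1 ℤ.+ k) * (Q * P * Z)
    log-power-step {Q} {dQ} {P} {dP} {Z} k e₁ e₂ = trans (+-cong (*-congʳ e₁) (*-congˡ e₂)) (trans
      (+-congʳ (trans (sym (*-identityˡ _)) (*-congʳ (sym 1-homo))))
      (trans (solve 5 (λ Q P Z k o → o :* (Q :* Z :* P) :+ Q :* (k :* (P :* Z)) := (o :+ k) :* (Q :* P :* Z)) refl Q P Z (int k) (int (+ 1)))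
      (*-congʳ (sym (+-homo (+ 1) k)))))
      where open _-Raw-AlmostCommutative⟶_ ι

    -- The exponent k is right because (1 + L) k = 12 is the constant in a² = 1 + 12 W: the summand
    -- 1 + L from the factor X and 12 (W + L W′) from the power combine to U + L V.
    hauptmodul-step : ∀ {X dX P dP Z U V W W′} k L → dX ≈ X → dP ≈ int k * (P * Z) → Z ≈ W + int L * W′ → 
      U ≈ int (+ 1) + int (+ 12) * W → V ≈ int (+ 1) + int (+ 12) * W′ → (+ 1 ℤ.+ L) ℤ.* k ≡ + 12 →
      int (+ 1 ℤ.+ L) * (dX * P + X * dP) ≈ X * P * (U + int L * V)
    hauptmodul-step {X} {dX} {P} {dP} {Z} {U} {V} {W} {W′} k L e₁ e₂ e₃ e₄ e₅ e₆ = trans (*-congˡ (+-cong (*-congʳ e₁) (*-congˡ (trans e₂ (*-congˡ (*-congˡ e₃))))))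
      (trans (*-congʳ (+-homo (+ 1) L)) (trans (solve 6 (λ X P W W′ k l → (con (+ 1) :+ l) :* (X :* P :+ X :* (k :* (P :* (W :+ l :* W′)))) :=
          X :* P :* ((con (+ 1) :+ l) :+ (con (+ 1) :+ l) :* k :* (W :+ l :* W′))) refl X P W W′ (int k) (int L))
        (trans (*-congˡ (+-congˡ (*-congʳ (trans (*-congʳ (sym (+-homo (+ 1) L))) (trans (sym (*-homo (+ 1 ℤ.+ L) k)) (reflexive (≡.cong int e₆)))))))
        (trans (solve 5 (λ X P W W′ l → X :* P :* ((con (+ 1) :+ l) :+ con (+ 12) :* (W :+ l :* W′)) := X :* P :* ((con (+ 1) :+ con (+ 12) :* W) :+ l :* (con (+ 1) :+ con (+ 12) :* W′)))
          refl X P W W′ (int L)) (*-congˡ (+-cong (sym e₄) (*-congˡ (sym e₅))))))))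
      where open _-Raw-AlmostCommutative⟶_ ι

  open Logarithmic PS-commutativeRing PS-ι

  private
    module P = CommutativeRing PS-commutativeRing

  -- Partial sums of Σ c q^c/(1 - q^c) over the multiples c of m, the negative logarithmic
  -- derivative of `euler m`.
  logSum : ℕ → ℕ → PS
  logSum m zero    = 0ₚ
  logSum m (suc K) = logSum m K ⊕ const (+ (m ℕ.* suc K)) ⊗ geo (m ℕ.* suc K)

  logSeries : ℕ → PS
  logSeries m n = logSum m n n

  θ-prodTo : ∀ m K → θ (prodTo (suc m) K) ≈ₚ neg (prodTo (suc m) K ⊗ logSum (suc m) K)
  θ-prodTo m zero    n = ≡.trans (θ-const (+ 1) n) (≡.sym (≡.cong ℤ.-_ (P.zeroʳ 1ₚ n)))
  θ-prodTo m (suc K) n = ≡.trans (θ-⊗ (prodTo (suc m) K) (oneMinusXpow (suc m ℕ.* suc K)) n)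
    (log-step {prodTo (suc m) K} {θ (prodTo (suc m) K)} {oneMinusXpow c} {θ (oneMinusXpow c)} {logSum (suc m) K} {mono c} {geo c} (+ c)
      (θ-prodTo m K) θ-factor (λ k → ≡.trans (⊗-cong {g = geo c} (oneMinusXpow-mono (K ℕ.+ m ℕ.* suc K)) (λ _ → ≡.refl) k) (geo-product (K ℕ.+ m ℕ.* suc K) k)) n)
    where
    c : ℕ
    c = suc m ℕ.* suc K
    θ-factor : θ (oneMinusXpow c) ≈ₚ neg (const (+ c) ⊗ mono c)
    θ-factor k = ≡.trans (θ-cong (oneMinusXpow-mono (K ℕ.+ m ℕ.* suc K)) k) (≡.trans (expand (+ k) (1ₚ k) (mono c k))
      (≡.trans (≡.cong₂ (λ x y → x ℤ.- y) (θ-const (+ 1) k) (≡.trans (θ-mono c k) (≡.sym (const-⊗ (+ c) (mono c) k)))) (ℤₚ.+-identityˡ _)))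
      where
      expand : ∀ k x y → k ℤ.* (x ℤ.- y) ≡ k ℤ.* x ℤ.- k ℤ.* y
      expand = solve-∀

  geo-vanish : ∀ {c k} → k ℕ.< c → geo c k ≡ + 0
  geo-vanish {c} {k} k<c = ∑-zero k _ (λ a 1≤a _ → at-> (+ 1) (ℕₚ.<-≤-trans k<c (m≤n*m c 1≤a)))

  logSum-stable : ∀ m k j → logSum (suc m) (j ℕ.+ k) k ≡ logSum (suc m) k k
  logSum-stable m k zero    = ≡.refl
  logSum-stable m k (suc j) = ≡.trans (≡.cong₂ ℤ._+_ (logSum-stable m k j) (≡.trans (const-⊗ (+ c) (geo c) k)
      (≡.trans (≡.cong (+ c ℤ.*_) (geo-vanish (ℕₚ.<-≤-trans (s≤s (ℕₚ.m≤n+m k j)) (ℕₚ.m≤n*m (suc (j ℕ.+ k)) (suc m))))) (ℤₚ.*-zeroʳ (+ c))))) (ℤₚ.+-identityʳ _)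
    where
    c : ℕ
    c = suc m ℕ.* suc (j ℕ.+ k)

  logSum-limit : ∀ m n K → n ℕ.≤ K → logSum (suc m) K n ≡ logSeries (suc m) n
  logSum-limit m n K n≤K = ≡.trans (≡.cong (λ z → logSum (suc m) z n) (≡.sym (ℕₚ.m∸n+n≡m n≤K))) (logSum-stable m n (K ℕ.∸ n))

  θ-euler : ∀ m → θ (euler (suc m)) ≈ₚ neg (euler (suc m) ⊗ logSeries (suc m))
  θ-euler m n = ≡.trans (θ-prodTo m n n) (≡.cong ℤ.-_ (⊗-cong-mod {n} {prodTo (suc m) n} {euler (suc m)}
    (λ k k≤n → ≡.sym (euler-prodTo m n n ℕₚ.≤-refl k k≤n)) (λ k k≤n → logSum-limit m k n k≤n) n ℕₚ.≤-refl))

  -- The summands at multiples of 3, which ν removes, are exactly those of `logSeries 3`.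
  logSeries-difference : Λ (λ a x → + x ℤ.* ν x) ≈ₚ logSeries 1 ⊖ logSeries 3
  logSeries-difference n = ≡.trans lambert (≡.trans (≡.sym (∑-bound (λ x → + x ℤ.* ν x ℤ.* geo x n) (ℕₚ.m≤m*n n 3)
        (λ x n<x → ≡.trans (≡.cong (+ x ℤ.* ν x ℤ.*_) (geo-vanish n<x)) (ℤₚ.*-zeroʳ (+ x ℤ.* ν x)))))
      (≡.trans (by-residues n) (≡.cong (λ z → z ℤ.- logSum 3 n n) (logSum-limit 0 n (n ℕ.* 3) (ℕₚ.m≤m*n n 3)))))
    where
    lambert : Λ (λ a x → + x ℤ.* ν x) n ≡ ∑ n (λ x → + x ℤ.* ν x ℤ.* geo x n)
    lambert = ≡.trans (∑-swap n n _) (∑-ext n (λ x → ≡.trans (∑-ext n (λ a → at-mono (a ℕ.* x) n (+ x ℤ.* ν x))) (∑-*ˡ n (+ x ℤ.* ν x) _)))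
    by-residues : ∀ N → ∑ (N ℕ.* 3) (λ x → + x ℤ.* ν x ℤ.* geo x n) ≡ logSum 1 (N ℕ.* 3) n ℤ.- logSum 3 N n
    by-residues zero    = ≡.refl
    by-residues (suc N) = ≡.trans
      (≡.cong₂ ℤ._+_ (≡.cong₂ ℤ._+_ (≡.cong₂ ℤ._+_ (by-residues N)
          (≡.cong (λ z → + (1 ℕ.+ N ℕ.* 3) ℤ.* z ℤ.* geo (1 ℕ.+ N ℕ.* 3) n) (ν-1 N)))
          (≡.cong (λ z → + (2 ℕ.+ N ℕ.* 3) ℤ.* z ℤ.* geo (2 ℕ.+ N ℕ.* 3) n) (ν-2 N)))
          (≡.cong (λ z → + (3 ℕ.+ N ℕ.* 3) ℤ.* z ℤ.* geo (3 ℕ.+ N ℕ.* 3) n) (ν-0 N)))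
      (≡.trans (regroup (logSum 1 (N ℕ.* 3) n) (logSum 3 N n) (+ (1 ℕ.+ N ℕ.* 3)) (geo (1 ℕ.+ N ℕ.* 3) n) (+ (2 ℕ.+ N ℕ.* 3)) (geo (2 ℕ.+ N ℕ.* 3) n)
          (+ (3 ℕ.+ N ℕ.* 3)) (geo (3 ℕ.+ N ℕ.* 3) n))
      (≡.cong₂ ℤ._-_ (≡.cong₂ ℤ._+_ (≡.cong₂ ℤ._+_ (≡.cong (λ z → logSum 1 (N ℕ.* 3) n ℤ.+ z) (one-term (N ℕ.* 3))) (one-term (1 ℕ.+ N ℕ.* 3))) (one-term (2 ℕ.+ N ℕ.* 3)))
        (≡.cong (λ z → logSum 3 N n ℤ.+ z) (≡.trans (≡.cong (λ z → + z ℤ.* geo z n) (≡.trans (ℕₚ.*-comm (suc N) 3) ≡.refl)) (≡.sym (const-⊗ (+ (3 ℕ.* suc N)) (geo (3 ℕ.* suc N)) n))))))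
      where
      regroup : ∀ L M a x b y c z → L ℤ.- M ℤ.+ a ℤ.* + 1 ℤ.* x ℤ.+ b ℤ.* + 1 ℤ.* y ℤ.+ c ℤ.* + 0 ℤ.* z ≡ (L ℤ.+ a ℤ.* x ℤ.+ b ℤ.* y ℤ.+ c ℤ.* z) ℤ.- (M ℤ.+ c ℤ.* z)
      regroup = solve-∀
      one-term : ∀ k → + suc k ℤ.* geo (suc k) n ≡ (const (+ (1 ℕ.* suc k)) ⊗ geo (1 ℕ.* suc k)) n
      one-term k = ≡.trans (≡.cong (λ z → + z ℤ.* geo z n) (≡.sym (ℕₚ.*-identityˡ (suc k)))) (≡.sym (const-⊗ (+ (1 ℕ.* suc k)) (geo (1 ℕ.* suc k)) n))
      ν-0 : ∀ m → ν (3 ℕ.+ m ℕ.* 3) ≡ + 0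
      ν-0 zero    = ≡.refl
      ν-0 (suc m) = ν-0 m
      ν-1 : ∀ m → ν (1 ℕ.+ m ℕ.* 3) ≡ + 1
      ν-1 zero    = ≡.refl
      ν-1 (suc m) = ν-1 m
      ν-2 : ∀ m → ν (2 ℕ.+ m ℕ.* 3) ≡ + 1
      ν-2 zero    = ≡.refl
      ν-2 (suc m) = ν-2 m

-- The system for a, p, K, its scaled copy, and the derivative of H.

module CubicSystem where
  open Defs
  open PowerSeries
  open Inverse
  open DivisorSums
  open Residues
  open LambertSeries
  open RingIdentities
  open DualNumbersAndTruncation using (PS-ι)
  open EulerFunction
  open LambertExpansion using (a-lambert)
  open EulerDerivation
  open LogarithmicDerivative
  open import Data.Nat.DivMod using (_/_; _%_; m/n≤m)

  module CubicTheta {c ℓ} (R : CommutativeRing c ℓ)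
    (ι : ℤ-rawRing -Raw-AlmostCommutative⟶ fromCommutativeRing R) where
    open CommutativeRing R hiding (zero)
    open RingSolver R ι using (solve; con; _:=_; _:+_; _:*_; :-_; _:-_)
    open _-Raw-AlmostCommutative⟶_ ι using () renaming (⟦_⟧ to int)

    module _ {a s p K : Carrier} (a≈ : a ≈ int (+ 1) + int (+ 6) * s) where
      square : ∀ {W} → int (+ 3) * (s * s) + s ≈ W → a * a ≈ int (+ 1) + int (+ 12) * W
      square e = trans (*-cong a≈ a≈) (trans (solve 1 (λ s → (con (+ 1) :+ con (+ 6) :* s) :* (con (+ 1) :+ con (+ 6) :* s) :=
        con (+ 1) :+ con (+ 12) :* (con (+ 3) :* (s :* s) :+ s)) refl s) (+-congˡ (*-congˡ e)))

      derivative-a : ∀ {da ds} → da ≈ int (+ 6) * ds → int (+ 2) * ds ≈ int (+ 3) * K - int (+ 6) * (s * p) - p → da ≈ int (+ 9) * K - int (+ 3) * (p * a)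
      derivative-a {da} {ds} e e′ = trans e (trans (solve 1 (λ ds → con (+ 6) :* ds := con (+ 3) :* (con (+ 2) :* ds)) refl ds)
        (trans (*-congˡ e′) (trans (solve 3 (λ s p K → con (+ 3) :* (con (+ 3) :* K :- con (+ 6) :* (s :* p) :- p) := con (+ 9) :* K :- con (+ 3) :* (p :* (con (+ 1) :+ con (+ 6) :* s))) refl s p K)
        (+-congˡ (-‿cong (*-congˡ (*-congˡ (sym a≈))))))))

      derivative-p : ∀ {dp} → dp ≈ int (+ 6) * (s * K) - int (+ 3) * (p * p) + K → dp ≈ a * K - int (+ 3) * (p * p)
      derivative-p e = trans e (trans (solve 3 (λ s p K → con (+ 6) :* (s :* K) :- con (+ 3) :* (p :* p) :+ K := (con (+ 1) :+ con (+ 6) :* s) :* K :- con (+ 3) :* (p :* p)) refl s p K)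
        (+-congʳ (*-congʳ (sym a≈))))

      derivative-K : ∀ {dK t} → t ≈ int (+ 6) * (s * K) + K → dK ≈ int (+ 6) * (s * t) - int (+ 9) * (p * K) + t → dK ≈ K * (a * a - int (+ 9) * p)
      derivative-K {dK} {t} e e′ = trans e′ (trans (+-cong (+-congʳ (*-congˡ (*-congˡ e))) e) (trans
        (solve 3 (λ s p K → con (+ 6) :* (s :* (con (+ 6) :* (s :* K) :+ K)) :- con (+ 9) :* (p :* K) :+ (con (+ 6) :* (s :* K) :+ K) :=
          K :* ((con (+ 1) :+ con (+ 6) :* s) :* (con (+ 1) :+ con (+ 6) :* s) :- con (+ 9) :* p)) refl s p K)
        (*-congˡ (+-congʳ (*-cong (sym a≈) (sym a≈))))))

  private
    module C₃ = CubicTheta PS-commutativeRing PS-ι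
    open Logarithmic PS-commutativeRing PS-ι

    c⊗ : ∀ c f n → c ℤ.* f n ≡ (const c ⊗ f) n
    c⊗ c f n = ≡.sym (const-⊗ c f n)

  a-s₀ : a ≈ₚ const (+ 1) ⊕ const (+ 6) ⊗ s₀
  a-s₀ n = ≡.trans (a-lambert n) (≡.cong (λ z → const (+ 1) n ℤ.+ z) (c⊗ (+ 6) s₀ n))

  weight2 : PS
  weight2 = Λ (λ a x → + x ℤ.* ν x)

  a-square : a ⊗ a ≈ₚ const (+ 1) ⊕ const (+ 12) ⊗ weight2
  a-square = C₃.square {a} {s₀} {s₁} {s₂} a-s₀ {weight2} (λ n → ≡.trans (≡.cong (ℤ._+ s₀ n) (const-⊗ (+ 3) (s₀ ⊗ s₀) n)) (square-identity n))

  θ-const-⊗ : ∀ c f → θ (const c ⊗ f) ≈ₚ const c ⊗ θ f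
  θ-const-⊗ c f n = ≡.trans (≡.cong (+ n ℤ.*_) (const-⊗ c f n)) (≡.trans (swap (+ n) c (f n)) (c⊗ c (θ f) n))
    where
    swap : ∀ n c x → n ℤ.* (c ℤ.* x) ≡ c ℤ.* (n ℤ.* x)
    swap = solve-∀

  θ-a : θ a ≈ₚ const (+ 9) ⊗ s₂ ⊖ const (+ 3) ⊗ (s₁ ⊗ a)
  θ-a = C₃.derivative-a {a} {s₀} {s₁} {s₂} a-s₀ {θ a} {θ s₀}
    (λ n → ≡.trans (θ-cong a-s₀ n) (≡.trans (θ-⊕ (const (+ 1)) (const (+ 6) ⊗ s₀) n)
      (≡.trans (≡.cong₂ ℤ._+_ (θ-const (+ 1) n) (θ-const-⊗ (+ 6) s₀ n)) (ℤₚ.+-identityˡ _))))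
    (λ n → ≡.trans (const-⊗ (+ 2) (θ s₀) n) (≡.trans (θs₀-heat n)
      (≡.cong₂ (λ x y → x ℤ.- y ℤ.- s₁ n) (c⊗ (+ 3) s₂ n) (c⊗ (+ 6) (s₀ ⊗ s₁) n))))

  θ-s₁ : θ s₁ ≈ₚ a ⊗ s₂ ⊖ const (+ 3) ⊗ (s₁ ⊗ s₁)
  θ-s₁ = C₃.derivative-p {a} {s₀} {s₁} {s₂} a-s₀ {θ s₁} (λ n → ≡.trans (θs₁-star n)
    (≡.cong₂ (λ x y → x ℤ.- y ℤ.+ s₂ n) (c⊗ (+ 6) (s₀ ⊗ s₂) n) (c⊗ (+ 3) (s₁ ⊗ s₁) n)))

  θ-s₂ : θ s₂ ≈ₚ s₂ ⊗ (a ⊗ a ⊖ const (+ 9) ⊗ s₁)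
  θ-s₂ = C₃.derivative-K {a} {s₀} {s₁} {s₂} a-s₀ {θ s₂} {s₃}
    (λ n → ≡.trans (s₃-product n) (≡.cong (ℤ._+ s₂ n) (c⊗ (+ 6) (s₀ ⊗ s₂) n)))
    (λ n → ≡.trans (θs₂-star n) (≡.cong₂ (λ x y → x ℤ.- y ℤ.+ s₃ n) (c⊗ (+ 6) (s₀ ⊗ s₃) n) (c⊗ (+ 9) (s₁ ⊗ s₂) n)))

  module Scaled (d′ : ℕ) where
    d : ℕ
    d = suc d′
    L : ℤ
    L = + d
    S : PS → PS
    S = scale d

    S-const-⊗ : ∀ c f → S (const c ⊗ f) ≈ₚ const c ⊗ S f
    S-const-⊗ c f n = ≡.trans (scale-⊗ d′ (const c) f n) (⊗-cong {g = S f} (scale-const d′ c) (λ _ → ≡.refl) n)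

    θ-S : ∀ f g → θ f ≈ₚ g → θ (S f) ≈ₚ const L ⊗ S g
    θ-S f g e n = ≡.trans (θ-scale d′ f n) (≡.trans (≡.cong (L ℤ.*_) (scale-cong d′ e n)) (c⊗ L (S g) n))

    θ-S-a : θ (S a) ≈ₚ const L ⊗ (const (+ 9) ⊗ S s₂ ⊖ const (+ 3) ⊗ (S s₁ ⊗ S a))
    θ-S-a n = ≡.trans (θ-S a _ θ-a n) (⊗-cong {const L} (λ _ → ≡.refl) (λ k → ≡.trans (scale-⊖ d′ (const (+ 9) ⊗ s₂) (const (+ 3) ⊗ (s₁ ⊗ a)) k)
      (≡.cong₂ ℤ._-_ (S-const-⊗ (+ 9) s₂ k) (≡.trans (S-const-⊗ (+ 3) (s₁ ⊗ a) k) (⊗-cong {const (+ 3)} (λ _ → ≡.refl) (scale-⊗ d′ s₁ a) k)))) n)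

    θ-S-s₁ : θ (S s₁) ≈ₚ const L ⊗ (S a ⊗ S s₂ ⊖ const (+ 3) ⊗ (S s₁ ⊗ S s₁))
    θ-S-s₁ n = ≡.trans (θ-S s₁ _ θ-s₁ n) (⊗-cong {const L} (λ _ → ≡.refl) (λ k → ≡.trans (scale-⊖ d′ (a ⊗ s₂) (const (+ 3) ⊗ (s₁ ⊗ s₁)) k)
      (≡.cong₂ ℤ._-_ (scale-⊗ d′ a s₂ k) (≡.trans (S-const-⊗ (+ 3) (s₁ ⊗ s₁) k) (⊗-cong {const (+ 3)} (λ _ → ≡.refl) (scale-⊗ d′ s₁ s₁) k)))) n)

    θ-S-s₂ : θ (S s₂) ≈ₚ const L ⊗ (S s₂ ⊗ (S a ⊗ S a ⊖ const (+ 9) ⊗ S s₁))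
    θ-S-s₂ n = ≡.trans (θ-S s₂ _ θ-s₂ n) (⊗-cong {const L} (λ _ → ≡.refl) (λ k → ≡.trans (scale-⊗ d′ s₂ (a ⊗ a ⊖ const (+ 9) ⊗ s₁) k)
      (⊗-cong {S s₂} (λ _ → ≡.refl) (λ i → ≡.trans (scale-⊖ d′ (a ⊗ a) (const (+ 9) ⊗ s₁) i) (≡.cong₂ ℤ._-_ (scale-⊗ d′ a a i) (S-const-⊗ (+ 9) s₁ i))) k)) n)

    S-a-square : S a ⊗ S a ≈ₚ const (+ 1) ⊕ const (+ 12) ⊗ S weight2
    S-a-square n = ≡.trans (≡.sym (scale-⊗ d′ a a n)) (≡.trans (scale-cong d′ a-square n) (≡.trans (scale-⊕ d′ (const (+ 1)) (const (+ 12) ⊗ weight2) n)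
      (≡.cong₂ ℤ._+_ (scale-const d′ (+ 1) n) (S-const-⊗ (+ 12) weight2 n))))

    oneMinusXpow-scale : ∀ c → oneMinusXpow (d ℕ.* suc c) ≈ₚ S (oneMinusXpow (suc c))
    oneMinusXpow-scale c n = ≡.trans (oneMinusXpow-mono _ n) (≡.sym (≡.trans (scale-cong d′ (oneMinusXpow-mono c) n) (≡.trans (scale-⊖ d′ 1ₚ (mono (suc c)) n)
      (≡.cong₂ ℤ._-_ (scale-const d′ (+ 1) n) (scale-mono d′ (suc c) n)))))

    prodTo-scale : ∀ m K → prodTo (d ℕ.* suc m) K ≈ₚ S (prodTo (suc m) K)
    prodTo-scale m zero    n = ≡.sym (scale-const d′ (+ 1) n)
    prodTo-scale m (suc K) n = ≡.trans (⊗-cong (prodTo-scale m K) (λ k → ≡.trans (≡.cong (λ z → oneMinusXpow z k) (ℕₚ.*-assoc d (suc m) (suc K)))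
        (oneMinusXpow-scale _ k)) n) (≡.sym (scale-⊗ d′ (prodTo (suc m) K) (oneMinusXpow (suc m ℕ.* suc K)) n))

    -- The two sides cut the product at n and at n / d factors; both suffice, as partial products
    -- are stable beyond the degree read off.
    euler-scale : ∀ m → euler (d ℕ.* suc m) ≈ₚ S (euler (suc m))
    euler-scale m n = ≡.trans (prodTo-scale m n n) same
      where
      same : S (prodTo (suc m) n) n ≡ S (euler (suc m)) n
      same with n % d ≡ᵇ 0
      ... | true  = ≡.sym (euler-prodTo m n n ℕₚ.≤-refl (n / d) (m/n≤m n d))
      ... | false = ≡.refl

    module Hauptmodul (k : ℕ) (1+L*k : (+ 1 ℤ.+ L) ℤ.* + k ≡ + 12) where
      -- The indices `d * 1` and `d * 3` come from scaling; for a closed d they evaluate to those in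
      -- `HdagQ d`.
      denominator numerator quotient H : PS
      denominator = euler 1 ⊗ euler (d ℕ.* 1)
      numerator   = euler 3 ⊗ euler (d ℕ.* 3)
      quotient    = numerator ⊘ denominator
      H           = X ⊗ pow quotient k

      θ-euler-scale : ∀ m → θ (euler (d ℕ.* suc m)) ≈ₚ neg (euler (d ℕ.* suc m) ⊗ (const L ⊗ S (logSeries (suc m))))
      θ-euler-scale m n = ≡.trans (θ-cong (euler-scale m) n) (≡.trans (θ-scale d′ (euler (suc m)) n) (≡.trans
        (≡.cong (L ℤ.*_) (≡.trans (scale-cong d′ (θ-euler m) n) (neg-scale n))) (≡.trans (negate L (_))
        (≡.cong ℤ.-_ (≡.trans (≡.trans (≡.cong (L ℤ.*_) (scale-⊗ d′ (euler (suc m)) (logSeries (suc m)) n)) (c⊗ L (S (euler (suc m)) ⊗ S (logSeries (suc m))) n))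
          (≡.trans (left-comm n) (⊗-cong {g = const L ⊗ S (logSeries (suc m))} (λ i → ≡.sym (euler-scale m i)) (λ _ → ≡.refl) n)))))))
        where
        open CommutativeRing PS-commutativeRing using (*-commutativeSemigroup)
        open import Algebra.Properties.CommutativeSemigroup *-commutativeSemigroup using (x∙yz≈y∙xz)
        left-comm : const L ⊗ (S (euler (suc m)) ⊗ S (logSeries (suc m))) ≈ₚ S (euler (suc m)) ⊗ (const L ⊗ S (logSeries (suc m)))
        left-comm = x∙yz≈y∙xz (const L) (S (euler (suc m))) (S (logSeries (suc m)))
        neg-scale : S (neg (euler (suc m) ⊗ logSeries (suc m))) ≈ₚ neg (S (euler (suc m) ⊗ logSeries (suc m)))
        neg-scale i with i % d ≡ᵇ 0
        ... | true  = ≡.refl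
        ... | false = ≡.refl
        negate : ∀ l x → l ℤ.* ℤ.- x ≡ ℤ.- (l ℤ.* x)
        negate = solve-∀

      unit : denominator ⊗ inv denominator ≈ₚ 1ₚ
      unit = ⊗-inverseʳ denominator ≡.refl

      quotient-denominator : quotient ⊗ denominator ≈ₚ numerator
      quotient-denominator n = ≡.trans (⊗-assoc numerator (inv denominator) denominator n) (≡.trans
        (⊗-cong {numerator} (λ _ → ≡.refl) (⊗-inverseˡ denominator ≡.refl) n) (≡.trans (⊗-comm numerator 1ₚ n) (⊗-identityˡ numerator n)))

      exponentRate : PS
      exponentRate = (logSeries 1 ⊖ logSeries 3) ⊕ (const L ⊗ S (logSeries 1) ⊖ const L ⊗ S (logSeries 3))

      θ-quotient : θ quotient ≈ₚ quotient ⊗ exponentRate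
      θ-quotient = log-quotient {euler 1} {euler (d ℕ.* 1)} {euler 3} {euler (d ℕ.* 3)}
        {logSeries 1} {const L ⊗ S (logSeries 1)} {logSeries 3} {const L ⊗ S (logSeries 3)}
        {θ (euler 1)} {θ (euler (d ℕ.* 1))} {θ (euler 3)} {θ (euler (d ℕ.* 3))} {θ quotient} {quotient} {inv denominator}
        (θ-euler 0) (θ-euler-scale 0) (θ-euler 2) (θ-euler-scale 2)
        (λ n → ≡.trans (≡.cong (λ z → (θ quotient ⊗ denominator) n ℤ.+ z) (⊗-cong {quotient} (λ _ → ≡.refl) (λ i → ≡.sym (θ-⊗ (euler 1) (euler (d ℕ.* 1)) i)) n))
          (≡.trans (≡.sym (θ-⊗ quotient denominator n)) (≡.trans (θ-cong quotient-denominator n) (θ-⊗ (euler 3) (euler (d ℕ.* 3)) n))))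
        quotient-denominator unit

      rate : exponentRate ≈ₚ weight2 ⊕ const L ⊗ S weight2
      rate n = ≡.cong₂ ℤ._+_ (≡.sym (logSeries-difference n)) (≡.trans (distribute n)
        (⊗-cong {const L} (λ _ → ≡.refl) (λ i → ≡.sym (≡.trans (scale-cong d′ logSeries-difference i) (scale-⊖ d′ (logSeries 1) (logSeries 3) i))) n))
        where
        distribute : const L ⊗ S (logSeries 1) ⊖ const L ⊗ S (logSeries 3) ≈ₚ const L ⊗ (S (logSeries 1) ⊖ S (logSeries 3))
        distribute i = ≡.trans (≡.cong₂ ℤ._-_ (const-⊗ L (S (logSeries 1)) i) (const-⊗ L (S (logSeries 3)) i))
          (≡.trans (factor L (S (logSeries 1) i) (S (logSeries 3) i)) (c⊗ L (S (logSeries 1) ⊖ S (logSeries 3)) i))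
          where
          factor : ∀ l x y → l ℤ.* x ℤ.- l ℤ.* y ≡ l ℤ.* (x ℤ.- y)
          factor = solve-∀

      θ-pow : ∀ j → θ (pow quotient j) ≈ₚ const (+ j) ⊗ (pow quotient j ⊗ exponentRate)
      θ-pow zero    n = ≡.trans (θ-const (+ 1) n) (≡.sym (≡.trans (const-⊗ (+ 0) (1ₚ ⊗ exponentRate) n) (ℤₚ.*-zeroˡ ((1ₚ ⊗ exponentRate) n))))
      θ-pow (suc j) n = ≡.trans (θ-⊗ quotient (pow quotient j) n)
        (log-power-step {quotient} {θ quotient} {pow quotient j} {θ (pow quotient j)} {exponentRate} (+ j) θ-quotient (θ-pow j) n)

      θ-X : θ X ≈ₚ X
      θ-X zero          = ≡.refl
      θ-X (suc zero)    = ≡.refl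
      θ-X (suc (suc n)) = ℤₚ.*-zeroʳ (+ suc (suc n))

      θ-H : const (+ 1 ℤ.+ L) ⊗ θ H ≈ₚ H ⊗ (a ⊗ a ⊕ const L ⊗ (S a ⊗ S a))
      θ-H n = ≡.trans (⊗-cong {const (+ 1 ℤ.+ L)} (λ _ → ≡.refl) (θ-⊗ X (pow quotient k)) n)
        (hauptmodul-step {X} {θ X} {pow quotient k} {θ (pow quotient k)} {exponentRate} {a ⊗ a} {S a ⊗ S a} {weight2} {S weight2} (+ k) L
          θ-X (θ-pow k) rate a-square S-a-square 1+L*k n)

-- The autonomous system in weight zero.

module LevelSystem where
  open RingIdentities
  open import Level using () renaming (suc to lsuc)

  record DifferentialRing c ℓ : Set (lsuc (c ⊔ ℓ)) where
    field
      R : CommutativeRing c ℓ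
      ι : ℤ-rawRing -Raw-AlmostCommutative⟶ fromCommutativeRing R
    open CommutativeRing R using (Carrier; _≈_; _+_; _*_; 0#)
    field
      θ      : Carrier → Carrier
      θ-cong : ∀ {x y} → x ≈ y → θ x ≈ θ y
      θ-+    : ∀ x y → θ (x + y) ≈ θ x + θ y
      θ-*    : ∀ x y → θ (x * y) ≈ θ x * y + x * θ y
      θ-int  : ∀ i → θ (_-Raw-AlmostCommutative⟶_.⟦_⟧ ι i) ≈ 0#

  module Differential {c ℓ} (𝔻 : DifferentialRing c ℓ) where
    open DifferentialRing 𝔻
    open CommutativeRing R hiding (zero)
    open RingSolver R ι using (solve; con; _:=_; _:+_; _:*_; :-_; _:-_)
    open _-Raw-AlmostCommutative⟶_ ι using (1-homo) renaming (⟦_⟧ to int)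
    open import Relation.Binary.Reasoning.Setoid setoid

    int*-θ : ∀ i x → θ (int i * x) ≈ int i * θ x
    int*-θ i x = trans (θ-* (int i) x) (trans (+-congʳ (trans (*-congʳ (θ-int i)) (zeroˡ x))) (+-identityˡ _))

    θ-neg : ∀ x → θ (- x) ≈ - θ x
    θ-neg x = trans (θ-cong (minus x)) (trans (int*-θ (ℤ.- (+ 1)) x) (sym (minus (θ x))))
      where
      minus : ∀ y → - y ≈ int (ℤ.- (+ 1)) * y
      minus y = solve 1 (λ y → :- y := con (ℤ.- (+ 1)) :* y) refl y

    θ-minus : ∀ x y → θ (x - y) ≈ θ x - θ y
    θ-minus x y = trans (θ-+ x (- y)) (+-congˡ (θ-neg y))

    θ-inverse : ∀ {x ix A} → x * ix ≈ 1# → θ x ≈ x * A → θ ix ≈ - (ix * A)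
    θ-inverse {x} {ix} {A} unit e = begin
      θ ix
        ≈⟨ trans (*-congʳ unit) (*-identityˡ _) ⟨
      x * ix * θ ix
        ≈⟨ solve 4 (λ x ix d A → x :* ix :* d := ix :* (x :* A :* ix :+ x :* d) :- ix :* A :* (x :* ix)) refl x ix (θ ix) A ⟩
      ix * (x * A * ix + x * θ ix) - ix * A * (x * ix)
        ≈⟨ +-cong (*-congˡ (trans (+-congʳ (*-congʳ (sym e))) (trans (sym (θ-* x ix)) (trans (θ-cong (trans unit (sym 1-homo))) (θ-int (+ 1))))))
            (-‿cong (trans (*-congˡ unit) (*-identityʳ _))) ⟩
      ix * 0# - ix * A
        ≈⟨ trans (+-congʳ (zeroʳ ix)) (+-identityˡ _) ⟩
      - (ix * A) ∎

    module Side (l : ℤ) (x ix K p : Carrier) (unit : x * ix ≈ 1#)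
      (θx : θ x ≈ int l * (int (+ 9) * K - int (+ 3) * (p * x)))
      (θp : θ p ≈ int l * (x * K - int (+ 3) * (p * p)))
      (θK : θ K ≈ int l * (K * (x * x - int (+ 9) * p))) where

      -- K/x and the logarithmic derivative of x. Both have weight 2, when x, p, K are given the
      -- weights 1, 2, 3.
      κ A : Carrier
      κ = K * ix
      A = int l * (int (+ 9) * κ - int (+ 3) * p)

      K≈ : K ≈ x * κ
      K≈ = trans (sym (trans (*-congˡ unit) (*-identityʳ K))) (solve 3 (λ K x ix → K :* (x :* ix) := x :* (K :* ix)) refl K x ix)

      θx≈ : θ x ≈ x * A
      θx≈ = trans θx (trans (*-congˡ (+-congʳ (*-congˡ K≈))) (solve 4 (λ l x k p → l :* (con (+ 9) :* (x :* k) :- con (+ 3) :* (p :* x)) := x :* (l :* (con (+ 9) :* k :- con (+ 3) :* p))) refl (int l) x κ p))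

      θix≈ : θ ix ≈ - (ix * A)
      θix≈ = θ-inverse unit θx≈

      θκ≈ : θ κ ≈ int l * (κ * (x * x - int (+ 9) * p)) - κ * A
      θκ≈ = trans (θ-* K ix) (trans (+-cong (*-congʳ θK) (*-congˡ θix≈))
        (solve 5 (λ l K q ix A → l :* (K :* q) :* ix :+ K :* (:- (ix :* A)) := l :* (K :* ix :* q) :- K :* ix :* A) refl (int l) K (x * x - int (+ 9) * p) ix A))

      θp≈ : θ p ≈ int l * (x * x * κ - int (+ 3) * (p * p))
      θp≈ = trans θp (*-congˡ (+-congʳ (trans (*-congˡ K≈) (sym (*-assoc x x κ)))))

      -- A Riccati equation in which p survives only inside A².
      θA≈ : θ A ≈ A * A + int l * int l * (int (+ 6) * (κ * (x * x)) - int (+ 162) * (κ * κ))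
      θA≈ = trans (int*-θ l _) (trans (*-congˡ (trans (θ-minus _ _) (+-cong (trans (int*-θ (+ 9) κ) (*-congˡ θκ≈)) (-‿cong (trans (int*-θ (+ 3) p) (*-congˡ θp≈))))))
        (solve 4 (λ l x k p → l :* (con (+ 9) :* (l :* (k :* (x :* x :- con (+ 9) :* p)) :- k :* (l :* (con (+ 9) :* k :- con (+ 3) :* p))) :- con (+ 3) :* (l :* (x :* x :* k :- con (+ 3) :* (p :* p)))) := l :* (con (+ 9) :* k :- con (+ 3) :* p) :* (l :* (con (+ 9) :* k :- con (+ 3) :* p)) :+ l :* l :* (con (+ 6) :* (k :* (x :* x)) :- con (+ 162) :* (k :* k))) refl (int l) x κ p))

    module WeightZeroPair (L : ℤ) (u iu K₁ p₁ v iv K₂ p₂ : Carrier) (u-unit : u * iu ≈ 1#) (v-unit : v * iv ≈ 1#)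
      (θu : θ u ≈ int (+ 1) * (int (+ 9) * K₁ - int (+ 3) * (p₁ * u)))
      (θp₁ : θ p₁ ≈ int (+ 1) * (u * K₁ - int (+ 3) * (p₁ * p₁)))
      (θK₁ : θ K₁ ≈ int (+ 1) * (K₁ * (u * u - int (+ 9) * p₁)))
      (θv : θ v ≈ int L * (int (+ 9) * K₂ - int (+ 3) * (p₂ * v)))
      (θp₂ : θ p₂ ≈ int L * (v * K₂ - int (+ 3) * (p₂ * p₂)))
      (θK₂ : θ K₂ ≈ int L * (K₂ * (v * v - int (+ 9) * p₂))) where
      private
        module S₁ = Side (+ 1) u iu K₁ p₁ u-unit θu θp₁ θK₁
        module S₂ = Side L v iv K₂ p₂ v-unit θv θp₂ θK₂
        open S₁ using () renaming (κ to κ₁; A to A₁)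
        open S₂ using () renaming (κ to κ₂; A to A₂)
        l j : Carrier
        l = int L
        j = iu * iv

      -- Division by u v brings all of these but e to weight 0; e = u v is the common factor that θ
      -- then produces.
      e r r̄ X₁ X₂ w R₀ T P M : Carrier
      e = u * v
      r = u * iv
      r̄ = l * (v * iu)
      X₁ = int (+ 27) * (κ₁ * j)
      X₂ = int (+ 27) * (l * κ₂ * j)
      w = (A₂ - A₁) * j
      R₀ = r - r̄
      T = r + r̄
      P = X₁ + X₂
      M = X₁ - X₂

      private
        ej : e * j ≈ 1#
        ej = trans (solve 4 (λ u v iu iv → u :* v :* (iu :* iv) := u :* iu :* (v :* iv)) refl u v iu iv) (trans (*-cong u-unit v-unit) (*-identityˡ 1#))

        er : e * r ≈ u * u
        er = trans (solve 3 (λ u v iv → u :* v :* (u :* iv) := u :* u :* (v :* iv)) refl u v iv) (trans (*-congˡ v-unit) (*-identityʳ _))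

        er̄ : e * r̄ ≈ l * (v * v)
        er̄ = trans (solve 4 (λ u v iu l → u :* v :* (l :* (v :* iu)) := l :* (v :* v) :* (u :* iu)) refl u v iu l) (trans (*-congˡ u-unit) (*-identityʳ _))

        eX₁ : e * X₁ ≈ int (+ 27) * κ₁
        eX₁ = trans (solve 3 (λ e k j → e :* (con (+ 27) :* (k :* j)) := con (+ 27) :* k :* (e :* j)) refl e κ₁ j) (trans (*-congˡ ej) (*-identityʳ _))

        eX₂ : e * X₂ ≈ int (+ 27) * (l * κ₂)
        eX₂ = trans (solve 3 (λ e k j → e :* (con (+ 27) :* (k :* j)) := con (+ 27) :* k :* (e :* j)) refl e (l * κ₂) j) (trans (*-congˡ ej) (*-identityʳ _))

        ew : e * w ≈ A₂ - A₁
        ew = trans (solve 3 (λ e a j → e :* (a :* j) := a :* (e :* j)) refl e (A₂ - A₁) j) (trans (*-congˡ ej) (*-identityʳ _))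

        θj : θ j ≈ - (j * (A₁ + A₂))
        θj = trans (θ-* iu iv) (trans (+-cong (*-congʳ S₁.θix≈) (*-congˡ S₂.θix≈))
          (solve 4 (λ iu iv a b → (:- (iu :* a)) :* iv :+ iu :* (:- (iv :* b)) := :- (iu :* iv :* (a :+ b))) refl iu iv A₁ A₂))

        θr : θ r ≈ - (e * (r * w))
        θr = trans (θ-* u iv) (trans (+-cong (*-congʳ S₁.θx≈) (*-congˡ S₂.θix≈)) (trans
          (solve 4 (λ u iv a b → u :* a :* iv :+ u :* (:- (iv :* b)) := :- (u :* iv :* (b :- a))) refl u iv A₁ A₂)
          (-‿cong (trans (*-congˡ (sym ew)) (solve 3 (λ r e w → r :* (e :* w) := e :* (r :* w)) refl r e w)))))

        θr̄ : θ r̄ ≈ e * (r̄ * w)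
        θr̄ = trans (int*-θ L (v * iu)) (trans (*-congˡ (trans (θ-* v iu) (+-cong (*-congʳ S₂.θx≈) (*-congˡ S₁.θix≈)))) (trans
          (solve 5 (λ l v iu a b → l :* (v :* b :* iu :+ v :* (:- (iu :* a))) := l :* (v :* iu) :* (b :- a)) refl l v iu A₁ A₂)
          (trans (*-congˡ (sym ew)) (solve 3 (λ r e w → r :* (e :* w) := e :* (r :* w)) refl r̄ e w))))

        -- The term 9 p in θ K cancels against 3 A, which leaves 27 κ₁ = e X₁. This fixes the factor
        -- 27 and makes the equation logistic.
        θX₁ : θ X₁ ≈ e * (X₁ * (r - X₁ - w))
        θX₁ = begin
          θ X₁
            ≈⟨ trans (int*-θ (+ 27) _) (*-congˡ (trans (θ-* κ₁ j) (+-cong (*-congʳ S₁.θκ≈) (*-congˡ θj)))) ⟩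
          int (+ 27) * ((int (+ 1) * (κ₁ * (u * u - int (+ 9) * p₁)) - κ₁ * A₁) * j + κ₁ * - (j * (A₁ + A₂)))
            ≈⟨ solve 5 (λ k j u p b → con (+ 27) :* ((con (+ 1) :* (k :* (u :* u :- con (+ 9) :* p)) :- k :* (con (+ 1) :* (con (+ 9) :* k :- con (+ 3) :* p))) :* j :+ k :* (:- (j :* (con (+ 1) :* (con (+ 9) :* k :- con (+ 3) :* p) :+ b))))
                  := con (+ 27) :* (k :* j) :* (u :* u :- con (+ 27) :* k :- (b :- con (+ 1) :* (con (+ 9) :* k :- con (+ 3) :* p)))) refl κ₁ j u p₁ A₂ ⟩
          X₁ * (u * u - int (+ 27) * κ₁ - (A₂ - A₁))
            ≈⟨ *-congˡ (+-cong (+-cong er (-‿cong eX₁)) (-‿cong ew)) ⟨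
          X₁ * (e * r - e * X₁ - e * w)
            ≈⟨ solve 4 (λ X e r w → X :* (e :* r :- e :* X :- e :* w) := e :* (X :* (r :- X :- w))) refl X₁ e r w ⟩
          e * (X₁ * (r - X₁ - w)) ∎

        θX₂ : θ X₂ ≈ e * (X₂ * (r̄ - X₂ + w))
        θX₂ = begin
          θ X₂
            ≈⟨ trans (int*-θ (+ 27) _) (*-congˡ (trans (θ-* (l * κ₂) j) (+-cong (*-congʳ (trans (int*-θ L κ₂) (*-congˡ S₂.θκ≈))) (*-congˡ θj)))) ⟩
          int (+ 27) * (l * (l * (κ₂ * (v * v - int (+ 9) * p₂)) - κ₂ * A₂) * j + l * κ₂ * - (j * (A₁ + A₂)))
            ≈⟨ solve 6 (λ k j v p a l → con (+ 27) :* (l :* (l :* (k :* (v :* v :- con (+ 9) :* p)) :- k :* (l :* (con (+ 9) :* k :- con (+ 3) :* p))) :* j :+ l :* k :* (:- (j :* (a :+ l :* (con (+ 9) :* k :- con (+ 3) :* p)))))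
                  := con (+ 27) :* (l :* k :* j) :* (l :* (v :* v) :- con (+ 27) :* (l :* k) :+ (l :* (con (+ 9) :* k :- con (+ 3) :* p) :- a))) refl κ₂ j v p₂ A₁ l ⟩
          X₂ * (l * (v * v) - int (+ 27) * (l * κ₂) + (A₂ - A₁))
            ≈⟨ *-congˡ (+-cong (+-cong er̄ (-‿cong eX₂)) ew) ⟨
          X₂ * (e * r̄ - e * X₂ + e * w)
            ≈⟨ solve 4 (λ X e r w → X :* (e :* r :- e :* X :+ e :* w) := e :* (X :* (r :- X :+ w))) refl X₂ e r̄ w ⟩
          e * (X₂ * (r̄ - X₂ + w)) ∎

        -- The square of each logarithmic derivative A cancels, leaving modular terms only.
        9θw : int (+ 9) * θ w ≈ - (int (+ 2) * (e * (X₁ * (r - X₁) - X₂ * (r̄ - X₂))))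
        9θw = begin
          int (+ 9) * θ w
            ≈⟨ *-congˡ (trans (θ-* _ j) (+-cong (*-congʳ (trans (θ-minus A₂ A₁) (+-cong S₂.θA≈ (-‿cong S₁.θA≈)))) (*-congˡ θj))) ⟩
          int (+ 9) * ((A₂ * A₂ + l * l * (int (+ 6) * (κ₂ * (v * v)) - int (+ 162) * (κ₂ * κ₂)) - (A₁ * A₁ + int (+ 1) * int (+ 1) * (int (+ 6) * (κ₁ * (u * u)) - int (+ 162) * (κ₁ * κ₁)))) * j + (A₂ - A₁) * - (j * (A₁ + A₂)))
            ≈⟨ solve 8 (λ a b j l k m u v → con (+ 9) :* ((b :* b :+ l :* l :* (con (+ 6) :* (m :* v) :- con (+ 162) :* (m :* m)) :- (a :* a :+ con (+ 1) :* con (+ 1) :* (con (+ 6) :* (k :* u) :- con (+ 162) :* (k :* k)))) :* j :+ (b :- a) :* (:- (j :* (a :+ b))))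
                  := :- (con (+ 2) :* (con (+ 27) :* (k :* j) :* (u :- con (+ 27) :* k) :- con (+ 27) :* (l :* m :* j) :* (l :* v :- con (+ 27) :* (l :* m))))) refl A₁ A₂ j l κ₁ κ₂ (u * u) (v * v) ⟩
          - (int (+ 2) * (X₁ * (u * u - int (+ 27) * κ₁) - X₂ * (l * (v * v) - int (+ 27) * (l * κ₂))))
            ≈⟨ -‿cong (*-congˡ (+-cong (*-congˡ (+-cong er (-‿cong eX₁))) (-‿cong (*-congˡ (+-cong er̄ (-‿cong eX₂)))))) ⟨
          - (int (+ 2) * (X₁ * (e * r - e * X₁) - X₂ * (e * r̄ - e * X₂)))
            ≈⟨ solve 5 (λ e r s x y → :- (con (+ 2) :* (x :* (e :* r :- e :* x) :- y :* (e :* s :- e :* y))) := :- (con (+ 2) :* (e :* (x :* (r :- x) :- y :* (s :- y))))) refl e r r̄ X₁ X₂ ⟩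
          - (int (+ 2) * (e * (X₁ * (r - X₁) - X₂ * (r̄ - X₂)))) ∎

      θR₀ : θ R₀ ≈ - (e * (T * w))
      θR₀ = trans (θ-minus r r̄) (trans (+-cong θr (-‿cong θr̄)) (solve 4 (λ e r s w → :- (e :* (r :* w)) :- e :* (s :* w) := :- (e :* ((r :+ s) :* w))) refl e r r̄ w))

      θT : θ T ≈ - (e * (R₀ * w))
      θT = trans (θ-+ r r̄) (trans (+-cong θr θr̄) (solve 4 (λ e r s w → :- (e :* (r :* w)) :+ e :* (s :* w) := :- (e :* ((r :- s) :* w))) refl e r r̄ w))

      θw : int (+ 9) * θ w ≈ - (e * (P * R₀ + M * T - int (+ 2) * (P * M)))
      θw = trans 9θw (solve 5 (λ e r s x y → :- (con (+ 2) :* (e :* (x :* (r :- x) :- y :* (s :- y)))) :=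
        :- (e :* ((x :+ y) :* (r :- s) :+ (x :- y) :* (r :+ s) :- con (+ 2) :* ((x :+ y) :* (x :- y))))) refl e r r̄ X₁ X₂)

      θP : int (+ 2) * θ P ≈ e * (P * T + M * R₀ - P * P - M * M - int (+ 2) * (w * M))
      θP = trans (*-congˡ (trans (θ-+ X₁ X₂) (+-cong θX₁ θX₂))) (solve 6 (λ e r s x y w → con (+ 2) :* (e :* (x :* (r :- x :- w)) :+ e :* (y :* (s :- y :+ w))) :=
        e :* ((x :+ y) :* (r :+ s) :+ (x :- y) :* (r :- s) :- (x :+ y) :* (x :+ y) :- (x :- y) :* (x :- y) :- con (+ 2) :* (w :* (x :- y)))) refl e r r̄ X₁ X₂ w)

      θM : int (+ 2) * θ M ≈ e * (P * R₀ + M * T - int (+ 2) * (P * M) - int (+ 2) * (w * P))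
      θM = trans (*-congˡ (trans (θ-minus X₁ X₂) (+-cong θX₁ (-‿cong θX₂)))) (solve 6 (λ e r s x y w → con (+ 2) :* (e :* (x :* (r :- x :- w)) :- e :* (y :* (s :- y :+ w))) :=
        e :* ((x :+ y) :* (r :- s) :+ (x :- y) :* (r :+ s) :- con (+ 2) :* ((x :+ y) :* (x :- y)) :- con (+ 2) :* (w :* (x :+ y)))) refl e r r̄ X₁ X₂ w)

      T² : T * T ≈ R₀ * R₀ + int (+ 4) * l
      T² = trans (solve 2 (λ r s → (r :+ s) :* (r :+ s) := (r :- s) :* (r :- s) :+ con (+ 4) :* (r :* s)) refl r r̄)
        (+-congˡ (*-congˡ (trans (solve 5 (λ u iv l v iu → u :* iv :* (l :* (v :* iu)) := l :* (u :* iu :* (v :* iv))) refl u iv l v iu)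
          (trans (*-congˡ (trans (*-cong u-unit v-unit) (*-identityˡ 1#))) (*-identityʳ l)))))

      eT : e * T ≈ u * u + l * (v * v)
      eT = trans (distribˡ e r r̄) (+-cong er er̄)

      -- The right side is the determinant in the definition of `C`, so w is C_ℓ.
      wronskian : e * e * w ≈ u * θ v - v * θ u
      wronskian = trans (*-assoc e e w) (trans (*-congˡ ew) (trans (solve 4 (λ u v a b → u :* v :* (b :- a) := u :* (v :* b) :- v :* (u :* a)) refl u v A₁ A₂)
        (+-cong (*-congˡ (sym S₂.θx≈)) (-‿cong (*-congˡ (sym S₁.θx≈))))))

-- The linear system for the differences of two solutions.

module ErrorSystem where
  open RingIdentities
  open LevelSystem

  module Errors {c ℓ} (𝔻 : DifferentialRing c ℓ) where
    open DifferentialRing 𝔻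
    open CommutativeRing R hiding (zero)
    open RingSolver R ι using (solve; con; _:=_; _:+_; _:*_; :-_; _:-_)
    open _-Raw-AlmostCommutative⟶_ ι using () renaming (⟦_⟧ to int)
    open import Relation.Binary.Reasoning.Setoid setoid

    open Differential 𝔻 using (int*-θ; θ-minus)

    -- Linear in the errors, with coefficients mixed from both solutions. Comparing lowest terms
    -- will use the constant terms of these coefficients.
    record ErrorEquations (n e R₀ T w P M R̂ ŵ m̂ p̂ q : Carrier) : Set ℓ where
      field
        θe₁ : n * θ (R₀ - R̂) ≈ - (n * (e * T)) * (w - ŵ)
        θe₂ : int (+ 36) * θ (w - ŵ) ≈ - e * ((int (+ 4) * P) * (R₀ - R̂) + (int (+ 4) * T - int (+ 8) * P) * (M - m̂) + (R̂ - int (+ 2) * m̂) * (int (+ 4) * P - T * p̂))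
        θe₃ : int (+ 8) * θ (M - m̂) ≈ e * ((int (+ 4) * P) * (R₀ - R̂) + (- (int (+ 8) * P)) * (w - ŵ)
          + (int (+ 4) * T - int (+ 8) * P) * (M - m̂) + (R̂ - int (+ 2) * m̂ - int (+ 2) * ŵ) * (int (+ 4) * P - T * p̂))
        θe₄ : int (+ 8) * (n * θ (int (+ 4) * P - T * p̂)) ≈ e * (
          (n * (int (+ 16) * m̂ + int (+ 8) * (p̂ * ŵ) + (int (+ 4) * p̂ - p̂ * p̂) * (R₀ + R̂)) - int (+ 8) * (q * (R₀ + R̂))) * (R₀ - R̂)
          + (n * (int (+ 8) * (R₀ * p̂) - int (+ 32) * M)) * (w - ŵ)
          + (n * (int (+ 16) * R₀ - int (+ 16) * (M + m̂) - int (+ 32) * ŵ)) * (M - m̂)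
          + (n * (int (+ 4) * T - int (+ 4) * P - T * p̂)) * (int (+ 4) * P - T * p̂))

    module System (n : Carrier) (l e R₀ T w P M : Carrier)
      (θR₀ : θ R₀ ≈ - (e * (T * w)))
      (θT : θ T ≈ - (e * (R₀ * w)))
      (θw : int (+ 9) * θ w ≈ - (e * (P * R₀ + M * T - int (+ 2) * (P * M))))
      (θP : int (+ 2) * θ P ≈ e * (P * T + M * R₀ - P * P - M * M - int (+ 2) * (w * M)))
      (θM : int (+ 2) * θ M ≈ e * (P * R₀ + M * T - int (+ 2) * (P * M) - int (+ 2) * (w * P)))
      (T² : T * T ≈ R₀ * R₀ + int (+ 4) * l)
      (R̂ ŵ m̂ p̂ q : Carrier)
      (θR̂ : n * θ R̂ ≈ - (n * (e * (T * ŵ))))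
      (θŵ : int (+ 36) * θ ŵ ≈ - (e * (T * (p̂ * R̂ + int (+ 4) * m̂ - int (+ 2) * (p̂ * m̂)))))
      (θm̂ : int (+ 8) * θ m̂ ≈ e * (T * (p̂ * R̂ + int (+ 4) * m̂ - int (+ 2) * (p̂ * m̂) - int (+ 2) * (ŵ * p̂))))
      (θp̂ : n * θ p̂ ≈ q * (e * T))
      (q-identity : int (+ 8) * ((R̂ * R̂ + int (+ 4) * l) * q) ≈ n * (int (+ 8) * (ŵ * R̂ * p̂) - int (+ 32) * (ŵ * m̂)
        + int (+ 4) * ((R̂ * R̂ + int (+ 4) * l) * p̂) + int (+ 16) * (m̂ * R̂) - (R̂ * R̂ + int (+ 4) * l) * (p̂ * p̂) - int (+ 16) * (m̂ * m̂))) where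

      e₁ e₂ e₃ e₄ : Carrier
      e₁ = R₀ - R̂
      e₂ = w - ŵ
      e₃ = M - m̂
      -- The rational solution supplies p̂ for the ratio 4 P/T, not a value for P; multiplying by T
      -- avoids the division.
      e₄ = int (+ 4) * P - T * p̂

      θe₁ : n * θ e₁ ≈ - (n * (e * T)) * e₂
      θe₁ = trans (*-congˡ (θ-minus R₀ R̂)) (trans (solve 3 (λ n a b → n :* (a :- b) := n :* a :- n :* b) refl n (θ R₀) (θ R̂))
        (trans (+-cong (*-congˡ θR₀) (-‿cong θR̂)) (solve 5 (λ n e t w v → n :* (:- (e :* (t :* w))) :- (:- (n :* (e :* (t :* v)))) := (:- (n :* (e :* t))) :* (w :- v)) refl n e T w ŵ)))

      θe₂ : int (+ 36) * θ e₂ ≈ - e * ((int (+ 4) * P) * e₁ + (int (+ 4) * T - int (+ 8) * P) * e₃ + (R̂ - int (+ 2) * m̂) * e₄)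
      θe₂ = trans (*-congˡ (θ-minus w ŵ)) (trans (solve 2 (λ a b → con (+ 36) :* (a :- b) := con (+ 4) :* (con (+ 9) :* a) :- con (+ 36) :* b) refl (θ w) (θ ŵ))
        (trans (+-cong (*-congˡ θw) (-‿cong θŵ)) (solve 8 (λ e t p m r r′ m′ p′ →
          con (+ 4) :* (:- (e :* (p :* r :+ m :* t :- con (+ 2) :* (p :* m)))) :- (:- (e :* (t :* (p′ :* r′ :+ con (+ 4) :* m′ :- con (+ 2) :* (p′ :* m′))))) :=
          (:- e) :* ((con (+ 4) :* p) :* (r :- r′) :+ (con (+ 4) :* t :- con (+ 8) :* p) :* (m :- m′) :+ (r′ :- con (+ 2) :* m′) :* (con (+ 4) :* p :- t :* p′)))
          refl e T P M R₀ R̂ m̂ p̂)))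

      θe₃ : int (+ 8) * θ e₃ ≈ e * ((int (+ 4) * P) * e₁ + (- (int (+ 8) * P)) * e₂ + (int (+ 4) * T - int (+ 8) * P) * e₃ + (R̂ - int (+ 2) * m̂ - int (+ 2) * ŵ) * e₄)
      θe₃ = trans (*-congˡ (θ-minus M m̂)) (trans (solve 2 (λ a b → con (+ 8) :* (a :- b) := con (+ 4) :* (con (+ 2) :* a) :- con (+ 8) :* b) refl (θ M) (θ m̂))
        (trans (+-cong (*-congˡ θM) (-‿cong θm̂)) (solve 10 (λ e t p m r r′ m′ p′ w w′ →
          con (+ 4) :* (e :* (p :* r :+ m :* t :- con (+ 2) :* (p :* m) :- con (+ 2) :* (w :* p))) :- e :* (t :* (p′ :* r′ :+ con (+ 4) :* m′ :- con (+ 2) :* (p′ :* m′) :- con (+ 2) :* (w′ :* p′))) :=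
          e :* ((con (+ 4) :* p) :* (r :- r′) :+ (:- (con (+ 8) :* p)) :* (w :- w′) :+ (con (+ 4) :* t :- con (+ 8) :* p) :* (m :- m′) :+ (r′ :- con (+ 2) :* m′ :- con (+ 2) :* w′) :* (con (+ 4) :* p :- t :* p′)))
          refl e T P M R₀ R̂ m̂ p̂ w ŵ)))

      private
        Ŝ : Carrier
        Ŝ = R̂ * R̂ + int (+ 4) * l

        -- T is accessible through its square only, and the error of the square is a multiple of the
        -- error of R₀.
        T²-Ŝ : T * T ≈ Ŝ + (R₀ + R̂) * e₁
        T²-Ŝ = trans T² (solve 3 (λ r s l → r :* r :+ con (+ 4) :* l := (s :* s :+ con (+ 4) :* l) :+ (r :+ s) :* (r :- s)) refl R₀ R̂ l)

      -- Differentiating T p̂ produces T², which `T²-Ŝ` splits into a rational part and a multiple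
      -- of e₁. The rational part is disposed of by `q-identity`, and the remaining differences are
      -- expanded in the errors.
      θe₄ : int (+ 8) * (n * θ e₄) ≈ e * (
        (n * (int (+ 16) * m̂ + int (+ 8) * (p̂ * ŵ) + (int (+ 4) * p̂ - p̂ * p̂) * (R₀ + R̂)) - int (+ 8) * (q * (R₀ + R̂))) * e₁
        + (n * (int (+ 8) * (R₀ * p̂) - int (+ 32) * M)) * e₂
        + (n * (int (+ 16) * R₀ - int (+ 16) * (M + m̂) - int (+ 32) * ŵ)) * e₃
        + (n * (int (+ 4) * T - int (+ 4) * P - T * p̂)) * e₄)
      θe₄ = begin
        int (+ 8) * (n * θ e₄)
          ≈⟨ *-congˡ (*-congˡ (trans (θ-minus _ _) (+-cong (int*-θ (+ 4) P) (-‿cong (trans (θ-* T p̂) (+-congʳ (*-congʳ θT))))))) ⟩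
        int (+ 8) * (n * (int (+ 4) * θ P - (- (e * (R₀ * w)) * p̂ + T * θ p̂)))
          ≈⟨ solve 8 (λ n a e r w p t b → con (+ 8) :* (n :* (con (+ 4) :* a :- ((:- (e :* (r :* w))) :* p :+ t :* b))) :=
              con (+ 16) :* (n :* (con (+ 2) :* a)) :+ con (+ 8) :* (n :* (e :* (r :* w :* p))) :- con (+ 8) :* (t :* (n :* b))) refl n (θ P) e R₀ w p̂ T (θ p̂) ⟩
        int (+ 16) * (n * (int (+ 2) * θ P)) + int (+ 8) * (n * (e * (R₀ * w * p̂))) - int (+ 8) * (T * (n * θ p̂))
          ≈⟨ +-cong (+-congʳ (*-congˡ (*-congˡ θP))) (-‿cong (*-congˡ (*-congˡ θp̂))) ⟩
        int (+ 16) * (n * (e * Y)) + int (+ 8) * (n * (e * (R₀ * w * p̂))) - int (+ 8) * (T * (q * (e * T)))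
          ≈⟨ solve 6 (λ n e y z t q → con (+ 16) :* (n :* (e :* y)) :+ con (+ 8) :* (n :* (e :* z)) :- con (+ 8) :* (t :* (q :* (e :* t))) :=
              e :* (n :* (con (+ 16) :* y :+ con (+ 8) :* z) :- con (+ 8) :* (t :* t :* q))) refl n e Y (R₀ * w * p̂) T q ⟩
        e * (n * (int (+ 16) * Y + int (+ 8) * (R₀ * w * p̂)) - int (+ 8) * (T * T * q))
          ≈⟨ *-congˡ (+-congˡ (-‿cong (*-congˡ (*-congʳ T²-Ŝ)))) ⟩
        e * (n * (int (+ 16) * Y + int (+ 8) * (R₀ * w * p̂)) - int (+ 8) * ((Ŝ + (R₀ + R̂) * e₁) * q))
          ≈⟨ *-congˡ (trans (solve 5 (λ y s d q n → y :- con (+ 8) :* ((s :+ d) :* q) := y :- con (+ 8) :* (s :* q) :- con (+ 8) :* (q :* d)) refl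
              (n * (int (+ 16) * Y + int (+ 8) * (R₀ * w * p̂))) Ŝ ((R₀ + R̂) * e₁) q n) (+-congʳ (+-congˡ (-‿cong q-identity)))) ⟩
        e * (n * (int (+ 16) * Y + int (+ 8) * (R₀ * w * p̂)) - n * Z - int (+ 8) * (q * ((R₀ + R̂) * e₁)))
          ≈⟨ *-congˡ (+-congʳ (trans (solve 3 (λ n y z → n :* y :- n :* z := n :* (y :- z)) refl n _ Z) (*-congˡ difference))) ⟩
        e * (n * W - int (+ 8) * (q * ((R₀ + R̂) * e₁)))
          ≈⟨ *-congˡ (solve 11 (λ n a b c d e₁ e₂ e₃ e₄ q r → n :* (a :* e₁ :+ b :* e₂ :+ c :* e₃ :+ d :* e₄) :- con (+ 8) :* (q :* (r :* e₁)) :=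
              (n :* a :- con (+ 8) :* (q :* r)) :* e₁ :+ (n :* b) :* e₂ :+ (n :* c) :* e₃ :+ (n :* d) :* e₄) refl n _ _ _ _ e₁ e₂ e₃ e₄ q (R₀ + R̂)) ⟩
        e * (
        (n * (int (+ 16) * m̂ + int (+ 8) * (p̂ * ŵ) + (int (+ 4) * p̂ - p̂ * p̂) * (R₀ + R̂)) - int (+ 8) * (q * (R₀ + R̂))) * e₁
        + (n * (int (+ 8) * (R₀ * p̂) - int (+ 32) * M)) * e₂
        + (n * (int (+ 16) * R₀ - int (+ 16) * (M + m̂) - int (+ 32) * ŵ)) * e₃
        + (n * (int (+ 4) * T - int (+ 4) * P - T * p̂)) * e₄) ∎
        where
        Y Z W : Carrier
        Y = P * T + M * R₀ - P * P - M * M - int (+ 2) * (w * M)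
        Z = int (+ 8) * (ŵ * R̂ * p̂) - int (+ 32) * (ŵ * m̂) + int (+ 4) * (Ŝ * p̂) + int (+ 16) * (m̂ * R̂) - Ŝ * (p̂ * p̂) - int (+ 16) * (m̂ * m̂)
        W = (int (+ 16) * m̂ + int (+ 8) * (p̂ * ŵ) + (int (+ 4) * p̂ - p̂ * p̂) * (R₀ + R̂)) * e₁
          + (int (+ 8) * (R₀ * p̂) - int (+ 32) * M) * e₂
          + (int (+ 16) * R₀ - int (+ 16) * (M + m̂) - int (+ 32) * ŵ) * e₃
          + (int (+ 4) * T - int (+ 4) * P - T * p̂) * e₄
        difference : int (+ 16) * Y + int (+ 8) * (R₀ * w * p̂) - Z ≈ W
        difference = begin
          int (+ 16) * Y + int (+ 8) * (R₀ * w * p̂) - Z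
            ≈⟨ solve 10 (λ t p m r r′ m′ p′ w w′ s → 
                con (+ 16) :* (p :* t :+ m :* r :- p :* p :- m :* m :- con (+ 2) :* (w :* m)) :+ con (+ 8) :* (r :* w :* p′)
                  :- (con (+ 8) :* (w′ :* r′ :* p′) :- con (+ 32) :* (w′ :* m′) :+ con (+ 4) :* (s :* p′) :+ con (+ 16) :* (m′ :* r′) :- s :* (p′ :* p′) :- con (+ 16) :* (m′ :* m′)) :=
                (con (+ 16) :* m′ :+ con (+ 8) :* (p′ :* w′)) :* (r :- r′) :+ (con (+ 8) :* (r :* p′) :- con (+ 32) :* m) :* (w :- w′)
                  :+ (con (+ 16) :* r :- con (+ 16) :* (m :+ m′) :- con (+ 32) :* w′) :* (m :- m′) :+ (con (+ 4) :* t :- con (+ 4) :* p :- t :* p′) :* (con (+ 4) :* p :- t :* p′)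
                  :+ (con (+ 4) :* p′ :- p′ :* p′) :* (t :* t :- s)) refl T P M R₀ R̂ m̂ p̂ w ŵ Ŝ ⟩
          (int (+ 16) * m̂ + int (+ 8) * (p̂ * ŵ)) * e₁ + (int (+ 8) * (R₀ * p̂) - int (+ 32) * M) * e₂
            + (int (+ 16) * R₀ - int (+ 16) * (M + m̂) - int (+ 32) * ŵ) * e₃ + (int (+ 4) * T - int (+ 4) * P - T * p̂) * e₄
            + (int (+ 4) * p̂ - p̂ * p̂) * (T * T - Ŝ)
            ≈⟨ +-congˡ (*-congˡ (trans (+-congʳ T²-Ŝ) (solve 2 (λ s d → s :+ d :- s := d) refl Ŝ ((R₀ + R̂) * e₁)))) ⟩
          (int (+ 16) * m̂ + int (+ 8) * (p̂ * ŵ)) * e₁ + (int (+ 8) * (R₀ * p̂) - int (+ 32) * M) * e₂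
            + (int (+ 16) * R₀ - int (+ 16) * (M + m̂) - int (+ 32) * ŵ) * e₃ + (int (+ 4) * T - int (+ 4) * P - T * p̂) * e₄
            + (int (+ 4) * p̂ - p̂ * p̂) * ((R₀ + R̂) * e₁)
            ≈⟨ solve 7 (λ a b k r x y z → a :* x :+ y :+ z :+ b :+ k :* (r :* x) := (a :+ k :* r) :* x :+ y :+ z :+ b) refl
                (int (+ 16) * m̂ + int (+ 8) * (p̂ * ŵ)) ((int (+ 4) * T - int (+ 4) * P - T * p̂) * e₄) (int (+ 4) * p̂ - p̂ * p̂) (R₀ + R̂) e₁
                ((int (+ 8) * (R₀ * p̂) - int (+ 32) * M) * e₂) ((int (+ 16) * R₀ - int (+ 16) * (M + m̂) - int (+ 32) * ŵ) * e₃) ⟩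
          W ∎

      -- (T p̂ + 4 m̂)(T p̂ - 4 m̂) vanishes to high order at the solution.
      product-identity : (T * p̂ + int (+ 4) * m̂) * (T * p̂ - int (+ 4) * m̂) ≈ (Ŝ * (p̂ * p̂) - int (+ 16) * (m̂ * m̂)) + (p̂ * p̂ * (R₀ + R̂)) * e₁
      product-identity = trans (solve 3 (λ t p m → (t :* p :+ con (+ 4) :* m) :* (t :* p :- con (+ 4) :* m) := t :* t :* (p :* p) :- con (+ 16) :* (m :* m)) refl T p̂ m̂)
        (trans (+-congʳ (*-congʳ T²-Ŝ)) (solve 5 (λ s r d p m → (s :+ r :* d) :* p :- m := (s :* p :- m) :+ (p :* r) :* d) refl Ŝ (R₀ + R̂) e₁ (p̂ * p̂) (int (+ 16) * (m̂ * m̂))))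

      errors : ErrorEquations n e R₀ T w P M R̂ ŵ m̂ p̂ q
      errors = record { θe₁ = θe₁ ; θe₂ = θe₂ ; θe₃ = θe₃ ; θe₄ = θe₄ }

-- Rational functions of H that solve the system.

module RationalSystem where
  open RingIdentities
  open LevelSystem

  module RationalParametrization {c ℓ} (𝔻 : DifferentialRing c ℓ) where
    open DifferentialRing 𝔻
    open CommutativeRing R hiding (zero)
    open RingSolver R ι using (solve; con; _:=_; _:+_; _:*_; :-_; _:-_)
    open _-Raw-AlmostCommutative⟶_ ι using () renaming (⟦_⟧ to int)
    open import Relation.Binary.Reasoning.Setoid setoid

    open Differential 𝔻 using (int*-θ; θ-neg; θ-inverse)

    module Hats (n : Carrier) (n-cancel : ∀ {x y} → n * x ≈ n * y → x ≈ y) (l τ H : Carrier) (θH : n * θ H ≈ H * τ)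
      (V iV V′ : Carrier) (unit : V * iV ≈ 1#) (θV : θ V ≈ V′ * θ H) where

      private
        h = θ H

        θiV : θ iV ≈ - (iV * (iV * (V′ * h)))
        θiV = θ-inverse unit (trans θV (sym (trans (solve 3 (λ V i y → V :* (i :* y) := V :* i :* y) refl V iV (V′ * h)) (trans (*-congʳ unit) (*-identityˡ _)))))

        absorb : ∀ y → y * (iV * iV) ≈ y * V * (iV * iV * iV)
        absorb y = trans (sym (trans (*-congˡ unit) (*-identityʳ _))) (solve 3 (λ y i V → y :* (i :* i) :* (V :* i) := y :* V :* (i :* i :* i)) refl y iV V)

        absorb₂ : ∀ y → y * (iV * iV * iV) ≈ y * V * (iV * iV * (iV * iV))
        absorb₂ y = trans (sym (trans (*-congˡ unit) (*-identityʳ _))) (solve 3 (λ y i V → y :* (i :* i :* i) :* (V :* i) := y :* V :* (i :* i :* (i :* i))) refl y iV V)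

        fraction : ∀ {f f′} → θ f ≈ f′ * h → θ (f * iV) ≈ (f′ * V - f * V′) * (iV * iV) * h
        fraction {f} {f′} e = begin
          θ (f * iV)
            ≈⟨ trans (θ-* f iV) (+-cong (*-congʳ e) (*-congˡ θiV)) ⟩
          f′ * h * iV + f * - (iV * (iV * (V′ * h)))
            ≈⟨ +-congʳ (trans (sym (trans (*-congˡ unit) (*-identityʳ _))) (solve 4 (λ a h i V → a :* h :* i :* (V :* i) := a :* V :* (i :* i) :* h) refl f′ h iV V)) ⟩
          f′ * V * (iV * iV) * h + f * - (iV * (iV * (V′ * h)))
            ≈⟨ solve 6 (λ a V i h f b → a :* V :* (i :* i) :* h :+ f :* (:- (i :* (i :* (b :* h)))) := (a :* V :- f :* b) :* (i :* i) :* h) refl f′ V iV h f V′ ⟩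
          (f′ * V - f * V′) * (iV * iV) * h ∎

        fraction₂ : ∀ {f f′} → θ f ≈ f′ * h → θ (f * (iV * iV)) ≈ (f′ * V - int (+ 2) * (f * V′)) * (iV * iV * iV) * h
        fraction₂ {f} {f′} e = begin
          θ (f * (iV * iV))
            ≈⟨ trans (θ-cong (sym (*-assoc f iV iV))) (trans (θ-* (f * iV) iV) (+-cong (*-congʳ (fraction e)) (*-congˡ θiV))) ⟩
          (f′ * V - f * V′) * (iV * iV) * h * iV + f * iV * - (iV * (iV * (V′ * h)))
            ≈⟨ solve 6 (λ a V i h f b → (a :* V :- f :* b) :* (i :* i) :* h :* i :+ f :* i :* (:- (i :* (i :* (b :* h)))) := (a :* V :- con (+ 2) :* (f :* b)) :* (i :* i :* i) :* h) refl f′ V iV h f V′ ⟩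
          (f′ * V - int (+ 2) * (f * V′)) * (iV * iV * iV) * h ∎

        n-h : ∀ y → n * (y * h) ≈ y * H * τ
        n-h y = trans (solve 3 (λ n y h → n :* (y :* h) := y :* (n :* h)) refl n y h) (trans (*-congˡ θH) (sym (*-assoc y H τ)))

      -- The identities are the equations of the system with H as the independent variable: n θ H =
      -- H τ has been inserted, and τ and the powers of V have been cleared.
      module Rational (N N′ G G′ U m m′ p p′ : Carrier) (G≈ : G ≈ H * U)
        (θN : θ N ≈ N′ * θ H) (θG : θ G ≈ G′ * θ H) (θm : θ m ≈ m′ * θ H) (θp : θ p ≈ p′ * θ H)
        (identity-N : N′ * V - N * V′ ≈ n * (int (+ 6) * U))
        (identity-G : int (+ 216) * (H * (G′ * V - int (+ 2) * (G * V′))) ≈ n * (p * N * V + int (+ 4) * (m * V) - int (+ 2) * (p * m)))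
        (identity-m : int (+ 8) * (H * (m′ * V - int (+ 2) * (m * V′))) ≈ n * (int (+ 12) * (G * p) + p * N * V + int (+ 4) * (m * V) - int (+ 2) * (p * m)))
        (identity-p : int (+ 8) * (H * ((N * N + int (+ 4) * (l * (V * V))) * (p′ * V - p * V′))) ≈
          n * (int (+ 192) * (G * m) + int (+ 4) * ((N * N + int (+ 4) * (l * (V * V))) * p * V) + int (+ 16) * (m * N * V)
            - (N * N + int (+ 4) * (l * (V * V))) * (p * p) - int (+ 16) * (m * m) - int (+ 48) * (G * N * p))) where

        -- `ŵ` is the asserted value of C_ℓ; `R̂`, `m̂`, `p̂` are the candidates for R₀, M and 4
        -- P/T, and `q` is n θ p̂ divided by τ.
        R̂ ŵ m̂ p̂ q : Carrier
        R̂ = N * iV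
        ŵ = - (int (+ 6) * (G * (iV * iV)))
        m̂ = m * (iV * iV)
        p̂ = p * iV
        q = (p′ * V - p * V′) * (iV * iV) * H

        θR̂ : n * θ R̂ ≈ - (n * (τ * ŵ))
        θR̂ = begin
          n * θ R̂
            ≈⟨ trans (*-congˡ (fraction θN)) (n-h _) ⟩
          (N′ * V - N * V′) * (iV * iV) * H * τ
            ≈⟨ *-congʳ (*-congʳ (*-congʳ identity-N)) ⟩
          n * (int (+ 6) * U) * (iV * iV) * H * τ
            ≈⟨ solve 5 (λ n U i H t → n :* (con (+ 6) :* U) :* (i :* i) :* H :* t := :- (n :* (t :* (:- (con (+ 6) :* (H :* U :* (i :* i))))))) refl n U iV H τ ⟩
          - (n * (τ * - (int (+ 6) * (H * U * (iV * iV)))))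
            ≈⟨ -‿cong (*-congˡ (*-congˡ (-‿cong (*-congˡ (*-congʳ (sym G≈)))))) ⟩
          - (n * (τ * ŵ)) ∎

        private
          common : Carrier
          common = p̂ * R̂ + int (+ 4) * m̂ - int (+ 2) * (p̂ * m̂)

          common≈ : (p * N * V + int (+ 4) * (m * V) - int (+ 2) * (p * m)) * (iV * iV * iV) ≈ common
          common≈ = begin
            (p * N * V + int (+ 4) * (m * V) - int (+ 2) * (p * m)) * (iV * iV * iV)
              ≈⟨ solve 5 (λ p N V m j → (p :* N :* V :+ con (+ 4) :* (m :* V) :- con (+ 2) :* (p :* m)) :* j := p :* N :* V :* j :+ con (+ 4) :* (m :* V :* j) :- con (+ 2) :* (p :* m :* j)) refl p N V m (iV * iV * iV) ⟩
            p * N * V * (iV * iV * iV) + int (+ 4) * (m * V * (iV * iV * iV)) - int (+ 2) * (p * m * (iV * iV * iV))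
              ≈⟨ +-congʳ (+-cong (sym (absorb (p * N))) (*-congˡ (sym (absorb m)))) ⟩
            p * N * (iV * iV) + int (+ 4) * (m * (iV * iV)) - int (+ 2) * (p * m * (iV * iV * iV))
              ≈⟨ solve 4 (λ p N m i → p :* N :* (i :* i) :+ con (+ 4) :* (m :* (i :* i)) :- con (+ 2) :* (p :* m :* (i :* i :* i)) :=
                  p :* i :* (N :* i) :+ con (+ 4) :* (m :* (i :* i)) :- con (+ 2) :* (p :* i :* (m :* (i :* i)))) refl p N m iV ⟩
            common ∎

        θŵ : int (+ 36) * θ ŵ ≈ - (τ * common)
        θŵ = n-cancel (begin
          n * (int (+ 36) * θ ŵ)
            ≈⟨ *-congˡ (*-congˡ (trans (θ-neg _) (-‿cong (trans (int*-θ (+ 6) _) (*-congˡ (fraction₂ θG)))))) ⟩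
          n * (int (+ 36) * - (int (+ 6) * ((G′ * V - int (+ 2) * (G * V′)) * (iV * iV * iV) * h)))
            ≈⟨ solve 4 (λ n y j h → n :* (con (+ 36) :* (:- (con (+ 6) :* (y :* j :* h)))) := :- (con (+ 216) :* (y :* j) :* (n :* h))) refl n _ _ h ⟩
          - (int (+ 216) * ((G′ * V - int (+ 2) * (G * V′)) * (iV * iV * iV)) * (n * h))
            ≈⟨ -‿cong (*-congˡ θH) ⟩
          - (int (+ 216) * ((G′ * V - int (+ 2) * (G * V′)) * (iV * iV * iV)) * (H * τ))
            ≈⟨ solve 4 (λ y j H t → :- (con (+ 216) :* (y :* j) :* (H :* t)) := :- (con (+ 216) :* (H :* y) :* j :* t)) refl _ _ H τ ⟩
          - (int (+ 216) * (H * (G′ * V - int (+ 2) * (G * V′))) * (iV * iV * iV) * τ)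
            ≈⟨ -‿cong (*-congʳ (*-congʳ identity-G)) ⟩
          - (n * (p * N * V + int (+ 4) * (m * V) - int (+ 2) * (p * m)) * (iV * iV * iV) * τ)
            ≈⟨ solve 4 (λ n y j t → :- (n :* y :* j :* t) := n :* (:- (t :* (y :* j)))) refl n _ _ τ ⟩
          n * - (τ * ((p * N * V + int (+ 4) * (m * V) - int (+ 2) * (p * m)) * (iV * iV * iV)))
            ≈⟨ *-congˡ (-‿cong (*-congˡ common≈)) ⟩
          n * - (τ * common) ∎)

        θm̂ : int (+ 8) * θ m̂ ≈ τ * (p̂ * R̂ + int (+ 4) * m̂ - int (+ 2) * (p̂ * m̂) - int (+ 2) * (ŵ * p̂))
        θm̂ = n-cancel (begin
          n * (int (+ 8) * θ m̂)
            ≈⟨ *-congˡ (*-congˡ (fraction₂ θm)) ⟩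
          n * (int (+ 8) * ((m′ * V - int (+ 2) * (m * V′)) * (iV * iV * iV) * h))
            ≈⟨ solve 4 (λ n y j h → n :* (con (+ 8) :* (y :* j :* h)) := con (+ 8) :* (y :* j) :* (n :* h)) refl n _ _ h ⟩
          int (+ 8) * ((m′ * V - int (+ 2) * (m * V′)) * (iV * iV * iV)) * (n * h)
            ≈⟨ *-congˡ θH ⟩
          int (+ 8) * ((m′ * V - int (+ 2) * (m * V′)) * (iV * iV * iV)) * (H * τ)
            ≈⟨ solve 4 (λ y j H t → con (+ 8) :* (y :* j) :* (H :* t) := con (+ 8) :* (H :* y) :* j :* t) refl _ _ H τ ⟩
          int (+ 8) * (H * (m′ * V - int (+ 2) * (m * V′))) * (iV * iV * iV) * τ
            ≈⟨ *-congʳ (*-congʳ identity-m) ⟩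
          n * (int (+ 12) * (G * p) + p * N * V + int (+ 4) * (m * V) - int (+ 2) * (p * m)) * (iV * iV * iV) * τ
            ≈⟨ solve 7 (λ n g a b c i t → n :* (con (+ 12) :* g :+ a :+ b :- c) :* (i :* i :* i) :* t := n :* (t :* ((a :+ b :- c) :* (i :* i :* i) :+ con (+ 12) :* g :* (i :* i :* i)))) refl n (G * p) (p * N * V) (int (+ 4) * (m * V)) (int (+ 2) * (p * m)) iV τ ⟩
          n * (τ * ((p * N * V + int (+ 4) * (m * V) - int (+ 2) * (p * m)) * (iV * iV * iV) + int (+ 12) * (G * p) * (iV * iV * iV)))
            ≈⟨ *-congˡ (*-congˡ (+-cong common≈ (solve 3 (λ G p i → con (+ 12) :* (G :* p) :* (i :* i :* i) := :- (con (+ 2) :* ((:- (con (+ 6) :* (G :* (i :* i)))) :* (p :* i)))) refl G p iV))) ⟩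
          n * (τ * (common - int (+ 2) * (ŵ * p̂))) ∎)

        θp̂ : n * θ p̂ ≈ q * τ
        θp̂ = trans (*-congˡ (fraction θp)) (n-h _)

        private
          s Ŝ : Carrier
          s = N * N + int (+ 4) * (l * (V * V))
          Ŝ = R̂ * R̂ + int (+ 4) * l

          Ŝ≈ : Ŝ ≈ s * (iV * iV)
          Ŝ≈ = trans (+-congˡ (*-congˡ (sym (trans (*-congˡ (trans (*-cong unit unit) (*-identityˡ 1#))) (*-identityʳ l)))))
            (solve 4 (λ N i l V → N :* i :* (N :* i) :+ con (+ 4) :* (l :* (V :* i :* (V :* i))) := (N :* N :+ con (+ 4) :* (l :* (V :* V))) :* (i :* i)) refl N iV l V)

        q-identity : int (+ 8) * (Ŝ * q) ≈ n * (int (+ 8) * (ŵ * R̂ * p̂) - int (+ 32) * (ŵ * m̂)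
          + int (+ 4) * (Ŝ * p̂) + int (+ 16) * (m̂ * R̂) - Ŝ * (p̂ * p̂) - int (+ 16) * (m̂ * m̂))
        q-identity = begin
          int (+ 8) * (Ŝ * q)
            ≈⟨ *-congˡ (*-congʳ Ŝ≈) ⟩
          int (+ 8) * (s * (iV * iV) * q)
            ≈⟨ solve 4 (λ s i d H → con (+ 8) :* (s :* (i :* i) :* (d :* (i :* i) :* H)) := con (+ 8) :* (H :* (s :* d)) :* (i :* i :* (i :* i))) refl s iV (p′ * V - p * V′) H ⟩
          int (+ 8) * (H * (s * (p′ * V - p * V′))) * I₄
            ≈⟨ *-congʳ identity-p ⟩
          n * (int (+ 192) * (G * m) + int (+ 4) * (s * p * V) + int (+ 16) * (m * N * V) - s * (p * p) - int (+ 16) * (m * m) - int (+ 48) * (G * N * p)) * I₄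
            ≈⟨ solve 8 (λ n a b c d e f j → n :* (con (+ 192) :* a :+ con (+ 4) :* b :+ con (+ 16) :* c :- d :- con (+ 16) :* e :- con (+ 48) :* f) :* j :=
                n :* (con (+ 192) :* (a :* j) :+ con (+ 4) :* (b :* j) :+ con (+ 16) :* (c :* j) :- d :* j :- con (+ 16) :* (e :* j) :- con (+ 48) :* (f :* j)))
                refl n (G * m) (s * p * V) (m * N * V) (s * (p * p)) (m * m) (G * N * p) I₄ ⟩
          n * (int (+ 192) * (G * m * I₄) + int (+ 4) * (s * p * V * I₄) + int (+ 16) * (m * N * V * I₄) - s * (p * p) * I₄ - int (+ 16) * (m * m * I₄) - int (+ 48) * (G * N * p * I₄))
            ≈⟨ *-congˡ (+-congʳ (+-congʳ (+-congʳ (+-cong (+-congˡ (*-congˡ (sym (absorb₂ (s * p))))) (*-congˡ (sym (absorb₂ (m * N)))))))) ⟩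
          n * (int (+ 192) * (G * m * I₄) + int (+ 4) * (s * p * (iV * iV * iV)) + int (+ 16) * (m * N * (iV * iV * iV)) - s * (p * p) * I₄ - int (+ 16) * (m * m * I₄) - int (+ 48) * (G * N * p * I₄))
            ≈⟨ *-congˡ (solve 6 (λ G m i s p N → con (+ 192) :* (G :* m :* (i :* i :* (i :* i))) :+ con (+ 4) :* (s :* p :* (i :* i :* i)) :+ con (+ 16) :* (m :* N :* (i :* i :* i))
                  :- s :* (p :* p) :* (i :* i :* (i :* i)) :- con (+ 16) :* (m :* m :* (i :* i :* (i :* i))) :- con (+ 48) :* (G :* N :* p :* (i :* i :* (i :* i))) :=
                con (+ 8) :* ((:- (con (+ 6) :* (G :* (i :* i)))) :* (N :* i) :* (p :* i)) :- con (+ 32) :* ((:- (con (+ 6) :* (G :* (i :* i)))) :* (m :* (i :* i)))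
                  :+ con (+ 4) :* (s :* (i :* i) :* (p :* i)) :+ con (+ 16) :* (m :* (i :* i) :* (N :* i)) :- s :* (i :* i) :* (p :* i :* (p :* i)) :- con (+ 16) :* (m :* (i :* i) :* (m :* (i :* i)))) refl G m iV s p N) ⟩
          n * (int (+ 8) * (ŵ * R̂ * p̂) - int (+ 32) * (ŵ * m̂) + int (+ 4) * (s * (iV * iV) * p̂) + int (+ 16) * (m̂ * R̂) - s * (iV * iV) * (p̂ * p̂) - int (+ 16) * (m̂ * m̂))
            ≈⟨ *-congˡ (+-congʳ (+-cong (+-congʳ (+-congˡ (*-congˡ (*-congʳ (sym Ŝ≈))))) (-‿cong (*-congʳ (sym Ŝ≈))))) ⟩
          n * (int (+ 8) * (ŵ * R̂ * p̂) - int (+ 32) * (ŵ * m̂) + int (+ 4) * (Ŝ * p̂) + int (+ 16) * (m̂ * R̂) - Ŝ * (p̂ * p̂) - int (+ 16) * (m̂ * m̂)) ∎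
          where
          I₄ : Carrier
          I₄ = iV * iV * (iV * iV)

        product-numerator : Ŝ * (p̂ * p̂) - int (+ 16) * (m̂ * m̂) ≈ (s * (p * p) - int (+ 16) * (m * m)) * (iV * iV * (iV * iV))
        product-numerator = trans (+-congʳ (*-congʳ Ŝ≈)) (solve 4 (λ s i p m → s :* (i :* i) :* (p :* i :* (p :* i)) :- con (+ 16) :* (m :* (i :* i) :* (m :* (i :* i))) :=
          (s :* (p :* p) :- con (+ 16) :* (m :* m)) :* (i :* i :* (i :* i))) refl s iV p m)

-- Polynomial identities by evaluation of coefficient lists.

module PolynomialReflection where
  open Defs
  open PowerSeries
  open RingIdentities
  open DualNumbersAndTruncation using (PS-ι; const-0; const-+; const-*)
  open EulerDerivation
  open CubicSystem

  open CommutativeRing PS-commutativeRing using (_≈_; +-cong; *-cong; +-congˡ; *-congˡ; trans; sym; zeroˡ; zeroʳ; +-identityˡ; +-identityʳ; -‿cong)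
    renaming (refl to ≈-refl; _+_ to _+ₚ_; _*_ to _*ₚ_; _-_ to _-ₚ_; -_ to -ₚ_)
  open RingSolver PS-commutativeRing PS-ι using (solve; _:=_; _:+_; _:*_)

  addL mulL : List ℤ → List ℤ → List ℤ
  addL []       g        = g
  addL (a ∷ f) []       = a ∷ f
  addL (a ∷ f) (b ∷ g) = a ℤ.+ b ∷ addL f g

  scaleL : ℤ → List ℤ → List ℤ
  scaleL c = map (c ℤ.*_)

  mulL []       g = []
  mulL (a ∷ f) g = addL (scaleL a g) (+ 0 ∷ mulL f g)

  -- The derivative of a + s f is f + s f′.
  derivL : List ℤ → List ℤ
  derivL []       = []
  derivL (a ∷ f) = addL f (+ 0 ∷ derivL f)

  isZero : List ℤ → Bool
  isZero []       = true
  isZero (a ∷ f) = ⌊ a ℤ.≟ + 0 ⌋ ∧ isZero f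

  module _ (s : PS) where

    poly-add : ∀ f g → poly (addL f g) s ≈ poly f s +ₚ poly g s
    poly-add []       g        = sym (trans (+-cong const-0 ≈-refl) (+-identityˡ (poly g s)))
    poly-add (a ∷ f) []       = sym (trans (+-congˡ {poly (a ∷ f) s} const-0) (+-identityʳ (poly (a ∷ f) s)))
    poly-add (a ∷ f) (b ∷ g) = trans (+-cong (const-+ a b) (*-congˡ {s} (poly-add f g)))
      (regroup (const a) (const b) s (poly f s) (poly g s))
      where
      regroup : ∀ a b s f g → (a +ₚ b) +ₚ s *ₚ (f +ₚ g) ≈ (a +ₚ s *ₚ f) +ₚ (b +ₚ s *ₚ g)
      regroup = solve 5 (λ a b s f g → (a :+ b) :+ s :* (f :+ g) := (a :+ s :* f) :+ (b :+ s :* g)) ≈-refl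

    poly-scale : ∀ c f → poly (scaleL c f) s ≈ const c *ₚ poly f s
    poly-scale c []       = sym (trans (*-congˡ {const c} const-0) (trans (zeroʳ (const c)) (sym const-0)))
    poly-scale c (a ∷ f) = trans (+-cong (const-* c a) (*-congˡ {s} (poly-scale c f))) (regroup (const c) (const a) s (poly f s))
      where
      regroup : ∀ c a s f → c *ₚ a +ₚ s *ₚ (c *ₚ f) ≈ c *ₚ (a +ₚ s *ₚ f)
      regroup = solve 4 (λ c a s f → c :* a :+ s :* (c :* f) := c :* (a :+ s :* f)) ≈-refl

    poly-shift : ∀ f → poly (+ 0 ∷ f) s ≈ s *ₚ poly f s
    poly-shift f = trans (+-cong const-0 ≈-refl) (+-identityˡ (s *ₚ poly f s))

    poly-mul : ∀ f g → poly (mulL f g) s ≈ poly f s *ₚ poly g s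
    poly-mul []       g = sym (trans (*-cong const-0 (≈-refl {poly g s})) (trans (zeroˡ (poly g s)) (sym const-0)))
    poly-mul (a ∷ f) g = trans (poly-add (scaleL a g) (+ 0 ∷ mulL f g))
      (trans (+-cong (poly-scale a g) (trans (poly-shift (mulL f g)) (*-congˡ {s} (poly-mul f g)))) (regroup (const a) s (poly f s) (poly g s)))
      where
      regroup : ∀ a s f g → a *ₚ g +ₚ s *ₚ (f *ₚ g) ≈ (a +ₚ s *ₚ f) *ₚ g
      regroup = solve 4 (λ a s f g → a :* g :+ s :* (f :* g) := (a :+ s :* f) :* g) ≈-refl

    poly-θ : ∀ f → θ (poly f s) ≈ poly (derivL f) s *ₚ θ s
    poly-θ []       = trans (θ-const (+ 0)) (sym (trans (*-cong const-0 (≈-refl {θ s})) (zeroˡ (θ s))))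
    poly-θ (a ∷ f) = trans (θ-⊕ (const a) (s *ₚ poly f s)) (trans (+-cong (θ-const a) (trans (θ-⊗ s (poly f s)) (+-congˡ {θ s *ₚ poly f s} (*-congˡ {s} (poly-θ f)))))
      (trans (regroup s (θ s) (poly f s) (poly (derivL f) s))
      (*-cong (sym (trans (poly-add f (+ 0 ∷ derivL f)) (+-congˡ {poly f s} (poly-shift (derivL f))))) (≈-refl {θ s}))))
      where
      regroup : ∀ s d f f′ → 0ₚ +ₚ (d *ₚ f +ₚ s *ₚ (f′ *ₚ d)) ≈ (f +ₚ s *ₚ f′) *ₚ d
      regroup s d f f′ = trans (+-identityˡ _) (solve 4 (λ s d f f′ → d :* f :+ s :* (f′ :* d) := (f :+ s :* f′) :* d) ≈-refl s d f f′)

    poly-isZero : ∀ f → isZero f ≡ true → poly f s ≈ 0ₚ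
    poly-isZero []       _ = const-0
    poly-isZero (a ∷ f) e with a ℤ.≟ + 0
    ... | yes ≡.refl = trans (poly-shift f) (trans (*-congˡ {s} (poly-isZero f e)) (zeroʳ s))
    poly-isZero (a ∷ f) () | no _

    -- `lit` keeps a coefficient list whole, so that its meaning is literally `poly f s`, the form
    -- in which U, V and the other polynomials occur.
    data Polynomial : Set where
      lit             : List ℤ → Polynomial
      num             : ℤ → Polynomial
      var             : Polynomial
      _⟨+⟩_ _⟨*⟩_ _⟨-⟩_ : Polynomial → Polynomial → Polynomial

    infixl 6 _⟨+⟩_ _⟨-⟩_
    infixl 7 _⟨*⟩_

    coefficients : Polynomial → List ℤ
    coefficients (lit f)   = f
    coefficients (num c)   = c ∷ []
    coefficients var       = + 0 ∷ + 1 ∷ []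
    coefficients (x ⟨+⟩ y) = addL (coefficients x) (coefficients y)
    coefficients (x ⟨*⟩ y) = mulL (coefficients x) (coefficients y)
    coefficients (x ⟨-⟩ y) = addL (coefficients x) (scaleL (ℤ.- (+ 1)) (coefficients y))

    ⟦_⟧ₚ : Polynomial → PS
    ⟦ lit f ⟧ₚ   = poly f s
    ⟦ num c ⟧ₚ   = const c
    ⟦ var ⟧ₚ     = s
    ⟦ x ⟨+⟩ y ⟧ₚ = ⟦ x ⟧ₚ +ₚ ⟦ y ⟧ₚ
    ⟦ x ⟨*⟩ y ⟧ₚ = ⟦ x ⟧ₚ *ₚ ⟦ y ⟧ₚ
    ⟦ x ⟨-⟩ y ⟧ₚ = ⟦ x ⟧ₚ -ₚ ⟦ y ⟧ₚ

    power : ℕ → Polynomial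
    power zero    = num (+ 1)
    power (suc k) = var ⟨*⟩ power k

    power-sound : ∀ k → ⟦ power k ⟧ₚ ≈ pow s k
    power-sound zero    = ≈-refl
    power-sound (suc k) = *-congˡ {s} (power-sound k)

    coefficients-sound : ∀ x → poly (coefficients x) s ≈ ⟦ x ⟧ₚ
    coefficients-sound (lit f)   = ≈-refl
    coefficients-sound (num c)   = trans (+-congˡ {const c} (trans (*-congˡ {s} const-0) (zeroʳ s))) (+-identityʳ (const c))
    coefficients-sound var       = trans (poly-shift (+ 1 ∷ [])) (trans (*-congˡ {s} (trans (+-congˡ {1ₚ} (trans (*-congˡ {s} const-0) (zeroʳ s))) (+-identityʳ 1ₚ)))
      (λ n → ≡.trans (⊗-comm s 1ₚ n) (⊗-identityˡ s n)))
    coefficients-sound (x ⟨+⟩ y) = trans (poly-add (coefficients x) (coefficients y)) (+-cong (coefficients-sound x) (coefficients-sound y))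
    coefficients-sound (x ⟨*⟩ y) = trans (poly-mul (coefficients x) (coefficients y)) (*-cong (coefficients-sound x) (coefficients-sound y))
    coefficients-sound (x ⟨-⟩ y) = trans (poly-add (coefficients x) (scaleL (ℤ.- (+ 1)) (coefficients y))) (+-cong (coefficients-sound x)
      (trans (poly-scale (ℤ.- (+ 1)) (coefficients y)) (trans (λ n → ≡.trans (const-⊗ (ℤ.- (+ 1)) (poly (coefficients y) s) n) (ℤₚ.-1*i≡-i _)) (-‿cong (coefficients-sound y)))))

    -- The test computes with integer lists alone, so an identity in the series H is settled without
    -- touching its coefficients.
    polynomial-identity : ∀ x y → isZero (coefficients (x ⟨-⟩ y)) ≡ true → ⟦ x ⟧ₚ ≈ ⟦ y ⟧ₚ
    polynomial-identity x y e n = ℤₚ.i-j≡0⇒i≡j _ _ (≡.trans (≡.sym (coefficients-sound (x ⟨-⟩ y) n)) (poly-isZero (coefficients (x ⟨-⟩ y)) e n))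

-- Lowest coefficients, resonances, and expansions to first order.

module LeadingCoefficients where
  open Defs
  open PowerSeries
  open import Data.Integer using (-_; _+_; _*_; _-_)
  open ≡

  Order : ℕ → PS → Set
  Order m f = ∀ k → k ℕ.< m → f k ≡ + 0

  order-⊗ : ∀ {m} g f → Order m f → Order m (g ⊗ f)
  order-⊗ g f o k k<m = sumTo-zero _ k (λ i _ → trans (cong (g i *_) (o (k ℕ.∸ i) (ℕₚ.≤-<-trans (ℕₚ.m∸n≤m k i) k<m))) (ℤₚ.*-zeroʳ (g i)))

  order-⊕ : ∀ {m f g} → Order m f → Order m g → Order m (f ⊕ g)
  order-⊕ o o′ k k<m = cong₂ _+_ (o k k<m) (o′ k k<m)

  lead : ∀ m g f → Order m f → (g ⊗ f) m ≡ g 0 * f m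
  lead zero    g f o = refl
  lead (suc m) g f o = trans (⊗-head g f m) (trans (cong (λ z → g 0 * f (suc m) + z) (order-⊗ (tail g) f o m (ℕₚ.n<1+n m))) (ℤₚ.+-identityʳ _))

  lead₁ : ∀ m g f → g 0 ≡ + 0 → Order m f → (g ⊗ f) (suc m) ≡ g 1 * f m
  lead₁ m g f z o = trans (⊗-head g f m) (trans (cong₂ (λ x y → x * f (suc m) + y) z (lead m (tail g) f o)) (trans (cong (_+ g 1 * f m) (ℤₚ.*-zeroˡ (f (suc m)))) (ℤₚ.+-identityˡ _)))

  order-⊗₁ : ∀ m g f → g 0 ≡ + 0 → Order m f → Order (suc m) (g ⊗ f)
  order-⊗₁ m g f z o zero    _         = trans (cong (_* f 0) z) (ℤₚ.*-zeroˡ (f 0))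
  order-⊗₁ m g f z o (suc k) (s≤s k<m) = trans (⊗-head g f k) (trans (cong₂ (λ x y → x * f (suc k) + y) z (order-⊗ (tail g) f o k k<m)) (trans (ℤₚ.+-identityʳ _) (ℤₚ.*-zeroˡ (f (suc k)))))

  order-pow : ∀ f k → f 0 ≡ + 0 → Order k (pow f k)
  order-pow f zero    z i ()
  order-pow f (suc k) z = order-⊗₁ k f (pow f k) z (order-pow f k z)

  lead-pow : ∀ f k → f 0 ≡ + 0 → f 1 ≡ + 1 → pow f k k ≡ + 1
  lead-pow f zero    z e = refl
  lead-pow f (suc k) z e = trans (lead₁ k f (pow f k) z (order-pow f k z)) (cong₂ _*_ e (lead-pow f k z e))

  *-zero-cancel : ∀ x y → x ≢ + 0 → x * y ≡ + 0 → y ≡ + 0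
  *-zero-cancel x y x≢0 e with ℤₚ.i*j≡0⇒i≡0∨j≡0 x e
  ... | inj₁ x≡0 = ⊥-elim (x≢0 x≡0)
  ... | inj₂ y≡0 = y≡0

  -- If all errors vanish below q^m, only the constant terms of the coefficients act at q^m, and
  -- those given as zero decouple e₃ and e₄ from e₁ and e₂. Then e₂ follows from e₃ and e₄, and e₁
  -- from e₂. At m = 0, where θ loses the coefficient, `e₁-0` and `e₂-0` step in.
  module Uniqueness (ℓ : ℕ) (e₁ e₂ e₃ e₄ e α β b₁ b₃ b₄ g₁ g₂ g₃ g₄ h₁ h₂ h₃ h₄ : PS)
    (θe₁ : const (+ suc ℓ) ⊗ θ e₁ ≈ₚ α ⊗ e₂)
    (θe₂ : const (+ 36) ⊗ θ e₂ ≈ₚ β ⊗ (b₁ ⊗ e₁ ⊕ b₃ ⊗ e₃ ⊕ b₄ ⊗ e₄))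
    (θe₃ : const (+ 8) ⊗ θ e₃ ≈ₚ e ⊗ (g₁ ⊗ e₁ ⊕ g₂ ⊗ e₂ ⊕ g₃ ⊗ e₃ ⊕ g₄ ⊗ e₄))
    (θe₄ : const (+ 8) ⊗ (const (+ suc ℓ) ⊗ θ e₄) ≈ₚ e ⊗ (h₁ ⊗ e₁ ⊕ h₂ ⊗ e₂ ⊕ h₃ ⊗ e₃ ⊕ h₄ ⊗ e₄))
    (e-0 : e 0 ≡ + 1) (b₁-0 : b₁ 0 ≡ + 0) (g₁-0 : g₁ 0 ≡ + 0) (g₂-0 : g₂ 0 ≡ + 0) (h₁-0 : h₁ 0 ≡ + 0) (h₂-0 : h₂ 0 ≡ + 0)
    (g₃-0 : g₃ 0 ≡ + 4 * (+ 1 + + ℓ)) (g₄-0 : g₄ 0 ≡ + 1 - + ℓ)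
    (h₃-0 : h₃ 0 ≡ + suc ℓ * (+ 16 * (+ 1 - + ℓ))) (h₄-0 : h₄ 0 ≡ + suc ℓ * (+ 4 * (+ 1 + + ℓ)))
    (e₁-0 : e₁ 0 ≡ + 0) (e₂-0 : e₂ 0 ≡ + 0)
    (first : + 4 * e₃ 1 + e₄ 1 ≡ + 0)
    (second : Order ℓ e₁ → Order ℓ e₃ → Order ℓ e₄ → e₄ ℓ - + 4 * e₃ ℓ ≡ + 0) where

    Below : ℕ → Set
    Below m = Order m e₁ × Order m e₂ × Order m e₃ × Order m e₄

    const⊗const : ∀ c d f n → (const c ⊗ (const d ⊗ f)) n ≡ c * (d * f n)
    const⊗const c d f n = trans (const-⊗ c (const d ⊗ f) n) (cong (c *_) (const-⊗ d f n))

    module Step (m : ℕ) (o₁ : Order m e₁) (o₂ : Order m e₂) (o₃ : Order m e₃) (o₄ : Order m e₄) where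
      sum₄ : ∀ c₁ c₂ c₃ c₄ → (e ⊗ (c₁ ⊗ e₁ ⊕ c₂ ⊗ e₂ ⊕ c₃ ⊗ e₃ ⊕ c₄ ⊗ e₄)) m ≡ c₁ 0 * e₁ m + c₂ 0 * e₂ m + c₃ 0 * e₃ m + c₄ 0 * e₄ m
      sum₄ c₁ c₂ c₃ c₄ = trans (lead m e _ (order-⊕ (order-⊕ (order-⊕ (order-⊗ c₁ e₁ o₁) (order-⊗ c₂ e₂ o₂)) (order-⊗ c₃ e₃ o₃)) (order-⊗ c₄ e₄ o₄)))
        (trans (cong₂ _*_ e-0 (cong₂ _+_ (cong₂ _+_ (cong₂ _+_ (lead m c₁ e₁ o₁) (lead m c₂ e₂ o₂)) (lead m c₃ e₃ o₃)) (lead m c₄ e₄ o₄))) (ℤₚ.*-identityˡ _))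

      eq₃ : + 8 * (+ m * e₃ m) ≡ + 4 * (+ 1 + + ℓ) * e₃ m + (+ 1 - + ℓ) * e₄ m
      eq₃ = trans (sym (const-⊗ (+ 8) (θ e₃) m)) (trans (θe₃ m) (trans (sum₄ g₁ g₂ g₃ g₄)
        (trans (cong₂ _+_ (cong₂ _+_ (cong₂ (λ x y → x * e₁ m + y * e₂ m) g₁-0 g₂-0) (cong (_* e₃ m) g₃-0)) (cong (_* e₄ m) g₄-0))
        (drop (e₁ m) (e₂ m) (+ 4 * (+ 1 + + ℓ) * e₃ m) _))))
        where
        drop : ∀ x y z w → + 0 * x + + 0 * y + z + w ≡ z + w
        drop = solve-∀

      eq₄ : + 8 * (+ m * e₄ m) ≡ + 16 * (+ 1 - + ℓ) * e₃ m + + 4 * (+ 1 + + ℓ) * e₄ m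
      eq₄ = ℤₚ.*-cancelˡ-≡ (+ suc ℓ) _ _ (trans (swap (+ suc ℓ) (+ m * e₄ m)) (trans (sym (const⊗const (+ 8) (+ suc ℓ) (θ e₄) m)) (trans (θe₄ m) (trans (sum₄ h₁ h₂ h₃ h₄)
        (trans (cong₂ _+_ (cong₂ _+_ (cong₂ (λ x y → x * e₁ m + y * e₂ m) h₁-0 h₂-0) (cong (_* e₃ m) h₃-0)) (cong (_* e₄ m) h₄-0))
        (drop (e₁ m) (e₂ m) (+ suc ℓ) (+ 16 * (+ 1 - + ℓ)) (e₃ m) (+ 4 * (+ 1 + + ℓ)) (e₄ m)))))))
        where
        swap : ∀ n x → n * (+ 8 * x) ≡ + 8 * (n * x)
        swap = solve-∀
        drop : ∀ x y n z p w q → + 0 * x + + 0 * y + n * z * p + n * w * q ≡ n * (z * p + w * q)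
        drop = solve-∀

      -- The matrix with rows (4 (1 + ℓ), 1 - ℓ) and (16 (1 - ℓ), 4 (1 + ℓ)) acts on (e₃, e₄) with
      -- eigenvalue 8 m; (4, 1) is a left eigenvector for 8, hence the resonance at m = 1.
      plus : (+ m - + 1) * (+ 4 * e₃ m + e₄ m) ≡ + 0
      plus = ℤₚ.*-cancelˡ-≡ (+ 8) _ _ (trans (expand (+ m) (e₃ m) (e₄ m)) (trans (cong₂ (λ x y → + 4 * x + y - + 8 * (+ 4 * e₃ m + e₄ m)) eq₃ eq₄) (collect (+ ℓ) (e₃ m) (e₄ m))))
        where
        expand : ∀ m x y → + 8 * ((m - + 1) * (+ 4 * x + y)) ≡ + 4 * (+ 8 * (m * x)) + + 8 * (m * y) - + 8 * (+ 4 * x + y)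
        expand = solve-∀
        collect : ∀ l x y → + 4 * (+ 4 * (+ 1 + l) * x + (+ 1 - l) * y) + (+ 16 * (+ 1 - l) * x + + 4 * (+ 1 + l) * y) - + 8 * (+ 4 * x + y) ≡ + 0
        collect = solve-∀

      -- The other left eigenvector, (-4, 1), belongs to 8 ℓ.
      minus : (+ m - + ℓ) * (e₄ m - + 4 * e₃ m) ≡ + 0
      minus = ℤₚ.*-cancelˡ-≡ (+ 8) _ _ (trans (expand (+ m) (+ ℓ) (e₃ m) (e₄ m)) (trans (cong₂ (λ x y → y - + 4 * x - + 8 * + ℓ * (e₄ m - + 4 * e₃ m)) eq₃ eq₄) (collect (+ ℓ) (e₃ m) (e₄ m))))
        where
        expand : ∀ m l x y → + 8 * ((m - l) * (y - + 4 * x)) ≡ + 8 * (m * y) - + 4 * (+ 8 * (m * x)) - + 8 * l * (y - + 4 * x)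
        expand = solve-∀
        collect : ∀ l x y → + 16 * (+ 1 - l) * x + + 4 * (+ 1 + l) * y - + 4 * (+ 4 * (+ 1 + l) * x + (+ 1 - l) * y) - + 8 * l * (y - + 4 * x) ≡ + 0
        collect = solve-∀

      different : ∀ {i j} → i ≢ j → + i - + j ≢ + 0
      different i≢j e = i≢j (ℤₚ.+-injective (ℤₚ.i-j≡0⇒i≡j _ _ e))

      plus-zero : + 4 * e₃ m + e₄ m ≡ + 0
      plus-zero with m ℕ.≟ 1
      ... | yes refl = first
      ... | no m≢1   = *-zero-cancel (+ m - + 1) _ (different m≢1) plus

      minus-zero : e₄ m - + 4 * e₃ m ≡ + 0
      minus-zero with m ℕ.≟ ℓ
      ... | yes refl = second o₁ o₃ o₄
      ... | no m≢ℓ   = *-zero-cancel (+ m - + ℓ) _ (different m≢ℓ) minus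

      zero₃ : e₃ m ≡ + 0
      zero₃ = *-zero-cancel (+ 8) (e₃ m) (λ ()) (trans (combine (e₃ m) (e₄ m)) (cong₂ _-_ plus-zero minus-zero))
        where
        combine : ∀ x y → + 8 * x ≡ + 4 * x + y - (y - + 4 * x)
        combine = solve-∀

      zero₄ : e₄ m ≡ + 0
      zero₄ = *-zero-cancel (+ 2) (e₄ m) (λ ()) (trans (combine (e₃ m) (e₄ m)) (cong₂ _+_ plus-zero minus-zero))
        where
        combine : ∀ x y → + 2 * y ≡ + 4 * x + y + (y - + 4 * x)
        combine = solve-∀

    step₂ : ∀ m → Below m → e₃ m ≡ + 0 → e₄ m ≡ + 0 → e₂ m ≡ + 0
    step₂ zero    _ _ _ = e₂-0
    step₂ (suc m) (o₁ , o₂ , o₃ , o₄) z₃ z₄ = *-zero-cancel (+ 36 * + suc m) (e₂ (suc m)) (λ ()) (trans (ℤₚ.*-assoc (+ 36) (+ suc m) _)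
      (trans (sym (const-⊗ (+ 36) (θ e₂) (suc m))) (trans (θe₂ (suc m)) (trans (lead (suc m) β _ (order-⊕ (order-⊕ (order-⊗ b₁ e₁ o₁) (order-⊗ b₃ e₃ o₃)) (order-⊗ b₄ e₄ o₄)))
      (trans (cong (β 0 *_) (cong₂ _+_ (cong₂ _+_ (trans (lead (suc m) b₁ e₁ o₁) (trans (cong (_* e₁ (suc m)) b₁-0) (ℤₚ.*-zeroˡ (e₁ (suc m)))))
        (trans (lead (suc m) b₃ e₃ o₃) (trans (cong (b₃ 0 *_) z₃) (ℤₚ.*-zeroʳ (b₃ 0))))) (trans (lead (suc m) b₄ e₄ o₄) (trans (cong (b₄ 0 *_) z₄) (ℤₚ.*-zeroʳ (b₄ 0))))))
      (ℤₚ.*-zeroʳ (β 0)))))))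

    step₁ : ∀ m → Below m → e₂ m ≡ + 0 → e₁ m ≡ + 0
    step₁ zero    _ _ = e₁-0
    step₁ (suc m) (o₁ , o₂ , o₃ , o₄) z₂ = *-zero-cancel (+ suc ℓ * + suc m) (e₁ (suc m)) (λ ()) (trans (ℤₚ.*-assoc (+ suc ℓ) (+ suc m) _)
      (trans (sym (const-⊗ (+ suc ℓ) (θ e₁) (suc m))) (trans (θe₁ (suc m)) (trans (lead (suc m) α e₂ o₂) (trans (cong (α 0 *_) z₂) (ℤₚ.*-zeroʳ (α 0)))))))

    extend : ∀ {m f} → Order m f → f m ≡ + 0 → Order (suc m) f
    extend {m} o z k (s≤s k≤m) with ℕₚ.m≤n⇒m<n∨m≡n k≤m
    ... | inj₁ k<m  = o k k<m
    ... | inj₂ refl = z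

    below : ∀ m → Below m
    below zero    = (λ _ ()) , (λ _ ()) , (λ _ ()) , (λ _ ())
    below (suc m) with below m
    ... | b@(o₁ , o₂ , o₃ , o₄) = extend o₁ (step₁ m b z₂) , extend o₂ z₂ , extend o₃ S.zero₃ , extend o₄ S.zero₄
      where
      module S = Step m o₁ o₂ o₃ o₄
      z₂ : e₂ m ≡ + 0
      z₂ = step₂ m b S.zero₃ S.zero₄

    e₂-vanishes : e₂ ≈ₚ 0ₚ
    e₂-vanishes m = proj₁ (proj₂ (below (suc m))) m (ℕₚ.n<1+n m)

  -- The coefficients at q⁰ and q¹ as indices of the type: for a compound expression they are
  -- assembled by unification and then evaluated.
  record Jet (f : PS) (x y : ℤ) : Set where
    constructor jet
    field
      at-0 : f 0 ≡ x
      at-1 : f 1 ≡ y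

  open Jet public

  value₀ value₁ : ∀ {f x y} → Jet f x y → ℤ
  value₀ {x = x} _ = x
  value₁ {y = y} _ = y

  jet-⊗ : ∀ {f g x y z w} → Jet f x y → Jet g z w → Jet (f ⊗ g) (x * z) (x * w + y * z)
  jet-⊗ (jet a b) (jet c d) = jet (cong₂ _*_ a c) (cong₂ _+_ (cong₂ _*_ a d) (cong₂ _*_ b c))

  jet-⊕ : ∀ {f g x y z w} → Jet f x y → Jet g z w → Jet (f ⊕ g) (x + z) (y + w)
  jet-⊕ (jet a b) (jet c d) = jet (cong₂ _+_ a c) (cong₂ _+_ b d)

  jet-⊖ : ∀ {f g x y z w} → Jet f x y → Jet g z w → Jet (f ⊖ g) (x - z) (y - w)
  jet-⊖ (jet a b) (jet c d) = jet (cong₂ _-_ a c) (cong₂ _-_ b d)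

  jet-neg : ∀ {f x y} → Jet f x y → Jet (neg f) (- x) (- y)
  jet-neg (jet a b) = jet (cong -_ a) (cong -_ b)

  jet-const : ∀ c → Jet (const c) c (+ 0)
  jet-const c = jet refl refl

  -- The second value copies the unfolding of `inv` at 1.
  jet-inv : ∀ {f x y} → Jet f x y → Jet (inv f) x (- (x * (y * x + + 0)))
  jet-inv (jet a b) = jet a (cong₂ (λ x y → - (x * (y * x + + 0))) a b)

  jet-X : ∀ f → f 0 ≡ + 1 → Jet (X ⊗ f) (+ 0) (+ 1)
  jet-X f e = jet (ℤₚ.*-zeroˡ (f 0)) (trans (cong₂ (λ x y → x + + 1 * y) (ℤₚ.*-zeroˡ (f 1)) e) refl)

  pow-0 : ∀ f k → f 0 ≡ + 1 → pow f k 0 ≡ + 1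
  pow-0 f zero    e = refl
  pow-0 f (suc k) e = cong₂ _*_ e (pow-0 f k e)

  coefficient₀ coefficient₁ : List ℤ → ℤ
  coefficient₀ []      = + 0
  coefficient₀ (c ∷ _) = c
  coefficient₁ []       = + 0
  coefficient₁ (_ ∷ cs) = coefficient₀ cs

  jet-poly : ∀ {H} cs → Jet H (+ 0) (+ 1) → Jet (poly cs H) (coefficient₀ cs) (coefficient₁ cs)
  jet-poly          []       _         = jet-const (+ 0)
  jet-poly {H} (c ∷ cs) j@(jet a b) = jet (trans (cong (λ z → c + z * poly cs H 0) a) (simplify₀ c (poly cs H 0)))
    (trans (cong₂ (λ x y → + 0 + (x * poly cs H 1 + y * poly cs H 0)) a b) (trans (simplify₁ (poly cs H 1) (poly cs H 0)) (at-0 (jet-poly cs j))))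
    where
    simplify₀ : ∀ c x → c + + 0 * x ≡ c
    simplify₀ = solve-∀
    simplify₁ : ∀ x y → + 0 + (+ 0 * x + + 1 * y) ≡ y
    simplify₁ = solve-∀

-- Comparison of the modular and the rational solution.

module HauptmodulParametrization where
  open Defs
  open PowerSeries
  open Inverse
  open LambertSeries
  open RingIdentities
  open DualNumbersAndTruncation using (PS-ι)
  open EulerDerivation
  open CubicSystem
  open PolynomialReflection
  open LeadingCoefficients
  open LevelSystem
  open ErrorSystem
  open RationalSystem
  open DivisorSums using (mono)
  open FiniteSums using (at->)

  module Units {c ℓ} (R : CommutativeRing c ℓ)
    (ι : ℤ-rawRing -Raw-AlmostCommutative⟶ fromCommutativeRing R) where
    open CommutativeRing R hiding (zero)
    open RingSolver R ι using (solve; con; _:=_; _:+_; _:*_; :-_; _:-_)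
    open _-Raw-AlmostCommutative⟶_ ι using () renaming (⟦_⟧ to int)

    inverse-unique : ∀ {x i j} → x * i ≈ 1# → x * j ≈ 1# → i ≈ j
    inverse-unique {x} {i} {j} p q = trans (sym (trans (*-congˡ q) (*-identityʳ i))) (trans
      (solve 3 (λ i x j → i :* (x :* j) := x :* i :* j) refl i x j) (trans (*-congʳ p) (*-identityˡ j)))

    square-inverse : ∀ {x i} → x * i ≈ 1# → x * (x * 1#) * (i * i) ≈ 1#
    square-inverse {x} {i} p = trans (*-congʳ (*-congˡ (*-identityʳ x))) (trans (solve 2 (λ x i → x :* x :* (i :* i) := x :* i :* (x :* i)) refl x i)
      (trans (*-cong p p) (*-identityˡ 1#)))

    divide : ∀ {u v w i W} → u * v * (u * v) * w ≈ W → u * (u * 1#) * (v * (v * 1#)) * i ≈ 1# → W * i ≈ w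
    divide {u} {v} {w} {i} {W} p q = trans (*-congʳ (sym p)) (trans (solve 4 (λ u v w i → u :* v :* (u :* v) :* w :* i := w :* (u :* u :* (v :* v) :* i)) refl u v w i)
      (trans (*-congˡ (trans (*-congʳ (sym (*-cong (*-congˡ (*-identityʳ u)) (*-congˡ (*-identityʳ v))))) q)) (*-identityʳ w)))

    minus-six : ∀ {G H U i j} → G ≈ H * U → i ≈ j → - (int (+ 6) * (G * i)) ≈ int (ℤ.- (+ 6)) * (H * (U * j))
    minus-six {G} {H} {U} {i} {j} p q = trans (-‿cong (*-congˡ (*-cong p q)))
      (solve 3 (λ H U j → :- (con (+ 6) :* (H :* U :* j)) := con (ℤ.- (+ 6)) :* (H :* (U :* j))) refl H U j)

    to-right : ∀ c V h i → c * (V * h) * i ≈ c * V * i * h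
    to-right = solve 4 (λ c V h i → c :* (V :* h) :* i := c :* V :* i :* h) refl

    difference-zero : ∀ {x y} → x - y ≈ 0# → x ≈ y
    difference-zero {x} {y} p = trans (solve 2 (λ x y → x := (x :- y) :+ y) refl x y) (trans (+-congʳ p) (+-identityˡ y))

  open Units PS-commutativeRing PS-ι

  PS-differentialRing : DifferentialRing 0ℓ 0ℓ
  PS-differentialRing = record
    { R = PS-commutativeRing ; ι = PS-ι ; θ = θ ; θ-cong = θ-cong ; θ-+ = θ-⊕ ; θ-* = θ-⊗ ; θ-int = θ-const }


  one-⊗ : ∀ {f g} → f ≈ₚ g → f ≈ₚ const (+ 1) ⊗ g
  one-⊗ {g = g} e n = ≡.trans (e n) (≡.sym (⊗-identityˡ g n))

  const-cancel : ∀ c {x y} → const (+ suc c) ⊗ x ≈ₚ const (+ suc c) ⊗ y → x ≈ₚ y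
  const-cancel c {x} {y} e n = ℤₚ.*-cancelˡ-≡ (+ suc c) (x n) (y n) (≡.trans (≡.sym (const-⊗ (+ suc c) x n)) (≡.trans (e n) (const-⊗ (+ suc c) y n)))

  order-scale : ∀ d f → f 0 ≡ + 0 → Order (suc d) (scale (suc d) f)
  order-scale d f z k k<d = ≡.trans (scale-expansion d k f k ℕₚ.≤-refl) (sumTo-zero _ k (λ { zero _ → ≡.trans (≡.cong (ℤ._* mono (suc d ℕ.* 0) k) z) (ℤₚ.*-zeroˡ (mono (suc d ℕ.* 0) k))
    ; (suc i) _ → ≡.trans (≡.cong (f (suc i) ℤ.*_) (at-> (+ 1) (ℕₚ.<-≤-trans k<d (ℕₚ.m≤m*n (suc d) (suc i))))) (ℤₚ.*-zeroʳ (f (suc i))) }))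

  lead-left : ∀ {m} f g → Order m f → (f ⊗ g) m ≡ f m ℤ.* g 0
  lead-left {m} f g o = ≡.trans (⊗-comm f g m) (≡.trans (lead m g f o) (ℤₚ.*-comm (g 0) (f m)))

  order-left : ∀ {m} f g → Order m f → Order m (f ⊗ g)
  order-left f g o k k<m = ≡.trans (⊗-comm f g k) (order-⊗ g f o k k<m)

  module _ {d : ℕ} {e R₀ T w P M R̂ ŵ m̂ p̂ q : PS}
    (errors : Errors.ErrorEquations PS-differentialRing (const (+ suc d)) e R₀ T w P M R̂ ŵ m̂ p̂ q)
    (e-0 : e 0 ≡ + 1) (P-0 : (const (+ 4) ⊗ P) 0 ≡ + 0) (P′-0 : neg (const (+ 8) ⊗ P) 0 ≡ + 0)
    (h₁-0 : (const (+ suc d) ⊗ (const (+ 16) ⊗ m̂ ⊕ const (+ 8) ⊗ (p̂ ⊗ ŵ) ⊕ (const (+ 4) ⊗ p̂ ⊖ p̂ ⊗ p̂) ⊗ (R₀ ⊕ R̂)) ⊖ const (+ 8) ⊗ (q ⊗ (R₀ ⊕ R̂))) 0 ≡ + 0)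
    (h₂-0 : (const (+ suc d) ⊗ (const (+ 8) ⊗ (R₀ ⊗ p̂) ⊖ const (+ 32) ⊗ M)) 0 ≡ + 0)
    (g₃-0 : (const (+ 4) ⊗ T ⊖ const (+ 8) ⊗ P) 0 ≡ + 4 ℤ.* (+ 1 ℤ.+ + d))
    (g₄-0 : (R̂ ⊖ const (+ 2) ⊗ m̂ ⊖ const (+ 2) ⊗ ŵ) 0 ≡ + 1 ℤ.- + d)
    (h₃-0 : (const (+ suc d) ⊗ (const (+ 16) ⊗ R₀ ⊖ const (+ 16) ⊗ (M ⊕ m̂) ⊖ const (+ 32) ⊗ ŵ)) 0 ≡ + suc d ℤ.* (+ 16 ℤ.* (+ 1 ℤ.- + d)))
    (h₄-0 : (const (+ suc d) ⊗ (const (+ 4) ⊗ T ⊖ const (+ 4) ⊗ P ⊖ T ⊗ p̂)) 0 ≡ + suc d ℤ.* (+ 4 ℤ.* (+ 1 ℤ.+ + d)))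
    (e₁-0 : (R₀ ⊖ R̂) 0 ≡ + 0) (e₂-0 : (w ⊖ ŵ) 0 ≡ + 0) (first : + 4 ℤ.* (M ⊖ m̂) 1 ℤ.+ (const (+ 4) ⊗ P ⊖ T ⊗ p̂) 1 ≡ + 0)
    (second : Order d (R₀ ⊖ R̂) → Order d (M ⊖ m̂) → Order d (const (+ 4) ⊗ P ⊖ T ⊗ p̂) →
      (const (+ 4) ⊗ P ⊖ T ⊗ p̂) d ℤ.- + 4 ℤ.* (M ⊖ m̂) d ≡ + 0) where

    open Errors.ErrorEquations errors

    errors-vanish : w ≈ₚ ŵ
    errors-vanish = difference-zero (Uniqueness.e₂-vanishes d (R₀ ⊖ R̂) (w ⊖ ŵ) (M ⊖ m̂) (const (+ 4) ⊗ P ⊖ T ⊗ p̂) e (neg (const (+ suc d) ⊗ (e ⊗ T))) (neg e)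
      (const (+ 4) ⊗ P) (const (+ 4) ⊗ T ⊖ const (+ 8) ⊗ P) (R̂ ⊖ const (+ 2) ⊗ m̂)
      (const (+ 4) ⊗ P) (neg (const (+ 8) ⊗ P)) (const (+ 4) ⊗ T ⊖ const (+ 8) ⊗ P) (R̂ ⊖ const (+ 2) ⊗ m̂ ⊖ const (+ 2) ⊗ ŵ)
      (const (+ suc d) ⊗ (const (+ 16) ⊗ m̂ ⊕ const (+ 8) ⊗ (p̂ ⊗ ŵ) ⊕ (const (+ 4) ⊗ p̂ ⊖ p̂ ⊗ p̂) ⊗ (R₀ ⊕ R̂)) ⊖ const (+ 8) ⊗ (q ⊗ (R₀ ⊕ R̂)))
      (const (+ suc d) ⊗ (const (+ 8) ⊗ (R₀ ⊗ p̂) ⊖ const (+ 32) ⊗ M))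
      (const (+ suc d) ⊗ (const (+ 16) ⊗ R₀ ⊖ const (+ 16) ⊗ (M ⊕ m̂) ⊖ const (+ 32) ⊗ ŵ))
      (const (+ suc d) ⊗ (const (+ 4) ⊗ T ⊖ const (+ 4) ⊗ P ⊖ T ⊗ p̂))
      θe₁ θe₂ θe₃ θe₄ e-0 P-0 P-0 P′-0 h₁-0 h₂-0 g₃-0 g₄-0 h₃-0 h₄-0 e₁-0 e₂-0 first second)

  module Parametrization (d′ k : ℕ) (1+L*k : (+ 1 ℤ.+ + suc d′) ℤ.* + k ≡ + 12) (Ul Vl Nl ml pl : List ℤ) where
    open Scaled d′
    open Hauptmodul k 1+L*k

    private
      S-a-0 : S a 0 ≡ + 1
      S-a-0 = ≡.refl

    module Lv = Differential.WeightZeroPair PS-differentialRing L a (inv a) s₂ s₁ (S a) (inv (S a)) (S s₂) (S s₁)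
      (⊗-inverseʳ a ≡.refl) (⊗-inverseʳ (S a) S-a-0) (one-⊗ θ-a) (one-⊗ θ-s₁) (one-⊗ θ-s₂) θ-S-a θ-S-s₁ θ-S-s₂

    n l U V iV N G m p : PS
    n = const (+ suc d)
    l = const L
    U = poly Ul H
    V = poly Vl H
    iV = inv V
    N = poly Nl H
    G = poly (+ 0 ∷ Ul) H
    m = poly ml H
    p = poly pl H

    τ : PS
    τ = Lv.e ⊗ Lv.T

    θH-τ : n ⊗ θ H ≈ₚ H ⊗ τ
    θH-τ i = ≡.trans (θ-H i) (⊗-cong {H} (λ _ → ≡.refl) (λ j → ≡.sym (Lv.eT j)) i)

    module _ (V-0 : V 0 ≡ + 1) where
      unit-V : V ⊗ iV ≈ₚ 1ₚ
      unit-V = ⊗-inverseʳ V V-0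

      private
        Vp Np Gp Up mp pp V′p N′p G′p m′p p′p lp sp : Polynomial H
        Vp = lit Vl
        Np = lit Nl
        Gp = lit (+ 0 ∷ Ul)
        Up = lit Ul
        mp = lit ml
        pp = lit pl
        V′p = lit (derivL Vl)
        N′p = lit (derivL Nl)
        G′p = lit (derivL (+ 0 ∷ Ul))
        m′p = lit (derivL ml)
        p′p = lit (derivL pl)
        lp = num L
        sp = Np ⟨*⟩ Np ⟨+⟩ num (+ 4) ⟨*⟩ (lp ⟨*⟩ (Vp ⟨*⟩ Vp))
        np : Polynomial H
        np = num (+ suc d)

        lhs-N rhs-N lhs-G rhs-G lhs-m rhs-m lhs-p rhs-p lhs-g rhs-g : Polynomial H
        lhs-N = N′p ⟨*⟩ Vp ⟨-⟩ Np ⟨*⟩ V′p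
        rhs-N = np ⟨*⟩ (num (+ 6) ⟨*⟩ Up)
        lhs-G = num (+ 216) ⟨*⟩ (var ⟨*⟩ (G′p ⟨*⟩ Vp ⟨-⟩ num (+ 2) ⟨*⟩ (Gp ⟨*⟩ V′p)))
        rhs-G = np ⟨*⟩ (pp ⟨*⟩ Np ⟨*⟩ Vp ⟨+⟩ num (+ 4) ⟨*⟩ (mp ⟨*⟩ Vp) ⟨-⟩ num (+ 2) ⟨*⟩ (pp ⟨*⟩ mp))
        lhs-m = num (+ 8) ⟨*⟩ (var ⟨*⟩ (m′p ⟨*⟩ Vp ⟨-⟩ num (+ 2) ⟨*⟩ (mp ⟨*⟩ V′p)))
        rhs-m = np ⟨*⟩ (num (+ 12) ⟨*⟩ (Gp ⟨*⟩ pp) ⟨+⟩ pp ⟨*⟩ Np ⟨*⟩ Vp ⟨+⟩ num (+ 4) ⟨*⟩ (mp ⟨*⟩ Vp) ⟨-⟩ num (+ 2) ⟨*⟩ (pp ⟨*⟩ mp))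
        lhs-p = num (+ 8) ⟨*⟩ (var ⟨*⟩ (sp ⟨*⟩ (p′p ⟨*⟩ Vp ⟨-⟩ pp ⟨*⟩ V′p)))
        rhs-p = np ⟨*⟩ (num (+ 192) ⟨*⟩ (Gp ⟨*⟩ mp) ⟨+⟩ num (+ 4) ⟨*⟩ (sp ⟨*⟩ pp ⟨*⟩ Vp) ⟨+⟩ num (+ 16) ⟨*⟩ (mp ⟨*⟩ Np ⟨*⟩ Vp)
          ⟨-⟩ sp ⟨*⟩ (pp ⟨*⟩ pp) ⟨-⟩ num (+ 16) ⟨*⟩ (mp ⟨*⟩ mp) ⟨-⟩ num (+ 48) ⟨*⟩ (Gp ⟨*⟩ Np ⟨*⟩ pp))
        lhs-g = sp ⟨*⟩ (pp ⟨*⟩ pp) ⟨-⟩ num (+ 16) ⟨*⟩ (mp ⟨*⟩ mp)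
        -- 46656 = 216²: of the two factors of the difference of squares, one begins with 216 q and
        -- the other must begin with 216 L q^d.
        rhs-g = num (+ 46656 ℤ.* L) ⟨*⟩ (Vp ⟨*⟩ power H (suc d))

      module _
        (check-N : isZero (coefficients H (lhs-N ⟨-⟩ rhs-N)) ≡ true) (check-G : isZero (coefficients H (lhs-G ⟨-⟩ rhs-G)) ≡ true)
        (check-m : isZero (coefficients H (lhs-m ⟨-⟩ rhs-m)) ≡ true) (check-p : isZero (coefficients H (lhs-p ⟨-⟩ rhs-p)) ≡ true)
        (check-g : isZero (coefficients H (lhs-g ⟨-⟩ rhs-g)) ≡ true) where

        module Hat = RationalParametrization.Hats.Rational PS-differentialRing n (const-cancel d) l τ H θH-τ V iV (poly (derivL Vl) H) unit-V (poly-θ H Vl)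
            N (poly (derivL Nl) H) G (poly (derivL (+ 0 ∷ Ul)) H) U m (poly (derivL ml) H) p (poly (derivL pl) H) (poly-shift H Ul)
          (poly-θ H Nl) (poly-θ H (+ 0 ∷ Ul)) (poly-θ H ml) (poly-θ H pl)
          (polynomial-identity H lhs-N rhs-N check-N) (polynomial-identity H lhs-G rhs-G check-G)
          (polynomial-identity H lhs-m rhs-m check-m) (polynomial-identity H lhs-p rhs-p check-p)

        common : PS
        common = Hat.p̂ ⊗ Hat.R̂ ⊕ const (+ 4) ⊗ Hat.m̂ ⊖ const (+ 2) ⊗ (Hat.p̂ ⊗ Hat.m̂)

        private
          reassociate : ∀ f → τ ⊗ f ≈ₚ Lv.e ⊗ (Lv.T ⊗ f)
          reassociate f = ⊗-assoc Lv.e Lv.T f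

        module Err = Errors.System PS-differentialRing n l Lv.e Lv.R₀ Lv.T Lv.w Lv.P Lv.M Lv.θR₀ Lv.θT Lv.θw Lv.θP Lv.θM Lv.T²
          Hat.R̂ Hat.ŵ Hat.m̂ Hat.p̂ Hat.q
          (λ i → ≡.trans (Hat.θR̂ i) (≡.cong ℤ.-_ (⊗-cong {n} (λ _ → ≡.refl) (reassociate Hat.ŵ) i)))
          (λ i → ≡.trans (Hat.θŵ i) (≡.cong ℤ.-_ (reassociate common i)))
          (λ i → ≡.trans (Hat.θm̂ i) (reassociate (common ⊖ const (+ 2) ⊗ (Hat.ŵ ⊗ Hat.p̂)) i))
          Hat.θp̂ Hat.q-identity

        A Bm g : PS
        A  = Lv.T ⊗ Hat.p̂ ⊕ const (+ 4) ⊗ Hat.m̂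
        Bm = Lv.T ⊗ Hat.p̂ ⊖ const (+ 4) ⊗ Hat.m̂
        g  = Hat.p̂ ⊗ Hat.p̂ ⊗ (Lv.R₀ ⊕ Hat.R̂)

        -- As 4 P - 4 M = 8 X₂, the combination that is resonant at q^d compares X₂ with `Bm`. The
        -- lowest term of X₂ is known, because K(q^d) begins with q^d.
        key : ∀ i → Err.e₄ i ℤ.- + 4 ℤ.* Err.e₃ i ≡ + 8 ℤ.* Lv.X₂ i ℤ.- Bm i
        key i = ≡.trans (≡.cong (λ z → z ℤ.- (Lv.T ⊗ Hat.p̂) i ℤ.- + 4 ℤ.* (Lv.X₁ i ℤ.- Lv.X₂ i ℤ.- Hat.m̂ i)) (const-⊗ (+ 4) Lv.P i))
          (≡.trans (regroup (Lv.X₁ i) (Lv.X₂ i) ((Lv.T ⊗ Hat.p̂) i) (Hat.m̂ i)) (≡.cong (λ z → + 8 ℤ.* Lv.X₂ i ℤ.- ((Lv.T ⊗ Hat.p̂) i ℤ.- z)) (≡.sym (const-⊗ (+ 4) Hat.m̂ i))))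
          where
          regroup : ∀ x y t m → + 4 ℤ.* (x ℤ.+ y) ℤ.- t ℤ.- + 4 ℤ.* (x ℤ.- y ℤ.- m) ≡ + 8 ℤ.* y ℤ.- (t ℤ.- + 4 ℤ.* m)
          regroup = solve-∀

        product : A ⊗ Bm ≈ₚ const (+ 46656 ℤ.* L) ⊗ V ⊗ (iV ⊗ iV ⊗ (iV ⊗ iV)) ⊗ pow H (suc d) ⊕ g ⊗ Err.e₁
        product i = ≡.trans (Err.product-identity i) (≡.cong (ℤ._+ (g ⊗ Err.e₁) i) (≡.trans (Hat.product-numerator i)
          (≡.trans (⊗-cong {g = iV ⊗ iV ⊗ (iV ⊗ iV)} (polynomial-identity H lhs-g rhs-g check-g) (λ _ → ≡.refl) i)
          (≡.trans (⊗-cong {g = iV ⊗ iV ⊗ (iV ⊗ iV)} (⊗-cong {const (+ 46656 ℤ.* L)} (λ _ → ≡.refl) (⊗-cong {V} (λ _ → ≡.refl) (power-sound H (suc d)))) (λ _ → ≡.refl) i)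
          (to-right (const (+ 46656 ℤ.* L)) V (pow H (suc d)) (iV ⊗ iV ⊗ (iV ⊗ iV)) i)))))

        X₂-inner : PS
        X₂-inner = const L ⊗ (S s₂ ⊗ inv (S a)) ⊗ (inv a ⊗ inv (S a))

        order-κ : Order d (S s₂ ⊗ inv (S a))
        order-κ = order-left (S s₂) (inv (S a)) (order-scale d′ s₂ ≡.refl)

        order-X₂ : Order d Lv.X₂
        order-X₂ = order-⊗ (const (+ 27)) X₂-inner (order-left (const L ⊗ (S s₂ ⊗ inv (S a))) (inv a ⊗ inv (S a)) (order-⊗ (const L) (S s₂ ⊗ inv (S a)) order-κ))

        lead-X₂ : Lv.X₂ d ≡ + 27 ℤ.* L
        lead-X₂ = ≡.trans (const-⊗ (+ 27) X₂-inner d) (≡.cong (+ 27 ℤ.*_) (≡.trans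
          (lead-left (const L ⊗ (S s₂ ⊗ inv (S a))) (inv a ⊗ inv (S a)) (order-⊗ (const L) (S s₂ ⊗ inv (S a)) order-κ))
          (≡.trans (≡.cong₂ (λ x y → x ℤ.* (+ 1 ℤ.* y)) (≡.trans (const-⊗ L (S s₂ ⊗ inv (S a)) d) (≡.cong (L ℤ.*_) (≡.trans (lead-left (S s₂) (inv (S a)) (order-scale d′ s₂ ≡.refl))
            (≡.cong₂ ℤ._*_ S-s₂-d S-a-0)))) S-a-0) (unit-factors L))))
          where
          S-s₂-d : S s₂ d ≡ + 1
          S-s₂-d = ≡.trans (≡.cong (S s₂) (≡.sym (ℕₚ.*-identityʳ d))) (scale-* d′ s₂ 1)
          unit-factors : ∀ x → x ℤ.* + 1 ℤ.* + 1 ≡ x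
          unit-factors = solve-∀

        -- The hypotheses hold by computation for a given d ≥ 2, since the scaled series have no
        -- term in q.
        module Jets (S-a-1 : S a 1 ≡ + 0) (S-s₁-1 : S s₁ 1 ≡ + 0) (S-s₂-1 : S s₂ 1 ≡ + 0) where
          private
            ja   = jet {a} {+ 1} {+ 6} ≡.refl ≡.refl
            js₁  = jet {s₁} {+ 0} {+ 1} ≡.refl ≡.refl
            js₂  = jet {s₂} {+ 0} {+ 1} ≡.refl ≡.refl
            jv   = jet {S a} {+ 1} {+ 0} S-a-0 S-a-1
            jp₂  = jet {S s₁} {+ 0} {+ 0} ≡.refl S-s₁-1
            jK₂  = jet {S s₂} {+ 0} {+ 0} ≡.refl S-s₂-1
            jiu  = jet-inv ja
            jiv  = jet-inv jv
            jj   = jet-⊗ jiu jiv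
            jκ₁  = jet-⊗ js₂ jiu
            jκ₂  = jet-⊗ jK₂ jiv
            num-⊗ : ∀ c {f x y} → Jet f x y → Jet (const c ⊗ f) _ _
            num-⊗ c = jet-⊗ (jet-const c)
          jH : Jet H _ _
          jH = jet-X (pow quotient k) (pow-0 quotient k ≡.refl)
          je : Jet Lv.e _ _
          je = jet-⊗ ja jv
          jr   = jet-⊗ ja jiv
          jr̄   = num-⊗ L (jet-⊗ jv jiu)
          jR₀  = jet-⊖ jr jr̄
          jT   = jet-⊕ jr jr̄
          jX₁  = num-⊗ (+ 27) (jet-⊗ jκ₁ jj)
          jX₂  = num-⊗ (+ 27) (jet-⊗ (num-⊗ L jκ₂) jj)
          jP   = jet-⊕ jX₁ jX₂
          jM   = jet-⊖ jX₁ jX₂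
          jw   = jet-⊗ (jet-⊖ (num-⊗ L (jet-⊖ (num-⊗ (+ 9) jκ₂) (num-⊗ (+ 3) jp₂))) (num-⊗ (+ 1) (jet-⊖ (num-⊗ (+ 9) jκ₁) (num-⊗ (+ 3) js₁)))) jj
          jV   = jet-poly Vl jH
          jiV  = jet-inv jV
          jR̂   = jet-⊗ (jet-poly Nl jH) jiV
          jŵ   = jet-neg (num-⊗ (+ 6) (jet-⊗ (jet-poly (+ 0 ∷ Ul) jH) (jet-⊗ jiV jiV)))
          jm̂   = jet-⊗ (jet-poly ml jH) (jet-⊗ jiV jiV)
          jp̂   = jet-⊗ (jet-poly pl jH) jiV
          jq   = jet-⊗ (jet-⊗ (jet-⊖ (jet-⊗ (jet-poly (derivL pl) jH) jV) (jet-⊗ (jet-poly pl jH) (jet-poly (derivL Vl) jH))) (jet-⊗ jiV jiV)) jH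
          jn   = jet-const (+ suc d)
          jA : Jet A _ _
          jA = jet-⊕ (jet-⊗ jT jp̂) (num-⊗ (+ 4) jm̂)
          jRR̂  = jet-⊕ jR₀ jR̂
          jg : Jet g _ _
          jg = jet-⊗ (jet-⊗ jp̂ jp̂) jRR̂
          j4P : Jet (const (+ 4) ⊗ Lv.P) _ _
          j4P = num-⊗ (+ 4) jP
          j8P : Jet (neg (const (+ 8) ⊗ Lv.P)) _ _
          j8P = jet-neg (num-⊗ (+ 8) jP)
          jh₁ : Jet (n ⊗ (const (+ 16) ⊗ Hat.m̂ ⊕ const (+ 8) ⊗ (Hat.p̂ ⊗ Hat.ŵ) ⊕ (const (+ 4) ⊗ Hat.p̂ ⊖ Hat.p̂ ⊗ Hat.p̂) ⊗ (Lv.R₀ ⊕ Hat.R̂)) ⊖ const (+ 8) ⊗ (Hat.q ⊗ (Lv.R₀ ⊕ Hat.R̂))) _ _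
          jh₁ = jet-⊖ (jet-⊗ jn (jet-⊕ (jet-⊕ (num-⊗ (+ 16) jm̂) (num-⊗ (+ 8) (jet-⊗ jp̂ jŵ))) (jet-⊗ (jet-⊖ (num-⊗ (+ 4) jp̂) (jet-⊗ jp̂ jp̂)) jRR̂))) (num-⊗ (+ 8) (jet-⊗ jq jRR̂))
          jh₂ : Jet (n ⊗ (const (+ 8) ⊗ (Lv.R₀ ⊗ Hat.p̂) ⊖ const (+ 32) ⊗ Lv.M)) _ _
          jh₂ = jet-⊗ jn (jet-⊖ (num-⊗ (+ 8) (jet-⊗ jR₀ jp̂)) (num-⊗ (+ 32) jM))
          jg₃ : Jet (const (+ 4) ⊗ Lv.T ⊖ const (+ 8) ⊗ Lv.P) _ _
          jg₃ = jet-⊖ (num-⊗ (+ 4) jT) (num-⊗ (+ 8) jP)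
          jg₄ : Jet (Hat.R̂ ⊖ const (+ 2) ⊗ Hat.m̂ ⊖ const (+ 2) ⊗ Hat.ŵ) _ _
          jg₄ = jet-⊖ (jet-⊖ jR̂ (num-⊗ (+ 2) jm̂)) (num-⊗ (+ 2) jŵ)
          jh₃ : Jet (n ⊗ (const (+ 16) ⊗ Lv.R₀ ⊖ const (+ 16) ⊗ (Lv.M ⊕ Hat.m̂) ⊖ const (+ 32) ⊗ Hat.ŵ)) _ _
          jh₃ = jet-⊗ jn (jet-⊖ (jet-⊖ (num-⊗ (+ 16) jR₀) (num-⊗ (+ 16) (jet-⊕ jM jm̂))) (num-⊗ (+ 32) jŵ))
          jh₄ : Jet (n ⊗ (const (+ 4) ⊗ Lv.T ⊖ const (+ 4) ⊗ Lv.P ⊖ Lv.T ⊗ Hat.p̂)) _ _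
          jh₄ = jet-⊗ jn (jet-⊖ (jet-⊖ (num-⊗ (+ 4) jT) (num-⊗ (+ 4) jP)) (jet-⊗ jT jp̂))
          je₁ : Jet Err.e₁ _ _
          je₁ = jet-⊖ jR₀ jR̂
          je₂ : Jet Err.e₂ _ _
          je₂ = jet-⊖ jw jŵ
          je₃ : Jet Err.e₃ _ _
          je₃ = jet-⊖ jM jm̂
          je₄ : Jet Err.e₄ _ _
          je₄ = jet-⊖ (num-⊗ (+ 4) jP) (jet-⊗ jT jp̂)

          module Conclusion (A-0 : value₀ jA ≡ + 0) (A-1 : value₁ jA ≡ + 216) (g-0 : value₀ jg ≡ + 0) (g-1 : value₁ jg ≡ + 0)
            (e-0 : value₀ je ≡ + 1) (P-0 : value₀ j4P ≡ + 0) (P′-0 : value₀ j8P ≡ + 0) (h₁-0 : value₀ jh₁ ≡ + 0) (h₂-0 : value₀ jh₂ ≡ + 0)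
            (g₃-0 : value₀ jg₃ ≡ + 4 ℤ.* (+ 1 ℤ.+ + d)) (g₄-0 : value₀ jg₄ ≡ + 1 ℤ.- + d)
            (h₃-0 : value₀ jh₃ ≡ + suc d ℤ.* (+ 16 ℤ.* (+ 1 ℤ.- + d))) (h₄-0 : value₀ jh₄ ≡ + suc d ℤ.* (+ 4 ℤ.* (+ 1 ℤ.+ + d)))
            (e₁-0 : value₀ je₁ ≡ + 0) (e₂-0 : value₀ je₂ ≡ + 0) (first : + 4 ℤ.* value₁ je₃ ℤ.+ value₁ je₄ ≡ + 0) where

            -- The factorization of T² p̂² - 16 m̂² replaces an expansion of H up to the order d.
            second : Order d Err.e₁ → Order d Err.e₃ → Order d Err.e₄ → Err.e₄ d ℤ.- + 4 ℤ.* Err.e₃ d ≡ + 0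
            second o₁ o₃ o₄ = ≡.trans (key d) (≡.trans (≡.cong₂ (λ x y → + 8 ℤ.* x ℤ.- y) lead-X₂ lead-Bm) (cancel L))
              where
              cancel : ∀ x → + 8 ℤ.* (+ 27 ℤ.* x) ℤ.- + 216 ℤ.* x ≡ + 0
              cancel = solve-∀
              -- Read backwards, `key` gives this from the vanishing of e₃, e₄ and X₂ below q^d.
              order-Bm : Order d Bm
              order-Bm i i<d = ≡.trans (isolate (Bm i) (Lv.X₂ i)) (≡.trans (≡.cong₂ (λ x y → + 8 ℤ.* x ℤ.- y) (order-X₂ i i<d)
                (≡.trans (≡.sym (key i)) (≡.cong₂ (λ x y → x ℤ.- + 4 ℤ.* y) (o₄ i i<d) (o₃ i i<d)))) ≡.refl)
                where
                isolate : ∀ b x → b ≡ + 8 ℤ.* x ℤ.- (+ 8 ℤ.* x ℤ.- b)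
                isolate = solve-∀
              -- The coefficient of q^(d+1) in `product`: A begins with 216 q, and g e₁ does not
              -- contribute, as g has no terms in q⁰ and q¹ while e₁ vanishes below q^d.
              lead-Bm : Bm d ≡ + 216 ℤ.* L
              lead-Bm = ℤₚ.*-cancelˡ-≡ (+ 216) _ _ (≡.trans (≡.sym (≡.trans (lead₁ d A Bm (≡.trans (at-0 jA) A-0) order-Bm) (≡.cong (ℤ._* Bm d) (≡.trans (at-1 jA) A-1)))) (≡.trans (product (suc d))
                (≡.trans (≡.cong₂ ℤ._+_
                  (≡.trans (lead (suc d) (const (+ 46656 ℤ.* L) ⊗ V ⊗ (iV ⊗ iV ⊗ (iV ⊗ iV))) (pow H (suc d)) (order-pow H (suc d) (at-0 jH)))
                    (≡.cong₂ (λ x y → + 46656 ℤ.* L ℤ.* x ℤ.* (x ℤ.* x ℤ.* (x ℤ.* x)) ℤ.* y) V-0 (lead-pow H (suc d) (at-0 jH) (at-1 jH))))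
                  (≡.trans (lead₁ d g Err.e₁ (≡.trans (at-0 jg) g-0) o₁) (≡.trans (≡.cong (ℤ._* Err.e₁ d) (≡.trans (at-1 jg) g-1)) (ℤₚ.*-zeroˡ (Err.e₁ d))))) (simplify L))))
                where
                simplify : ∀ x → + 46656 ℤ.* x ℤ.* + 1 ℤ.* (+ 1 ℤ.* + 1 ℤ.* (+ 1 ℤ.* + 1)) ℤ.* + 1 ℤ.+ + 0 ≡ + 216 ℤ.* (+ 216 ℤ.* x)
                simplify = solve-∀

            w-ŵ : Lv.w ≈ₚ Hat.ŵ
            w-ŵ = errors-vanish Err.errors (≡.trans (at-0 je) e-0) (≡.trans (at-0 j4P) P-0) (≡.trans (at-0 j8P) P′-0)
              (≡.trans (at-0 jh₁) h₁-0) (≡.trans (at-0 jh₂) h₂-0) (≡.trans (at-0 jg₃) g₃-0) (≡.trans (at-0 jg₄) g₄-0) (≡.trans (at-0 jh₃) h₃-0) (≡.trans (at-0 jh₄) h₄-0)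
              (≡.trans (at-0 je₁) e₁-0) (≡.trans (at-0 je₂) e₂-0) (≡.trans (≡.cong₂ (λ x y → + 4 ℤ.* x ℤ.+ y) (at-1 je₃) (at-1 je₄)) first) second

            -- By `wronskian` the quotient defining `C` is w, hence ŵ. Uniqueness of inverses
            -- identifies the square of `iV` with `inv (pow V 2)`.
            C-formula : C d ≈ₚ (ℤ.- (+ 6)) · (H ⊗ (U ⊘ pow V 2))
            C-formula i = ≡.trans (divide {a} {S a} {Lv.w} {inv (pow a 2 ⊗ pow (S a) 2)} Lv.wronskian
                (⊗-inverseʳ (pow a 2 ⊗ pow (S a) 2) (≡.cong (λ x → + 1 ℤ.* (x ℤ.* (x ℤ.* + 1))) S-a-0)) i)
              (≡.trans (w-ŵ i) (≡.trans (minus-six {G} {H} {U} {iV ⊗ iV} {inv (pow V 2)} (poly-shift H Ul)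
                (inverse-unique {pow V 2} {iV ⊗ iV} {inv (pow V 2)} (square-inverse {V} {iV} unit-V) (⊗-inverseʳ (pow V 2) (≡.cong (λ x → x ℤ.* (x ℤ.* + 1)) V-0))) i)
              (const-⊗ (ℤ.- (+ 6)) (H ⊗ (U ⊘ pow V 2)) i)))

            -- A syntactic name h for H keeps the later type comparisons from unfolding the coefficients.
            C-formula-for : ∀ h → H ≡ h → C d ≈ₚ (ℤ.- (+ 6)) · (h ⊗ (poly Ul h ⊘ pow (poly Vl h) 2))
            C-formula-for h ≡.refl = C-formula

-- The substitution of q² for q and the three levels.

open import Defs
open import Data.Integer using (+_; -_)
open import Data.List using (List; []; _∷_)
open import Data.Product using (_×_)
open PowerSeries
open Inverse
open RingIdentities
open DualNumbersAndTruncation using (PS-ι)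
open EulerDerivation
open HauptmodulParametrization
open import Relation.Binary.PropositionalEquality using (refl; trans; sym; cong; cong₂)
open Units PS-commutativeRing PS-ι using (inverse-unique)

scale-pow : ∀ d f k → scale (suc d) (pow f k) ≈ₚ pow (scale (suc d) f) k
scale-pow d f zero    = scale-const d (+ 1)
scale-pow d f (suc k) n = trans (scale-⊗ d f (pow f k) n) (⊗-cong {scale (suc d) f} (λ _ → refl) (scale-pow d f k) n)

scale-poly : ∀ d cs f → scale (suc d) (poly cs f) ≈ₚ poly cs (scale (suc d) f)
scale-poly d []       f = scale-const d (+ 0)
scale-poly d (c ∷ cs) f n = trans (scale-⊕ d (const c) (f ⊗ poly cs f) n) (cong₂ ℤ._+_ (scale-const d c n)
  (trans (scale-⊗ d f (poly cs f) n) (⊗-cong {scale (suc d) f} (λ _ → refl) (scale-poly d cs f) n)))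

inv-cong : ∀ {f g} → f 0 ≡ + 1 → f ≈ₚ g → inv f ≈ₚ inv g
inv-cong {f} {g} e p = inverse-unique {g} {inv f} {inv g}
  (λ n → trans (⊗-cong {g = inv f} (λ k → sym (p k)) (λ _ → refl) n) (⊗-inverseʳ f e n)) (⊗-inverseʳ g (trans (sym (p 0)) e))

scale-inv : ∀ d f → f 0 ≡ + 1 → scale (suc d) (inv f) ≈ₚ inv (scale (suc d) f)
scale-inv d f e = inverse-unique {scale (suc d) f} {scale (suc d) (inv f)} {inv (scale (suc d) f)}
  (λ n → trans (sym (scale-⊗ d f (inv f) n)) (trans (scale-cong d (⊗-inverseʳ f e) n) (scale-const d (+ 1) n)))
  (⊗-inverseʳ (scale (suc d) f) e)

scale-⊘ : ∀ d f g → g 0 ≡ + 1 → scale (suc d) (f ⊘ g) ≈ₚ scale (suc d) f ⊘ scale (suc d) g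
scale-⊘ d f g e n = trans (scale-⊗ d f (inv g) n) (⊗-cong {scale (suc d) f} (λ _ → refl) (scale-inv d g e) n)

scale-quotient : ∀ d U V (H : PS) → pow (poly V H) 2 0 ≡ + 1 →
  scale (suc d) (poly U H ⊘ pow (poly V H) 2) ≈ₚ poly U (scale (suc d) H) ⊘ pow (poly V (scale (suc d) H)) 2
scale-quotient d U V H e n = trans (scale-⊘ d (poly U H) (pow (poly V H) 2) e n) (⊗-cong (scale-poly d U H) (inv-cong {scale (suc d) (pow (poly V H) 2)} e (λ k →
  trans (scale-pow d (poly V H) 2 k) (pow-cong 2 (scale-poly d V H) k))) n)
  where
  pow-cong : ∀ {f g} k → f ≈ₚ g → pow f k ≈ₚ pow g k
  pow-cong zero    p n = refl
  pow-cong (suc k) p = ⊗-cong p (pow-cong k p)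

-- The substitution respects sums, products and inverses, so it passes through the rational function
-- to H.
scale-formula : ∀ d c (C H : PS) U V → pow (poly V H) 2 0 ≡ + 1 → C ≈ₚ c · (H ⊗ (poly U H ⊘ pow (poly V H) 2)) →
  scale (suc d) C ≈ₚ c · (scale (suc d) H ⊗ (poly U (scale (suc d) H) ⊘ pow (poly V (scale (suc d) H)) 2))
scale-formula d c C H U V e p n = trans (scale-cong d p n) (trans (scale-· d c (H ⊗ (poly U H ⊘ pow (poly V H) 2)) n) (cong (c ℤ.*_)
  (trans (scale-⊗ d H (poly U H ⊘ pow (poly V H) 2) n) (⊗-cong {scale (suc d) H} (λ _ → refl) (scale-quotient d U V H e) n))))

-- For ℓ = 2 the numerator is the constant 1, which the asserted formula omits.
constant-numerator : ∀ H f → H ⊗ (poly (+ 1 ∷ []) H ⊘ f) ≈ₚ H ⊘ f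
constant-numerator H f = ⊗-cong {H} (λ _ → refl) (λ n → trans (⊗-cong {g = inv f} unit (λ _ → refl) n) (⊗-identityˡ (inv f) n))
  where
  unit : poly (+ 1 ∷ []) H ≈ₚ 1ₚ
  unit zero    = cong (λ z → + 1 ℤ.+ z) (trans (⊗-comm H (const (+ 0)) 0) (trans (const-⊗ (+ 0) H 0) refl))
  unit (suc n) = trans (cong (λ z → + 0 ℤ.+ z) (trans (⊗-comm H (const (+ 0)) (suc n)) (const-⊗ (+ 0) H (suc n)))) refl

-- The last three lists are the numerators in R₀ = N/V, M = m/V² and 4 P/T = p/V, found by comparing expansions in H;
-- the trailing proofs evaluate polynomial identities and coefficients at q⁰ and q¹.
private
  formula₂ = Parametrization.Jets.Conclusion.C-formula-for 1 4 refl (+ 1 ∷ []) (+ 1 ∷ + 9 ∷ []) (- (+ 1) ∷ + 9 ∷ []) (+ 0 ∷ + 27 ∷ + 81 ∷ []) (+ 0 ∷ + 36 ∷ [])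
    refl refl refl refl refl refl refl refl refl
    refl refl refl refl refl refl refl refl refl refl refl refl refl refl refl refl

C₂ : C 2 ≈ₚ (- (+ 6)) · (HdagQ 2 ⊗ (poly (+ 1 ∷ []) (HdagQ 2) ⊘ pow (poly (+ 1 ∷ + 9 ∷ []) (HdagQ 2)) 2))
C₂ = formula₂ (HdagQ 2) refl

private
  formula₅ = Parametrization.Jets.Conclusion.C-formula-for 4 2 refl (+ 1 ∷ + 4 ∷ + 9 ∷ []) (+ 1 ∷ + 9 ∷ + 9 ∷ []) (- (+ 4) ∷ + 0 ∷ + 36 ∷ [])
    (+ 0 ∷ + 27 ∷ + 189 ∷ + 567 ∷ + 324 ∷ []) (+ 0 ∷ + 18 ∷ + 36 ∷ [])
    refl refl refl refl refl refl refl refl refl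
    refl refl refl refl refl refl refl refl refl refl refl refl refl refl refl refl

C₅ : C 5 ≈ₚ (- (+ 6)) · (HdagQ 5 ⊗ (poly (+ 1 ∷ + 4 ∷ + 9 ∷ []) (HdagQ 5) ⊘ pow (poly (+ 1 ∷ + 9 ∷ + 9 ∷ []) (HdagQ 5)) 2))
C₅ = formula₅ (HdagQ 5) refl

private
  formula₁₁ = Parametrization.Jets.Conclusion.C-formula-for 10 1 refl Ucoeffs Vcoeffs (- (+ 10) ∷ - (+ 18) ∷ + 0 ∷ + 54 ∷ + 90 ∷ [])
    -- The lowest coefficients can be seen directly: P and M begin with 27 q and T with ℓ + 1 = 12,
    -- whence 27 and 4 · 27/12 = 9.
    (+ 0 ∷ + 27 ∷ + 216 ∷ + 972 ∷ + 2538 ∷ + 4536 ∷ + 5022 ∷ + 3645 ∷ + 810 ∷ []) (+ 0 ∷ + 9 ∷ + 36 ∷ + 81 ∷ + 36 ∷ [])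
    refl refl refl refl refl refl refl refl refl
    refl refl refl refl refl refl refl refl refl refl refl refl refl refl refl refl

C₁₁ : C 11 ≈ₚ (- (+ 6)) · (HdagQ 11 ⊗ (poly Ucoeffs (HdagQ 11) ⊘ pow (poly Vcoeffs (HdagQ 11)) 2))
C₁₁ = formula₁₁ (HdagQ 11) refl

theorem5p3 : (scale 2 (C 2) ≈ₚ (- (+ 6)) · (Hdag 2 ⊘ pow (poly (+ 1 ∷ + 9 ∷ []) (Hdag 2)) 2))
    × (scale 2 (C 5) ≈ₚ (- (+ 6)) · (Hdag 5 ⊗ (poly (+ 1 ∷ + 4 ∷ + 9 ∷ []) (Hdag 5)
    ⊘ pow (poly (+ 1 ∷ + 9 ∷ + 9 ∷ []) (Hdag 5)) 2)))
    × (scale 2 (C 11) ≈ₚ (- (+ 6)) · (Hdag 11 ⊗ (poly Ucoeffs (Hdag 11)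
    ⊘ pow (poly Vcoeffs (Hdag 11)) 2)))
theorem5p3 =
    (λ n → trans (scale-formula 1 (- (+ 6)) (C 2) (HdagQ 2) (+ 1 ∷ []) (+ 1 ∷ + 9 ∷ []) refl C₂ n)
      (cong (λ z → - (+ 6) ℤ.* z) (constant-numerator (Hdag 2) (pow (poly (+ 1 ∷ + 9 ∷ []) (Hdag 2)) 2) n)))
  , scale-formula 1 (- (+ 6)) (C 5) (HdagQ 5) (+ 1 ∷ + 4 ∷ + 9 ∷ []) (+ 1 ∷ + 9 ∷ + 9 ∷ []) refl C₅
  , scale-formula 1 (- (+ 6)) (C 11) (HdagQ 11) Ucoeffs Vcoeffs refl C₁₁
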